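{- For every $0<\varepsilon<1$ there exists $\gamma>0$ such that the following holds. Let $G$ be a multipartite graph with parts $V_1,\ldots,V_k$, each of size $|V_i|\ge n$, such that the maximum degree of $G$ is at most $(1-\varepsilon)n$ and the local degree of $G$ is at most $\gamma n$. Then $G$ contains at least $(1-\varepsilon)n$ pairwise disjoint independent transversals.
   Context: A multipartite graph with parts $V_1,\ldots,V_k$ is a graph whose vertex set is the disjoint union $V_1\cup\cdots\cup V_k$ and which has no edge inside any part $V_i$. An independent transversal is an independent set of $G$ containing exactly one vertex from each part $V_i$. The local degree of $G$ is the maximum, over all vertices $v$ and all parts $V_i$, of the number of neighbours of $v$ in $V_i$. Quantities such as $(1-\varepsilon)n$ are understood up to rounding. -}

module Defs where

open import Data.Nat using (ℕ; zero; suc; _+_)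
open import Data.Fin using (Fin; zero; suc; _≟_)
open import Data.Bool using (Bool; true; false; if_then_else_)
open import Data.Integer using (+_)
open import Data.Rational using (ℚ; _/_; _*_; _-_; _≤_; _<_; 1ℚ)
open import Data.Product using (_×_; Σ)
open import Relation.Nullary using (does)
open import Relation.Binary.PropositionalEquality using (_≡_)

ℕ→ℚ : ℕ → ℚ
ℕ→ℚ m = + m / 1

count : ∀ {N} → (Fin N → Bool) → ℕ
count {zero}  P = 0
count {suc N} P = (if P zero then 1 else 0) + count (λ x → P (suc x))

record MultipartiteGraph (N k : ℕ) : Set where
  field
    part    : Fin N → Fin k
    adj     : Fin N → Fin N → Bool
    adj-sym : ∀ u v → adj u v ≡ adj v u
    -- no edges inside a part (this also excludes loops)
    adj-multipartite : ∀ u v → part u ≡ part v → adj u v ≡ false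

module _ {N k : ℕ} (G : MultipartiteGraph N k) where
  open MultipartiteGraph G

  partSize : Fin k → ℕ
  partSize i = count (λ w → does (part w ≟ i))

  degree : Fin N → ℕ
  degree v = count (adj v)

  localDegree : Fin N → Fin k → ℕ
  localDegree v i = count (λ w → if adj v w then does (part w ≟ i) else false)

  IsIndependentTransversal : (Fin k → Fin N) → Set
  IsIndependentTransversal T =
    (∀ i → part (T i) ≡ i) × (∀ i j → adj (T i) (T j) ≡ false)

  DisjointIndependentTransversals : (m : ℕ) → (Fin m → Fin k → Fin N) → Set
  DisjointIndependentTransversals m T =
    (∀ a → IsIndependentTransversal (T a)) ×
    (∀ a b i j → T a i ≡ T b j → a ≡ b)

{-# OPTIONS --safe #-}

-- Discarding vertices, all parts have size s 2^j with 4^κ ≤ s ≤ 2 4^κ and κ depending on ε only. Pair up the vertices of every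
-- part and send one of each pair, chosen by a fair coin, to each of two halves. By the local lemma the two induced graphs nearly keep
-- the ratios of degree and of local degree to part size; the relative loss is of order 1/(j+1)(j+2) at scale j, hence
-- summable, and after j halvings the parts have size s and the local degrees are at most √s.
--
-- There m ≈ (1 - ε) s transversals are found at once: for every part i and colour a choose a vertex of V_i such that
-- choices of one colour are non-adjacent and choices in one part are distinct. Every pair (i , a) starts with the list
-- V_i, and both kinds of conflict have degree at most c times the list size for some c < 1. In each round every pair
-- picks each candidate of its list with a small probability, a pick is kept unless an earlier pick conflicts with it,
-- and candidates conflicting with a pick are deleted, with extra coins to even out the deletion probabilities. By the
-- local lemma some outcome shrinks the ratio of degree to list size by a constant factor. Concentration holds because a
-- candidate has at most √s conflicts with any one group of pairs. When the ratio is below 1/32, one more use of the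
-- local lemma completes the choice.
--
-- Probabilities are rational-valued expectations on finite products, and large deviations come from E x^count with
-- x = (1+w)^a for rational w, in place of exponentials.

module Submission where

open import Defs
open import Data.Nat using (ℕ)
open import Data.Fin using (Fin)
open import Data.Rational using (ℚ; _*_; _-_; _+_; _≤_; _<_; 0ℚ; 1ℚ)
open import Data.Product using (Σ; _×_)
open import Data.Product using (_,_; proj₁; proj₂)
import Data.Nat as ℕ
open import Data.Nat using (zero; suc; s≤s; z≤n; _^_)
import Data.Nat.Properties as ℕP
import Data.Nat.DivMod as ℕD
open import Data.Nat.Coprimality using (Coprime)
import Data.Nat.Solver
import Data.Integer as ℤ
open import Data.Integer using (ℤ)
import Data.Integer.Properties as ℤP
import Data.Rational as ℚ
open import Data.Rational using (mkℚ; -_; *≤*; *<*; toℚᵘ)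
import Data.Rational.Properties as ℚP
open import Data.Rational.Properties using (≤-refl; ≤-trans; ≤-reflexive; <⇒≤; <-≤-trans; ≤-<-trans; +-mono-≤)
import Data.Rational.Unnormalised as ℚᵘ
import Data.Rational.Unnormalised.Properties as ℚᵘP
open import Data.Rational.Solver using (module +-*-Solver)
open import Data.Fin using (zero; suc; _≟_)
import Data.Fin as F
import Data.Fin.Properties as FP
import Data.Bool as B
open import Data.Bool using (Bool; true; false; if_then_else_; _∧_; _∨_; not)
import Data.Bool.Properties as BP
open import Data.Maybe using (Maybe; just; nothing)
open import Data.List using (List; []; _∷_; _++_; length; tabulate)
import Data.List.Properties as LP
import Data.Sum as Sum
open import Data.Sum using (_⊎_; inj₁; inj₂; [_,_]′)
open import Data.Empty using (⊥; ⊥-elim)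
open import Relation.Nullary using (¬_; Dec; yes; no; does)
open import Relation.Binary.Definitions using (tri<; tri≈; tri>)
open import Relation.Binary.PropositionalEquality
open +-*-Solver using (solve; _:=_; _:+_; _:*_; _:-_; con; :-_)
module NS = Data.Nat.Solver.+-*-Solver

-- Ordered field arithmetic

-- The number of parts is unbounded and γ may depend on ε only. The nibble needs one pick to affect
-- at most about the square root of a list, but a local degree γ n is linear in n; after halving the
-- list size is a constant, and a suitable γ brings the local degree below its root. Failure
-- probabilities are then constants too, so only the local lemma, with dependence measured by
-- distance between parts, reaches all parts. A candidate has one vertex conflict per other colour,
-- so about (1 - ε) s colours give both kinds of conflict the same degree bound. The ratio improves
-- for this reason. Let θ be the probability that an open slot picks and μ < θ the rate of hits
-- through one kind of conflict. A list loses a share of about 2 μ, whereas a neighbour disappears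
-- at rate about θ + μ: its slot is filled, or it is hit through the other kind of conflict. Hits of
-- the kind being counted are ignored, which makes the survival of neighbours in different groups
-- independent. Inequalities are mostly certified by `le-by`: the difference is written as a visibly
-- nonnegative polynomial and the identity is left to the ring solver.

le-by : ∀ {x y} d → 0ℚ ≤ d → y ≡ x + d → x ≤ y
le-by {x} {y} d p e = subst₂ _≤_ (ℚP.+-identityʳ x) (sym e) (ℚP.+-monoʳ-≤ x p)

sub≥0 : ∀ {a b} → a ≤ b → 0ℚ ≤ b - a
sub≥0 {a} {b} p = subst (_≤ b - a) (ℚP.+-inverseʳ a) (ℚP.+-monoˡ-≤ (- a) p)

*mono : ∀ {c a b} → 0ℚ ≤ c → a ≤ b → c * a ≤ c * b
*mono {c} p q = ℚP.*-monoˡ-≤-nonNeg c {{ℚ.nonNegative p}} q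

*monoʳ : ∀ {c a b} → 0ℚ ≤ c → a ≤ b → a * c ≤ b * c
*monoʳ {c} p q = ℚP.*-monoʳ-≤-nonNeg c {{ℚ.nonNegative p}} q

0≤* : ∀ {a b} → 0ℚ ≤ a → 0ℚ ≤ b → 0ℚ ≤ a * b
0≤* {a} {b} p q = subst (_≤ a * b) (ℚP.*-zeroʳ a) (*mono p q)

0≤+ : ∀ {a b} → 0ℚ ≤ a → 0ℚ ≤ b → 0ℚ ≤ a + b
0≤+ p q = +-mono-≤ p q

*-mono₂ : ∀ {a b c d} → 0ℚ ≤ a → 0ℚ ≤ d → a ≤ b → c ≤ d → a * c ≤ b * d
*-mono₂ pa pd p q = ≤-trans (*mono pa q) (*monoʳ pd p)

0<* : ∀ {a b} → 0ℚ < a → 0ℚ < b → 0ℚ < a * b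
0<* {a} {b} p q = subst (_< a * b) (ℚP.*-zeroʳ a) (ℚP.*-monoʳ-<-pos a {{ℚ.positive p}} q)

0<+ : ∀ {a b} → 0ℚ < a → 0ℚ ≤ b → 0ℚ < a + b
0<+ p q = ℚP.+-mono-<-≤ p q

0<1 : 0ℚ < 1ℚ
0<1 = *<* (ℤ.+<+ (s≤s z≤n))

0≤1 : 0ℚ ≤ 1ℚ
0≤1 = <⇒≤ 0<1

*cancel : ∀ {c a b} → 0ℚ < c → c * a ≤ c * b → a ≤ b
*cancel {c} p q = ℚP.*-cancelˡ-≤-pos c {{ℚ.positive p}} q

private
  reciprocal : (x : ℚ) → 0ℚ < x → Σ ℚ λ y → 0ℚ < y × x * y ≡ 1ℚ
  reciprocal x p = y , ℚP.positive⁻¹ y {{ℚP.1/pos⇒pos x {{pp}}}} , ℚP.*-inverseʳ x {{nz}}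
    where
    pp = ℚ.positive p
    nz = ℚP.pos⇒nonZero x {{pp}}
    y = ℚ.1/_ x {{nz}}

abstract
  recip : (x : ℚ) → 0ℚ < x → Σ ℚ λ y → 0ℚ < y × x * y ≡ 1ℚ
  recip = reciprocal

-- Natural numbers inside ℚ

abstract
  -- Abstract, so that conversion checking never normalises large rationals. `lit` below is the
  -- transparent copy, for numerals that the ring solver must evaluate.
  ι : ℕ → ℚ
  ι = ℕ→ℚ

  ι-def : ∀ n → ι n ≡ ℕ→ℚ n
  ι-def n = refl

  ι-0 : ι 0 ≡ 0ℚ
  ι-0 = refl

  ι-1 : ι 1 ≡ 1ℚ
  ι-1 = refl

private
  ιᵘ : ∀ a → toℚᵘ (ι a) ℚᵘ.≃ ℚᵘ.mkℚᵘ (ℤ.+ a) 0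
  ιᵘ a = ℚᵘP.≃-trans (ℚᵘP.≃-reflexive (cong toℚᵘ (ι-def a))) (ℚP.toℚᵘ-fromℚᵘ (ℚᵘ.mkℚᵘ (ℤ.+ a) 0))

ι-+ : ∀ a b → ι (a ℕ.+ b) ≡ ι a + ι b
ι-+ a b = ℚP.toℚᵘ-injective (ℚᵘP.≃-trans (ιᵘ (a ℕ.+ b)) (ℚᵘP.≃-trans
   (ℚᵘ.*≡* (cong (ℤ._* ℤ.+ 1) (cong₂ ℤ._+_ (sym (ℤP.*-identityʳ (ℤ.+ a))) (sym (ℤP.*-identityʳ (ℤ.+ b))))))
   (ℚᵘP.≃-sym (ℚᵘP.≃-trans (ℚP.toℚᵘ-homo-+ (ι a) (ι b)) (ℚᵘP.+-cong (ιᵘ a) (ιᵘ b))))))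

ι-* : ∀ a b → ι (a ℕ.* b) ≡ ι a * ι b
ι-* a b = ℚP.toℚᵘ-injective (ℚᵘP.≃-trans (ιᵘ (a ℕ.* b)) (ℚᵘP.≃-trans
   (ℚᵘ.*≡* (cong (ℤ._* ℤ.+ 1) (ℤP.pos-* a b)))
   (ℚᵘP.≃-sym (ℚᵘP.≃-trans (ℚP.toℚᵘ-homo-* (ι a) (ι b)) (ℚᵘP.*-cong (ιᵘ a) (ιᵘ b))))))

ι-suc : ∀ a → ι (suc a) ≡ 1ℚ + ι a
ι-suc a = trans (ι-+ 1 a) (cong (_+ ι a) ι-1)

0≤ι : ∀ a → 0ℚ ≤ ι a
0≤ι zero = ≤-reflexive (sym ι-0)
0≤ι (suc a) = subst (0ℚ ≤_) (sym (ι-suc a)) (0≤+ 0≤1 (0≤ι a))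

ι-mono : ∀ {a b} → a ℕ.≤ b → ι a ≤ ι b
ι-mono {a} {b} p = le-by (ι (b ℕ.∸ a)) (0≤ι _) (trans (cong ι (sym (ℕP.m+[n∸m]≡n p))) (ι-+ a _))

0<ι : ∀ {a} → 1 ℕ.≤ a → 0ℚ < ι a
0<ι p = <-≤-trans 0<1 (≤-trans (≤-reflexive (sym ι-1)) (ι-mono p))

ι-mono-< : ∀ {a b} → a ℕ.< b → ι a < ι b
ι-mono-< {a} p = <-≤-trans (subst₂ _<_ (ℚP.+-identityˡ (ι a)) (sym (ι-suc a)) (ℚP.+-monoˡ-< (ι a) 0<1)) (ι-mono p)

ι-cancel : ∀ {a b} → ι a ≤ ι b → a ℕ.≤ b
ι-cancel {a} {b} p with a ℕP.≤? b
... | yes q = q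
... | no q = ⊥-elim (ℚP.<-irrefl refl (<-≤-trans (ι-mono-< (ℕP.≰⇒> q)) p))

ι-cancel-< : ∀ {a b} → ι a < ι b → a ℕ.< b
ι-cancel-< {a} {b} p with suc a ℕP.≤? b
... | yes q = q
... | no q = ⊥-elim (ℚP.<-irrefl refl (<-≤-trans p (ι-mono (ℕP.≤-pred (ℕP.≰⇒> q)))))

private
  mk-num : ∀ n d .(c : Coprime n (suc d)) → mkℚ (ℤ.+ n) d c * ι (suc d) ≡ ι n
  mk-num n d c = ℚP.toℚᵘ-injective (ℚᵘP.≃-trans (ℚP.toℚᵘ-homo-* x (ι (suc d)))
     (ℚᵘP.≃-trans (ℚᵘP.*-congˡ {ℚᵘ.mkℚᵘ (ℤ.+ n) d} (ιᵘ (suc d))) (ℚᵘP.≃-trans (ℚᵘ.*≡* eq) (ℚᵘP.≃-sym (ιᵘ n)))))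
    where
    x = mkℚ (ℤ.+ n) d c
    eq : (ℤ.+ n ℤ.* ℤ.+ suc d) ℤ.* ℤ.+ 1 ≡ ℤ.+ n ℤ.* ℤ.+ (suc d ℕ.* 1)
    eq = trans (ℤP.*-identityʳ _) (cong (λ z → ℤ.+ n ℤ.* ℤ.+ z) (sym (ℕP.*-identityʳ (suc d))))

fraction : ∀ x → 0ℚ ≤ x → Σ ℕ λ n → Σ ℕ λ d → x * ι (suc d) ≡ ι n
fraction (mkℚ (ℤ.+ n) d c) p = n , d , mk-num n d c
fraction (mkℚ (ℤ.-[1+ n ]) d c) (*≤* ())

private
  ceiling : ∀ x → 0ℚ ≤ x → Σ ℕ λ b → x ≤ ι b × ι b ≤ x + 1ℚ
  ceiling x p with fraction x p
  -- One more than the integer quotient, also when x is an integer; the bound x + 1 leaves room for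
  -- this.
  ... | n , d , e = suc q , *cancel {ι (suc d)} D>0 h1 , *cancel {ι (suc d)} D>0 h2
    where
    q = n ℕD./ suc d
    r = n ℕD.% suc d
    D = ι (suc d)
    D>0 : 0ℚ < D
    D>0 = 0<ι (s≤s z≤n)
    r≤ : ι r ≤ D
    r≤ = ι-mono (ℕP.<⇒≤ (ℕD.m%n<n n (suc d)))
    ne : x * D ≡ ι r + ι q * D
    ne = trans e (trans (cong ι (ℕD.m≡m%n+[m/n]*n n (suc d))) (trans (ι-+ r _) (cong (ι r +_) (ι-* q (suc d)))))
    h1 : D * x ≤ D * ι (suc q)
    h1 = le-by (D - ι r) (sub≥0 r≤) (trans (cong (D *_) (ι-suc q)) (trans
          (solve 3 (λ D q r → D :* (con 1ℚ :+ q) := (r :+ q :* D) :+ (D :- r)) refl D (ι q) (ι r))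
          (cong (_+ (D - ι r)) (trans (sym ne) (ℚP.*-comm x D)))))
    h2 : D * ι (suc q) ≤ D * (x + 1ℚ)
    h2 = le-by (ι r) (0≤ι r) (trans (solve 2 (λ D x → D :* (x :+ con 1ℚ) := x :* D :+ D) refl D x)
          (trans (cong (_+ D) ne) (trans (solve 3 (λ D q r → r :+ q :* D :+ D := D :* (con 1ℚ :+ q) :+ r) refl D (ι q) (ι r))
            (cong (λ z → D * z + ι r) (sym (ι-suc q))))))

abstract
  ceil : ∀ x → 0ℚ ≤ x → Σ ℕ λ b → x ≤ ι b × ι b ≤ x + 1ℚ
  ceil = ceiling

-- Powers

pow : ℚ → ℕ → ℚ
pow x zero = 1ℚ
pow x (suc n) = x * pow x n

pow-+ : ∀ x m n → pow x (m ℕ.+ n) ≡ pow x m * pow x n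
pow-+ x zero n = sym (ℚP.*-identityˡ _)
pow-+ x (suc m) n = trans (cong (x *_) (pow-+ x m n)) (sym (ℚP.*-assoc x _ _))

pow-* : ∀ x m n → pow x (m ℕ.* n) ≡ pow (pow x n) m
pow-* x zero n = refl
pow-* x (suc m) n = trans (pow-+ x n (m ℕ.* n)) (cong (pow x n *_) (pow-* x m n))

pow-dist : ∀ x y n → pow (x * y) n ≡ pow x n * pow y n
pow-dist x y zero = refl
pow-dist x y (suc n) = trans (cong (x * y *_) (pow-dist x y n))
  (solve 4 (λ x y a b → x :* y :* (a :* b) := x :* a :* (y :* b)) refl x y (pow x n) (pow y n))

pow≥1 : ∀ {x} n → 1ℚ ≤ x → 1ℚ ≤ pow x n
pow≥1 zero p = ≤-refl
pow≥1 {x} (suc n) p = *-mono₂ {1ℚ} {x} {1ℚ} 0≤1 (≤-trans 0≤1 (pow≥1 n p)) p (pow≥1 n p)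

0<pow : ∀ {x} n → 0ℚ < x → 0ℚ < pow x n
0<pow zero p = 0<1
0<pow (suc n) p = 0<* p (0<pow n p)

0≤pow : ∀ {x} n → 0ℚ ≤ x → 0ℚ ≤ pow x n
0≤pow zero p = 0≤1
0≤pow (suc n) p = 0≤* p (0≤pow n p)

pow-monoˡ : ∀ {x y} n → 0ℚ ≤ x → x ≤ y → pow x n ≤ pow y n
pow-monoˡ zero p q = ≤-refl
pow-monoˡ (suc n) p q = *-mono₂ p (0≤pow n (≤-trans p q)) q (pow-monoˡ n p q)

pow-monoʳ : ∀ {x m n} → 1ℚ ≤ x → m ℕ.≤ n → pow x m ≤ pow x n
pow-monoʳ {x} {m} {n} p q = subst (pow x m ≤_) (trans (sym (pow-+ x m (n ℕ.∸ m))) (cong (pow x) (ℕP.m+[n∸m]≡n q)))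
  (le-by (pow x m * (pow x (n ℕ.∸ m) - 1ℚ)) (0≤* (0≤pow m (≤-trans 0≤1 p)) (sub≥0 (pow≥1 (n ℕ.∸ m) p)))
    (solve 2 (λ a b → a :* b := a :+ a :* (b :- con 1ℚ)) refl (pow x m) (pow x (n ℕ.∸ m))))

bernoulli : ∀ {w} n → 0ℚ ≤ w → 1ℚ + ι n * w ≤ pow (1ℚ + w) n
bernoulli {w} zero p = ≤-reflexive (trans (cong (1ℚ +_) (trans (cong (_* w) ι-0) (ℚP.*-zeroˡ w))) (ℚP.+-identityʳ 1ℚ))
bernoulli {w} (suc n) p = ≤-trans
  (le-by (ι n * (w * w)) (0≤* (0≤ι n) (0≤* p p))
     (trans (solve 2 (λ w n → (con 1ℚ :+ w) :* (con 1ℚ :+ n :* w) := con 1ℚ :+ (con 1ℚ :+ n) :* w :+ n :* (w :* w)) refl w (ι n))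
        (cong (λ z → 1ℚ + z * w + ι n * (w * w)) (sym (ι-suc n)))))
  (*mono (0≤+ 0≤1 p) (bernoulli n p))

-- (1+w)^n ≤ 1/(1-nw), cleared of the division
pow-upper : ∀ {w} n → 0ℚ ≤ w → pow (1ℚ + w) n * (1ℚ - ι n * w) ≤ 1ℚ
pow-upper {w} zero p = ≤-reflexive (trans (cong (λ z → 1ℚ * (1ℚ - z * w)) ι-0)
    (solve 1 (λ w → con 1ℚ :* (con 1ℚ :- con 0ℚ :* w) := con 1ℚ) refl w))
pow-upper {w} (suc n) p = ≤-trans (le-by (pow (1ℚ + w) n * ((1ℚ + ι n) * (w * w)))
    (0≤* (0≤pow n (0≤+ 0≤1 p)) (0≤* (0≤+ 0≤1 (0≤ι n)) (0≤* p p)))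
    (trans (solve 3 (λ w n P → P :* (con 1ℚ :- n :* w) := (con 1ℚ :+ w) :* P :* (con 1ℚ :- (con 1ℚ :+ n) :* w) :+ P :*
        ((con 1ℚ :+ n) :* (w :* w))) refl w (ι n) (pow (1ℚ + w) n))
      (cong (λ z → (1ℚ + w) * pow (1ℚ + w) n * (1ℚ - z * w) + pow (1ℚ + w) n * ((1ℚ + ι n) * (w * w))) (sym (ι-suc n)))))
  (pow-upper n p)

-- With d = C - c the difference is x^c (x^d - 1), at least x^d - 1, and Bernoulli bounds that below
-- by d (x - 1).
pow-gap : ∀ {x c C} → 1ℚ ≤ x → c ℕ.≤ C → (ι C - ι c) * (x - 1ℚ) ≤ pow x C - pow x c
pow-gap {x} {c} {C} p q = ≤-trans (≤-trans
    (≤-reflexive (cong (_* (x - 1ℚ)) (trans (cong (_- ι c) ιC) (solve 2 (λ a d → a :+ d :- a := d) refl (ι c) (ι d)))))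
    (≤-trans (le-by (1ℚ + ι d * (x - 1ℚ) - 1ℚ - ι d * (x - 1ℚ))
        (≤-reflexive (solve 2 (λ d x → con 0ℚ := con 1ℚ :+ d :* (x :- con 1ℚ) :- con 1ℚ :- d :* (x :- con 1ℚ)) refl (ι d) x))
       (solve 2 (λ d x → con 1ℚ :+ d :* (x :- con 1ℚ) :- con 1ℚ := d :* (x :- con 1ℚ) :+
           (con 1ℚ :+ d :* (x :- con 1ℚ) :- con 1ℚ :- d :* (x :- con 1ℚ))) refl (ι d) x))
       (ℚP.+-monoˡ-≤ (- 1ℚ) (subst (λ z → 1ℚ + ι d * (x - 1ℚ) ≤ pow z d) (solve 1 (λ x → con 1ℚ :+ (x :- con 1ℚ) := x) refl x)
           (bernoulli d (sub≥0 p))))))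
  (le-by ((B - 1ℚ) * (X - 1ℚ)) (0≤* (sub≥0 (pow≥1 c p)) (sub≥0 (pow≥1 d p)))
    (trans (cong (_- B) Ceq) (solve 2 (λ B X → B :* X :- B := X :- con 1ℚ :+ (B :- con 1ℚ) :* (X :- con 1ℚ)) refl B X)))
  where
  d = C ℕ.∸ c
  ιC : ι C ≡ ι c + ι d
  ιC = trans (cong ι (sym (ℕP.m+[n∸m]≡n q))) (ι-+ c d)
  B = pow x c
  X = pow x d
  Ceq : pow x C ≡ B * X
  Ceq = trans (cong (pow x) (sym (ℕP.m+[n∸m]≡n q))) (pow-+ x c d)

-- x^c ≤ 1 + (c/C)(x^C - 1), by convexity of t ↦ x^t, cleared of the division
pow-convex : ∀ {x c C} → 1ℚ ≤ x → c ℕ.≤ C → ι C * (pow x c - 1ℚ) ≤ ι c * (pow x C - 1ℚ)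
pow-convex {x} {zero} {C} p q = ≤-reflexive (trans (solve 2 (λ C X → C :* (con 1ℚ :- con 1ℚ) := con 0ℚ :* X) refl (ι C)
    (pow x C - 1ℚ)) (cong (_* (pow x C - 1ℚ)) (sym ι-0)))
pow-convex {x} {suc c} {suc C} p (s≤s q) = subst₂ (λ a b → a * (x * pow x c - 1ℚ) ≤ b * (x * pow x C - 1ℚ)) (sym (ι-suc C))
    (sym (ι-suc c))
  (le-by (x * (ι c * (A - 1ℚ) - ι C * (B - 1ℚ)) + ((A - B) - (ι C - ι c) * (x - 1ℚ)) + (x - 1ℚ) * (A - B))
    (0≤+ (0≤+ (0≤* (≤-trans 0≤1 p) (sub≥0 (pow-convex p q))) (sub≥0 (pow-gap p q))) (0≤* (sub≥0 p) (sub≥0 (pow-monoʳ p q))))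
    (solve 5 (λ x a b A B → (con 1ℚ :+ a) :* (x :* A :- con 1ℚ) :=
        (con 1ℚ :+ b) :* (x :* B :- con 1ℚ) :+ (x :* (a :* (A :- con 1ℚ) :- b :* (B :- con 1ℚ)) :+
            ((A :- B) :- (b :- a) :* (x :- con 1ℚ)) :+ (x :- con 1ℚ) :* (A :- B)))
         refl x (ι c) (ι C) A B))
  where
  A = pow x C
  B = pow x c

-- Sums and products

⟦_⟧ : Bool → ℚ
⟦ b ⟧ = if b then 1ℚ else 0ℚ

0≤⟦_⟧ : ∀ b → 0ℚ ≤ ⟦ b ⟧
0≤⟦ true ⟧ = 0≤1
0≤⟦ false ⟧ = ≤-refl

⟦_⟧≤1 : ∀ b → ⟦ b ⟧ ≤ 1ℚ
⟦ true ⟧≤1 = ≤-refl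
⟦ false ⟧≤1 = 0≤1

⟦∧⟧ : ∀ a b → ⟦ a ∧ b ⟧ ≡ ⟦ a ⟧ * ⟦ b ⟧
⟦∧⟧ true b = sym (ℚP.*-identityˡ ⟦ b ⟧)
⟦∧⟧ false b = sym (ℚP.*-zeroˡ ⟦ b ⟧)

⟦∨⟧ : ∀ a b → ⟦ a ∨ b ⟧ ≤ ⟦ a ⟧ + ⟦ b ⟧
⟦∨⟧ true b = le-by ⟦ b ⟧ 0≤⟦ b ⟧ refl
⟦∨⟧ false b = ≤-reflexive (sym (ℚP.+-identityˡ _))

⟦⟧-mono : ∀ {a b} → (a ≡ true → b ≡ true) → ⟦ a ⟧ ≤ ⟦ b ⟧
⟦⟧-mono {true} {b} p rewrite p refl = ≤-refl
⟦⟧-mono {false} {b} p = 0≤⟦ b ⟧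

_==_ : ∀ {n} → Fin n → Fin n → Bool
i == j = does (i ≟ j)

==-refl : ∀ {n} (i : Fin n) → (i == i) ≡ true
==-refl i with i ≟ i
... | yes _ = refl
... | no q = ⊥-elim (q refl)

==→≡ : ∀ {n} {i j : Fin n} → (i == j) ≡ true → i ≡ j
==→≡ {i = i} {j} e with i ≟ j
... | yes p = p
==→≡ () | no _

==-false : ∀ {n} {i j : Fin n} → ¬ (i ≡ j) → (i == j) ≡ false
==-false {i = i} {j} n with i ≟ j
... | yes p = ⊥-elim (n p)
... | no _ = refl

==-sym : ∀ {n} (i j : Fin n) → (i == j) ≡ (j == i)
==-sym i j with i ≟ j
... | yes refl = sym (==-refl i)
... | no p = sym (==-false (λ e → p (sym e)))

∑ : ∀ {n} → (Fin n → ℚ) → ℚ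
∑ {zero} f = 0ℚ
∑ {suc n} f = f zero + ∑ (λ i → f (suc i))

∏ : ∀ {n} → (Fin n → ℚ) → ℚ
∏ {zero} f = 1ℚ
∏ {suc n} f = f zero * ∏ (λ i → f (suc i))

∑-cong : ∀ {n} {f g : Fin n → ℚ} → (∀ i → f i ≡ g i) → ∑ f ≡ ∑ g
∑-cong {zero} p = refl
∑-cong {suc n} p = cong₂ _+_ (p zero) (∑-cong (λ i → p (suc i)))

∑-mono : ∀ {n} {f g : Fin n → ℚ} → (∀ i → f i ≤ g i) → ∑ f ≤ ∑ g
∑-mono {zero} p = ≤-refl
∑-mono {suc n} p = +-mono-≤ (p zero) (∑-mono (λ i → p (suc i)))

∑-+ : ∀ {n} (f g : Fin n → ℚ) → ∑ (λ i → f i + g i) ≡ ∑ f + ∑ g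
∑-+ {zero} f g = refl
∑-+ {suc n} f g = trans (cong (f zero + g zero +_) (∑-+ (λ i → f (suc i)) (λ i → g (suc i))))
  (solve 4 (λ a b c d → a :+ b :+ (c :+ d) := a :+ c :+ (b :+ d)) refl (f zero) (g zero) (∑ (λ i → f (suc i)))
      (∑ (λ i → g (suc i))))

∑-* : ∀ {n} c (f : Fin n → ℚ) → ∑ (λ i → c * f i) ≡ c * ∑ f
∑-* {zero} c f = sym (ℚP.*-zeroʳ c)
∑-* {suc n} c f = trans (cong (c * f zero +_) (∑-* c (λ i → f (suc i)))) (sym (ℚP.*-distribˡ-+ c _ _))

∑-*ʳ : ∀ {n} c (f : Fin n → ℚ) → ∑ (λ i → f i * c) ≡ ∑ f * c
∑-*ʳ c f = trans (∑-cong (λ i → ℚP.*-comm (f i) c)) (trans (∑-* c f) (ℚP.*-comm c _))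

∑-0 : ∀ {n} → ∑ {n} (λ _ → 0ℚ) ≡ 0ℚ
∑-0 {zero} = refl
∑-0 {suc n} = trans (ℚP.+-identityˡ _) (∑-0 {n})

∑-const : ∀ {n} c → ∑ {n} (λ _ → c) ≡ ι n * c
∑-const {zero} c = sym (trans (cong (_* c) ι-0) (ℚP.*-zeroˡ c))
∑-const {suc n} c = trans (cong (c +_) (∑-const {n} c)) (trans (solve 2 (λ c n → c :+ n :* c := (con 1ℚ :+ n) :* c) refl c (ι n))
    (cong (_* c) (sym (ι-suc n))))

∑-nonneg : ∀ {n} {f : Fin n → ℚ} → (∀ i → 0ℚ ≤ f i) → 0ℚ ≤ ∑ f
∑-nonneg {n} {f} p = subst (_≤ ∑ f) (∑-0 {n}) (∑-mono p)

∑-swap : ∀ {m n} (f : Fin m → Fin n → ℚ) → ∑ (λ i → ∑ (λ j → f i j)) ≡ ∑ (λ j → ∑ (λ i → f i j))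
∑-swap {zero} {n} f = sym (∑-0 {n})
∑-swap {suc m} f = trans (cong (∑ (f zero) +_) (∑-swap (λ i → f (suc i)))) (sym (∑-+ (f zero) _))

∑-term : ∀ {n} {f : Fin n → ℚ} → (∀ i → 0ℚ ≤ f i) → ∀ i → f i ≤ ∑ f
∑-term {suc n} {f} p zero = le-by (∑ (λ i → f (suc i))) (∑-nonneg (λ i → p (suc i))) refl
∑-term {suc n} {f} p (suc i) = ≤-trans (∑-term (λ i → p (suc i)) i) (le-by (f zero) (p zero) (ℚP.+-comm (f zero) _))

∑-single : ∀ {n} (i : Fin n) (f : Fin n → ℚ) → ∑ (λ j → ⟦ i == j ⟧ * f j) ≡ f i
∑-single {suc n} zero f = trans (cong₂ _+_ (ℚP.*-identityˡ (f zero)) (trans (∑-cong (λ j → ℚP.*-zeroˡ (f (suc j)))) (∑-0 {n})))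
    (ℚP.+-identityʳ _)
∑-single {suc n} (suc i) f = trans (cong₂ _+_ (ℚP.*-zeroˡ (f zero))
    (trans (∑-cong (λ j → cong (λ b → ⟦ b ⟧ * f (suc j)) (eq j))) (∑-single i (λ j → f (suc j))))) (ℚP.+-identityˡ _)
  where
  eq : ∀ j → (suc i == suc j) ≡ (i == j)
  eq j with i ≟ j
  ... | yes _ = refl
  ... | no _ = refl

∏-cong : ∀ {n} {f g : Fin n → ℚ} → (∀ i → f i ≡ g i) → ∏ f ≡ ∏ g
∏-cong {zero} p = refl
∏-cong {suc n} p = cong₂ _*_ (p zero) (∏-cong (λ i → p (suc i)))

∏-nonneg : ∀ {n} {f : Fin n → ℚ} → (∀ i → 0ℚ ≤ f i) → 0ℚ ≤ ∏ f
∏-nonneg {zero} p = 0≤1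
∏-nonneg {suc n} p = 0≤* (p zero) (∏-nonneg (λ i → p (suc i)))

∏-mono : ∀ {n} {f g : Fin n → ℚ} → (∀ i → 0ℚ ≤ f i) → (∀ i → f i ≤ g i) → ∏ f ≤ ∏ g
∏-mono {zero} z p = ≤-refl
∏-mono {suc n} z p = *-mono₂ (z zero) (≤-trans (∏-nonneg (λ i → z (suc i))) q) (p zero) q
  where q = ∏-mono (λ i → z (suc i)) (λ i → p (suc i))

∏-* : ∀ {n} (f g : Fin n → ℚ) → ∏ (λ i → f i * g i) ≡ ∏ f * ∏ g
∏-* {zero} f g = refl
∏-* {suc n} f g = trans (cong (f zero * g zero *_) (∏-* (λ i → f (suc i)) (λ i → g (suc i))))
  (solve 4 (λ a b c d → a :* b :* (c :* d) := a :* c :* (b :* d)) refl (f zero) (g zero) (∏ (λ i → f (suc i)))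
      (∏ (λ i → g (suc i))))

∏-1 : ∀ {n} → ∏ {n} (λ _ → 1ℚ) ≡ 1ℚ
∏-1 {zero} = refl
∏-1 {suc n} = trans (ℚP.*-identityˡ _) (∏-1 {n})

∏-swap : ∀ {m n} (f : Fin m → Fin n → ℚ) → ∏ (λ i → ∏ (λ j → f i j)) ≡ ∏ (λ j → ∏ (λ i → f i j))
∏-swap {zero} {n} f = sym (∏-1 {n})
∏-swap {suc m} f = trans (cong (∏ (f zero) *_) (∏-swap (λ i → f (suc i)))) (sym (∏-* (f zero) _))

1+∑≤∏ : ∀ {n} {a : Fin n → ℚ} → (∀ i → 0ℚ ≤ a i) → 1ℚ + ∑ a ≤ ∏ (λ i → 1ℚ + a i)
1+∑≤∏ {zero} p = ≤-refl
1+∑≤∏ {suc n} {a} p = ≤-trans (le-by (a zero * S) (0≤* (p zero) (∑-nonneg (λ i → p (suc i))))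
   (solve 2 (λ a S → (con 1ℚ :+ a) :* (con 1ℚ :+ S) := con 1ℚ :+ (a :+ S) :+ a :* S) refl (a zero) S))
   (*mono (0≤+ 0≤1 (p zero)) (1+∑≤∏ (λ i → p (suc i))))
  where S = ∑ (λ i → a (suc i))

-- One factor at a time: (1 + a)(1 - a - S) ≤ 1 - S for nonnegative a and S. It serves as the bound
-- 1/(1 - S) without a division.
∏-upper : ∀ {n} {a : Fin n → ℚ} → (∀ i → 0ℚ ≤ a i) → ∏ (λ i → 1ℚ + a i) * (1ℚ - ∑ a) ≤ 1ℚ
∏-upper {zero} p = ≤-refl
∏-upper {suc n} {a} p = ≤-trans (le-by (P * (a zero * (a zero + S)))
    (0≤* (∏-nonneg (λ i → 0≤+ 0≤1 (p (suc i)))) (0≤* (p zero) (0≤+ (p zero) (∑-nonneg (λ i → p (suc i))))))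
    (solve 3 (λ a S P → P :* (con 1ℚ :- S) := (con 1ℚ :+ a) :* P :* (con 1ℚ :- (a :+ S)) :+ P :* (a :* (a :+ S))) refl
        (a zero) S P))
    (∏-upper (λ i → p (suc i)))
  where
  S = ∑ (λ i → a (suc i))
  P = ∏ (λ i → 1ℚ + a (suc i))

-- Applied to the probability that none of several independent events occurs. The square of the sum
-- is a generous second-order term, chosen because it passes through the induction.
∏-bonferroni : ∀ {n} {a : Fin n → ℚ} → (∀ i → 0ℚ ≤ a i) → (∀ i → a i ≤ 1ℚ) →
  ∏ (λ i → 1ℚ - a i) ≤ 1ℚ - ∑ a + ∑ a * ∑ a
∏-bonferroni {zero} p q = ≤-refl
∏-bonferroni {suc n} {a} p q = ≤-trans (*mono (sub≥0 (q zero)) (∏-bonferroni (λ i → p (suc i)) (λ i → q (suc i))))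
  (le-by (a zero * a zero + a zero * S + a zero * (S * S)) (0≤+ (0≤+ (0≤* (p zero) (p zero)) (0≤* (p zero) S≥0))
      (0≤* (p zero) (0≤* S≥0 S≥0)))
   (solve 2 (λ a S → con 1ℚ :- (a :+ S) :+ (a :+ S) :* (a :+ S) := (con 1ℚ :- a) :* (con 1ℚ :- S :+ S :* S) :+
       (a :* a :+ a :* S :+ a :* (S :* S))) refl (a zero) S))
  where
  S = ∑ (λ i → a (suc i))
  S≥0 : 0ℚ ≤ S
  S≥0 = ∑-nonneg (λ i → p (suc i))

-- Counting

ι-count : ∀ {n} (P : Fin n → Bool) → ι (count P) ≡ ∑ (λ i → ⟦ P i ⟧)
ι-count {zero} P = ι-0
ι-count {suc n} P with P zero
... | true = trans (ι-suc _) (cong (1ℚ +_) (ι-count (λ i → P (suc i))))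
... | false = trans (ι-count (λ i → P (suc i))) (sym (ℚP.+-identityˡ _))

count-mono : ∀ {n} {P R : Fin n → Bool} → (∀ i → P i ≡ true → R i ≡ true) → count P ℕ.≤ count R
count-mono {n} {P} {R} h = ι-cancel (subst₂ _≤_ (sym (ι-count P)) (sym (ι-count R)) (∑-mono (λ i → ⟦⟧-mono (h i))))

sumN : ∀ {n} → (Fin n → ℕ) → ℕ
sumN {zero} f = 0
sumN {suc n} f = f zero ℕ.+ sumN (λ i → f (suc i))

ι-sumN : ∀ {n} (f : Fin n → ℕ) → ι (sumN f) ≡ ∑ (λ i → ι (f i))
ι-sumN {zero} f = ι-0
ι-sumN {suc n} f = trans (ι-+ (f zero) _) (cong (ι (f zero) +_) (ι-sumN (λ i → f (suc i))))

ι-inj : ∀ {a b} → ι a ≡ ι b → a ≡ b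
ι-inj e = ℕP.≤-antisym (ι-cancel (≤-reflexive e)) (ι-cancel (≤-reflexive (sym e)))

count-fibre : ∀ {n m} (P : Fin n → Bool) (g : Fin n → Fin m) → count P ≡ sumN (λ j → count (λ i → P i ∧ (g i == j)))
count-fibre {n} {m} P g = ι-inj (trans (ι-count P) (trans (∑-cong h1)
   (trans (∑-swap (λ i j → ⟦ P i ∧ (g i == j) ⟧)) (sym (trans (ι-sumN f) (∑-cong (λ j → ι-count (λ i → P i ∧ (g i == j)))))))))
  where
  f : Fin m → ℕ
  f j = count (λ i → P i ∧ (g i == j))
  h1 : ∀ i → ⟦ P i ⟧ ≡ ∑ (λ j → ⟦ P i ∧ (g i == j) ⟧)
  h1 i = sym (trans (∑-cong (λ j → trans (⟦∧⟧ (P i) (g i == j)) (ℚP.*-comm ⟦ P i ⟧ ⟦ g i == j ⟧)))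
      (∑-single (g i) (λ _ → ⟦ P i ⟧)))

pow-sumN : ∀ {n} x (f : Fin n → ℕ) → pow x (sumN f) ≡ ∏ (λ i → pow x (f i))
pow-sumN {zero} x f = refl
pow-sumN {suc n} x f = trans (pow-+ x (f zero) _) (cong (pow x (f zero) *_) (pow-sumN x (λ i → f (suc i))))

∏-if : ∀ {n} x (P : Fin n → Bool) → ∏ (λ i → if P i then x else 1ℚ) ≡ pow x (count P)
∏-if {zero} x P = refl
∏-if {suc n} x P with P zero
... | true = cong (x *_) (∏-if x (λ i → P (suc i)))
... | false = trans (ℚP.*-identityˡ _) (∏-if x (λ i → P (suc i)))

-- Finite expectations

-- A probability space reduced to a positive normalised linear functional. `wit` is the only way
-- back from expectations to outcomes, and it replaces any explicit finiteness of the sample space.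
record Exp (B : Set) : Set where
  field
    𝔼 : (B → ℚ) → ℚ
    𝔼-mono : ∀ {f g} → (∀ b → f b ≤ g b) → 𝔼 f ≤ 𝔼 g
    𝔼-lin : ∀ c f g → 𝔼 (λ b → c * f b + g b) ≡ c * 𝔼 f + 𝔼 g
    𝔼-1 : 𝔼 (λ _ → 1ℚ) ≡ 1ℚ
    wit : ∀ {f} → 0ℚ < 𝔼 f → Σ B λ b → 0ℚ < f b

  𝔼-cong : ∀ {f g} → (∀ b → f b ≡ g b) → 𝔼 f ≡ 𝔼 g
  𝔼-cong h = ℚP.≤-antisym (𝔼-mono (λ b → ≤-reflexive (h b))) (𝔼-mono (λ b → ≤-reflexive (sym (h b))))

  𝔼-+ : ∀ f g → 𝔼 (λ b → f b + g b) ≡ 𝔼 f + 𝔼 g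
  𝔼-+ f g = trans (𝔼-cong (λ b → cong (_+ g b) (sym (ℚP.*-identityˡ (f b)))))
      (trans (𝔼-lin 1ℚ f g) (cong (_+ 𝔼 g) (ℚP.*-identityˡ (𝔼 f))))

  𝔼-0 : 𝔼 (λ _ → 0ℚ) ≡ 0ℚ
  𝔼-0 = trans (𝔼-lin (- 1ℚ) (λ _ → 0ℚ) (λ _ → 0ℚ)) (solve 1 (λ x → :- con 1ℚ :* x :+ x := con 0ℚ) refl (𝔼 (λ _ → 0ℚ)))

  𝔼-* : ∀ c f → 𝔼 (λ b → c * f b) ≡ c * 𝔼 f
  𝔼-* c f = trans (𝔼-cong (λ b → sym (ℚP.+-identityʳ (c * f b))))
      (trans (𝔼-lin c f (λ _ → 0ℚ)) (trans (cong (c * 𝔼 f +_) 𝔼-0) (ℚP.+-identityʳ _)))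

  𝔼-const : ∀ c → 𝔼 (λ _ → c) ≡ c
  𝔼-const c = trans (𝔼-cong (λ _ → sym (ℚP.*-identityʳ c))) (trans (𝔼-* c (λ _ → 1ℚ))
      (trans (cong (c *_) 𝔼-1) (ℚP.*-identityʳ c)))

  𝔼-nonneg : ∀ {f} → (∀ b → 0ℚ ≤ f b) → 0ℚ ≤ 𝔼 f
  𝔼-nonneg {f} h = subst (_≤ 𝔼 f) 𝔼-0 (𝔼-mono h)

  𝔼-∑ : ∀ {n} (f : Fin n → B → ℚ) → 𝔼 (λ b → ∑ (λ i → f i b)) ≡ ∑ (λ i → 𝔼 (f i))
  𝔼-∑ {zero} f = 𝔼-0
  𝔼-∑ {suc n} f = trans (𝔼-+ (f zero) _) (cong (𝔼 (f zero) +_) (𝔼-∑ (λ i → f (suc i))))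

  𝔼-sub : ∀ f g → 𝔼 (λ b → f b - g b) ≡ 𝔼 f - 𝔼 g
  𝔼-sub f g = trans (𝔼-cong (λ b → solve 2 (λ x y → x :- y := :- con 1ℚ :* y :+ x) refl (f b) (g b)))
    (trans (𝔼-lin (- 1ℚ) g f) (solve 2 (λ x y → :- con 1ℚ :* y :+ x := x :- y) refl (𝔼 f) (𝔼 g)))

open Exp public

pos-factor : ∀ {a b} → 0ℚ ≤ a → 0ℚ < a * b → 0ℚ < b
pos-factor {a} {b} p q = ℚP.*-cancelˡ-<-nonNeg a {{ℚ.nonNegative p}} (subst (_< a * b) (sym (ℚP.*-zeroʳ a)) q)

pos-summand : ∀ {a b} → 0ℚ < a + b → 0ℚ < a ⊎ 0ℚ < b
pos-summand {a} {b} p with a ℚP.≤? 0ℚ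
... | no q = inj₁ (ℚP.≰⇒> q)
... | yes q = inj₂ (<-≤-trans p (≤-trans (ℚP.+-monoˡ-≤ b q) (≤-reflexive (ℚP.+-identityˡ b))))

pos-∑ : ∀ {n} {f : Fin n → ℚ} → 0ℚ < ∑ f → Σ (Fin n) λ i → 0ℚ < f i
pos-∑ {zero} p = ⊥-elim (ℚP.<-irrefl refl p)
pos-∑ {suc n} {f} p with pos-summand {f zero} p
... | inj₁ q = zero , q
... | inj₂ q with pos-∑ q
... | i , r = suc i , r

pick : ∀ {Q} (π : Fin Q → ℚ) → (∀ y → 0ℚ ≤ π y) → ∑ π ≤ 1ℚ → Exp (Maybe (Fin Q))
pick {Q} π π≥0 π≤1 = record { 𝔼 = e ; 𝔼-mono = mono ; 𝔼-lin = lin ; 𝔼-1 = one ; wit = λ {f} → w f }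
  where
  e : (Maybe (Fin Q) → ℚ) → ℚ
  e f = (1ℚ - ∑ π) * f nothing + ∑ (λ y → π y * f (just y))
  mono : ∀ {f g} → (∀ b → f b ≤ g b) → e f ≤ e g
  mono h = +-mono-≤ (*mono (sub≥0 π≤1) (h nothing)) (∑-mono (λ y → *mono (π≥0 y) (h (just y))))
  lin : ∀ c f g → e (λ b → c * f b + g b) ≡ c * e f + e g
  lin c f g = trans (cong ((1ℚ - ∑ π) * (c * f nothing + g nothing) +_)
     (trans (∑-cong (λ y → solve 4 (λ p c a b → p :* (c :* a :+ b) := c :* (p :* a) :+ p :* b) refl (π y) c (f (just y))
         (g (just y))))
       (trans (∑-+ (λ y → c * (π y * f (just y))) (λ y → π y * g (just y)))
           (cong (_+ ∑ (λ y → π y * g (just y))) (∑-* c (λ y → π y * f (just y)))))))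
     (solve 6 (λ r c a b S T → r :* (c :* a :+ b) :+ (c :* S :+ T) := c :* (r :* a :+ S) :+ (r :* b :+ T)) refl
        (1ℚ - ∑ π) c (f nothing) (g nothing) (∑ (λ y → π y * f (just y))) (∑ (λ y → π y * g (just y))))
  one : e (λ _ → 1ℚ) ≡ 1ℚ
  one = trans (cong ((1ℚ - ∑ π) * 1ℚ +_) (∑-cong (λ y → ℚP.*-identityʳ (π y))))
      (solve 1 (λ S → (con 1ℚ :- S) :* con 1ℚ :+ S := con 1ℚ) refl (∑ π))
  w : ∀ f → 0ℚ < e f → Σ (Maybe (Fin Q)) λ b → 0ℚ < f b
  w f p with pos-summand {(1ℚ - ∑ π) * f nothing} p
  ... | inj₁ q = nothing , pos-factor (sub≥0 π≤1) q
  ... | inj₂ q with pos-∑ q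
  ... | y , r = just y , pos-factor (π≥0 y) r

pick-nothing0 : ∀ {Q} (π : Fin Q → ℚ) h₁ h₂ f → f nothing ≡ 0ℚ → 𝔼 (pick π h₁ h₂) f ≡ ∑ (λ y → π y * f (just y))
pick-nothing0 π h₁ h₂ f e = trans (cong (_+ ∑ (λ y → π y * f (just y))) (trans (cong ((1ℚ - ∑ π) *_) e) (ℚP.*-zeroʳ (1ℚ - ∑ π))))
    (ℚP.+-identityˡ _)

infixr 5 _◂_
_◂_ : ∀ {V} {B : Set} → B → (Fin V → B) → Fin (suc V) → B
(b ◂ ω) zero = b
(b ◂ ω) (suc i) = ω i

prodExp : ∀ {B V} → (Fin V → Exp B) → Exp (Fin V → B)
prodExp {B} {zero} P = record { 𝔼 = λ f → f (λ ()) ; 𝔼-mono = λ h → h (λ ()) ; 𝔼-lin = λ c f g → refl ; 𝔼-1 = refl ; wit = λ p →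
    (λ ()) , p }
prodExp {B} {suc V} P = record
  { 𝔼 = λ f → 𝔼 P₀ (λ b → 𝔼 R (λ ω → f (b ◂ ω)))
  ; 𝔼-mono = λ h → 𝔼-mono P₀ (λ b → 𝔼-mono R (λ ω → h (b ◂ ω)))
  ; 𝔼-lin = λ c f g → trans (𝔼-cong P₀ (λ b → 𝔼-lin R c (λ ω → f (b ◂ ω)) (λ ω → g (b ◂ ω)))) (𝔼-lin P₀ c _ _)
  ; 𝔼-1 = trans (𝔼-cong P₀ (λ b → 𝔼-1 R)) (𝔼-1 P₀)
  ; wit = λ {f} → w f }
  where
  P₀ = P zero
  R = prodExp (λ i → P (suc i))
  w : ∀ f → 0ℚ < 𝔼 P₀ (λ b → 𝔼 R (λ ω → f (b ◂ ω))) → Σ (Fin (suc V) → B) λ ω → 0ℚ < f ω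
  w f p with wit P₀ p
  ... | b , q with wit R q
  ... | ω , r = (b ◂ ω) , r

E : ∀ {B V} → (Fin V → Exp B) → ((Fin V → B) → ℚ) → ℚ
E P = 𝔼 (prodExp P)

-- Dependence and independence

Dep : ∀ {V} {B : Set} → (Fin V → Bool) → ((Fin V → B) → ℚ) → Set
Dep S f = ∀ ω ω' → (∀ t → S t ≡ true → ω t ≡ ω' t) → f ω ≡ f ω'

Dep-mono : ∀ {V} {B : Set} {S T : Fin V → Bool} {f : (Fin V → B) → ℚ} → (∀ t → S t ≡ true → T t ≡ true) → Dep S f → Dep T f
Dep-mono h d ω ω' e = d ω ω' (λ t s → e t (h t s))

Dep-∏ : ∀ {V n} {B : Set} {S : Fin V → Bool} {f : Fin n → (Fin V → B) → ℚ} → (∀ i → Dep S (f i)) → Dep S (λ ω → ∏ (λ i → f i ω))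
Dep-∏ d ω ω' e = ∏-cong (λ i → d i ω ω' e)

-- Integrate one coordinate at a time. At coordinate zero at most one of f and g may vary, because S
-- and T are disjoint; the inner expectation of the other is constant and factors out.
indep : ∀ {B V} (P : Fin V → Exp B) (S T : Fin V → Bool) (f g : (Fin V → B) → ℚ) → Dep S f → Dep T g →
  (∀ t → S t ≡ true → T t ≡ true → ⊥) → E P (λ ω → f ω * g ω) ≡ E P f * E P g
indep {B} {zero} P S T f g df dg dis = refl
indep {B} {suc V} P S T f g df dg dis = trans (𝔼-cong P₀ ih) (byCase (S zero) refl)
  where
  P₀ = P zero
  R = prodExp (λ i → P (suc i))
  shift : ∀ (S : Fin (suc V) → Bool) h → Dep S h → ∀ b → Dep (λ t → S (suc t)) (λ ω → h (b ◂ ω))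
  shift S h d b ω ω' e = d (b ◂ ω) (b ◂ ω') (λ { zero _ → refl ; (suc t) s → e t s })
  frozen : ∀ (S : Fin (suc V) → Bool) h → Dep S h → S zero ≡ false → ∀ b c → 𝔼 R (λ ω → h (b ◂ ω)) ≡ 𝔼 R (λ ω → h (c ◂ ω))
  frozen S h d z b c = 𝔼-cong R (λ ω → d (b ◂ ω) (c ◂ ω) (λ { zero s → ⊥-elim (absurd s z) ; (suc t) _ → refl }))
    where
    absurd : ∀ {b} → b ≡ true → b ≡ false → ⊥
    absurd refl ()
  ih : ∀ b → 𝔼 R (λ ω → f (b ◂ ω) * g (b ◂ ω)) ≡ 𝔼 R (λ ω → f (b ◂ ω)) * 𝔼 R (λ ω → g (b ◂ ω))
  ih b = indep (λ i → P (suc i)) (λ t → S (suc t)) (λ t → T (suc t)) _ _ (shift S f df b) (shift T g dg b) (λ t → dis (suc t))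
  F G : B → ℚ
  F b = 𝔼 R (λ ω → f (b ◂ ω))
  G b = 𝔼 R (λ ω → g (b ◂ ω))
  const-left : (∀ b c → F b ≡ F c) → 𝔼 P₀ (λ b → F b * G b) ≡ 𝔼 P₀ F * 𝔼 P₀ G
  const-left h = trans (𝔼-cong P₀ (λ b → cong (_* G b) (sym (avg b)))) (𝔼-* P₀ (𝔼 P₀ F) G)
    where
    avg : ∀ b → 𝔼 P₀ F ≡ F b
    avg b = trans (𝔼-cong P₀ (λ c → h c b)) (𝔼-const P₀ (F b))
  const-right : (∀ b c → G b ≡ G c) → 𝔼 P₀ (λ b → F b * G b) ≡ 𝔼 P₀ F * 𝔼 P₀ G
  const-right h = trans (𝔼-cong P₀ (λ b → trans (ℚP.*-comm (F b) (G b)) (cong (_* F b) (sym (avg b)))))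
      (trans (𝔼-* P₀ (𝔼 P₀ G) F) (ℚP.*-comm (𝔼 P₀ G) _))
    where
    avg : ∀ b → 𝔼 P₀ G ≡ G b
    avg b = trans (𝔼-cong P₀ (λ c → h c b)) (𝔼-const P₀ (G b))
  T-false : S zero ≡ true → T zero ≡ false
  T-false s with T zero in e
  ... | false = refl
  ... | true = ⊥-elim (dis zero s e)
  byCase : ∀ b → S zero ≡ b → 𝔼 P₀ (λ b → F b * G b) ≡ 𝔼 P₀ F * 𝔼 P₀ G
  byCase false e = const-left (frozen S f df e)
  byCase true e = const-right (frozen T g dg (T-false e))

indep-∏ : ∀ {B V} (P : Fin V → Exp B) {n} (S : Fin n → Fin V → Bool) (h : Fin n → (Fin V → B) → ℚ) → (∀ i → Dep (S i) (h i)) →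
  (∀ i j t → S i t ≡ true → S j t ≡ true → i ≡ j) → E P (λ ω → ∏ (λ i → h i ω)) ≡ ∏ (λ i → E P (h i))
indep-∏ P {zero} S h d dis = 𝔼-1 (prodExp P)
indep-∏ P {suc n} S h d dis = trans
  (indep P (S zero) (λ t → not (S zero t)) (h zero) (λ ω → ∏ (λ i → h (suc i) ω)) (d zero)
      (Dep-∏ (λ i → Dep-mono {f = h (suc i)} (outside i) (d (suc i)))) opp)
  (cong (E P (h zero) *_) (indep-∏ P (λ i → S (suc i)) (λ i → h (suc i)) (λ i → d (suc i))
      (λ i j t p q → FPsuc (dis (suc i) (suc j) t p q))))
  where
  FPsuc : ∀ {n} {i j : Fin n} → Fin.suc i ≡ suc j → i ≡ j
  FPsuc refl = refl
  outside : ∀ i t → S (suc i) t ≡ true → not (S zero t) ≡ true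
  outside i t p with S zero t in e
  ... | false = refl
  ... | true with dis zero (suc i) t e p
  ... | ()
  opp : ∀ t → S zero t ≡ true → not (S zero t) ≡ true → ⊥
  opp t p q rewrite p with q
  ... | ()

E-∏single : ∀ {B V} (P : Fin V → Exp B) (f : Fin V → B → ℚ) → E P (λ ω → ∏ (λ t → f t (ω t))) ≡ ∏ (λ t → 𝔼 (P t) (f t))
E-∏single {V = zero} P f = refl
E-∏single {V = suc V} P f = trans (𝔼-cong (P zero) (λ b → trans (𝔼-* (prodExp (λ i → P (suc i))) (f zero b) _)
    (trans (cong (f zero b *_) (E-∏single (λ i → P (suc i)) (λ i → f (suc i)))) (ℚP.*-comm (f zero b) _))))
  (trans (𝔼-* (P zero) (∏ (λ t → 𝔼 (P (suc t)) (f (suc t)))) (f zero)) (ℚP.*-comm _ (𝔼 (P zero) (f zero))))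

E-single : ∀ {B V} (P : Fin V → Exp B) t (f : B → ℚ) → E P (λ ω → f (ω t)) ≡ 𝔼 (P t) f
E-single {V = suc V} P zero f = 𝔼-cong (P zero) (λ b → 𝔼-const (prodExp (λ i → P (suc i))) (f b))
E-single {V = suc V} P (suc t) f = trans (𝔼-const (P zero) _) (E-single (λ i → P (suc i)) t f)

-- The symmetric Lovász local lemma

module LocalLemma {B : Set} {V I : ℕ} (P : Fin V → Exp B) (bad : Fin I → (Fin V → B) → Bool)
  (ball : Fin I → Fin V → Bool) (dep : ∀ i → Dep (ball i) (λ ω → ⟦ bad i ω ⟧))
  (nb : Fin I → Fin I → Bool) (apart : ∀ i j → nb i j ≡ false → ∀ t → ball i t ≡ true → ball j t ≡ true → ⊥)
  (p d : ℚ) (0≤p : 0ℚ ≤ p) (rare : ∀ i → E P (λ ω → ⟦ bad i ω ⟧) ≤ p) (few : ∀ i → ι (count (nb i)) ≤ d)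
  (4p<1 : (p + p) + (p + p) < 1ℚ) (4pd≤1 : ((p + p) + (p + p)) * d ≤ 1ℚ) where

  Ω = Fin V → B

  good : List (Fin I) → Ω → ℚ
  good [] ω = 1ℚ
  good (i ∷ S) ω = (1ℚ - ⟦ bad i ω ⟧) * good S ω

  0≤1-bad : ∀ i ω → 0ℚ ≤ 1ℚ - ⟦ bad i ω ⟧
  0≤1-bad i ω = sub≥0 ⟦ bad i ω ⟧≤1

  0≤good : ∀ S ω → 0ℚ ≤ good S ω
  0≤good [] ω = 0≤1
  0≤good (i ∷ S) ω = 0≤* (0≤1-bad i ω) (0≤good S ω)

  good≤1 : ∀ S ω → good S ω ≤ 1ℚ
  good≤1 [] ω = ≤-refl
  good≤1 (i ∷ S) ω = *-mono₂ {1ℚ - ⟦ bad i ω ⟧} {1ℚ} {good S ω} {1ℚ} (0≤1-bad i ω) 0≤1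
      (le-by ⟦ bad i ω ⟧ 0≤⟦ bad i ω ⟧ (solve 1 (λ b → con 1ℚ := con 1ℚ :- b :+ b) refl ⟦ bad i ω ⟧)) (good≤1 S ω)

  good-++ : ∀ S T ω → good (S ++ T) ω ≡ good S ω * good T ω
  good-++ [] T ω = sym (ℚP.*-identityˡ _)
  good-++ (i ∷ S) T ω = trans (cong ((1ℚ - ⟦ bad i ω ⟧) *_) (good-++ S T ω)) (sym (ℚP.*-assoc (1ℚ - ⟦ bad i ω ⟧) _ _))

  -- Neighbours are counted with multiplicity, since lists may repeat an event; the bound `Sparse`
  -- is then inherited by tails and by any splitting of the list.
  weight : Fin I → List (Fin I) → ℚ
  weight i [] = 0ℚ
  weight i (j ∷ S) = ⟦ nb i j ⟧ + weight i S

  Sparse : List (Fin I) → Set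
  Sparse S = ∀ i → weight i S ≤ d

  keep drop : Fin I → List (Fin I) → List (Fin I)
  keep i [] = []
  keep i (j ∷ S) = if nb i j then j ∷ keep i S else keep i S
  drop i [] = []
  drop i (j ∷ S) = if nb i j then drop i S else j ∷ drop i S

  weight-++ : ∀ i S T → weight i (S ++ T) ≡ weight i S + weight i T
  weight-++ i [] T = sym (ℚP.+-identityˡ _)
  weight-++ i (j ∷ S) T = trans (cong (⟦ nb i j ⟧ +_) (weight-++ i S T)) (sym (ℚP.+-assoc ⟦ nb i j ⟧ _ _))

  0≤weight : ∀ i S → 0ℚ ≤ weight i S
  0≤weight i [] = ≤-refl
  0≤weight i (j ∷ S) = 0≤+ 0≤⟦ nb i j ⟧ (0≤weight i S)

  sparse-tail : ∀ j S → Sparse (j ∷ S) → Sparse S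
  sparse-tail j S h i = ≤-trans (le-by ⟦ nb i j ⟧ 0≤⟦ nb i j ⟧ (ℚP.+-comm ⟦ nb i j ⟧ (weight i S))) (h i)

  split-weight : ∀ i h S → weight h (keep i S ++ drop i S) ≡ weight h S
  split-weight i h [] = refl
  split-weight i h (j ∷ S) with nb i j
  ... | true = cong (⟦ nb h j ⟧ +_) (split-weight i h S)
  ... | false = trans (weight-++ h (keep i S) (j ∷ drop i S))
      (trans (solve 3 (λ a b c → a :+ (b :+ c) := b :+ (a :+ c)) refl (weight h (keep i S)) ⟦ nb h j ⟧ (weight h (drop i S)))
      (cong (⟦ nb h j ⟧ +_) (trans (sym (weight-++ h (keep i S) (drop i S))) (split-weight i h S))))

  split-good : ∀ i S ω → good S ω ≡ good (keep i S) ω * good (drop i S) ω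
  split-good i [] ω = refl
  split-good i (j ∷ S) ω with nb i j
  ... | true = trans (cong ((1ℚ - ⟦ bad j ω ⟧) *_) (split-good i S ω)) (sym (ℚP.*-assoc (1ℚ - ⟦ bad j ω ⟧) _ _))
  ... | false = trans (cong ((1ℚ - ⟦ bad j ω ⟧) *_) (split-good i S ω))
      (solve 3 (λ a b c → a :* (b :* c) := b :* (a :* c)) refl (1ℚ - ⟦ bad j ω ⟧) (good (keep i S) ω) (good (drop i S) ω))

  split-length : ∀ i S → length (keep i S) ℕ.+ length (drop i S) ≡ length S
  split-length i [] = refl
  split-length i (j ∷ S) with nb i j
  ... | true = cong suc (split-length i S)
  ... | false = trans (ℕP.+-suc _ _) (cong suc (split-length i S))

  keep-length : ∀ i S → ι (length (keep i S)) ≡ weight i S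
  keep-length i [] = ι-0
  keep-length i (j ∷ S) with nb i j
  ... | true = trans (ι-suc _) (cong (1ℚ +_) (keep-length i S))
  ... | false = trans (keep-length i S) (sym (ℚP.+-identityˡ _))

  drop-indep : ∀ i S → E P (λ ω → ⟦ bad i ω ⟧ * good (drop i S) ω) ≡ E P (λ ω → ⟦ bad i ω ⟧) * E P (good (drop i S))
  drop-indep i S = indep P (ball i) (λ t → not (ball i t)) _ (good (drop i S)) (dep i) (depG S) opp
    where
    opp : ∀ t → ball i t ≡ true → not (ball i t) ≡ true → ⊥
    opp t e f rewrite e with f
    ... | ()
    out : ∀ j → nb i j ≡ false → ∀ t → ball j t ≡ true → not (ball i t) ≡ true
    out j e t b with ball i t in f
    ... | false = refl
    ... | true = ⊥-elim (apart i j e t f b)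
    depG : ∀ S → Dep (λ t → not (ball i t)) (good (drop i S))
    depG [] ω ω' e = refl
    depG (j ∷ S) with nb i j in q
    ... | true = depG S
    ... | false = λ ω ω' e → cong₂ (λ x y → (1ℚ - x) * y) (dep j ω ω' (λ t b → e t (out j q t b))) (depG S ω ω' e)

  2p = p + p
  0≤2p : 0ℚ ≤ 2p
  0≤2p = 0≤+ 0≤p 0≤p

  -- The classical estimate that an event has probability at most 2 p given that none of S occurs,
  -- multiplied out so that nothing is divided by a possibly zero probability. Without its
  -- neighbours the event is independent of S; `remove` restores the neighbours and at least half of
  -- the probability remains, because 4 p d ≤ 1.
  conditional : ∀ n S → length S ℕ.≤ n → Sparse S → ∀ i → E P (λ ω → ⟦ bad i ω ⟧ * good S ω) ≤ 2p * E P (good S)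
  -- Each event of T that is put back costs at most 2 p times E (good S), by `conditional` for a
  -- list that is shorter by one; n bounds the total length and drives the mutual induction.
  remove : ∀ n T S → length T ℕ.+ length S ℕ.≤ n → Sparse (T ++ S) → (1ℚ - 2p * ι (length T)) * E P (good S) ≤ E P (good (T ++ S))

  remove n [] S le sp = ≤-reflexive (trans (cong (λ z → (1ℚ - 2p * z) * E P (good S)) ι-0)
      (solve 2 (λ p e → (con 1ℚ :- p :* con 0ℚ) :* e := e) refl 2p (E P (good S))))
  remove (suc n) (j ∷ T) S (s≤s le) sp = ≤-trans step1 (≤-reflexive (sym eq))
    where
    sp' : Sparse (T ++ S)
    sp' = sparse-tail j (T ++ S) sp
    G = E P (good (T ++ S))
    Bd = E P (λ ω → ⟦ bad j ω ⟧ * good (T ++ S) ω)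
    e0 = E P (good S)
    G≤ : G ≤ e0
    G≤ = 𝔼-mono (prodExp P) (λ ω → subst₂ _≤_ (sym (good-++ T S ω)) (ℚP.*-identityˡ _) (*monoʳ (0≤good S ω) (good≤1 T ω)))
    len-eq : length (T ++ S) ≡ length T ℕ.+ length S
    len-eq = LP.length-++ T
    Bd≤ : Bd ≤ 2p * e0
    Bd≤ = ≤-trans (conditional n (T ++ S) (subst (ℕ._≤ n) (sym len-eq) le) sp' j) (*mono 0≤2p G≤)
    ih : (1ℚ - 2p * ι (length T)) * e0 ≤ G
    ih = remove n T S le sp'
    eq : E P (good (j ∷ T ++ S)) ≡ G - Bd
    eq = trans (𝔼-cong (prodExp P) (λ ω → solve 2 (λ b g → (con 1ℚ :- b) :* g := g :- b :* g) refl ⟦ bad j ω ⟧ (good (T ++ S) ω)))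
        (𝔼-sub (prodExp P) (good (T ++ S)) (λ ω → ⟦ bad j ω ⟧ * good (T ++ S) ω))
    step1 : (1ℚ - 2p * ι (suc (length T))) * e0 ≤ G - Bd
    step1 = le-by ((G - (1ℚ - 2p * ι (length T)) * e0) + (2p * e0 - Bd)) (0≤+ (sub≥0 ih) (sub≥0 Bd≤))
      (trans (solve 5 (λ G B q l e → G :- B := (con 1ℚ :- q :* (con 1ℚ :+ l)) :* e :+
          ((G :- (con 1ℚ :- q :* l) :* e) :+ (q :* e :- B))) refl G Bd 2p (ι (length T)) e0)
        (cong (λ z → (1ℚ - 2p * z) * e0 + ((G - (1ℚ - 2p * ι (length T)) * e0) + (2p * e0 - Bd))) (sym (ι-suc (length T)))))

  conditional n S le sp i = ≤-trans up (≤-trans up2 (≤-trans (*mono 0≤p half) (≤-reflexive *two)))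
    where
    T = keep i S
    S' = drop i S
    e0 = E P (good S')
    up : E P (λ ω → ⟦ bad i ω ⟧ * good S ω) ≤ E P (λ ω → ⟦ bad i ω ⟧ * good S' ω)
    up = 𝔼-mono (prodExp P) (λ ω → *mono 0≤⟦ bad i ω ⟧ (subst₂ _≤_ (sym (split-good i S ω)) (ℚP.*-identityˡ _)
        (*monoʳ (0≤good S' ω) (good≤1 T ω))))
    0≤e0 : 0ℚ ≤ e0
    0≤e0 = 𝔼-nonneg (prodExp P) (0≤good S')
    up2 : E P (λ ω → ⟦ bad i ω ⟧ * good S' ω) ≤ p * e0
    up2 = ≤-trans (≤-reflexive (drop-indep i S)) (*monoʳ 0≤e0 (rare i))
    G = E P (good S)
    lower : (1ℚ - 2p * ι (length T)) * e0 ≤ G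
    lower = ≤-trans (remove n T S' (subst (ℕ._≤ n) (sym (split-length i S)) le)
        (λ h → subst (_≤ d) (sym (split-weight i h S)) (sp h)))
       (≤-reflexive (𝔼-cong (prodExp P) (λ ω → trans (good-++ T S' ω) (sym (split-good i S ω)))))
    len≤ : ι (length T) ≤ d
    len≤ = ≤-trans (≤-reflexive (keep-length i S)) (sp i)
    small : (2p + 2p) * ι (length T) ≤ 1ℚ
    small = ≤-trans (*mono (0≤+ 0≤2p 0≤2p) len≤) 4pd≤1
    half : e0 ≤ G + G
    half = le-by ((1ℚ - (2p + 2p) * ι (length T)) * e0 + ((G - (1ℚ - 2p * ι (length T)) * e0) +
        (G - (1ℚ - 2p * ι (length T)) * e0)))
       (0≤+ (0≤* (sub≥0 small) 0≤e0) (0≤+ (sub≥0 lower) (sub≥0 lower)))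
       (solve 4 (λ G q l e → G :+ G := e :+ ((con 1ℚ :- (q :+ q) :* l) :* e :+
           ((G :- (con 1ℚ :- q :* l) :* e) :+ (G :- (con 1ℚ :- q :* l) :* e)))) refl G 2p (ι (length T)) e0)
    *two : p * (G + G) ≡ 2p * G
    *two = solve 2 (λ p g → p :* (g :+ g) := (p :+ p) :* g) refl p G

  2p<1 : 2p < 1ℚ
  2p<1 = ≤-<-trans (le-by 2p 0≤2p refl) 4p<1

  positive : ∀ S → Sparse S → 0ℚ < E P (good S)
  positive [] sp = subst (0ℚ <_) (sym (𝔼-1 (prodExp P))) 0<1
  positive (j ∷ S) sp = <-≤-trans (0<* (subst (_< 1ℚ - 2p) (ℚP.+-inverseʳ 2p) (ℚP.+-monoˡ-< (- 2p) 2p<1))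
      (positive S (sparse-tail j S sp)))
    (≤-trans (le-by (2p * G - Bd) (sub≥0 (conditional (length S) S ℕP.≤-refl (sparse-tail j S sp) j))
        (solve 3 (λ G B q → G :- B := (con 1ℚ :- q) :* G :+ (q :* G :- B)) refl G Bd 2p)) (≤-reflexive (sym eq)))
    where
    G = E P (good S)
    Bd = E P (λ ω → ⟦ bad j ω ⟧ * good S ω)
    eq : E P (good (j ∷ S)) ≡ G - Bd
    eq = trans (𝔼-cong (prodExp P) (λ ω → solve 2 (λ b g → (con 1ℚ :- b) :* g := g :- b :* g) refl ⟦ bad j ω ⟧ (good S ω)))
        (𝔼-sub (prodExp P) (good S) (λ ω → ⟦ bad j ω ⟧ * good S ω))

  weight-tabulate : ∀ i {n} (f : Fin n → Fin I) → weight i (tabulate f) ≡ ∑ (λ j → ⟦ nb i (f j) ⟧)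
  weight-tabulate i {zero} f = refl
  weight-tabulate i {suc n} f = cong (⟦ nb i (f zero) ⟧ +_) (weight-tabulate i (λ j → f (suc j)))

  good-tabulate : ∀ ω {n} (f : Fin n → Fin I) → 0ℚ < good (tabulate f) ω → ∀ j → bad (f j) ω ≡ false
  good-tabulate ω {suc n} f h zero with bad (f zero) ω
  ... | false = refl
  ... | true = ⊥-elim (ℚP.<-irrefl refl (subst (0ℚ <_) (ℚP.*-zeroˡ (good (tabulate (λ j → f (suc j))) ω)) h))
  good-tabulate ω {suc n} f h (suc j) = good-tabulate ω (λ j → f (suc j)) (pos-factor (0≤1-bad (f zero) ω) h) j

  everything : List (Fin I)
  everything = tabulate (λ i → i)

  all-good-positive : 0ℚ < E P (good everything)
  all-good-positive = positive everything (λ i → ≤-trans (≤-reflexive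
      (trans (weight-tabulate i (λ j → j)) (sym (ι-count (nb i))))) (few i))

  -- `full` is a condition that holds almost surely. Subtracting the indicator of its failure leaves
  -- the expectation of `good everything` positive, so a single outcome satisfies everything at
  -- once.
  avoid : (full : Ω → Bool) → E P (λ ω → ⟦ not (full ω) ⟧) ≤ 0ℚ → Σ Ω λ ω → full ω ≡ true × (∀ i → bad i ω ≡ false)
  avoid full null = ω , isfull , good-tabulate ω (λ i → i) (<-≤-trans (proj₂ w)
      (le-by ⟦ not (full ω) ⟧ 0≤⟦ not (full ω) ⟧ (solve 2 (λ g b → g := g :- b :+ b) refl (good everything ω) ⟦ not (full ω) ⟧)))
    where
    f : Ω → ℚ
    f ω = good everything ω - ⟦ not (full ω) ⟧
    w : Σ Ω λ ω → 0ℚ < f ω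
    w = wit (prodExp P) (<-≤-trans all-good-positive (≤-trans (le-by (0ℚ - E P (λ ω → ⟦ not (full ω) ⟧)) (sub≥0 null)
          (solve 2 (λ g n → g :- n := g :+ (con 0ℚ :- n)) refl (E P (good everything)) (E P (λ ω → ⟦ not (full ω) ⟧))))
              (≤-reflexive (sym (𝔼-sub (prodExp P) (good everything) (λ ω → ⟦ not (full ω) ⟧))))))
    ω = proj₁ w
    check : ∀ ω b → 0ℚ < good everything ω - ⟦ not b ⟧ → b ≡ true
    check ω true _ = refl
    check ω false q = ⊥-elim (ℚP.<-irrefl refl (<-≤-trans q (≤-trans (ℚP.+-monoˡ-≤ (- 1ℚ) (good≤1 everything ω))
        (≤-reflexive (ℚP.+-inverseʳ 1ℚ)))))
    isfull : full ω ≡ true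
    isfull = check ω (full ω) (proj₂ w)

-- Exponential moments

true≢false : ∀ {b} → b ≡ true → b ≡ false → ⊥
true≢false refl ()

-- Chernoff's method with rational bases: `x` is the base of the moment and its a-th root `y` the
-- unit in which tails are measured. `C` bounds the contribution of one independent group, twice ℓ
-- because a pick acts through two kinds of conflict. The choice w = 1/(a² C) makes x^C about 1 +
-- 1/a, so replacing x^c by a linear function of c loses only a lower-order term.
module Moment (a ℓ : ℕ) (2≤a : 2 ℕ.≤ a) (1≤ℓ : 1 ℕ.≤ ℓ) where

  C : ℕ
  C = 2 ℕ.* ℓ
  A Cq D : ℚ
  A = ι a
  Cq = ι C
  D = A * A * Cq

  2≤A : 1ℚ + 1ℚ ≤ A
  2≤A = subst (_≤ A) (trans (ι-suc 1) (cong (1ℚ +_) ι-1)) (ι-mono 2≤a)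
  2≤Cq : 1ℚ + 1ℚ ≤ Cq
  2≤Cq = subst (_≤ Cq) (trans (ι-suc 1) (cong (1ℚ +_) ι-1)) (ι-mono
      (ℕP.≤-trans (ℕP.≤-reflexive (sym (ℕP.*-identityʳ 2))) (ℕP.*-monoʳ-≤ 2 1≤ℓ)))
  0<2 : 0ℚ < 1ℚ + 1ℚ
  0<2 = 0<+ 0<1 0≤1
  0<A : 0ℚ < A
  0<A = <-≤-trans 0<2 2≤A
  0<Cq : 0ℚ < Cq
  0<Cq = <-≤-trans 0<2 2≤Cq
  1≤A-1 : 1ℚ ≤ A - 1ℚ
  1≤A-1 = le-by (A - (1ℚ + 1ℚ)) (sub≥0 2≤A) (solve 1 (λ A → A :- con 1ℚ := con 1ℚ :+ (A :- (con 1ℚ :+ con 1ℚ))) refl A)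
  0<A-1 : 0ℚ < A - 1ℚ
  0<A-1 = <-≤-trans 0<1 1≤A-1
  0<D : 0ℚ < D
  0<D = 0<* (0<* 0<A 0<A) 0<Cq

  w : ℚ
  w = proj₁ (recip D 0<D)
  0<w : 0ℚ < w
  0<w = proj₁ (proj₂ (recip D 0<D))
  0≤w : 0ℚ ≤ w
  0≤w = <⇒≤ 0<w
  Dw : D * w ≡ 1ℚ
  Dw = proj₂ (proj₂ (recip D 0<D))

  y x : ℚ
  y = 1ℚ + w
  x = pow y a
  1≤y : 1ℚ ≤ y
  1≤y = le-by w 0≤w refl
  1≤x : 1ℚ ≤ x
  1≤x = pow≥1 a 1≤y

  X : ℚ
  X = pow x C - 1ℚ
  0≤X : 0ℚ ≤ X
  0≤X = sub≥0 (pow≥1 C 1≤x)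

  -- Here x^C is the (C a)-th power of 1 + w and C a w = 1/a, so `pow-upper` bounds it by a/(a - 1).
  X-bound : X * (A - 1ℚ) ≤ 1ℚ
  X-bound = le-by (A * (1ℚ - Z * (1ℚ - ι (C ℕ.* a) * w))) (0≤* (<⇒≤ 0<A) (sub≥0 (pow-upper (C ℕ.* a) 0≤w)))
    (sym (trans (cong (λ z → (z - 1ℚ) * (A - 1ℚ) + A * (1ℚ - Z * (1ℚ - ι (C ℕ.* a) * w))) (sym (pow-* y C a)))
      (trans (cong (λ z → (Z - 1ℚ) * (A - 1ℚ) + A * (1ℚ - Z * (1ℚ - z * w))) (ι-* C a))
        (trans (solve 4 (λ Z A C w → (Z :- con 1ℚ) :* (A :- con 1ℚ) :+ A :*
            (con 1ℚ :- Z :* (con 1ℚ :- C :* A :* w)) := con 1ℚ :+ Z :* ((A :* A :* C :* w) :- con 1ℚ)) refl Z A Cq w)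
          (trans (cong (λ z → 1ℚ + Z * (z - 1ℚ)) Dw) (solve 1 (λ Z → con 1ℚ :+ Z :* (con 1ℚ :- con 1ℚ) := con 1ℚ) refl Z))))))
    where
    Z = pow y (C ℕ.* a)

  1/C = proj₁ (recip Cq 0<Cq)
  C1/C : Cq * 1/C ≡ 1ℚ
  C1/C = proj₂ (proj₂ (recip Cq 0<Cq))

  -- Slope of the chord of t ↦ x^t over the interval from 0 to C.
  β : ℚ
  β = X * 1/C
  0≤β : 0ℚ ≤ β
  0≤β = 0≤* 0≤X (<⇒≤ (proj₁ (proj₂ (recip Cq 0<Cq))))
  Cβ : Cq * β ≡ X
  Cβ = trans (solve 3 (λ C X i → C :* (X :* i) := X :* (C :* i)) refl Cq X 1/C) (trans (cong (X *_) C1/C) (ℚP.*-identityʳ X))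

  convex : ∀ {c} → c ℕ.≤ C → pow x c ≤ 1ℚ + β * ι c
  convex {c} h = *cancel 0<Cq (le-by (ι c * X - Cq * (pow x c - 1ℚ)) (sub≥0 (pow-convex 1≤x h))
    (trans (solve 3 (λ C b n → C :* (con 1ℚ :+ b :* n) := C :+ n :* (C :* b)) refl Cq β (ι c))
        (trans (cong (λ z → Cq + ι c * z) Cβ)
      (solve 4 (λ C n X p → C :+ n :* X := C :* p :+ (n :* X :- C :* (p :- con 1ℚ))) refl Cq (ι c) X (pow x c)))))

  β-bound : β * (Cq * (A - 1ℚ)) ≤ 1ℚ
  β-bound = subst (_≤ 1ℚ) (trans (cong (_* (A - 1ℚ)) (sym Cβ))
      (solve 3 (λ c b e → c :* b :* e := b :* (c :* e)) refl Cq β (A - 1ℚ))) X-bound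

  -- The hypothesis under which E x^count ≤ y^(bn) for a count of mean at most qn; b is about qa.
  Pays : ℕ → ℚ → Set
  Pays b q = q * (A * A * A) ≤ ι b * ((A - 1ℚ) * (A - 1ℚ))

  -- Since β ≤ 1/(C (a - 1)) and w = 1/(a² C), `Pays` turns u ≤ β q into a u ≤ b w (a - 1). Also u ≤
  -- 1/a, so 1 - 1/a may be replaced by 1 - u.
  pays : ∀ b q → 0ℚ ≤ q → q ≤ 1ℚ → Pays b q → ∀ u → 0ℚ ≤ u → u ≤ β * q → 1ℚ ≤ (1ℚ - u) * (1ℚ + ι b * w)
  pays b q 0≤q q≤1 h u 0≤u u≤ = le-by (B * w * (1ℚ - u) - u) (sub≥0 final)
      (solve 3 (λ B w u → (con 1ℚ :- u) :* (con 1ℚ :+ B :* w) := con 1ℚ :+ (B :* w :* (con 1ℚ :- u) :- u)) refl B w u)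
    where
    B = ι b
    CA = Cq * (A - 1ℚ)
    0<CA : 0ℚ < CA
    0<CA = 0<* 0<Cq 0<A-1
    h1 : u * CA ≤ q
    h1 = ≤-trans (*monoʳ (<⇒≤ 0<CA) u≤) (≤-trans (≤-reflexive (solve 3 (λ b q c → b :* q :* c := q :* (b :* c)) refl β q CA))
        (≤-trans (*mono 0≤q β-bound) (≤-reflexive (ℚP.*-identityʳ q))))
    h2 : u * A ≤ 1ℚ
    h2 = ≤-trans (*mono 0≤u (≤-trans (le-by (A - (1ℚ + 1ℚ)) (sub≥0 2≤A)
        (solve 1 (λ A → (con 1ℚ :+ con 1ℚ) :* (A :- con 1ℚ) := A :+ (A :- (con 1ℚ :+ con 1ℚ))) refl A))
        (*monoʳ (<⇒≤ 0<A-1) 2≤Cq)))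
            (≤-trans h1 q≤1)
    G = CA * (A * A)
    0<G : 0ℚ < G
    0<G = 0<* 0<CA (0<* 0<A 0<A)
    h3 : u * A ≤ B * w * (A - 1ℚ)
    h3 = *cancel 0<G (≤-trans (≤-reflexive (solve 3 (λ u A c → c :* (A :* A) :* (u :* A) := (u :* c) :* (A :* A :* A)) refl u A
        CA))
          (≤-trans (*monoʳ (0≤* (0≤* (<⇒≤ 0<A) (<⇒≤ 0<A)) (<⇒≤ 0<A)) h1) (≤-trans h (≤-reflexive
            (trans (sym (ℚP.*-identityʳ _)) (trans (cong (B * ((A - 1ℚ) * (A - 1ℚ)) *_) (sym Dw))
               (solve 4 (λ B A c w → B :* ((A :- con 1ℚ) :* (A :- con 1ℚ)) :* (A :* A :* c :* w) := c :* (A :- con 1ℚ) :*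
                   (A :* A) :* (B :* w :* (A :- con 1ℚ))) refl B A Cq w)))))))
    final : u ≤ B * w * (1ℚ - u)
    final = *cancel 0<A (≤-trans (≤-reflexive (ℚP.*-comm A u))
        (≤-trans h3 (le-by (B * w * (1ℚ - u * A)) (0≤* (0≤* (0≤ι b) 0≤w) (sub≥0 h2))
      (solve 4 (λ B w A u → A :* (B :* w :* (con 1ℚ :- u)) := B :* w :* (A :- con 1ℚ) :+ B :* w :* (con 1ℚ :- u :* A)) refl B w A
          u))))

  -- Double counting in multiplicative form. The factor of a group is split into a product over the
  -- items; after exchanging the products, each item collects at most 1/(1 - β q), which is at most
  -- 1 + b w and so at most y^b.
  exchange : ∀ {T Q} b q → 0ℚ ≤ q → q ≤ 1ℚ → Pays b q → (N : Fin Q → Bool) (ρ : Fin T → Fin Q → ℚ) → (∀ t i → 0ℚ ≤ ρ t i) →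
    (∀ i → N i ≡ true → ∑ (λ t → ρ t i) ≤ q) → ∏ (λ t → 1ℚ + β * ∑ (λ i → ⟦ N i ⟧ * ρ t i)) ≤ pow y (b ℕ.* count N)
  exchange {T} {Q} b q 0≤q q≤1 h N ρ ρ≥0 ρ≤ = ≤-trans (∏-mono
      (λ t → 0≤+ 0≤1 (0≤* 0≤β (∑-nonneg (λ i → 0≤* 0≤⟦ N i ⟧ (ρ≥0 t i))))) row)
     (≤-trans (≤-reflexive (∏-swap (λ t i → 1ℚ + β * (⟦ N i ⟧ * ρ t i))))
         (≤-trans (∏-mono (λ i → ∏-nonneg (λ t → 0≤+ 0≤1 (a≥0 t i))) col) (≤-reflexive fin)))
    where
    a≥0 : ∀ t i → 0ℚ ≤ β * (⟦ N i ⟧ * ρ t i)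
    a≥0 t i = 0≤* 0≤β (0≤* 0≤⟦ N i ⟧ (ρ≥0 t i))
    row : ∀ t → 1ℚ + β * ∑ (λ i → ⟦ N i ⟧ * ρ t i) ≤ ∏ (λ i → 1ℚ + β * (⟦ N i ⟧ * ρ t i))
    row t = ≤-trans (≤-reflexive (cong (1ℚ +_) (sym (∑-* β (λ i → ⟦ N i ⟧ * ρ t i))))) (1+∑≤∏ (a≥0 t))
    Y = pow y b
    col : ∀ i → ∏ (λ t → 1ℚ + β * (⟦ N i ⟧ * ρ t i)) ≤ (if N i then Y else 1ℚ)
    col i = byCase (N i) refl
      where
      u = ∑ (λ t → β * (1ℚ * ρ t i))
      Π = ∏ (λ t → 1ℚ + β * (1ℚ * ρ t i))
      nn : ∀ t → 0ℚ ≤ β * (1ℚ * ρ t i)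
      nn t = 0≤* 0≤β (0≤* 0≤1 (ρ≥0 t i))
      up : N i ≡ true → Π ≤ 1ℚ + ι b * w
      up e = ≤-trans (≤-trans (≤-reflexive (sym (ℚP.*-identityʳ Π)))
          (*mono (∏-nonneg (λ t → 0≤+ 0≤1 (nn t))) (pays b q 0≤q q≤1 h u (∑-nonneg nn) u≤)))
           (≤-trans (≤-reflexive (sym (ℚP.*-assoc Π (1ℚ - u) (1ℚ + ι b * w))))
               (≤-trans (*monoʳ (0≤+ 0≤1 (0≤* (0≤ι b) 0≤w)) (∏-upper nn)) (≤-reflexive (ℚP.*-identityˡ (1ℚ + ι b * w)))))
        where
        u≤ : u ≤ β * q
        u≤ = ≤-trans (≤-reflexive (trans (∑-cong (λ t → cong (β *_) (ℚP.*-identityˡ (ρ t i)))) (∑-* β (λ t → ρ t i))))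
            (*mono 0≤β (ρ≤ i e))
      byCase : ∀ v → N i ≡ v → ∏ (λ t → 1ℚ + β * (⟦ v ⟧ * ρ t i)) ≤ (if v then Y else 1ℚ)
      byCase false e = ≤-reflexive (trans (∏-cong {T} (λ t → solve 2 (λ b r → con 1ℚ :+ b :* (con 0ℚ :* r) := con 1ℚ) refl β
          (ρ t i))) (∏-1 {T}))
      byCase true e = ≤-trans (up e) (bernoulli b 0≤w)
    fin : ∏ (λ i → if N i then Y else 1ℚ) ≡ pow y (b ℕ.* count N)
    fin = trans (∏-if Y N) (trans (sym (pow-* y (count N) b)) (cong (pow y) (ℕP.*-comm (count N) b)))

  module _ {B : Set} {V : ℕ} (P : Fin V → Exp B) where

    -- The threshold satisfies x^K = y^(a K) ≥ y^((b+1) M). The moment uses up b M of this exponent,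
    -- and the remaining y^M is the tail bound. M may exceed the true number of items.
    markov : ∀ b n M K (c : (Fin V → B) → ℕ) → E P (λ ω → pow x (c ω)) ≤ pow y (b ℕ.* n) → n ℕ.≤ M → suc b ℕ.* M ℕ.≤ a ℕ.* K →
      E P (λ ω → ⟦ K ℕ.≤ᵇ c ω ⟧) * pow y M ≤ 1ℚ
    markov b n M K c h n≤M le = *cancel {pow y (b ℕ.* M)} (0<pow (b ℕ.* M) (<-≤-trans 0<1 1≤y))
        (≤-trans (≤-reflexive e1) (≤-trans (*mono p≥0 s1) (≤-trans s2 (≤-trans h s3))))
      where
      p = E P (λ ω → ⟦ K ℕ.≤ᵇ c ω ⟧)
      p≥0 : 0ℚ ≤ p
      p≥0 = 𝔼-nonneg (prodExp P) (λ ω → 0≤⟦ K ℕ.≤ᵇ c ω ⟧)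
      e1 : pow y (b ℕ.* M) * (p * pow y M) ≡ p * pow y (suc b ℕ.* M)
      e1 = trans (solve 3 (λ a p c → a :* (p :* c) := p :* (c :* a)) refl (pow y (b ℕ.* M)) p (pow y M))
          (cong (p *_) (sym (pow-+ y M (b ℕ.* M))))
      s1 : pow y (suc b ℕ.* M) ≤ pow x K
      s1 = ≤-trans (pow-monoʳ 1≤y le) (≤-reflexive (trans (cong (pow y) (ℕP.*-comm a K)) (pow-* y K a)))
      s2 : p * pow x K ≤ E P (λ ω → pow x (c ω))
      s2 = ≤-trans (≤-reflexive (trans (ℚP.*-comm p (pow x K)) (sym (𝔼-* (prodExp P) (pow x K) _))))
          (𝔼-mono (prodExp P) (λ ω → pt (c ω)))
        where
        byCase : ∀ m v → (v ≡ true → K ℕ.≤ m) → pow x K * ⟦ v ⟧ ≤ pow x m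
        byCase m true g = ≤-trans (≤-reflexive (ℚP.*-identityʳ (pow x K))) (pow-monoʳ 1≤x (g refl))
        byCase m false g = ≤-trans (≤-reflexive (ℚP.*-zeroʳ (pow x K))) (0≤pow m (≤-trans 0≤1 1≤x))
        pt : ∀ m → pow x K * ⟦ K ℕ.≤ᵇ m ⟧ ≤ pow x m
        pt m = byCase m (K ℕ.≤ᵇ m) (λ e → ℕP.≤ᵇ⇒≤ K m (subst B.T (sym e) _))
      s3 : pow y (b ℕ.* n) ≤ pow y (b ℕ.* M) * 1ℚ
      s3 = ≤-trans (pow-monoʳ 1≤y (ℕP.*-monoʳ-≤ b n≤M)) (≤-reflexive (sym (ℚP.*-identityʳ (pow y (b ℕ.* M)))))

    -- The groups depend on disjoint sets of variables and contribute at most C each. `ρ t i` is the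
    -- share of item i charged to group t; what matters is that no item is charged more than q in
    -- total.
    group-tail : ∀ {T Q} b q M K → 0ℚ ≤ q → q ≤ 1ℚ → Pays b q → (N : Fin Q → Bool) → count N ℕ.≤ M → suc b ℕ.* M ℕ.≤ a ℕ.* K →
      (S : Fin T → Fin V → Bool) (c : Fin T → (Fin V → B) → ℕ) → (∀ t → Dep (S t) (λ ω → ι (c t ω))) →
          (∀ i j t → S i t ≡ true → S j t ≡ true → i ≡ j) →
      (∀ t ω → c t ω ℕ.≤ C) → (ρ : Fin T → Fin Q → ℚ) → (∀ t i → 0ℚ ≤ ρ t i) → (∀ i → N i ≡ true → ∑ (λ t → ρ t i) ≤ q) →
      (∀ t → E P (λ ω → ι (c t ω)) ≤ ∑ (λ i → ⟦ N i ⟧ * ρ t i)) → E P (λ ω → ⟦ K ℕ.≤ᵇ sumN (λ t → c t ω) ⟧) * pow y M ≤ 1ℚ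
    group-tail {T} b q M K 0≤q q≤1 h N N≤ le S c dep dis c≤ ρ ρ≥0 ρ≤ mean = markov b (count N) M K _ mgf N≤ le
      where
      mgf : E P (λ ω → pow x (sumN (λ t → c t ω))) ≤ pow y (b ℕ.* count N)
      mgf = ≤-trans (𝔼-mono (prodExp P) (λ ω → ≤-trans (≤-reflexive (pow-sumN x (λ t → c t ω)))
          (∏-mono (λ t → 0≤pow (c t ω) (≤-trans 0≤1 1≤x)) (λ t → convex (c≤ t ω)))))
        (≤-trans (≤-reflexive (indep-∏ P S (λ t ω → 1ℚ + β * ι (c t ω))
            (λ t ω ω' e → cong (λ z → 1ℚ + β * z) (dep t ω ω' e)) dis))
          (≤-trans (∏-mono (λ t → 𝔼-nonneg (prodExp P) (λ ω → 0≤+ 0≤1 (0≤* 0≤β (0≤ι (c t ω))))) each)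
              (exchange b q 0≤q q≤1 h N ρ ρ≥0 ρ≤)))
        where
        each : ∀ t → E P (λ ω → 1ℚ + β * ι (c t ω)) ≤ 1ℚ + β * ∑ (λ i → ⟦ N i ⟧ * ρ t i)
        each t = ≤-trans (≤-reflexive (trans (𝔼-+ (prodExp P) (λ _ → 1ℚ) _) (cong₂ _+_ (𝔼-1 (prodExp P)) (𝔼-* (prodExp P) β _))))
            (ℚP.+-monoʳ-≤ 1ℚ (*mono 0≤β (mean t)))

-- Conflicts with earlier variables

before : ∀ {n} → Fin n → Fin n → Bool
before s t = F.toℕ s ℕ.<ᵇ F.toℕ t

-- Whether a pick fails depends on all earlier variables, so failures do not split into independent
-- groups. This product bounds their moment instead: each factor charges a variable for all
-- conflicts with earlier ones.
chain : ∀ {B : Set} {V} → (Fin V → ℚ) → (Fin V → B → ℚ) → (Fin V → Fin V → B → B → ℚ) → (Fin V → B) → ℚ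
chain c h conf ω = ∏ (λ t → 1ℚ + c t * (h t (ω t) + ∑ (λ s → ⟦ before s t ⟧ * conf s t (ω s) (ω t))))

-- The two consequences of T ≤ 1/(1 - s) that hold when s is at most one half.
slack : ∀ {s T} → 0ℚ ≤ s → 0ℚ ≤ T → s + s ≤ 1ℚ → T * (1ℚ - s) ≤ 1ℚ → T ≤ 1ℚ + (s + s) × T ≤ 1ℚ + 1ℚ
slack {s} {T} 0≤s 0≤T hs hT = le-by ((1ℚ - T * (1ℚ - s)) + s * (1ℚ + 1ℚ - T)) (0≤+ (sub≥0 hT) (0≤* 0≤s (sub≥0 t2)))
    (solve 2 (λ T s → con 1ℚ :+ (s :+ s) := T :+ ((con 1ℚ :- T :* (con 1ℚ :- s)) :+ s :* (con 1ℚ :+ con 1ℚ :- T))) refl T s) , t2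
  where
  t2 : T ≤ 1ℚ + 1ℚ
  t2 = le-by (((1ℚ - T * (1ℚ - s)) + (1ℚ - T * (1ℚ - s))) + T * (1ℚ - (s + s)))
      (0≤+ (0≤+ (sub≥0 hT) (sub≥0 hT)) (0≤* 0≤T (sub≥0 hs)))
    (solve 2 (λ T s → con 1ℚ :+ con 1ℚ := T :+ (((con 1ℚ :- T :* (con 1ℚ :- s)) :+ (con 1ℚ :- T :* (con 1ℚ :- s))) :+ T :*
        (con 1ℚ :- (s :+ s)))) refl T s)

2c : ℚ → ℚ
2c c = c + c

-- σ s bounds the expected weighted number of later conflicts of variable s, and by hypothesis no outcome of s carries more than 1/4.
-- By induction the conflicts of the first variable are absorbed into the h of the later ones; each variable leaves 1 + 4σ s.
chain-bound : ∀ {B V} (P : Fin V → Exp B) (c : Fin V → ℚ) (h : Fin V → B → ℚ) (conf : Fin V → Fin V → B → B → ℚ) (σ : Fin V → ℚ) →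
  (∀ t → 0ℚ ≤ c t) → (∀ t b → 0ℚ ≤ h t b) → (∀ s t b b' → 0ℚ ≤ conf s t b b') →
  (∀ s b → 2c (2c (∑ (λ t → c t * 𝔼 (P t) (conf s t b)))) ≤ 1ℚ) →
  (∀ s → ∑ (λ t → c t * 𝔼 (P s) (λ b → 𝔼 (P t) (conf s t b))) ≤ σ s) →
  E P (chain c h conf) ≤ ∏ (λ t → 1ℚ + 2c (c t) * 𝔼 (P t) (h t)) * ∏ (λ s → 1ℚ + 2c (2c (σ s)))
chain-bound {V = zero} P c h conf σ c≥0 h≥0 f≥0 small mean = ≤-refl
chain-bound {B} {V = suc V} P c h conf σ c≥0 h≥0 f≥0 small mean = ≤-trans (𝔼-mono P₀ step)
    (≤-trans (≤-reflexive pull) (≤-trans (*monoʳ HΓ≥0 last) (≤-reflexive shuffle)))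
  where
  P₀ = P zero
  P' : Fin V → Exp B
  P' t = P (suc t)
  c' : Fin V → ℚ
  c' t = c (suc t)
  conf' : Fin V → Fin V → B → B → ℚ
  conf' s t = conf (suc s) (suc t)
  h' : B → Fin V → B → ℚ
  h' z t b = h (suc t) b + conf zero (suc t) z b
  r : B → Fin V → ℚ
  r z t = 𝔼 (P' t) (conf zero (suc t) z)
  eh : Fin V → ℚ
  eh t = 𝔼 (P' t) (h (suc t))
  H Γ : ℚ
  H = ∏ (λ t → 1ℚ + 2c (c' t) * eh t)
  Γ = ∏ (λ s → 1ℚ + 2c (2c (σ (suc s))))
  sm mn : ∀ s → _
  sm s = λ b → ≤-trans (dbl (dbl (drop₁ (suc s) b))) (small (suc s) b)
    where
    dbl : ∀ {a b} → a ≤ b → 2c a ≤ 2c b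
    dbl p = +-mono-≤ p p
    drop₁ : ∀ s b → ∑ (λ t → c' t * 𝔼 (P' t) (conf s (suc t) b)) ≤ ∑ (λ t → c t * 𝔼 (P t) (conf s t b))
    drop₁ s b = le-by (c zero * 𝔼 P₀ (conf s zero b)) (0≤* (c≥0 zero) (𝔼-nonneg P₀ (f≥0 s zero b)))
        (ℚP.+-comm (c zero * 𝔼 P₀ (conf s zero b)) _)
  mn s = ≤-trans (le-by (c zero * 𝔼 (P (suc s)) (λ b → 𝔼 P₀ (conf (suc s) zero b)))
      (0≤* (c≥0 zero) (𝔼-nonneg (P (suc s)) (λ b → 𝔼-nonneg P₀ (f≥0 (suc s) zero b))))
      (ℚP.+-comm (c zero * 𝔼 (P (suc s)) (λ b → 𝔼 P₀ (conf (suc s) zero b))) _)) (mean (suc s))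
  T : B → ℚ
  T z = ∏ (λ t → 1ℚ + 2c (c' t) * r z t)
  2c≥0 : ∀ {a} → 0ℚ ≤ a → 0ℚ ≤ 2c a
  2c≥0 p = 0≤+ p p
  r≥0 : ∀ z t → 0ℚ ≤ r z t
  r≥0 z t = 𝔼-nonneg (P' t) (f≥0 zero (suc t) z)
  eh≥0 : ∀ t → 0ℚ ≤ eh t
  eh≥0 t = 𝔼-nonneg (P' t) (h≥0 (suc t))
  H≥0 : 0ℚ ≤ H
  H≥0 = ∏-nonneg (λ t → 0≤+ 0≤1 (0≤* (2c≥0 (c≥0 (suc t))) (eh≥0 t)))
  σ≥0 : ∀ s → 0ℚ ≤ σ s
  σ≥0 s = ≤-trans (∑-nonneg (λ t → 0≤* (c≥0 t) (𝔼-nonneg (P s) (λ b → 𝔼-nonneg (P t) (f≥0 s t b))))) (mean s)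
  HΓ≥0 : 0ℚ ≤ H * Γ
  HΓ≥0 = 0≤* H≥0 (∏-nonneg (λ s → 0≤+ 0≤1 (2c≥0 (2c≥0 (σ≥0 (suc s))))))
  own : B → ℚ
  own z = 1ℚ + c zero * h zero z
  own≥0 : ∀ z → 0ℚ ≤ own z
  own≥0 z = 0≤+ 0≤1 (0≤* (c≥0 zero) (h≥0 zero z))
  head : ∀ z ω → chain c h conf (z ◂ ω) ≡ own z * chain c' (h' z) conf' ω
  head z ω = cong₂ _*_ (cong (λ v → 1ℚ + c zero * v) (trans (cong (h zero z +_)
      (trans (∑-cong (λ s → ℚP.*-zeroˡ (conf s zero ((z ◂ ω) s) z))) (∑-0 {suc V}))) (ℚP.+-identityʳ (h zero z))))
    (∏-cong (λ t → cong (λ v → 1ℚ + c' t * v) (trans (cong (λ v → h (suc t) (ω t) +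
        (v + ∑ (λ s → ⟦ before s t ⟧ * conf' s t (ω s) (ω t)))) (ℚP.*-identityˡ (conf zero (suc t) z (ω t))))
        (sym (ℚP.+-assoc (h (suc t) (ω t)) (conf zero (suc t) z (ω t)) _)))))
  ih : ∀ z → E P' (chain c' (h' z) conf') ≤ ∏ (λ t → 1ℚ + 2c (c' t) * 𝔼 (P' t) (h' z t)) * Γ
  ih z = chain-bound P' c' (h' z) conf' (λ s → σ (suc s)) (λ t → c≥0 (suc t)) (λ t b → 0≤+ (h≥0 (suc t) b) (f≥0 zero (suc t) z b))
      (λ s t → f≥0 (suc s) (suc t)) sm mn
  splitH : ∀ z → ∏ (λ t → 1ℚ + 2c (c' t) * 𝔼 (P' t) (h' z t)) ≤ H * T z
  splitH z = ≤-trans (∏-mono (λ t → 0≤+ 0≤1 (0≤* (2c≥0 (c≥0 (suc t)))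
      (𝔼-nonneg (P' t) (λ b → 0≤+ (h≥0 (suc t) b) (f≥0 zero (suc t) z b))))) each)
      (≤-reflexive (∏-* (λ t → 1ℚ + 2c (c' t) * eh t) (λ t → 1ℚ + 2c (c' t) * r z t)))
    where
    each : ∀ t → 1ℚ + 2c (c' t) * 𝔼 (P' t) (h' z t) ≤ (1ℚ + 2c (c' t) * eh t) * (1ℚ + 2c (c' t) * r z t)
    each t = ≤-trans (≤-reflexive (cong (λ v → 1ℚ + 2c (c' t) * v) (𝔼-+ (P' t) (h (suc t)) (conf zero (suc t) z))))
      (le-by ((2c (c' t) * eh t) * (2c (c' t) * r z t)) (0≤* (0≤* (2c≥0 (c≥0 (suc t))) (eh≥0 t))
          (0≤* (2c≥0 (c≥0 (suc t))) (r≥0 z t)))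
        (solve 3 (λ c a b → (con 1ℚ :+ c :* a) :* (con 1ℚ :+ c :* b) := con 1ℚ :+ c :* (a :+ b) :+ (c :* a) :* (c :* b)) refl
            (2c (c' t)) (eh t) (r z t)))
  s : B → ℚ
  s z = ∑ (λ t → c' t * r z t)
  s≥0 : ∀ z → 0ℚ ≤ s z
  s≥0 z = ∑-nonneg (λ t → 0≤* (c≥0 (suc t)) (r≥0 z t))
  s≤all : ∀ z → s z ≤ ∑ (λ t → c t * 𝔼 (P t) (conf zero t z))
  s≤all z = le-by (c zero * 𝔼 P₀ (conf zero zero z)) (0≤* (c≥0 zero) (𝔼-nonneg P₀ (f≥0 zero zero z)))
      (ℚP.+-comm (c zero * 𝔼 P₀ (conf zero zero z)) _)
  sum2 : ∀ z → ∑ (λ t → 2c (c' t) * r z t) ≡ 2c (s z)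
  sum2 z = trans (∑-cong (λ t → ℚP.*-distribʳ-+ (r z t) (c' t) (c' t))) (∑-+ (λ t → c' t * r z t) (λ t → c' t * r z t))
  slackT : ∀ z → T z ≤ 1ℚ + 2c (2c (s z)) × T z ≤ 1ℚ + 1ℚ
  slackT z = slack {2c (s z)} {T z} (2c≥0 (s≥0 z)) (∏-nonneg tz)
      (≤-trans (+-mono-≤ (+-mono-≤ (s≤all z) (s≤all z)) (+-mono-≤ (s≤all z) (s≤all z))) (small zero z))
     (subst (λ v → T z * (1ℚ - v) ≤ 1ℚ) (sum2 z) (∏-upper (λ t → 0≤* (2c≥0 (c≥0 (suc t))) (r≥0 z t))))
    where
    tz : ∀ t → 0ℚ ≤ 1ℚ + 2c (c' t) * r z t
    tz t = 0≤+ 0≤1 (0≤* (2c≥0 (c≥0 (suc t))) (r≥0 z t))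
  step : ∀ z → E P' (λ ω → chain c h conf (z ◂ ω)) ≤ (H * Γ) * (own z * T z)
  step z = ≤-trans (≤-reflexive (trans (𝔼-cong (prodExp P') (head z)) (𝔼-* (prodExp P') (own z) (chain c' (h' z) conf'))))
    (≤-trans (*mono (own≥0 z) (≤-trans (ih z) (*monoʳ (∏-nonneg (λ s → 0≤+ 0≤1 (2c≥0 (2c≥0 (σ≥0 (suc s)))))) (splitH z))))
      (≤-reflexive (solve 4 (λ o H T G → o :* (H :* T :* G) := H :* G :* (o :* T)) refl (own z) H (T z) Γ)))
  pull : 𝔼 P₀ (λ z → (H * Γ) * (own z * T z)) ≡ 𝔼 P₀ (λ z → own z * T z) * (H * Γ)
  pull = trans (𝔼-* P₀ (H * Γ) (λ z → own z * T z)) (ℚP.*-comm (H * Γ) _)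
  e0 : ℚ
  e0 = 𝔼 P₀ (h zero)
  last : 𝔼 P₀ (λ z → own z * T z) ≤ (1ℚ + 2c (c zero) * e0) * (1ℚ + 2c (2c (σ zero)))
  last = ≤-trans (𝔼-mono P₀ pt) (≤-trans (≤-reflexive lin) (≤-trans mid fin))
    where
    Σs = 𝔼 P₀ s
    pt : ∀ z → own z * T z ≤ 1ℚ + (2c (2c (s z)) + 2c (c zero) * h zero z)
    pt z = ≤-trans (≤-reflexive (solve 3 (λ c h T → (con 1ℚ :+ c :* h) :* T := T :+ c :* h :* T) refl (c zero) (h zero z) (T z)))
      (≤-trans (+-mono-≤ (proj₁ (slackT z)) (*mono (0≤* (c≥0 zero) (h≥0 zero z)) (proj₂ (slackT z))))
        (≤-reflexive (solve 3 (λ c h u → con 1ℚ :+ u :+ c :* h :* (con 1ℚ :+ con 1ℚ) := con 1ℚ :+ (u :+ (c :+ c) :* h)) refl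
            (c zero) (h zero z) (2c (2c (s z))))))
    lin : 𝔼 P₀ (λ z → 1ℚ + (2c (2c (s z)) + 2c (c zero) * h zero z)) ≡ 1ℚ + (2c (2c Σs) + 2c (c zero) * e0)
    lin = trans (𝔼-+ P₀ (λ _ → 1ℚ) _) (cong₂ _+_ (𝔼-1 P₀) (trans (𝔼-+ P₀ (λ z → 2c (2c (s z))) (λ z → 2c (c zero) * h zero z))
        (cong₂ _+_ (trans (𝔼-+ P₀ (λ z → 2c (s z)) (λ z → 2c (s z))) (cong 2c (𝔼-+ P₀ s s))) (𝔼-* P₀ (2c (c zero)) (h zero)))))
    Σs≤ : Σs ≤ σ zero
    Σs≤ = ≤-trans (≤-reflexive (trans (𝔼-∑ P₀ (λ t z → c' t * r z t)) (∑-cong (λ t → 𝔼-* P₀ (c' t) (λ z → r z t)))))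
      (≤-trans (le-by (c zero * 𝔼 P₀ (λ b → 𝔼 P₀ (conf zero zero b)))
          (0≤* (c≥0 zero) (𝔼-nonneg P₀ (λ b → 𝔼-nonneg P₀ (f≥0 zero zero b))))
          (ℚP.+-comm (c zero * 𝔼 P₀ (λ b → 𝔼 P₀ (conf zero zero b))) _)) (mean zero))
    mid : 1ℚ + (2c (2c Σs) + 2c (c zero) * e0) ≤ 1ℚ + (2c (2c (σ zero)) + 2c (c zero) * e0)
    mid = ℚP.+-monoʳ-≤ 1ℚ (ℚP.+-monoˡ-≤ (2c (c zero) * e0) (+-mono-≤ (+-mono-≤ Σs≤ Σs≤) (+-mono-≤ Σs≤ Σs≤)))
    fin : 1ℚ + (2c (2c (σ zero)) + 2c (c zero) * e0) ≤ (1ℚ + 2c (c zero) * e0) * (1ℚ + 2c (2c (σ zero)))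
    fin = le-by ((2c (c zero) * e0) * 2c (2c (σ zero))) (0≤* (0≤* (2c≥0 (c≥0 zero)) (𝔼-nonneg P₀ (h≥0 zero)))
        (2c≥0 (2c≥0 (σ≥0 zero))))
      (solve 2 (λ u v → (con 1ℚ :+ u) :* (con 1ℚ :+ v) := con 1ℚ :+ (v :+ u) :+ u :* v) refl (2c (c zero) * e0)
          (2c (2c (σ zero))))
  shuffle : (1ℚ + 2c (c zero) * e0) * (1ℚ + 2c (2c (σ zero))) * (H * Γ) ≡ (1ℚ + 2c (c zero) * e0) * H *
      ((1ℚ + 2c (2c (σ zero))) * Γ)
  shuffle = solve 4 (λ a b H G → a :* b :* (H :* G) := a :* H :* (b :* G)) refl (1ℚ + 2c (c zero) * e0)
      (1ℚ + 2c (2c (σ zero))) H Γ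

∑-fibre : ∀ {n m} (N : Fin n → Bool) (o : Fin n → Fin m) (φ : Fin m → ℚ) → ∑ (λ t → ι (count (λ i → N i ∧ (o i == t))) * φ t) ≡ ∑
    (λ i → ⟦ N i ⟧ * φ (o i))
∑-fibre N o φ = trans (∑-cong (λ t → trans (cong (_* φ t) (ι-count (λ i → N i ∧ (o i == t))))
    (sym (∑-*ʳ (φ t) (λ i → ⟦ N i ∧ (o i == t) ⟧)))))
  (trans (∑-swap (λ t i → ⟦ N i ∧ (o i == t) ⟧ * φ t)) (∑-cong
      (λ i → trans (∑-cong (λ t → trans (cong (_* φ t) (⟦∧⟧ (N i) (o i == t)))
     (solve 3 (λ a b c → a :* b :* c := b :* (a :* c)) refl ⟦ N i ⟧ ⟦ o i == t ⟧ (φ t))))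
         (∑-single (o i) (λ t → ⟦ N i ⟧ * φ t)))))

count-cong : ∀ {n} {P R : Fin n → Bool} → (∀ i → P i ≡ R i) → count P ≡ count R
count-cong h = ℕP.≤-antisym (count-mono (λ i e → trans (sym (h i)) e)) (count-mono (λ i e → trans (h i) e))

count-false : ∀ {n} → count {n} (λ _ → false) ≡ 0
count-false {zero} = refl
count-false {suc n} = count-false {n}

sumN-cong : ∀ {n} {f g : Fin n → ℕ} → (∀ i → f i ≡ g i) → sumN f ≡ sumN g
sumN-cong {zero} h = refl
sumN-cong {suc n} h = cong₂ ℕ._+_ (h zero) (sumN-cong (λ i → h (suc i)))

module ChainTail (a ℓ : ℕ) (2≤a : 2 ℕ.≤ a) (1≤ℓ : 1 ℕ.≤ ℓ) (5≤a : 5 ℕ.≤ a) where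
  open Moment a ℓ 2≤a 1≤ℓ

  -- The reason for a ≥ 5: X ≤ 1/(a - 1) ≤ 1/4. This supplies the smallness hypothesis of
  -- `chain-bound`, as the conflicts created by one outcome have weight at most β C = X.
  4X≤1 : 2c (2c X) ≤ 1ℚ
  4X≤1 = ≤-trans (le-by (X * (A - (1ℚ + (1ℚ + (1ℚ + (1ℚ + 1ℚ)))))) (0≤* 0≤X (sub≥0 5≤A))
      (solve 2 (λ X A → X :* (A :- con 1ℚ) := ((X :+ X) :+ (X :+ X)) :+ X :*
          (A :- (con 1ℚ :+ (con 1ℚ :+ (con 1ℚ :+ (con 1ℚ :+ con 1ℚ)))))) refl X A)) X-bound
    where
    five : ι 5 ≡ 1ℚ + (1ℚ + (1ℚ + (1ℚ + 1ℚ)))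
    five = trans (ι-suc 4) (cong (1ℚ +_) (trans (ι-suc 3) (cong (1ℚ +_)
        (trans (ι-suc 2) (cong (1ℚ +_) (trans (ι-suc 1) (cong (1ℚ +_) ι-1)))))))
    5≤A : 1ℚ + (1ℚ + (1ℚ + (1ℚ + 1ℚ))) ≤ A
    5≤A = subst (_≤ A) five (ι-mono 5≤a)

  module _ {B : Set} {V : ℕ} (P : Fin V → Exp B) where

    -- The analogue of `group-tail` for items whose owner `o i` loses its pick. A failure is bounded
    -- by the number of earlier conflicts, after which `chain-bound` gives a product to which
    -- `exchange` applies; the factor 4 in the last hypothesis is the loss in `chain-bound`.
    chain-tail : ∀ {Q} b q M K → 0ℚ ≤ q → q ≤ 1ℚ → Pays b q → (N : Fin Q → Bool) → count N ℕ.≤ M → suc b ℕ.* M ℕ.≤ a ℕ.* K →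
      (o : Fin Q → Fin V) → (∀ t → count (λ i → N i ∧ (o i == t)) ℕ.≤ C) →
      (conf : Fin V → Fin V → B → B → Bool) (fail : Fin V → (Fin V → B) → Bool) →
      (∀ t ω → ⟦ fail t ω ⟧ ≤ ∑ (λ s → ⟦ before s t ⟧ * ⟦ conf s t (ω s) (ω t) ⟧)) →
      (∀ s z → ∑ (λ i → ⟦ N i ⟧ * 𝔼 (P (o i)) (λ z' → ⟦ conf s (o i) z z' ⟧)) ≤ ι C) →
      (∀ i → N i ≡ true → 2c (2c (∑ (λ s → 𝔼 (P s) (λ z → 𝔼 (P (o i)) (λ z' → ⟦ conf s (o i) z z' ⟧))))) ≤ q) →
      E P (λ ω → ⟦ K ℕ.≤ᵇ count (λ i → N i ∧ fail (o i) ω) ⟧) * pow y M ≤ 1ℚ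
    chain-tail {Q} b q M K 0≤q q≤1 h N N≤ le o κ≤ conf fail failed light mean = markov P b (count N) M K cnt mgf N≤ le
      where
      cnt : (Fin V → B) → ℕ
      cnt ω = count (λ i → N i ∧ fail (o i) ω)
      κ : Fin V → ℕ
      κ t = count (λ i → N i ∧ (o i == t))
      c : Fin V → ℚ
      c t = β * ι (κ t)
      g : Fin V → Fin V → B → B → ℚ
      g s t z z' = ⟦ conf s t z z' ⟧
      h0 : Fin V → B → ℚ
      h0 _ _ = 0ℚ
      φ : Fin V → Fin V → ℚ
      φ s t = 𝔼 (P s) (λ z → 𝔼 (P t) (g s t z))
      ρ : Fin V → Fin Q → ℚ
      ρ s i = 2c (2c (φ s (o i)))
      2c≥0 : ∀ {a} → 0ℚ ≤ a → 0ℚ ≤ 2c a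
      2c≥0 p = 0≤+ p p
      φ≥0 : ∀ s t → 0ℚ ≤ φ s t
      φ≥0 s t = 𝔼-nonneg (P s) (λ z → 𝔼-nonneg (P t) (λ z' → 0≤⟦ conf s t z z' ⟧))
      split : ∀ ω → cnt ω ≡ sumN (λ t → if fail t ω then κ t else 0)
      split ω = trans (count-fibre (λ i → N i ∧ fail (o i) ω) o) (sumN-cong each)
        where
        each : ∀ t → count (λ i → (N i ∧ fail (o i) ω) ∧ (o i == t)) ≡ (if fail t ω then κ t else 0)
        each t = byCase (fail t ω) refl
          where
          same : ∀ i → (N i ∧ fail (o i) ω) ∧ (o i == t) ≡ (N i ∧ fail t ω) ∧ (o i == t)
          same i with o i ≟ t
          ... | yes e = cong (λ u → (N i ∧ fail u ω) ∧ true) e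
          ... | no _ = trans (BP.∧-zeroʳ _) (sym (BP.∧-zeroʳ _))
          byCase : ∀ v → fail t ω ≡ v → count (λ i → (N i ∧ fail (o i) ω) ∧ (o i == t)) ≡ (if v then κ t else 0)
          byCase true e = count-cong (λ i → trans (same i) (trans (cong (λ v → (N i ∧ v) ∧ (o i == t)) e)
              (cong (_∧ (o i == t)) (BP.∧-identityʳ (N i)))))
          byCase false e = trans (count-cong (λ i → trans (same i)
              (trans (cong (λ v → (N i ∧ v) ∧ (o i == t)) e) (cong (_∧ (o i == t)) (BP.∧-zeroʳ (N i)))))) (count-false {Q})
      pointwise : ∀ ω → pow x (cnt ω) ≤ chain c h0 g ω
      pointwise ω = ≤-trans (≤-reflexive (trans (cong (pow x) (split ω)) (pow-sumN x (λ t → if fail t ω then κ t else 0))))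
          (∏-mono (λ t → 0≤pow (if fail t ω then κ t else 0) (≤-trans 0≤1 1≤x))
          (λ t → ≤-trans (each t (fail t ω)) (ℚP.+-monoʳ-≤ 1ℚ
          (*mono (0≤* 0≤β (0≤ι (κ t))) (≤-trans (failed t ω) (≤-reflexive (sym (ℚP.+-identityˡ _))))))))
        where
        each : ∀ t v → pow x (if v then κ t else 0) ≤ 1ℚ + c t * ⟦ v ⟧
        each t true = ≤-trans (convex (κ≤ t)) (≤-reflexive (cong (1ℚ +_) (sym (ℚP.*-identityʳ (c t)))))
        each t false = ≤-reflexive (solve 1 (λ c → con 1ℚ := con 1ℚ :+ c :* con 0ℚ) refl (c t))
      regroup : ∀ (ψ : Fin V → ℚ) → ∑ (λ t → c t * ψ t) ≡ β * ∑ (λ i → ⟦ N i ⟧ * ψ (o i))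
      regroup ψ = trans (∑-cong (λ t → ℚP.*-assoc β (ι (κ t)) (ψ t)))
          (trans (∑-* β (λ t → ι (κ t) * ψ t)) (cong (β *_) (∑-fibre N o ψ)))
      small : ∀ s z → 2c (2c (∑ (λ t → c t * 𝔼 (P t) (g s t z)))) ≤ 1ℚ
      small s z = ≤-trans (dbl (dbl (≤-trans (≤-reflexive (regroup (λ t → 𝔼 (P t) (g s t z))))
          (≤-trans (*mono 0≤β (light s z)) (≤-reflexive (trans (ℚP.*-comm β Cq) Cβ)))))) 4X≤1
        where
        dbl : ∀ {a b} → a ≤ b → 2c a ≤ 2c b
        dbl p = +-mono-≤ p p
      σ : Fin V → ℚ
      σ s = ∑ (λ t → c t * φ s t)
      mgf : E P (λ ω → pow x (cnt ω)) ≤ pow y (b ℕ.* count N)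
      mgf = ≤-trans (𝔼-mono (prodExp P) pointwise) (≤-trans (chain-bound P c h0 g σ (λ t → 0≤* 0≤β (0≤ι (κ t))) (λ _ _ → ≤-refl)
          (λ s t z z' → 0≤⟦ conf s t z z' ⟧) small (λ s → ≤-refl))
        (≤-trans (≤-reflexive (trans (cong (_* ∏ (λ s → 1ℚ + 2c (2c (σ s)))) one)
            (trans (ℚP.*-identityˡ _) (∏-cong (λ s → cong (1ℚ +_) (eq s))))))
            (exchange b q 0≤q q≤1 h N ρ (λ s i → 2c≥0 (2c≥0 (φ≥0 s (o i)))) sums)))
        where
        one : ∏ (λ t → 1ℚ + 2c (c t) * 𝔼 (P t) (h0 t)) ≡ 1ℚ
        one = trans (∏-cong (λ t → trans (cong (λ v → 1ℚ + 2c (c t) * v) (𝔼-0 (P t)))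
            (solve 1 (λ c → con 1ℚ :+ c :* con 0ℚ := con 1ℚ) refl (2c (c t))))) (∏-1 {V})
        eq : ∀ s → 2c (2c (σ s)) ≡ β * ∑ (λ i → ⟦ N i ⟧ * ρ s i)
        eq s = trans (cong (λ v → 2c (2c v)) (regroup (φ s)))
            (trans (solve 2 (λ b S → ((b :* S :+ b :* S) :+ (b :* S :+ b :* S)) := b :* ((S :+ S) :+ (S :+ S))) refl β S)
           (cong (β *_) (sym (trans (∑-cong (λ i → solve 2 (λ n u → n :* ((u :+ u) :+ (u :+ u)) := (n :* u :+ n :* u) :+
               (n :* u :+ n :* u)) refl ⟦ N i ⟧ (φ s (o i))))
             (trans (∑-+ (λ i → ⟦ N i ⟧ * φ s (o i) + ⟦ N i ⟧ * φ s (o i)) _)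
                 (cong₂ _+_ (∑-+ (λ i → ⟦ N i ⟧ * φ s (o i)) _) (∑-+ (λ i → ⟦ N i ⟧ * φ s (o i)) _)))))))
          where
          S = ∑ (λ i → ⟦ N i ⟧ * φ s (o i))
        sums : ∀ i → N i ≡ true → ∑ (λ s → ρ s i) ≤ q
        sums i e = ≤-trans (≤-reflexive (trans (∑-+ (λ s → 2c (φ s (o i))) (λ s → 2c (φ s (o i))))
            (cong 2c (∑-+ (λ s → φ s (o i)) (λ s → φ s (o i)))))) (mean i e)

-- Boolean quantifiers and counting

anyF : ∀ {n} → (Fin n → Bool) → Bool
anyF {zero} P = false
anyF {suc n} P = P zero ∨ anyF (λ i → P (suc i))

∧-elim : ∀ {a b} → a ∧ b ≡ true → a ≡ true × b ≡ true
∧-elim {true} e = refl , e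

∧-intro : ∀ {a b} → a ≡ true → b ≡ true → a ∧ b ≡ true
∧-intro refl e = e

∨-elim : ∀ {a b} → a ∨ b ≡ true → a ≡ true ⊎ b ≡ true
∨-elim {true} e = inj₁ refl
∨-elim {false} e = inj₂ e

∨-left : ∀ {a b} → a ≡ true → a ∨ b ≡ true
∨-left refl = refl

∨-right : ∀ {a b} → b ≡ true → a ∨ b ≡ true
∨-right {true} e = refl
∨-right {false} e = e

¬true : ∀ {b} → (b ≡ true → ⊥) → b ≡ false
¬true {true} h = ⊥-elim (h refl)
¬true {false} h = refl

not-true : ∀ {b} → not b ≡ true → b ≡ false
not-true {false} e = refl

not-false : ∀ {b} → b ≡ false → not b ≡ true
not-false refl = refl

anyF-witness : ∀ {n} {P : Fin n → Bool} → anyF P ≡ true → Σ (Fin n) λ i → P i ≡ true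
anyF-witness {suc n} {P} e with ∨-elim {P zero} e
... | inj₁ h = zero , h
... | inj₂ h with anyF-witness h
... | i , q = suc i , q

anyF-intro : ∀ {n} {P : Fin n → Bool} i → P i ≡ true → anyF P ≡ true
anyF-intro zero h = ∨-left h
anyF-intro {P = P} (suc i) h = ∨-right {P zero} (anyF-intro i h)

anyF-none : ∀ {n} {P : Fin n → Bool} → anyF P ≡ false → ∀ i → P i ≡ false
anyF-none e i = ¬true (λ h → true≢false (anyF-intro i h) e)

anyF-cong : ∀ {n} {P R : Fin n → Bool} → (∀ i → P i ≡ R i) → anyF P ≡ anyF R
anyF-cong {zero} h = refl
anyF-cong {suc n} h = cong₂ _∨_ (h zero) (anyF-cong (λ i → h (suc i)))

⟦anyF⟧ : ∀ {n} (P : Fin n → Bool) → ⟦ anyF P ⟧ ≤ ∑ (λ i → ⟦ P i ⟧)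
⟦anyF⟧ {zero} P = ≤-refl
⟦anyF⟧ {suc n} P = ≤-trans (⟦∨⟧ (P zero) _) (ℚP.+-monoʳ-≤ ⟦ P zero ⟧ (⟦anyF⟧ (λ i → P (suc i))))

⟦none⟧ : ∀ {n} (P : Fin n → Bool) → ⟦ not (anyF P) ⟧ ≡ ∏ (λ i → 1ℚ - ⟦ P i ⟧)
⟦none⟧ {zero} P = refl
⟦none⟧ {suc n} P = trans (byCase (P zero)) (cong ((1ℚ - ⟦ P zero ⟧) *_) (⟦none⟧ (λ i → P (suc i))))
  where
  byCase : ∀ b → ⟦ not (b ∨ anyF (λ i → P (suc i))) ⟧ ≡ (1ℚ - ⟦ b ⟧) * ⟦ not (anyF (λ i → P (suc i))) ⟧
  byCase true = sym (ℚP.*-zeroˡ ⟦ not (anyF (λ i → P (suc i))) ⟧)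
  byCase false = sym (ℚP.*-identityˡ ⟦ not (anyF (λ i → P (suc i))) ⟧)

count-∨ : ∀ {n} (P R : Fin n → Bool) → count (λ i → P i ∨ R i) ℕ.≤ count P ℕ.+ count R
count-∨ P R = ι-cancel (≤-trans (≤-reflexive (ι-count (λ i → P i ∨ R i)))
    (≤-trans (∑-mono (λ i → ⟦∨⟧ (P i) (R i))) (≤-reflexive (trans (∑-+ (λ i → ⟦ P i ⟧) (λ i → ⟦ R i ⟧))
    (trans (cong₂ _+_ (sym (ι-count P)) (sym (ι-count R))) (sym (ι-+ (count P) (count R))))))))

count-split : ∀ {n} (P R : Fin n → Bool) → count P ≡ count (λ i → P i ∧ R i) ℕ.+ count (λ i → P i ∧ not (R i))
count-split P R = ι-inj (trans (ι-count P) (trans (∑-cong (λ i → h (P i) (R i)))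
    (trans (∑-+ (λ i → ⟦ P i ∧ R i ⟧) (λ i → ⟦ P i ∧ not (R i) ⟧))
    (trans (cong₂ _+_ (sym (ι-count (λ i → P i ∧ R i))) (sym (ι-count (λ i → P i ∧ not (R i)))))
    (sym (ι-+ (count (λ i → P i ∧ R i)) (count (λ i → P i ∧ not (R i)))))))))
  where
  h : ∀ a b → ⟦ a ⟧ ≡ ⟦ a ∧ b ⟧ + ⟦ a ∧ not b ⟧
  h true true = refl
  h true false = refl
  h false b = refl

count-single : ∀ {n} (j : Fin n) → count (λ i → j == i) ≡ 1
count-single j = ι-inj (trans (ι-count (λ i → j == i)) (trans (∑-cong (λ i → sym (ℚP.*-identityʳ ⟦ j == i ⟧)))
    (trans (∑-single j (λ _ → 1ℚ)) (sym ι-1))))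

count-any : ∀ {n m} (P : Fin n → Fin m → Bool) → count (λ j → anyF (λ i → P i j)) ℕ.≤ sumN (λ i → count (P i))
count-any P = ι-cancel (≤-trans (≤-reflexive (ι-count (λ j → anyF (λ i → P i j))))
    (≤-trans (∑-mono (λ j → ⟦anyF⟧ (λ i → P i j))) (≤-reflexive
    (trans (∑-swap (λ j i → ⟦ P i j ⟧)) (sym (trans (ι-sumN (λ i → count (P i))) (∑-cong (λ i → ι-count (P i)))))))))

count-compose : ∀ {n m} (R : Fin n → Bool) (S : Fin n → Fin m → Bool) a b → count R ℕ.≤ a → (∀ i → count (S i) ℕ.≤ b) →
  count (λ j → anyF (λ i → R i ∧ S i j)) ℕ.≤ a ℕ.* b
count-compose {n} {m} R S a b ha hb = ℕP.≤-trans (count-any (λ i j → R i ∧ S i j)) (ℕP.≤-trans (ι-cancel up) (ℕP.*-monoˡ-≤ b ha))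
  where
  each : ∀ v i → ι (count (λ j → v ∧ S i j)) ≤ ⟦ v ⟧ * ι b
  each true i = ≤-trans (ι-mono (hb i)) (≤-reflexive (sym (ℚP.*-identityˡ (ι b))))
  each false i = ≤-reflexive (trans (cong ι (count-false {m})) (trans ι-0 (sym (ℚP.*-zeroˡ (ι b)))))
  up : ι (sumN (λ i → count (λ j → R i ∧ S i j))) ≤ ι (count R ℕ.* b)
  up = ≤-trans (≤-reflexive (ι-sumN (λ i → count (λ j → R i ∧ S i j))))
      (≤-trans (∑-mono (λ i → each (R i) i)) (≤-reflexive (trans (∑-*ʳ (ι b) (λ i → ⟦ R i ⟧))
      (trans (cong (_* ι b) (sym (ι-count R))) (sym (ι-* (count R) b))))))

-- Cuts a list to its first L members. Surviving lists are shortened to a common length, so that the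
-- next round again has one parameter L for all open slots.
trim : ∀ {n} → ℕ → (Fin n → Bool) → Fin n → Bool
trim zero P i = false
trim (suc L) P zero = P zero
trim (suc L) P (suc i) = trim (if P zero then L else suc L) (λ j → P (suc j)) i

trim-⊆ : ∀ {n} L (P : Fin n → Bool) i → trim L P i ≡ true → P i ≡ true
trim-⊆ (suc L) P zero e = e
trim-⊆ (suc L) P (suc i) e = trim-⊆ (if P zero then L else suc L) (λ j → P (suc j)) i e

trim-count : ∀ {n} L (P : Fin n → Bool) → L ℕ.≤ count P → count (trim L P) ≡ L
trim-count {n} zero P h = count-false {n}
trim-count {suc n} (suc L) P h with P zero
... | true = cong suc (trim-count L (λ j → P (suc j)) (ℕP.≤-pred h))
... | false = trim-count (suc L) (λ j → P (suc j)) h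

∑-splitAt : ∀ K {Q} (f : Fin K → ℚ) (h : Fin Q → ℚ) → ∑ (λ t → [ f , h ]′ (F.splitAt K t)) ≡ ∑ f + ∑ h
∑-splitAt zero f h = sym (ℚP.+-identityˡ _)
∑-splitAt (suc K) f h = trans (cong (f zero +_) (trans (∑-cong (λ t → sh (F.splitAt K t))) (∑-splitAt K (λ i → f (suc i)) h)))
    (sym (ℚP.+-assoc (f zero) _ _))
  where
  sh : ∀ u → [ f , h ]′ (Sum.map₁ suc u) ≡ [ (λ i → f (suc i)) , h ]′ u
  sh (inj₁ _) = refl
  sh (inj₂ _) = refl

-- Conflict systems

-- Slots are the pairs (part, colour) and candidates the pairs (vertex, colour). The relation r true is adjacency within a
-- colour, with g true grouping slots by part; r false is equality of the vertex, with g false grouping slots by colour.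
record System (ℓ D E₀ : ℕ) : Set where
  field
    K Q : ℕ
    slot : Fin Q → Fin K
    r : Bool → Fin Q → Fin Q → Bool
    G : Bool → ℕ
    g : (τ : Bool) → Fin K → Fin (G τ)
    near : Fin (G true) → Fin (G true) → Bool
    r-sym : ∀ τ x y → r τ x y ≡ r τ y x
    r-slot : ∀ τ x y → r τ x y ≡ true → slot x ≡ slot y → ⊥
    r-pres : ∀ τ x y → r τ x y ≡ true → g (not τ) (slot x) ≡ g (not τ) (slot y)
    local : ∀ τ x i → count (λ y → r τ x y ∧ (g τ (slot y) == i)) ℕ.≤ ℓ
    near-refl : ∀ i → near i i ≡ true
    near-sym : ∀ i j → near i j ≡ near j i
    near-r : ∀ τ x y → r τ x y ≡ true → near (g true (slot x)) (g true (slot y)) ≡ true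
    near-count : ∀ i → count (near i) ℕ.≤ D
    slots-count : ∀ i → count (λ s → g true s == i) ℕ.≤ E₀
    cands-count : ∀ i → count (λ x → g true (slot x) == i) ℕ.≤ E₀

-- The selection is final and nothing alive conflicts with it, so later picks can only conflict
-- among themselves. List lengths are exact, as picking probabilities refer to them; degrees are
-- only bounded.
record State {ℓ D E₀} (S : System ℓ D E₀) (L M : ℕ) : Set where
  open System S
  field
    sel : Fin K → Maybe (Fin Q)
    alive : Fin Q → Bool
    sel-slot : ∀ s y → sel s ≡ just y → slot y ≡ s
    sel-free : ∀ s s' y y' τ → sel s ≡ just y → sel s' ≡ just y' → r τ y y' ≡ false
    sel-alive : ∀ s y z τ → sel s ≡ just y → alive z ≡ true → r τ y z ≡ false
    alive-open : ∀ z → alive z ≡ true → sel (slot z) ≡ nothing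
    rows : ∀ s → sel s ≡ nothing → count (λ z → alive z ∧ (slot z == s)) ≡ L
    degs : ∀ τ x → alive x ≡ true → count (λ z → alive z ∧ r τ z x) ℕ.≤ M

-- One round of the nibble: picks, coins and survival

module Space {ℓ D E₀ : ℕ} (S : System ℓ D E₀) (L M : ℕ) (St : State S L M) (p : ℚ) (0≤p : 0ℚ ≤ p) (M≤L : M ℕ.≤ L) (9θ≤1 : ι 9 * (p * ι L) ≤ 1ℚ) where
  open System S
  open State St

  θ μ : ℚ
  θ = p * ι L
  μ = p * ι M

  0≤θ : 0ℚ ≤ θ
  0≤θ = 0≤* 0≤p (0≤ι L)
  0≤μ : 0ℚ ≤ μ
  0≤μ = 0≤* 0≤p (0≤ι M)
  μ≤θ : μ ≤ θ
  μ≤θ = *mono 0≤p (ι-mono M≤L)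
  ι9 : ι 9 ≡ 1ℚ + ι 8
  ι9 = ι-suc 8
  θ≤1 : θ ≤ 1ℚ
  θ≤1 = ≤-trans (le-by (ι 8 * θ) (0≤* (0≤ι 8) 0≤θ) (trans (cong (_* θ) ι9)
      (solve 2 (λ e t → (con 1ℚ :+ e) :* t := t :+ e :* t) refl (ι 8) θ))) 9θ≤1
  μ≤1 : μ ≤ 1ℚ
  μ≤1 = ≤-trans μ≤θ θ≤1

  d : Bool → Fin Q → ℕ
  d τ x = count (λ z → alive z ∧ r τ z x)
  -- With the coin of x of probability c x = p (m x), x is hit through each type at a rate of at least p M.
  m : Fin Q → ℕ
  m x = M ℕ.∸ (d true x ℕ.⊓ d false x)
  c : Fin Q → ℚ
  c x = p * ι (m x)

  m≤M : ∀ x → m x ℕ.≤ M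
  m≤M x = ℕP.m∸n≤m M (d true x ℕ.⊓ d false x)
  M≤d+m : ∀ τ x → M ℕ.≤ d τ x ℕ.+ m x
  M≤d+m τ x = ℕP.≤-trans (ℕP.m≤n+m∸n M (d true x ℕ.⊓ d false x)) (ℕP.+-monoˡ-≤ (m x) (h τ))
    where
    h : ∀ τ → d true x ℕ.⊓ d false x ℕ.≤ d τ x
    h true = ℕP.m⊓n≤m (d true x) (d false x)
    h false = ℕP.m⊓n≤n (d true x) (d false x)
  -- The coin raises the smaller of the two degrees to M, so the sum is M plus the larger degree.
  d+d+m≤2M : ∀ x → alive x ≡ true → d true x ℕ.+ d false x ℕ.+ m x ℕ.≤ M ℕ.+ M
  d+d+m≤2M x e with ℕP.≤-total (d true x) (d false x)
  ... | inj₁ h rewrite ℕP.m≤n⇒m⊓n≡m h = ℕP.≤-trans (ℕP.≤-reflexive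
      (trans (cong (ℕ._+ (M ℕ.∸ d true x)) (ℕP.+-comm (d true x) (d false x)))
      (trans (ℕP.+-assoc (d false x) (d true x) _) (cong (d false x ℕ.+_) (ℕP.m+[n∸m]≡n (degs true x e))))))
      (ℕP.+-monoˡ-≤ M (degs false x e))
  ... | inj₂ h rewrite ℕP.m≥n⇒m⊓n≡n h = ℕP.≤-trans (ℕP.≤-reflexive
      (trans (ℕP.+-assoc (d true x) (d false x) _) (cong (d true x ℕ.+_) (ℕP.m+[n∸m]≡n (degs false x e)))))
      (ℕP.+-monoˡ-≤ M (degs true x e))

  row≤L : ∀ s → count (λ z → alive z ∧ (slot z == s)) ℕ.≤ L
  row≤L s = byCase (sel s) refl
    where
    byCase : ∀ v → sel s ≡ v → count (λ z → alive z ∧ (slot z == s)) ℕ.≤ L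
    byCase nothing e = ℕP.≤-reflexive (rows s e)
    byCase (just y) e = ℕP.≤-trans (ℕP.≤-reflexive (trans (count-cong none) (count-false {Q}))) z≤n
      where
      none : ∀ z → alive z ∧ (slot z == s) ≡ false
      none z = ¬true λ h → absurd (trans (sym (alive-open z (proj₁ (∧-elim h))))
          (trans (cong sel (==→≡ (proj₂ (∧-elim {alive z} h)))) e))
        where
        absurd : ∀ {y : Fin Q} → nothing ≡ just y → ⊥
        absurd ()

  V : ℕ
  V = K ℕ.+ Q
  Var : Set
  Var = Fin K ⊎ Fin Q
  u : Fin V → Var
  u = F.splitAt K
  pickOf : Fin K → Fin V
  pickOf s = s F.↑ˡ Q
  u-pick : ∀ s → u (pickOf s) ≡ inj₁ s
  u-pick s = FP.splitAt-↑ˡ K s Q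

  -- A slot picks from its living candidates. The coin of x is encoded as a pick whose only possible
  -- value is x, so picks and coins share one outcome type.
  supp : Var → Fin Q → Bool
  supp (inj₁ s) z = alive z ∧ (slot z == s)
  supp (inj₂ x) z = alive z ∧ (x == z)
  val : Var → Fin Q → ℚ
  val (inj₁ s) z = p
  val (inj₂ x) z = c z
  wt : Var → Fin Q → ℚ
  wt v z = ⟦ supp v z ⟧ * val v z

  val≥0 : ∀ v z → 0ℚ ≤ val v z
  val≥0 (inj₁ s) z = 0≤p
  val≥0 (inj₂ x) z = 0≤* 0≤p (0≤ι (m z))
  wt≥0 : ∀ v z → 0ℚ ≤ wt v z
  wt≥0 v z = 0≤* 0≤⟦ supp v z ⟧ (val≥0 v z)

  sum-count : ∀ (X : Fin Q → Bool) → ∑ (λ z → ⟦ X z ⟧ * p) ≡ p * ι (count X)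
  sum-count X = trans (∑-*ʳ p (λ z → ⟦ X z ⟧)) (trans (cong (_* p) (sym (ι-count X))) (ℚP.*-comm (ι (count X)) p))

  wt≤1 : ∀ v → ∑ (wt v) ≤ 1ℚ
  wt≤1 (inj₁ s) = ≤-trans (≤-reflexive (sum-count (supp (inj₁ s)))) (≤-trans (*mono 0≤p (ι-mono (row≤L s))) θ≤1)
  wt≤1 (inj₂ x) = ≤-trans (≤-trans (≤-reflexive (∑-cong (λ z → trans
      (cong (_* c z) (trans (⟦∧⟧ (alive z) (x == z)) (ℚP.*-comm ⟦ alive z ⟧ ⟦ x == z ⟧)))
      (ℚP.*-assoc ⟦ x == z ⟧ ⟦ alive z ⟧ (c z)))))
      (≤-trans (≤-reflexive (∑-single x (λ z → ⟦ alive z ⟧ * c z))) (*monoʳ (val≥0 (inj₂ x) x) ⟦ alive x ⟧≤1)))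
    (≤-trans (≤-reflexive (ℚP.*-identityˡ (c x))) (≤-trans (*mono 0≤p (ι-mono (m≤M x))) μ≤1))

  B : Set
  B = Maybe (Fin Q)
  law : Var → Exp B
  law v = pick (wt v) (wt≥0 v) (wt≤1 v)
  P : Fin V → Exp B
  P t = law (u t)

  -- The support is tested again because outcomes of probability zero are still points of the space,
  -- and later arguments are pointwise.
  ev : (Fin Q → Bool) → Var → B → Bool
  ev H v nothing = false
  ev H v (just z) = supp v z ∧ H z

  𝔼-ev : ∀ H v → 𝔼 (law v) (λ b → ⟦ ev H v b ⟧) ≡ ∑ (λ z → ⟦ supp v z ∧ H z ⟧ * val v z)
  𝔼-ev H v = trans (pick-nothing0 (wt v) (wt≥0 v) (wt≤1 v) (λ b → ⟦ ev H v b ⟧) refl)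
      (∑-cong (λ z → h (supp v z) (H z) (val v z)))
    where
    h : ∀ a b x → ⟦ a ⟧ * x * ⟦ a ∧ b ⟧ ≡ ⟦ a ∧ b ⟧ * x
    h true true x = solve 1 (λ x → con 1ℚ :* x :* con 1ℚ := con 1ℚ :* x) refl x
    h true false x = solve 1 (λ x → con 1ℚ :* x :* con 0ℚ := con 0ℚ :* x) refl x
    h false b x = solve 1 (λ x → con 0ℚ :* x :* con 0ℚ := con 0ℚ :* x) refl x

  𝔼-ev≤1 : ∀ H v → 𝔼 (law v) (λ b → ⟦ ev H v b ⟧) ≤ 1ℚ
  𝔼-ev≤1 H v = ≤-trans (𝔼-mono (law v) (λ b → ⟦ ev H v b ⟧≤1)) (≤-reflexive (𝔼-1 (law v)))

  slot-sum : ∀ (H : Fin Q → Bool) → ∑ (λ s → ∑ (λ z → ⟦ supp (inj₁ s) z ∧ H z ⟧ * p)) ≡ p * ι (count (λ z → alive z ∧ H z))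
  slot-sum H = trans (∑-swap (λ s z → ⟦ supp (inj₁ s) z ∧ H z ⟧ * p))
      (trans (∑-cong (λ z → trans (∑-cong (λ s → h (alive z) (slot z == s) (H z)))
      (∑-single (slot z) (λ _ → ⟦ alive z ∧ H z ⟧ * p)))) (sum-count (λ z → alive z ∧ H z)))
    where
    h : ∀ a b e → ⟦ (a ∧ b) ∧ e ⟧ * p ≡ ⟦ b ⟧ * (⟦ a ∧ e ⟧ * p)
    h true true e = sym (ℚP.*-identityˡ (⟦ e ⟧ * p))
    h true false e = solve 2 (λ e p → con 0ℚ :* p := con 0ℚ :* (e :* p)) refl ⟦ e ⟧ p
    h false true e = sym (ℚP.*-identityˡ (0ℚ * p))
    h false false e = solve 1 (λ p → con 0ℚ :* p := con 0ℚ :* (con 0ℚ :* p)) refl p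

  -- The outcomes of a variable that block y: a pick satisfying H, or the coin of y.
  fam : (Fin Q → Bool) → Fin Q → Var → Fin Q → Bool
  fam H y (inj₁ s) z = H z
  fam H y (inj₂ x) z = y == z

  coin-sum : ∀ y → ∑ (λ x → ∑ (λ z → ⟦ supp (inj₂ x) z ∧ (y == z) ⟧ * c z)) ≡ ⟦ alive y ⟧ * c y
  coin-sum y = trans (∑-swap (λ x z → ⟦ supp (inj₂ x) z ∧ (y == z) ⟧ * c z))
      (trans (∑-cong (λ z → trans (∑-cong (λ x → h (alive z) (x == z) (z == x) (y == z) (==-sym x z) (c z)))
      (∑-single z (λ _ → ⟦ y == z ⟧ * (⟦ alive z ⟧ * c z))))) (∑-single y (λ z → ⟦ alive z ⟧ * c z)))
    where
    h : ∀ a b b' e → b ≡ b' → ∀ k → ⟦ (a ∧ b) ∧ e ⟧ * k ≡ ⟦ b' ⟧ * (⟦ e ⟧ * (⟦ a ⟧ * k))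
    h a b b e refl k = trans (cong (_* k) (trans (⟦∧⟧ (a ∧ b) e) (cong (_* ⟦ e ⟧) (⟦∧⟧ a b))))
        (solve 4 (λ a b e k → a :* b :* e :* k := b :* (e :* (a :* k))) refl ⟦ a ⟧ ⟦ b ⟧ ⟦ e ⟧ k)

  hits : (Fin Q → Bool) → Fin Q → Fin V → B → Bool
  hits H y t b = ev (fam H y (u t)) (u t) b

  total-hits : ∀ H y → alive y ≡ true → ∑ (λ t → 𝔼 (P t) (λ b → ⟦ hits H y t b ⟧)) ≡ p * ι (count (λ z → alive z ∧ H z) ℕ.+ m y)
  total-hits H y e = trans (∑-cong (λ t → trans (𝔼-ev (fam H y (u t)) (u t)) (pt (u t))))
      (trans (∑-splitAt K f h) (trans (cong₂ _+_ (slot-sum H)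
      (trans (coin-sum y) (trans (cong (λ b → ⟦ b ⟧ * c y) e) (ℚP.*-identityˡ (c y)))))
     (trans (sym (ℚP.*-distribˡ-+ p (ι n) (ι (m y)))) (cong (p *_) (sym (ι-+ n (m y)))))))
    where
    n = count (λ z → alive z ∧ H z)
    f : Fin K → ℚ
    f s = ∑ (λ z → ⟦ supp (inj₁ s) z ∧ H z ⟧ * p)
    h : Fin Q → ℚ
    h x = ∑ (λ z → ⟦ supp (inj₂ x) z ∧ (y == z) ⟧ * c z)
    pt : ∀ v → ∑ (λ z → ⟦ supp v z ∧ fam H y v z ⟧ * val v z) ≡ [ f , h ]′ v
    pt (inj₁ s) = refl
    pt (inj₂ x) = refl

  clash : Fin Q → Fin Q → Bool
  clash z y = r true z y ∨ r false z y

  -- Any conflicting pick kills, even one that is not kept. This wastes candidates but makes the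
  -- event a union of events about single variables, with no reference to the order of picks.
  killed : Fin Q → (Fin V → B) → Bool
  killed y ω = anyF (λ t → hits (λ z → clash z y) y t (ω t))

  -- When neighbours of type τ are counted, hits of type τ are left out. By `r-pres` what remains is
  -- decided by variables in the τ-group of y, so different groups become independent; the omission
  -- can only overestimate survival.
  obstacle : Bool → Fin Q → Fin Q → Bool
  obstacle τ y z = (slot z == slot y) ∨ r (not τ) z y

  main : Bool → Fin Q → (Fin V → B) → Bool
  main τ y ω = not (anyF (λ t → hits (obstacle τ y) y t (ω t)))

  isPick : Var → B → Bool
  isPick (inj₁ s) b = ev (λ _ → true) (inj₁ s) b
  isPick (inj₂ x) b = false

  hitBy : Var → B → Fin Q → Bool
  hitBy (inj₁ s) b z' = ev (λ z → clash z z') (inj₁ s) b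
  hitBy (inj₂ x) b z' = false

  conf : Var → Var → B → B → Bool
  conf v (inj₁ s') b b' = ev (hitBy v b) (inj₁ s') b'
  conf v (inj₂ x) b b' = false

  fail : Fin V → (Fin V → B) → Bool
  fail t ω = anyF (λ s → before s t ∧ conf (u s) (u t) (ω s) (ω t))

  filled : Fin K → (Fin V → B) → Bool
  filled s ω = isPick (inj₁ s) (ω (pickOf s)) ∧ not (fail (pickOf s) ω)

  alive₁ : Fin Q → (Fin V → B) → Bool
  alive₁ y ω = (alive y ∧ not (killed y ω)) ∧ not (filled (slot y) ω)

  9θ : ℚ
  9θ = ι 9 * (θ * θ)
  qm : ℚ
  qm = 1ℚ - (θ + μ) + 9θ

  count-obstacle : ∀ τ y → alive y ≡ true → count (λ z → alive z ∧ obstacle τ y z) ≡ L ℕ.+ d (not τ) y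
  count-obstacle τ y e = trans (ι-inj (trans (ι-count (λ z → alive z ∧ obstacle τ y z))
      (trans (∑-cong (λ z → h (alive z) (slot z == slot y) (r (not τ) z y) (λ p q → r-slot (not τ) z y q (==→≡ p))))
      (trans (∑-+ (λ z → ⟦ alive z ∧ (slot z == slot y) ⟧) (λ z → ⟦ alive z ∧ r (not τ) z y ⟧))
          (trans (cong₂ _+_ (sym (ι-count (λ z → alive z ∧ (slot z == slot y)))) (sym (ι-count (λ z → alive z ∧ r (not τ) z y))))
          (sym (ι-+ (count (λ z → alive z ∧ (slot z == slot y))) (d (not τ) y))))))))
          (cong (ℕ._+ d (not τ) y) (rows (slot y) (alive-open y e)))
    where
    h : ∀ a b e → (b ≡ true → e ≡ true → ⊥) → ⟦ a ∧ (b ∨ e) ⟧ ≡ ⟦ a ∧ b ⟧ + ⟦ a ∧ e ⟧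
    h false b e _ = refl
    h true true true n = ⊥-elim (n refl refl)
    h true true false n = refl
    h true false e n = sym (ℚP.+-identityˡ ⟦ e ⟧)

  -- The slot of y picks at rate θ, and hits of the other type together with the coin have a rate κ
  -- with μ ≤ κ ≤ 2 θ. The square (θ + κ)² left by `∏-bonferroni` is at most (3 θ)², the source of
  -- the 9 in `qm`.
  E-main : ∀ τ y → alive y ≡ true → E P (λ ω → ⟦ main τ y ω ⟧) ≤ qm
  E-main τ y e = ≤-trans (≤-reflexive (trans (𝔼-cong (prodExp P) (λ ω → ⟦none⟧ (λ t → hits H y t (ω t))))
      (trans (E-∏single P (λ t b → 1ℚ - ⟦ hits H y t b ⟧)) (∏-cong
      (λ t → trans (𝔼-sub (P t) (λ _ → 1ℚ) (λ b → ⟦ hits H y t b ⟧)) (cong (_- α t) (𝔼-1 (P t))))))))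
      (≤-trans (∏-bonferroni (λ t → 𝔼-nonneg (P t) (λ b → 0≤⟦ hits H y t b ⟧)) (λ t → 𝔼-ev≤1 (fam H y (u t)) (u t)))
          (≤-trans (≤-reflexive (cong (λ s → 1ℚ - s + s * s) σ-eq)) fin))
    where
    H = obstacle τ y
    α : Fin V → ℚ
    α t = 𝔼 (P t) (λ b → ⟦ hits H y t b ⟧)
    k = d (not τ) y ℕ.+ m y
    κ = p * ι k
    σ-eq : ∑ α ≡ θ + κ
    σ-eq = trans (total-hits H y e) (trans (cong (λ n → p * ι n)
        (trans (cong (ℕ._+ m y) (count-obstacle τ y e)) (ℕP.+-assoc L (d (not τ) y) (m y))))
        (trans (cong (p *_) (ι-+ L k)) (ℚP.*-distribˡ-+ p (ι L) (ι k))))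
    0≤κ : 0ℚ ≤ κ
    0≤κ = 0≤* 0≤p (0≤ι k)
    μ≤κ : μ ≤ κ
    μ≤κ = *mono 0≤p (ι-mono (M≤d+m (not τ) y))
    κ≤ : κ ≤ θ + θ
    κ≤ = ≤-trans (*mono 0≤p (ι-mono (ℕP.+-mono-≤ (ℕP.≤-trans (degs (not τ) y e) M≤L) (ℕP.≤-trans (m≤M y) M≤L))))
        (≤-reflexive (trans (cong (p *_) (ι-+ L L)) (ℚP.*-distribˡ-+ p (ι L) (ι L))))
    nine : ι 9 ≡ (1ℚ + 1ℚ + 1ℚ) * (1ℚ + 1ℚ + 1ℚ)
    nine = trans (ι-* 3 3) (cong (λ z → z * z) (trans (ι-+ 2 1) (cong₂ _+_ (trans (ι-+ 1 1) (cong₂ _+_ ι-1 ι-1)) ι-1)))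
    fin : 1ℚ - (θ + κ) + (θ + κ) * (θ + κ) ≤ qm
    fin = le-by ((κ - μ) + (θ + θ - κ) * (θ + θ + θ + (θ + κ)))
        (0≤+ (sub≥0 μ≤κ) (0≤* (sub≥0 κ≤) (0≤+ (0≤+ (0≤+ 0≤θ 0≤θ) 0≤θ) (0≤+ 0≤θ 0≤κ))))
       (trans (cong (λ n → 1ℚ - (θ + μ) + n * (θ * θ)) nine)
           (solve 3 (λ t k m → con 1ℚ :- (t :+ m) :+ (con 1ℚ :+ con 1ℚ :+ con 1ℚ) :* (con 1ℚ :+ con 1ℚ :+ con 1ℚ) :* (t :* t) :=
          con 1ℚ :- (t :+ k) :+ (t :+ k) :* (t :+ k) :+ ((k :- m) :+ (t :+ t :- k) :* (t :+ t :+ t :+ (t :+ k)))) refl θ κ μ))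

  qm≤1 : qm ≤ 1ℚ
  qm≤1 = le-by (μ + θ * (1ℚ - ι 9 * θ)) (0≤+ 0≤μ (0≤* 0≤θ (sub≥0 9θ≤1)))
    (solve 3 (λ t m n → con 1ℚ := con 1ℚ :- (t :+ m) :+ n :* (t :* t) :+ (m :+ t :* (con 1ℚ :- n :* t))) refl θ μ (ι 9))

  2θ≤1 : θ + θ ≤ 1ℚ
  2θ≤1 = ≤-trans (le-by (ι 7 * θ) (0≤* (0≤ι 7) 0≤θ) (trans (cong (_* θ)
      (trans (ι-+ 2 7) (cong (_+ ι 7) (trans (ι-+ 1 1) (cong₂ _+_ ι-1 ι-1)))))
      (solve 2 (λ e t → (con 1ℚ :+ con 1ℚ :+ e) :* t := t :+ t :+ e :* t) refl (ι 7) θ))) 9θ≤1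

  0≤qm : 0ℚ ≤ qm
  0≤qm = 0≤+ (sub≥0 (≤-trans (ℚP.+-monoʳ-≤ θ μ≤θ) 2θ≤1)) (0≤* (0≤ι 9) (0≤* 0≤θ 0≤θ))

-- Concentration within one round

not-not : ∀ b → not (not b) ≡ b
not-not true = refl
not-not false = refl

module Tails {ℓ D E₀ : ℕ} (S : System ℓ D E₀) (L M : ℕ) (St : State S L M) (p : ℚ) (0≤p : 0ℚ ≤ p) (M≤L : M ℕ.≤ L)
    (9θ≤1 : ι 9 * (p * ι L) ≤ 1ℚ)
  (a : ℕ) (2≤a : 2 ℕ.≤ a) (5≤a : 5 ℕ.≤ a) (1≤ℓ : 1 ℕ.≤ ℓ) where
  open System S
  open State St
  open Space S L M St p 0≤p M≤L 9θ≤1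
  open Moment a ℓ 2≤a 1≤ℓ
  open ChainTail a ℓ 2≤a 1≤ℓ 5≤a

  C-split : C ≡ ℓ ℕ.+ ℓ
  C-split = cong (ℓ ℕ.+_) (ℕP.+-identityʳ ℓ)
  ℓ≤C : ℓ ℕ.≤ C
  ℓ≤C = ℕP.m≤m+n ℓ _
  1≤C : 1 ℕ.≤ C
  1≤C = ℕP.≤-trans 1≤ℓ ℓ≤C

  E-count : ∀ {n} (N : Fin n → Bool) (F : Fin n → (Fin V → B) → Bool) → E P (λ ω → ι (count (λ y → N y ∧ F y ω))) ≡ ∑
      (λ y → ⟦ N y ⟧ * E P (λ ω → ⟦ F y ω ⟧))
  E-count N F = trans (𝔼-cong (prodExp P) (λ ω → trans (ι-count (λ y → N y ∧ F y ω)) (∑-cong (λ y → ⟦∧⟧ (N y) (F y ω)))))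
      (trans (𝔼-∑ (prodExp P) (λ y ω → ⟦ N y ⟧ * ⟦ F y ω ⟧)) (∑-cong (λ y → 𝔼-* (prodExp P) ⟦ N y ⟧ (λ ω → ⟦ F y ω ⟧))))

  count-clash : ∀ y → count (λ z → alive z ∧ clash z y) ℕ.≤ d true y ℕ.+ d false y
  count-clash y = ℕP.≤-trans (count-mono (λ z e → h (alive z) (r true z y) (r false z y) e))
      (count-∨ (λ z → alive z ∧ r true z y) (λ z → alive z ∧ r false z y))
    where
    h : ∀ a b e → a ∧ (b ∨ e) ≡ true → (a ∧ b) ∨ (a ∧ e) ≡ true
    h true b e q = q

  qr : ℚ
  qr = μ + μ
  qr≤1 : qr ≤ 1ℚ
  qr≤1 = ≤-trans (+-mono-≤ μ≤θ μ≤θ) 2θ≤1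

  rowOf : Fin K → Fin Q → Bool
  rowOf s y = alive y ∧ (slot y == s)

  rowHits : Fin K → Fin V → (Fin V → B) → ℕ
  rowHits s t ω = count (λ y → rowOf s y ∧ hits (λ z → clash z y) y t (ω t))

  -- A row lies in one part and has one colour, so by `local` a pick hits at most ℓ of its
  -- candidates through each of the two types; a coin hits only its own candidate.
  rowHits≤C : ∀ s t ω → rowHits s t ω ℕ.≤ C
  rowHits≤C s t ω = byCase (u t) (ω t)
    where
    byCase : ∀ v b → count (λ y → rowOf s y ∧ ev (fam (λ z → clash z y) y v) v b) ℕ.≤ C
    byCase v nothing = ℕP.≤-trans (ℕP.≤-reflexive (trans (count-cong {R = λ _ → false} (λ y → BP.∧-zeroʳ (rowOf s y)))
        (count-false {Q}))) z≤n
    byCase (inj₁ s') (just z) = ℕP.≤-trans (count-mono h) (ℕP.≤-trans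
        (count-∨ (λ y → r true z y ∧ (g true (slot y) == g true s)) (λ y → r false z y ∧ (g false (slot y) == g false s)))
        (ℕP.≤-trans (ℕP.+-mono-≤ (local true z (g true s)) (local false z (g false s))) (ℕP.≤-reflexive (sym C-split))))
      where
      h : ∀ y → rowOf s y ∧ (supp (inj₁ s') z ∧ clash z y) ≡ true → (r true z y ∧ (g true (slot y) == g true s)) ∨
          (r false z y ∧ (g false (slot y) == g false s)) ≡ true
      h y e with ∧-elim {rowOf s y} e
      ... | e1 , e2 with ==→≡ {i = slot y} {s} (proj₂ (∧-elim {alive y} e1)) | ∨-elim {r true z y} {r false z y} (proj₂ (∧-elim {supp (inj₁ s') z} e2))
      ... | refl | inj₁ q = ∨-left (∧-intro q (==-refl (g true (slot y))))
      ... | refl | inj₂ q = ∨-right (∧-intro q (==-refl (g false (slot y))))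
    byCase (inj₂ x) (just z) = ℕP.≤-trans (count-mono (λ y e → trans (==-sym z y)
        (proj₂ (∧-elim {supp (inj₂ x) z} (proj₂ (∧-elim {rowOf s y} e)))))) (ℕP.≤-trans (ℕP.≤-reflexive (count-single z)) 1≤C)

  -- Lost candidates are counted once for every variable that hits them. This overcounts, but the
  -- total is a sum of functions of single variables, and by `d+d+m≤2M` each candidate is hit at
  -- rate at most 2 μ.
  row-tail : ∀ b Kr → Pays b qr → suc b ℕ.* L ℕ.≤ a ℕ.* Kr → ∀ s → E P
      (λ ω → ⟦ Kr ℕ.≤ᵇ sumN (λ t → rowHits s t ω) ⟧) * pow y L ≤ 1ℚ
  row-tail b Kr pays' le s = group-tail P b qr L Kr (0≤+ 0≤μ 0≤μ) qr≤1 pays' (rowOf s) (row≤L s) le (λ t t' → t == t') (rowHits s)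
      (λ t ω ω' e → cong (λ b → ι (count (λ y → rowOf s y ∧ hits (λ z → clash z y) y t b))) (e t (==-refl t)))
      (λ i j t p q → trans (==→≡ p) (sym (==→≡ q))) (rowHits≤C s) ρ
          (λ t y → 𝔼-nonneg (P t) (λ b → 0≤⟦ hits (λ z → clash z y) y t b ⟧)) sums mean
    where
    ρ : Fin V → Fin Q → ℚ
    ρ t y = 𝔼 (P t) (λ b → ⟦ hits (λ z → clash z y) y t b ⟧)
    sums : ∀ y → rowOf s y ≡ true → ∑ (λ t → ρ t y) ≤ qr
    sums y e = ≤-trans (≤-reflexive (total-hits (λ z → clash z y) y al))
        (≤-trans (*mono 0≤p (ι-mono (ℕP.≤-trans (ℕP.+-monoˡ-≤ (m y) (count-clash y)) (d+d+m≤2M y al))))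
        (≤-reflexive (trans (cong (p *_) (ι-+ M M)) (ℚP.*-distribˡ-+ p (ι M) (ι M)))))
      where
      al = proj₁ (∧-elim e)
    mean : ∀ t → E P (λ ω → ι (rowHits s t ω)) ≤ ∑ (λ y → ⟦ rowOf s y ⟧ * ρ t y)
    mean t = ≤-reflexive (trans (E-count (rowOf s) (λ y ω → hits (λ z → clash z y) y t (ω t)))
        (∑-cong (λ y → cong (⟦ rowOf s y ⟧ *_) (E-single P t (λ b → ⟦ hits (λ z → clash z y) y t b ⟧)))))

  nbr : Bool → Fin Q → Fin Q → Bool
  nbr τ x y = alive x ∧ (alive y ∧ r τ x y)

  nbr-alive : ∀ τ x y → nbr τ x y ≡ true → alive y ≡ true
  nbr-alive τ x y e = proj₁ (∧-elim (proj₂ (∧-elim {alive x} e)))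
  nbr-r : ∀ τ x y → nbr τ x y ≡ true → r τ x y ≡ true
  nbr-r τ x y e = proj₂ (∧-elim {alive y} (proj₂ (∧-elim {alive x} e)))

  nbr≤M : ∀ τ x → count (nbr τ x) ℕ.≤ M
  nbr≤M τ x = byCase (alive x) refl
    where
    byCase : ∀ v → alive x ≡ v → count (λ y → v ∧ (alive y ∧ r τ x y)) ℕ.≤ M
    byCase true e = ℕP.≤-trans (ℕP.≤-reflexive (count-cong (λ y → cong (alive y ∧_) (r-sym τ x y)))) (degs τ x e)
    byCase false e = ℕP.≤-trans (ℕP.≤-reflexive (count-false {Q})) z≤n

  label : (τ : Bool) → Var → Fin (G τ)
  label τ (inj₁ s) = g τ s
  label τ (inj₂ x) = g τ (slot x)

  -- A pick in the slot of y, a conflict of the other type and the coin of y all carry the τ-label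
  -- of y. A conflict of type τ need not, which is why `obstacle` omits it.
  far : ∀ τ y v b → (label τ v ≡ g τ (slot y) → ⊥) → ev (fam (obstacle τ y) y v) v b ≡ false
  far τ y v nothing h = refl
  far τ y (inj₁ s) (just z) h = ¬true λ e → h (go (∧-elim {supp (inj₁ s) z} e))
    where
    go : supp (inj₁ s) z ≡ true × obstacle τ y z ≡ true → g τ s ≡ g τ (slot y)
    go (e1 , e2) with ∨-elim {slot z == slot y} e2 | ==→≡ {i = slot z} {s} (proj₂ (∧-elim {alive z} e1))
    ... | inj₁ q | refl = cong (g τ) (==→≡ q)
    ... | inj₂ q | refl = subst (λ σ → g σ (slot z) ≡ g σ (slot y)) (not-not τ) (r-pres (not τ) z y q)
  far τ y (inj₂ x) (just z) h = ¬true λ e → h (go (∧-elim {supp (inj₂ x) z} e))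
    where
    go : supp (inj₂ x) z ≡ true × (y == z) ≡ true → g τ (slot x) ≡ g τ (slot y)
    go (e1 , e2) = cong (λ x → g τ (slot x)) (trans (==→≡ (proj₂ (∧-elim {alive z} e1))) (sym (==→≡ e2)))

  mainCount : Bool → Fin Q → (Fin V → B) → ℕ
  mainCount τ x ω = count (λ y → nbr τ x y ∧ main τ y ω)

  -- The independent groups are the τ-labels. `local` allows at most ℓ neighbours of x in each, and
  -- every neighbour charges its whole survival probability `qm` to its own label.
  main-tail : ∀ b Km → Pays b qm → suc b ℕ.* M ℕ.≤ a ℕ.* Km → ∀ τ x → E P (λ ω → ⟦ Km ℕ.≤ᵇ mainCount τ x ω ⟧) * pow y M ≤ 1ℚ
  main-tail b Km pays' le τ x = (≤-trans (≤-reflexive (cong (_* pow y M)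
      (𝔼-cong (prodExp P) (λ ω → cong (λ n → ⟦ Km ℕ.≤ᵇ n ⟧) (count-fibre (λ y → nbr τ x y ∧ main τ y ω) (λ y → g τ (slot y)))))))
      (group-tail P b qm M Km 0≤qm qm≤1 pays' (nbr τ x) (nbr≤M τ x) le (λ i t → label τ (u t) == i) cg dep
          (λ i j t p q → trans (sym (==→≡ {i = label τ (u t)} {i} p)) (==→≡ {i = label τ (u t)} {j} q)) cg≤ ρ
          (λ i y → 0≤* 0≤⟦ g τ (slot y) == i ⟧ 0≤qm) (λ y e → ≤-reflexive (∑-single (g τ (slot y)) (λ _ → qm))) mean))
    where
    cg : Fin (G τ) → (Fin V → B) → ℕ
    cg i ω = count (λ y → (nbr τ x y ∧ main τ y ω) ∧ (g τ (slot y) == i))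
    ρ : Fin (G τ) → Fin Q → ℚ
    ρ i y = ⟦ g τ (slot y) == i ⟧ * qm
    cg≤ : ∀ i ω → cg i ω ℕ.≤ C
    cg≤ i ω = ℕP.≤-trans (count-mono (λ y e → ∧-intro (nbr-r τ x y (proj₁ (∧-elim (proj₁ (∧-elim {nbr τ x y ∧ main τ y ω} e)))))
        (proj₂ (∧-elim {nbr τ x y ∧ main τ y ω} e)))) (ℕP.≤-trans (local τ x i) ℓ≤C)
    dep : ∀ i → Dep (λ t → label τ (u t) == i) (λ ω → ι (cg i ω))
    dep i ω ω' e = cong ι (count-cong pt)
      where
      pt : ∀ y → (nbr τ x y ∧ main τ y ω) ∧ (g τ (slot y) == i) ≡ (nbr τ x y ∧ main τ y ω') ∧ (g τ (slot y) == i)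
      pt y = byCase (g τ (slot y) == i) refl
        where
        byCase : ∀ v → (g τ (slot y) == i) ≡ v → (nbr τ x y ∧ main τ y ω) ∧ v ≡ (nbr τ x y ∧ main τ y ω') ∧ v
        byCase false q = trans (BP.∧-zeroʳ _) (sym (BP.∧-zeroʳ _))
        byCase true q = cong (λ b → (nbr τ x y ∧ not b) ∧ true) (anyF-cong one)
          where
          one : ∀ t → hits (obstacle τ y) y t (ω t) ≡ hits (obstacle τ y) y t (ω' t)
          one t with label τ (u t) == i in f
          ... | true = cong (hits (obstacle τ y) y t) (e t f)
          ... | false = trans (far τ y (u t) (ω t) ne) (sym (far τ y (u t) (ω' t) ne))
            where
            ne : label τ (u t) ≡ g τ (slot y) → ⊥
            ne h = true≢false (trans (cong (_== i) h) q) f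
    mean : ∀ i → E P (λ ω → ι (cg i ω)) ≤ ∑ (λ y → ⟦ nbr τ x y ⟧ * ρ i y)
    mean i = ≤-trans (≤-reflexive (trans (𝔼-cong (prodExp P)
        (λ ω → cong ι (count-cong (λ y → sw (nbr τ x y) (main τ y ω) (g τ (slot y) == i)))))
        (E-count (λ y → nbr τ x y ∧ (g τ (slot y) == i)) (main τ)))) (∑-mono each)
      where
      sw : ∀ a b e → (a ∧ b) ∧ e ≡ (a ∧ e) ∧ b
      sw true b e = BP.∧-comm b e
      sw false b e = refl
      each : ∀ y → ⟦ nbr τ x y ∧ (g τ (slot y) == i) ⟧ * E P (λ ω → ⟦ main τ y ω ⟧) ≤ ⟦ nbr τ x y ⟧ * ρ i y
      each y = byCase (nbr τ x y) refl
        where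
        byCase : ∀ v → nbr τ x y ≡ v → ⟦ v ∧ (g τ (slot y) == i) ⟧ * E P (λ ω → ⟦ main τ y ω ⟧) ≤ ⟦ v ⟧ * ρ i y
        byCase true q = ≤-trans (*mono 0≤⟦ g τ (slot y) == i ⟧ (E-main τ y (nbr-alive τ x y q)))
            (≤-reflexive (sym (ℚP.*-identityˡ (ρ i y))))
        byCase false q = ≤-reflexive (trans (ℚP.*-zeroˡ (E P (λ ω → ⟦ main τ y ω ⟧))) (sym (ℚP.*-zeroˡ (ρ i y))))

  -- A slot picks with probability at most θ and the pick meets other picks at rate at most 2 μ; the
  -- factor 4 is the loss in `chain-bound`. This is of second order in θ, so failed picks are a
  -- minor correction.
  qc : ℚ
  qc = 2c (2c (θ * (μ + μ)))

  failCount : Bool → Fin Q → (Fin V → B) → ℕ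
  failCount τ x ω = count (λ y → nbr τ x y ∧ fail (pickOf (slot y)) ω)

  𝔼-conf : ∀ v s' b → 𝔼 (P (pickOf s')) (λ b' → ⟦ conf v (u (pickOf s')) b b' ⟧) ≡ p * ι
      (count (λ z' → rowOf s' z' ∧ hitBy v b z'))
  𝔼-conf v s' b = trans (cong (λ v' → 𝔼 (law v') (λ b' → ⟦ conf v v' b b' ⟧)) (u-pick s'))
      (trans (𝔼-ev (hitBy v b) (inj₁ s')) (sum-count (λ z' → rowOf s' z' ∧ hitBy v b z')))

  clash-sym : ∀ z y → clash z y ≡ clash y z
  clash-sym z y = cong₂ _∨_ (r-sym true z y) (r-sym false z y)

  count-clash≤2M : ∀ z → alive z ≡ true → count (λ z' → alive z' ∧ clash z' z) ℕ.≤ M ℕ.+ M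
  count-clash≤2M z e = ℕP.≤-trans (count-clash z) (ℕP.+-mono-≤ (degs true z e) (degs false z e))

  p2M : p * ι (M ℕ.+ M) ≡ μ + μ
  p2M = trans (cong (p *_) (ι-+ M M)) (ℚP.*-distribˡ-+ p (ι M) (ι M))

  hit-light : ∀ v b → count (λ z' → alive z' ∧ hitBy v b z') ℕ.≤ M ℕ.+ M
  hit-light (inj₂ x) b = ℕP.≤-trans (ℕP.≤-reflexive (trans (count-cong {R = λ _ → false} (λ z' → BP.∧-zeroʳ (alive z')))
      (count-false {Q}))) z≤n
  hit-light (inj₁ s) nothing = ℕP.≤-trans (ℕP.≤-reflexive (trans (count-cong {R = λ _ → false} (λ z' → BP.∧-zeroʳ (alive z')))
      (count-false {Q}))) z≤n
  hit-light (inj₁ s) (just z) = byCase (alive z) refl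
    where
    byCase : ∀ v → alive z ≡ v → count (λ z' → alive z' ∧ ((v ∧ (slot z == s)) ∧ clash z z')) ℕ.≤ M ℕ.+ M
    byCase false e = ℕP.≤-trans (ℕP.≤-reflexive (trans (count-cong {R = λ _ → false} (λ z' → BP.∧-zeroʳ (alive z')))
        (count-false {Q}))) z≤n
    byCase true e = ℕP.≤-trans (count-mono (λ z' h → ∧-intro (proj₁ (∧-elim h))
        (trans (clash-sym z' z) (proj₂ (∧-elim {slot z == s} (proj₂ (∧-elim {alive z'} h))))))) (count-clash≤2M z e)

  nbr-slot : ∀ τ x s → count (λ y → nbr τ x y ∧ (slot y == s)) ℕ.≤ ℓ
  nbr-slot τ x s = ℕP.≤-trans (count-mono (λ y e → ∧-intro (nbr-r τ x y (proj₁ (∧-elim e)))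
      (trans (cong (λ s' → g τ s' == g τ s) (==→≡ (proj₂ (∧-elim {nbr τ x y} e)))) (==-refl (g τ s))))) (local τ x (g τ s))

  pickOf-inj : ∀ {s s'} → pickOf s ≡ pickOf s' → s ≡ s'
  pickOf-inj {s} {s'} e = FP.↑ˡ-injective Q s s' e

  fail-tail : ∀ b Kc → Pays b qc → suc b ℕ.* M ℕ.≤ a ℕ.* Kc → qc ≤ 1ℚ → ∀ τ x → E P
      (λ ω → ⟦ Kc ℕ.≤ᵇ failCount τ x ω ⟧) * pow y M ≤ 1ℚ
  fail-tail b Kc pays' le qc≤1 τ x = chain-tail P b qc M Kc (2c≥0 (2c≥0 (0≤* 0≤θ (0≤+ 0≤μ 0≤μ)))) qc≤1 pays' (nbr τ x)
      (nbr≤M τ x) le o κ≤ cf fail failed light mean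
    where
    2c≥0 : ∀ {a} → 0ℚ ≤ a → 0ℚ ≤ 2c a
    2c≥0 p = 0≤+ p p
    o : Fin Q → Fin V
    o y = pickOf (slot y)
    cf : Fin V → Fin V → B → B → Bool
    cf s t = conf (u s) (u t)
    κ≤ : ∀ t → count (λ y → nbr τ x y ∧ (o y == t)) ℕ.≤ C
    κ≤ t = byCase (u t) refl
      where
      byCase : ∀ v → u t ≡ v → count (λ y → nbr τ x y ∧ (o y == t)) ℕ.≤ C
      byCase (inj₁ s) e = ℕP.≤-trans (count-mono h) (ℕP.≤-trans (nbr-slot τ x s) ℓ≤C)
        where
        h : ∀ y → nbr τ x y ∧ (o y == t) ≡ true → nbr τ x y ∧ (slot y == s) ≡ true
        h y k = ∧-intro (proj₁ (∧-elim k)) (trans (cong (_== s)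
            (pickOf-inj (trans (==→≡ {i = o y} {t} (proj₂ (∧-elim {nbr τ x y} k))) (sym (FP.splitAt⁻¹-↑ˡ e))))) (==-refl s))
      byCase (inj₂ z) e = ℕP.≤-trans (count-mono {R = λ _ → false}
          (λ y h → ⊥-elim (absurd (trans (sym (u-pick (slot y))) (trans (cong u (==→≡ (proj₂ (∧-elim {nbr τ x y} h)))) e)))))
          (ℕP.≤-trans (ℕP.≤-reflexive (count-false {Q})) z≤n)
        where
        absurd : ∀ {s : Fin K} {z : Fin Q} → inj₁ s ≡ inj₂ z → ⊥
        absurd ()
    failed : ∀ t ω → ⟦ fail t ω ⟧ ≤ ∑ (λ s → ⟦ before s t ⟧ * ⟦ cf s t (ω s) (ω t) ⟧)
    failed t ω = ≤-trans (⟦anyF⟧ (λ s → before s t ∧ cf s t (ω s) (ω t)))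
        (≤-reflexive (∑-cong (λ s → ⟦∧⟧ (before s t) (cf s t (ω s) (ω t)))))
    -- One outcome conflicts with at most 2 M candidates, each picked with probability p, and every
    -- slot stands for at most ℓ neighbours of x. The total is at most 2 μ ℓ, and 2 μ ≤ 1.
    light : ∀ s b → ∑ (λ y → ⟦ nbr τ x y ⟧ * 𝔼 (P (o y)) (λ b' → ⟦ cf s (o y) b b' ⟧)) ≤ ι C
    light s b = ≤-trans (≤-reflexive (trans (∑-cong (λ y → cong (⟦ nbr τ x y ⟧ *_) (𝔼-conf (u s) (slot y) b)))
        (sym (∑-fibre (nbr τ x) slot φ))))
       (≤-trans (∑-mono (λ s' → *monoʳ (0≤* 0≤p (0≤ι (count (λ z' → rowOf s' z' ∧ hitBy (u s) b z'))))
           (ι-mono (nbr-slot τ x s')))) (≤-trans (≤-reflexive (trans (∑-* (ι ℓ) φ) (cong (ι ℓ *_) tot)))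
         (≤-trans (*mono (0≤ι ℓ) (≤-trans (*mono 0≤p (ι-mono (hit-light (u s) b))) (≤-trans (≤-reflexive p2M) qr≤1)))
             (≤-trans (≤-reflexive (ℚP.*-identityʳ (ι ℓ))) (ι-mono ℓ≤C)))))
      where
      φ : Fin K → ℚ
      φ s' = p * ι (count (λ z' → rowOf s' z' ∧ hitBy (u s) b z'))
      tot : ∑ φ ≡ p * ι (count (λ z' → alive z' ∧ hitBy (u s) b z'))
      tot = trans (∑-cong (λ s' → sym (sum-count (λ z' → rowOf s' z' ∧ hitBy (u s) b z')))) (slot-sum (hitBy (u s) b))
    hit-sum : ∀ z' → alive z' ≡ true → ∑ (λ t → 𝔼 (P t) (λ b → ⟦ hitBy (u t) b z' ⟧)) ≤ μ + μ
    hit-sum z' e = ≤-trans (∑-mono (λ t → pt (u t))) (≤-trans (≤-reflexive (∑-splitAt K f (λ _ → 0ℚ)))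
        (≤-trans (≤-reflexive (trans (cong₂ _+_ (slot-sum (λ z → clash z z')) (∑-0 {Q})) (ℚP.+-identityʳ _)))
        (≤-trans (*mono 0≤p (ι-mono (count-clash≤2M z' e))) (≤-reflexive p2M))))
      where
      f : Fin K → ℚ
      f s = ∑ (λ z → ⟦ supp (inj₁ s) z ∧ clash z z' ⟧ * p)
      pt : ∀ v → 𝔼 (law v) (λ b → ⟦ hitBy v b z' ⟧) ≤ [ f , (λ _ → 0ℚ) ]′ v
      pt (inj₁ s) = ≤-reflexive (𝔼-ev (λ z → clash z z') (inj₁ s))
      pt (inj₂ x) = ≤-reflexive (𝔼-0 (law (inj₂ x)))
    mean : ∀ y → nbr τ x y ≡ true → 2c (2c (∑ (λ s → 𝔼 (P s) (λ b → 𝔼 (P (o y)) (λ b' → ⟦ cf s (o y) b b' ⟧))))) ≤ qc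
    mean y e = dbl (dbl (≤-trans (≤-reflexive step1) (≤-trans
        (*mono 0≤p (≤-trans (∑-mono each) (≤-reflexive (∑-*ʳ (μ + μ) (λ z' → ⟦ rowOf (slot y) z' ⟧)))))
         (≤-trans (≤-reflexive (trans (sym (ℚP.*-assoc p _ (μ + μ)))
             (cong (λ n → p * n * (μ + μ)) (sym (ι-count (rowOf (slot y)))))))
             (*monoʳ (0≤+ 0≤μ 0≤μ) (*mono 0≤p (ι-mono (row≤L (slot y)))))))))
      where
      dbl : ∀ {a b} → a ≤ b → 2c a ≤ 2c b
      dbl p = +-mono-≤ p p
      R = rowOf (slot y)
      h : Fin V → Fin Q → ℚ
      h t z' = 𝔼 (P t) (λ b → ⟦ hitBy (u t) b z' ⟧)
      inner : ∀ t → 𝔼 (P t) (λ b → 𝔼 (P (o y)) (λ b' → ⟦ cf t (o y) b b' ⟧)) ≡ p * ∑ (λ z' → ⟦ R z' ⟧ * h t z')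
      inner t = trans (𝔼-cong (P t) (λ b → trans (𝔼-conf (u t) (slot y) b)
          (cong (p *_) (trans (ι-count (λ z' → R z' ∧ hitBy (u t) b z')) (∑-cong (λ z' → ⟦∧⟧ (R z') (hitBy (u t) b z')))))))
        (trans (𝔼-* (P t) p (λ b → ∑ (λ z' → ⟦ R z' ⟧ * ⟦ hitBy (u t) b z' ⟧)))
            (cong (p *_) (trans (𝔼-∑ (P t) (λ z' b → ⟦ R z' ⟧ * ⟦ hitBy (u t) b z' ⟧))
            (∑-cong (λ z' → 𝔼-* (P t) ⟦ R z' ⟧ (λ b → ⟦ hitBy (u t) b z' ⟧))))))
      step1 : ∑ (λ t → 𝔼 (P t) (λ b → 𝔼 (P (o y)) (λ b' → ⟦ cf t (o y) b b' ⟧))) ≡ p * ∑ (λ z' → ⟦ R z' ⟧ * ∑ (λ t → h t z'))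
      step1 = trans (∑-cong inner) (trans (∑-* p (λ t → ∑ (λ z' → ⟦ R z' ⟧ * h t z')))
          (cong (p *_) (trans (∑-swap (λ t z' → ⟦ R z' ⟧ * h t z')) (∑-cong (λ z' → ∑-* ⟦ R z' ⟧ (λ t → h t z'))))))
      each : ∀ z' → ⟦ R z' ⟧ * ∑ (λ t → h t z') ≤ ⟦ R z' ⟧ * (μ + μ)
      each z' = byCase (R z') refl
        where
        byCase : ∀ v → R z' ≡ v → ⟦ v ⟧ * ∑ (λ t → h t z') ≤ ⟦ v ⟧ * (μ + μ)
        byCase true q = *mono 0≤1 (hit-sum z' (proj₁ (∧-elim q)))
        byCase false q = ≤-reflexive (trans (ℚP.*-zeroˡ (∑ (λ t → h t z'))) (sym (ℚP.*-zeroˡ (μ + μ))))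

-- Bad events of a round and their dependence

module Nibble {ℓ D E₀ : ℕ} (S : System ℓ D E₀) (L M : ℕ) (St : State S L M) (p : ℚ) (0≤p : 0ℚ ≤ p) (M≤L : M ℕ.≤ L)
    (9θ≤1 : ι 9 * (p * ι L) ≤ 1ℚ)
  (a : ℕ) (2≤a : 2 ℕ.≤ a) (5≤a : 5 ℕ.≤ a) (1≤ℓ : 1 ℕ.≤ ℓ) (1≤D : 1 ℕ.≤ D) (br bm bc Kr Km Kc : ℕ) where
  open System S
  open State St
  open Space S L M St p 0≤p M≤L 9θ≤1
  open Moment a ℓ 2≤a 1≤ℓ using (Pays; y; 1≤y; 0<w)
  open Tails S L M St p 0≤p M≤L 9θ≤1 a 2≤a 5≤a 1≤ℓ

  part : Fin Q → Fin (G true)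
  part z = g true (slot z)

  -- Radius two: a neighbour of a candidate of part i may lie one step away, and the picks that
  -- decide its fate one step further. Two bad events can share a variable only within distance
  -- four, whence the fourth power of D in `few`.
  ball₂ : Fin (G true) → Fin (G true) → Bool
  ball₂ i h = anyF (λ h' → near i h' ∧ near h' h)

  ball : Fin (G true) → Fin V → Bool
  ball i t = ball₂ i (label true (u t))

  nb : Fin (G true) → Fin (G true) → Bool
  nb i j = anyF (λ h → ball₂ i h ∧ ball₂ j h)

  badRow : Fin K → (Fin V → B) → Bool
  badRow s ω = Kr ℕ.≤ᵇ sumN (λ t → rowHits s t ω)
  badNbr : Bool → Fin Q → (Fin V → B) → Bool
  badNbr τ x ω = (Km ℕ.≤ᵇ mainCount τ x ω) ∨ (Kc ℕ.≤ᵇ failCount τ x ω)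
  -- All events about the slots and candidates of a part are bundled into one, so that dependence is
  -- a matter of distances between parts.
  bad : Fin (G true) → (Fin V → B) → Bool
  bad i ω = anyF (λ s → (g true s == i) ∧ badRow s ω) ∨ anyF (λ x → (part x == i) ∧ (badNbr true x ω ∨ badNbr false x ω))

  reach : ∀ H y v b → (∀ z → H z ≡ true → near (part z) (part y) ≡ true) → ev (fam H y v) v b ≡ true → near (label true v)
      (part y) ≡ true
  reach H y (inj₁ s) (just z) h e with ==→≡ {i = slot z} {s} (proj₂ (∧-elim {alive z} (proj₁ (∧-elim {supp (inj₁ s) z} e))))
  ... | refl = h z (proj₂ (∧-elim {supp (inj₁ s) z} e))
  reach H y (inj₂ x) (just z) h e with ==→≡ {i = x} {z} (proj₂ (∧-elim {alive z} (proj₁ (∧-elim {supp (inj₂ x) z} e)))) | ==→≡ {i = y} {z} (proj₂ (∧-elim {supp (inj₂ x) z} e))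
  ... | refl | refl = near-refl (part z)

  near-clash : ∀ y z → clash z y ≡ true → near (part z) (part y) ≡ true
  near-clash y z e with ∨-elim {r true z y} e
  ... | inj₁ q = near-r true z y q
  ... | inj₂ q = near-r false z y q

  near-obstacle : ∀ τ y z → obstacle τ y z ≡ true → near (part z) (part y) ≡ true
  near-obstacle τ y z e with ∨-elim {slot z == slot y} e
  ... | inj₁ q = subst (λ s → near (part z) (g true s) ≡ true) (==→≡ q) (near-refl (part z))
  ... | inj₂ q = near-r (not τ) z y q

  in-ball : ∀ i j k → near i j ≡ true → near k j ≡ true → ball₂ i k ≡ true
  in-ball i j k e f = anyF-intro j (∧-intro e (trans (near-sym j k) f))

  agree : ∀ {A : Set} (b : Bool) (f : A → Bool) x x' → (b ≡ true → x ≡ x') → (∀ x → f x ≡ true → b ≡ true) → f x ≡ f x'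
  agree true f x x' h k = cong f (h refl)
  agree false f x x' h k = trans (¬true (λ e → true≢false (k x e) refl)) (sym (¬true (λ e → true≢false (k x' e) refl)))

  ∧-cong : ∀ a {b c} → (a ≡ true → b ≡ c) → a ∧ b ≡ a ∧ c
  ∧-cong true h = h refl
  ∧-cong false h = refl

  -- Counts for part i involve candidates in parts near i. A hit on such a candidate, or a conflict
  -- with the pick of its slot, comes from a part near that one.
  dep : ∀ i → Dep (ball i) (λ ω → ⟦ bad i ω ⟧)
  dep i ω ω' e = cong ⟦_⟧ (cong₂ _∨_ (anyF-cong rowsD) (anyF-cong nbrsD))
    where
    same : ∀ H y → near i (part y) ≡ true → (∀ z → H z ≡ true → near (part z) (part y) ≡ true) → ∀ t → hits H y t
        (ω t) ≡ hits H y t (ω' t)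
    same H y n h t = agree (ball i t) (hits H y t) (ω t) (ω' t) (e t)
        (λ b q → in-ball i (part y) (label true (u t)) n (reach H y (u t) b h q))
    rowsD : ∀ s → (g true s == i) ∧ badRow s ω ≡ (g true s == i) ∧ badRow s ω'
    rowsD s = ∧-cong (g true s == i) λ q → cong (Kr ℕ.≤ᵇ_) (sumN-cong (λ t → count-cong (λ y → ∧-cong (rowOf s y) λ r →
        same (λ z → clash z y) y (trans (cong (near i) (trans (cong (g true) (==→≡ (proj₂ (∧-elim {alive y} r)))) (==→≡ q)))
            (near-refl i)) (near-clash y) t)))
    near-nbr : ∀ τ x y → (part x == i) ≡ true → nbr τ x y ≡ true → near i (part y) ≡ true
    near-nbr τ x y q n = subst (λ j → near j (part y) ≡ true) (==→≡ q) (near-r τ x y (nbr-r τ x y n))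
    mainD : ∀ τ x → (part x == i) ≡ true → mainCount τ x ω ≡ mainCount τ x ω'
    mainD τ x q = count-cong (λ y → ∧-cong (nbr τ x y) λ n → cong not
        (anyF-cong (same (obstacle τ y) y (near-nbr τ x y q n) (near-obstacle τ y))))
    failOne : ∀ s → near i (g true s) ≡ true → fail (pickOf s) ω ≡ fail (pickOf s) ω'
    failOne s n = anyF-cong one
      where
      own : ω (pickOf s) ≡ ω' (pickOf s)
      own = e (pickOf s) (trans (cong (λ v → ball₂ i (label true v)) (u-pick s))
          (in-ball i (g true s) (g true s) n (near-refl (g true s))))
      conf-near : ∀ v b b' → conf v (inj₁ s) b b' ≡ true → near (label true v) (g true s) ≡ true
      conf-near (inj₁ s') (just z) (just z') q with ==→≡ {i = slot z'} {s} (proj₂ (∧-elim {alive z'} (proj₁ (∧-elim {supp (inj₁ s) z'} q)))) | ∧-elim {supp (inj₁ s') z} {clash z z'} (proj₂ (∧-elim {supp (inj₁ s) z'} q))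
      ... | refl | q1 , q2 = subst (λ k → near (g true k) (part z') ≡ true) (==→≡ {i = slot z} {s'} (proj₂ (∧-elim {alive z} q1)))
          (near-clash z' z q2)
      conf-near (inj₁ s') nothing (just z') q = ⊥-elim (true≢false (proj₂ (∧-elim {supp (inj₁ s) z'} q)) refl)
      conf-near (inj₂ x) b (just z') q = ⊥-elim (true≢false (proj₂ (∧-elim {supp (inj₁ s) z'} q)) refl)
      one : ∀ t → before t (pickOf s) ∧ conf (u t) (u (pickOf s)) (ω t) (ω (pickOf s)) ≡ before t (pickOf s) ∧ conf (u t)
          (u (pickOf s)) (ω' t) (ω' (pickOf s))
      one t = cong (before t (pickOf s) ∧_) (trans (cong (conf (u t) (u (pickOf s)) (ω t)) own)
        (agree (ball i t) (λ b → conf (u t) (u (pickOf s)) b (ω' (pickOf s))) (ω t) (ω' t) (e t)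
          (λ b q → in-ball i (g true s) (label true (u t)) n
              (conf-near (u t) b (ω' (pickOf s)) (subst (λ v → conf (u t) v b (ω' (pickOf s)) ≡ true) (u-pick s) q)))))
    failD : ∀ τ x → (part x == i) ≡ true → failCount τ x ω ≡ failCount τ x ω'
    failD τ x q = count-cong (λ y → ∧-cong (nbr τ x y) λ n → failOne (slot y) (near-nbr τ x y q n))
    nbrD : ∀ τ x → (part x == i) ≡ true → badNbr τ x ω ≡ badNbr τ x ω'
    nbrD τ x q = cong₂ (λ m n → (Km ℕ.≤ᵇ m) ∨ (Kc ℕ.≤ᵇ n)) (mainD τ x q) (failD τ x q)
    nbrsD : ∀ x → (part x == i) ∧ (badNbr true x ω ∨ badNbr false x ω) ≡ (part x == i) ∧ (badNbr true x ω' ∨ badNbr false x ω')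
    nbrsD x = ∧-cong (part x == i) λ q → cong₂ _∨_ (nbrD true x q) (nbrD false x q)

  apart : ∀ i j → nb i j ≡ false → ∀ t → ball i t ≡ true → ball j t ≡ true → ⊥
  apart i j n t e f = true≢false (anyF-intro (label true (u t)) (∧-intro e f)) n

  few : ∀ i → count (nb i) ℕ.≤ (D ℕ.* D) ℕ.* (D ℕ.* D)
  few i = count-compose (ball₂ i) (λ h j → ball₂ j h) (D ℕ.* D) (D ℕ.* D) (two i)
      (λ h → ℕP.≤-trans (count-mono (λ j e → flip j h e)) (two h))
    where
    two : ∀ i → count (ball₂ i) ℕ.≤ D ℕ.* D
    two i = count-compose (near i) near D D (near-count i) near-count
    flip : ∀ j h → ball₂ j h ≡ true → ball₂ h j ≡ true
    flip j h e with anyF-witness e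
    ... | k , q = anyF-intro k (∧-intro (trans (near-sym h k) (proj₂ (∧-elim {near j k} q)))
        (trans (near-sym k j) (proj₁ (∧-elim q))))

  module Outcome (pays-r : Pays br qr) (pays-m : Pays bm qm) (pays-c : Pays bc qc) (qc≤1 : qc ≤ 1ℚ)
    (le-r : suc br ℕ.* L ℕ.≤ a ℕ.* Kr) (le-m : suc bm ℕ.* M ℕ.≤ a ℕ.* Km) (le-c : suc bc ℕ.* M ℕ.≤ a ℕ.* Kc)
    (big : ι (suc (20 ℕ.* E₀ ℕ.* ((D ℕ.* D) ℕ.* (D ℕ.* D)))) ≤ pow y M) where

    Y : ℚ
    Y = pow y M
    0<Y : 0ℚ < Y
    0<Y = 0<pow M (<-≤-trans 0<1 1≤y)
    δ : ℚ
    δ = proj₁ (recip Y 0<Y)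
    0<δ : 0ℚ < δ
    0<δ = proj₁ (proj₂ (recip Y 0<Y))
    Yδ : Y * δ ≡ 1ℚ
    Yδ = proj₂ (proj₂ (recip Y 0<Y))

    toδ : ∀ {x} → x * Y ≤ 1ℚ → x ≤ δ
    toδ {x} h = *cancel 0<Y (≤-trans (≤-reflexive (ℚP.*-comm Y x)) (≤-trans h (≤-reflexive (sym Yδ))))

    row-rare : ∀ s → E P (λ ω → ⟦ badRow s ω ⟧) ≤ δ
    row-rare s = toδ {E P (λ ω → ⟦ badRow s ω ⟧)} (≤-trans (*mono (𝔼-nonneg (prodExp P) (λ ω → 0≤⟦ badRow s ω ⟧))
        (pow-monoʳ 1≤y M≤L)) (row-tail br Kr pays-r le-r s))

    nbr-rare : ∀ τ x → E P (λ ω → ⟦ badNbr τ x ω ⟧) ≤ δ + δ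
    nbr-rare τ x = ≤-trans (𝔼-mono (prodExp P) (λ ω → ⟦∨⟧ (Km ℕ.≤ᵇ mainCount τ x ω) (Kc ℕ.≤ᵇ failCount τ x ω)))
        (≤-trans (≤-reflexive (𝔼-+ (prodExp P) (λ ω → ⟦ Km ℕ.≤ᵇ mainCount τ x ω ⟧) (λ ω → ⟦ Kc ℕ.≤ᵇ failCount τ x ω ⟧)))
       (+-mono-≤ (toδ {E P (λ ω → ⟦ Km ℕ.≤ᵇ mainCount τ x ω ⟧)} (main-tail bm Km pays-m le-m τ x))
           (toδ {E P (λ ω → ⟦ Kc ℕ.≤ᵇ failCount τ x ω ⟧)} (fail-tail bc Kc pays-c le-c qc≤1 τ x))))

    union : ∀ {n} (N : Fin n → Bool) (F : Fin n → (Fin V → B) → Bool) ε → 0ℚ ≤ ε → count N ℕ.≤ E₀ →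
        (∀ x → E P (λ ω → ⟦ F x ω ⟧) ≤ ε) → E P (λ ω → ⟦ anyF (λ x → N x ∧ F x ω) ⟧) ≤ ι E₀ * ε
    union N F ε 0≤ε N≤ h = ≤-trans (𝔼-mono (prodExp P) (λ ω → ≤-trans (⟦anyF⟧ (λ x → N x ∧ F x ω))
        (≤-reflexive (∑-cong (λ x → ⟦∧⟧ (N x) (F x ω))))))
       (≤-trans (≤-reflexive (trans (𝔼-∑ (prodExp P) (λ x ω → ⟦ N x ⟧ * ⟦ F x ω ⟧))
           (∑-cong (λ x → 𝔼-* (prodExp P) ⟦ N x ⟧ (λ ω → ⟦ F x ω ⟧)))))
         (≤-trans (∑-mono (λ x → *mono 0≤⟦ N x ⟧ (h x))) (≤-trans
             (≤-reflexive (trans (∑-*ʳ ε (λ x → ⟦ N x ⟧)) (cong (_* ε) (sym (ι-count N))))) (*monoʳ 0≤ε (ι-mono N≤)))))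

    0≤δ : 0ℚ ≤ δ
    0≤δ = <⇒≤ 0<δ
    -- Every slot has one row event, and every candidate has four events: two types, each with the
    -- survivor count and the failure count. Hence 4 η is 20 E₀ δ, the 20 in the hypothesis `big`;
    -- the `suc` there yields the strict inequality 4 η < 1.
    η : ℚ
    η = ι E₀ * (δ + (2c (2c δ)))

    rare : ∀ i → E P (λ ω → ⟦ bad i ω ⟧) ≤ η
    rare i = ≤-trans (𝔼-mono (prodExp P) (λ ω → ⟦∨⟧ (R ω) (N ω)))
        (≤-trans (≤-reflexive (𝔼-+ (prodExp P) (λ ω → ⟦ R ω ⟧) (λ ω → ⟦ N ω ⟧)))
        (≤-trans (+-mono-≤ (union (λ s → g true s == i) badRow δ 0≤δ (slots-count i) row-rare)
            (union (λ x → part x == i) (λ x ω → badNbr true x ω ∨ badNbr false x ω) (2c (2c δ)) (0≤+ (0≤+ 0≤δ 0≤δ) (0≤+ 0≤δ 0≤δ))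
            (cands-count i) both))
          (≤-reflexive (sym (ℚP.*-distribˡ-+ (ι E₀) δ (2c (2c δ)))))))
      where
      R N : (Fin V → B) → Bool
      R ω = anyF (λ s → (g true s == i) ∧ badRow s ω)
      N ω = anyF (λ x → (part x == i) ∧ (badNbr true x ω ∨ badNbr false x ω))
      both : ∀ x → E P (λ ω → ⟦ badNbr true x ω ∨ badNbr false x ω ⟧) ≤ 2c (2c δ)
      both x = ≤-trans (𝔼-mono (prodExp P) (λ ω → ⟦∨⟧ (badNbr true x ω) (badNbr false x ω)))
          (≤-trans (≤-reflexive (𝔼-+ (prodExp P) (λ ω → ⟦ badNbr true x ω ⟧) (λ ω → ⟦ badNbr false x ω ⟧)))
          (+-mono-≤ (nbr-rare true x) (nbr-rare false x)))

    D⁴ : ℕ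
    D⁴ = (D ℕ.* D) ℕ.* (D ℕ.* D)
    1≤D⁴ : 1 ℕ.≤ D⁴
    1≤D⁴ = ℕP.*-mono-≤ (ℕP.*-mono-≤ 1≤D 1≤D) (ℕP.*-mono-≤ 1≤D 1≤D)

    4η : ∀ n → (((η + η) + (η + η)) * ι n) * Y ≡ ι (20 ℕ.* E₀ ℕ.* n)
    4η n = trans (solve 4 (λ e d n Y → ((e :* (d :+ ((d :+ d) :+ (d :+ d))) :+ e :* (d :+ ((d :+ d) :+ (d :+ d)))) :+
        (e :* (d :+ ((d :+ d) :+ (d :+ d))) :+ e :* (d :+ ((d :+ d) :+ (d :+ d))))) :* n :* Y
        := ((con 1ℚ :+ con 1ℚ) :* (con 1ℚ :+ con 1ℚ) :* (con 1ℚ :+ (con 1ℚ :+ con 1ℚ) :* (con 1ℚ :+ con 1ℚ))) :* e :* n :*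
            (Y :* d)) refl (ι E₀) δ (ι n) Y)
      (trans (cong (λ z → ((1ℚ + 1ℚ) * (1ℚ + 1ℚ) * (1ℚ + (1ℚ + 1ℚ) * (1ℚ + 1ℚ))) * ι E₀ * ι n * z) Yδ) (trans (ℚP.*-identityʳ _)
        (sym (trans (ι-* (20 ℕ.* E₀) n) (cong (_* ι n) (trans (ι-* 20 E₀) (cong (_* ι E₀) twenty)))))))
      where
      two : ι 2 ≡ 1ℚ + 1ℚ
      two = trans (ι-+ 1 1) (cong₂ _+_ ι-1 ι-1)
      four : ι 4 ≡ (1ℚ + 1ℚ) * (1ℚ + 1ℚ)
      four = trans (ι-* 2 2) (cong₂ _*_ two two)
      twenty : ι 20 ≡ (1ℚ + 1ℚ) * (1ℚ + 1ℚ) * (1ℚ + (1ℚ + 1ℚ) * (1ℚ + 1ℚ))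
      twenty = trans (ι-* 4 5) (cong₂ _*_ four (trans (ι-suc 4) (cong (1ℚ +_) four)))

    4ηD⁴≤1 : ((η + η) + (η + η)) * ι D⁴ ≤ 1ℚ
    4ηD⁴≤1 = *cancel 0<Y (≤-trans (≤-reflexive (trans (ℚP.*-comm Y _) (4η D⁴)))
        (≤-trans (ι-mono (ℕP.n≤1+n _)) (≤-trans big (≤-reflexive (sym (ℚP.*-identityʳ Y))))))

    4η<1 : (η + η) + (η + η) < 1ℚ
    4η<1 = ℚP.*-cancelʳ-<-nonNeg Y {{ℚ.nonNegative (<⇒≤ 0<Y)}}
        (<-≤-trans (≤-<-trans (≤-reflexive (trans (cong (_* Y)
        (trans (sym (ℚP.*-identityʳ ((η + η) + (η + η)))) (cong (((η + η) + (η + η)) *_) (sym ι-1)))) (4η 1)))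
        (ι-mono-< (s≤s (ℕP.*-monoʳ-≤ (20 ℕ.* E₀) 1≤D⁴)))) (≤-trans big (≤-reflexive (sym (ℚP.*-identityˡ Y)))))

    0≤η : 0ℚ ≤ η
    0≤η = 0≤* (0≤ι E₀) (0≤+ 0≤δ (0≤+ (0≤+ 0≤δ 0≤δ) (0≤+ 0≤δ 0≤δ)))

    module LL = LocalLemma P bad ball dep nb apart η (ι D⁴) 0≤η rare (λ i → ι-mono (few i)) 4η<1 4ηD⁴≤1

    outcome : Σ (Fin V → B) λ ω → ∀ i → bad i ω ≡ false
    outcome = proj₁ avoided , proj₂ (proj₂ avoided)
      where
      avoided : Σ (Fin V → B) λ ω → true ≡ true × (∀ i → bad i ω ≡ false)
      avoided = LL.avoid (λ _ → true) (≤-reflexive (𝔼-0 (prodExp P)))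

-- From a good outcome to the next state

T⇒≡true : ∀ {b} → B.T b → b ≡ true
T⇒≡true {true} _ = refl

≤ᵇ-false : ∀ {m n} → (m ℕ.≤ᵇ n) ≡ false → n ℕ.< m
≤ᵇ-false {m} {n} e = ℕP.≰⇒> λ h → true≢false (T⇒≡true (ℕP.≤⇒≤ᵇ h)) e

∨-false-elim : ∀ {a b} → a ∨ b ≡ false → a ≡ false × b ≡ false
∨-false-elim {false} e = refl , e

before-total : ∀ {n} {s t : Fin n} → (s ≡ t → ⊥) → before s t ≡ true ⊎ before t s ≡ true
before-total {s = s} {t} h with ℕP.<-cmp (F.toℕ s) (F.toℕ t)
... | tri< q _ _ = inj₁ (T⇒≡true (ℕP.<⇒<ᵇ q))
... | tri> _ _ q = inj₂ (T⇒≡true (ℕP.<⇒<ᵇ q))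
... | tri≈ _ q _ = ⊥-elim (h (FP.toℕ-injective q))

module Advance {ℓ D E₀ : ℕ} (S : System ℓ D E₀) (L M : ℕ) (St : State S L M) (p : ℚ) (0≤p : 0ℚ ≤ p) (M≤L : M ℕ.≤ L)
    (9θ≤1 : ι 9 * (p * ι L) ≤ 1ℚ)
  (a : ℕ) (2≤a : 2 ℕ.≤ a) (5≤a : 5 ℕ.≤ a) (1≤ℓ : 1 ℕ.≤ ℓ) (1≤D : 1 ℕ.≤ D) (br bm bc Kr Km Kc : ℕ) where
  open System S
  open State St
  open Space S L M St p 0≤p M≤L 9θ≤1
  open Tails S L M St p 0≤p M≤L 9θ≤1 a 2≤a 5≤a 1≤ℓ
  open Nibble S L M St p 0≤p M≤L 9θ≤1 a 2≤a 5≤a 1≤ℓ 1≤D br bm bc Kr Km Kc using (bad; badRow; badNbr)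

  module _ (ω : Fin V → B) (fine : ∀ i → bad i ω ≡ false) where

    L' M' : ℕ
    L' = L ℕ.∸ Kr
    M' = Km ℕ.+ Kc

    fineRow : ∀ s → badRow s ω ≡ false
    fineRow s = trans (sym (cong (_∧ badRow s ω) (==-refl (g true s)))) (anyF-none (proj₁ (∨-false-elim (fine (g true s)))) s)

    fineNbr : ∀ τ x → badNbr τ x ω ≡ false
    fineNbr τ x = pickτ τ (∨-false-elim {badNbr true x ω} (trans
        (sym (cong (_∧ (badNbr true x ω ∨ badNbr false x ω)) (==-refl (g true (slot x)))))
        (anyF-none (proj₂ (∨-false-elim {anyF (λ s → (g true s == g true (slot x)) ∧ badRow s ω)} (fine (g true (slot x))))) x)))
      where
      pickτ : ∀ τ → badNbr true x ω ≡ false × badNbr false x ω ≡ false → badNbr τ x ω ≡ false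
      pickτ true = proj₁
      pickτ false = proj₂

    filled-pick : ∀ s → filled s ω ≡ true → Σ (Fin Q) λ z → ω (pickOf s) ≡ just z × (alive z ≡ true × slot z ≡ s)
    filled-pick s e = go (ω (pickOf s)) refl (proj₁ (∧-elim e))
      where
      go : ∀ b → ω (pickOf s) ≡ b → isPick (inj₁ s) b ≡ true → Σ (Fin Q) λ z → ω (pickOf s) ≡ just z ×
          (alive z ≡ true × slot z ≡ s)
      go (just z) q h = z , q , proj₁ (∧-elim sp) , ==→≡ (proj₂ (∧-elim {alive z} sp))
        where sp = proj₁ (∧-elim {supp (inj₁ s) z} h)

    supp-intro : ∀ {z s} → alive z ≡ true → slot z ≡ s → supp (inj₁ s) z ≡ true
    supp-intro {z} e refl = ∧-intro e (==-refl (slot z))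

    choose : Fin K → Bool → Maybe (Fin Q) → Maybe (Fin Q)
    choose s b (just y) = just y
    choose s b nothing = if b then ω (pickOf s) else nothing

    sel' : Fin K → Maybe (Fin Q)
    sel' s = choose s (filled s ω) (sel s)

    data Chosen (s : Fin K) (y : Fin Q) : Set where
      old : sel s ≡ just y → Chosen s y
      new : sel s ≡ nothing → filled s ω ≡ true → ω (pickOf s) ≡ just y → Chosen s y

    chosen : ∀ s y → sel' s ≡ just y → Chosen s y
    chosen s y = go (sel s) (filled s ω) refl refl
      where
      go : ∀ v b → sel s ≡ v → filled s ω ≡ b → choose s b v ≡ just y → Chosen s y
      go (just y') b e f refl = old e
      go nothing true e f h = new e f h
      go nothing false e f ()

    unchosen : ∀ s → sel' s ≡ nothing → sel s ≡ nothing × filled s ω ≡ false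
    unchosen s = go (sel s) (filled s ω) refl refl
      where
      go : ∀ v b → sel s ≡ v → filled s ω ≡ b → choose s b v ≡ nothing → sel s ≡ nothing × filled s ω ≡ false
      go (just y') b e f ()
      go nothing false e f h = e , f
      go nothing true e f h with filled-pick s f
      ... | z , q , _ = ⊥-elim (absurd (trans (sym q) h))
        where
        absurd : ∀ {z : Fin Q} → just z ≡ nothing → ⊥
        absurd ()

    picked : ∀ s y → filled s ω ≡ true → ω (pickOf s) ≡ just y → alive y ≡ true × slot y ≡ s
    picked s y e q with filled-pick s e
    ... | z , q' , h with trans (sym q) q'
    ... | refl = h

    al₁ : Fin K → Fin Q → Bool
    al₁ s z = alive₁ z ω ∧ (slot z == s)

    alive' : Fin Q → Bool
    alive' z = trim L' (al₁ (slot z)) z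

    alive'→₁ : ∀ z → alive' z ≡ true → alive₁ z ω ≡ true
    alive'→₁ z e = proj₁ (∧-elim (trim-⊆ L' (al₁ (slot z)) z e))

    ₁→alive : ∀ z → alive₁ z ω ≡ true → alive z ≡ true
    ₁→alive z e = proj₁ (∧-elim (proj₁ (∧-elim {alive z ∧ not (killed z ω)} e)))
    ₁→safe : ∀ z → alive₁ z ω ≡ true → killed z ω ≡ false
    ₁→safe z e = not-true (proj₂ (∧-elim {alive z} (proj₁ (∧-elim {alive z ∧ not (killed z ω)} e))))
    ₁→open : ∀ z → alive₁ z ω ≡ true → filled (slot z) ω ≡ false
    ₁→open z e = not-true (proj₂ (∧-elim {alive z ∧ not (killed z ω)} e))

    clash-r : ∀ τ y z → clash y z ≡ false → r τ y z ≡ false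
    clash-r true y z e = proj₁ (∨-false-elim e)
    clash-r false y z e = proj₂ (∨-false-elim {r true y z} e)

    sel-slot' : ∀ s y → sel' s ≡ just y → slot y ≡ s
    sel-slot' s y e with chosen s y e
    ... | old q = sel-slot s y q
    ... | new _ f q = proj₂ (picked s y f q)

    -- Only the later slot needs to have kept its pick: keeping it means that no earlier pick, kept
    -- or not, conflicts with it.
    new-free : ∀ s s' y y' → filled s' ω ≡ true → ω (pickOf s) ≡ just y → ω
        (pickOf s') ≡ just y' → alive y ≡ true → slot y ≡ s → alive y' ≡ true → slot y' ≡ s' →
      before (pickOf s) (pickOf s') ≡ true → clash y y' ≡ false
    new-free s s' y y' f' q q' ay sy ay' sy' bf = ¬true λ c → true≢false (anyF-intro (pickOf s) (∧-intro bf (conflict c)))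
        (not-true (proj₂ (∧-elim {isPick (inj₁ s') (ω (pickOf s'))} f')))
      where
      conflict : clash y y' ≡ true → conf (u (pickOf s)) (u (pickOf s')) (ω (pickOf s)) (ω (pickOf s')) ≡ true
      conflict c = trans (cong₂ (λ v v' → conf v v' (ω (pickOf s)) (ω (pickOf s'))) (u-pick s) (u-pick s'))
          (trans (cong₂ (conf (inj₁ s) (inj₁ s')) q q')
         (∧-intro (supp-intro ay' sy') (∧-intro (supp-intro ay sy) c)))

    sel-free' : ∀ s s' y y' τ → sel' s ≡ just y → sel' s' ≡ just y' → r τ y y' ≡ false
    sel-free' s s' y y' τ e e' with chosen s y e | chosen s' y' e'
    ... | old q | old q' = sel-free s s' y y' τ q q'
    ... | old q | new _ f' q' = sel-alive s y y' τ q (proj₁ (picked s' y' f' q'))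
    ... | new _ f q | old q' = trans (r-sym τ y y') (sel-alive s' y' y τ q' (proj₁ (picked s y f q)))
    ... | new _ f q | new _ f' q' with s ≟ s'
    ...   | yes same = ¬true λ h → r-slot τ y y' h (trans (proj₂ (picked s y f q))
        (trans same (sym (proj₂ (picked s' y' f' q')))))
    ...   | no diff with before-total {s = pickOf s} {pickOf s'} (λ h → diff (pickOf-inj h))
    ...     | inj₁ bf = clash-r τ y y' (new-free s s' y y' f' q q' (proj₁ (picked s y f q)) (proj₂ (picked s y f q))
        (proj₁ (picked s' y' f' q')) (proj₂ (picked s' y' f' q')) bf)
    ...     | inj₂ bf = trans (r-sym τ y y') (clash-r τ y' y
        (new-free s' s y' y f q' q (proj₁ (picked s' y' f' q')) (proj₂ (picked s' y' f' q')) (proj₁ (picked s y f q))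
        (proj₂ (picked s y f q)) bf))

    sel-alive' : ∀ s y z τ → sel' s ≡ just y → alive' z ≡ true → r τ y z ≡ false
    sel-alive' s y z τ e al with chosen s y e
    ... | old q = sel-alive s y z τ q (₁→alive z (alive'→₁ z al))
    ... | new _ f q = clash-r τ y z (¬true λ c → true≢false (hit c)
        (anyF-none {P = λ t → hits (λ w → clash w z) z t (ω t)} (₁→safe z (alive'→₁ z al)) (pickOf s)))
      where
      hit : clash y z ≡ true → hits (λ w → clash w z) z (pickOf s) (ω (pickOf s)) ≡ true
      hit c = trans (cong₂ (λ v b → ev (fam (λ w → clash w z) z v) v b) (u-pick s) q)
          (∧-intro (supp-intro (proj₁ (picked s y f q)) (proj₂ (picked s y f q))) c)

    alive-open' : ∀ z → alive' z ≡ true → sel' (slot z) ≡ nothing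
    alive-open' z e = cong₂ (choose (slot z)) (₁→open z (alive'→₁ z e)) (alive-open z (₁→alive z (alive'→₁ z e)))

    row-count : ∀ s → sel' s ≡ nothing → L' ℕ.≤ count (al₁ s)
    row-count s e = ℕP.≤-trans (ℕP.m≤n+o⇒m∸n≤o L Kr (ℕP.≤-trans
        (ℕP.≤-reflexive (trans (sym (rows s (proj₁ (unchosen s e)))) (count-split (rowOf s) (λ z → killed z ω))))
        (ℕP.+-monoˡ-≤ _ (ℕP.≤-trans lost (ℕP.<⇒≤ (≤ᵇ-false (fineRow s))))))) (count-mono survive)
      where
      lost : count (λ z → rowOf s z ∧ killed z ω) ℕ.≤ sumN (λ t → rowHits s t ω)
      lost = ℕP.≤-trans (count-mono dist) (count-any (λ t z → rowOf s z ∧ hits (λ w → clash w z) z t (ω t)))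
        where
        dist : ∀ z → rowOf s z ∧ killed z ω ≡ true → anyF (λ t → rowOf s z ∧ hits (λ w → clash w z) z t (ω t)) ≡ true
        dist z h with anyF-witness {P = λ t → hits (λ w → clash w z) z t (ω t)} (proj₂ (∧-elim {rowOf s z} h))
        ... | t , q = anyF-intro {P = λ t → rowOf s z ∧ hits (λ w → clash w z) z t (ω t)} t
            (∧-intro (proj₁ (∧-elim {rowOf s z} h)) q)
      survive : ∀ z → rowOf s z ∧ not (killed z ω) ≡ true → al₁ s z ≡ true
      survive z h = ∧-intro (∧-intro (∧-intro (proj₁ (∧-elim h1)) (proj₂ (∧-elim {rowOf s z} h)))
          (trans (cong (λ s → not (filled s ω)) (==→≡ (proj₂ (∧-elim {alive z} h1)))) (not-false (proj₂ (unchosen s e)))))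
          (proj₂ (∧-elim {alive z} h1))
        where h1 = proj₁ (∧-elim {rowOf s z} h)

    rows' : ∀ s → sel' s ≡ nothing → count (λ z → alive' z ∧ (slot z == s)) ≡ L'
    rows' s e = trans (count-cong pt) (trim-count L' (al₁ s) (row-count s e))
      where
      pt : ∀ z → alive' z ∧ (slot z == s) ≡ trim L' (al₁ s) z
      pt z with slot z ≟ s
      ... | yes refl = BP.∧-identityʳ _
      ... | no ne = trans (BP.∧-zeroʳ (alive' z)) (sym (¬true λ h → ne
          (==→≡ (proj₂ (∧-elim {alive₁ z ω} (trim-⊆ L' (al₁ s) z h))))))

    -- The slot of a survivor is not filled. Either it picked and the pick failed, or it picked
    -- nothing, and then every remaining obstacle would also have killed the survivor. The new
    -- degree is therefore at most `Km` plus `Kc`.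
    main-or-fail : ∀ τ z → alive₁ z ω ≡ true → main τ z ω ∨ fail (pickOf (slot z)) ω ≡ true
    main-or-fail τ z e = byCase (isPick (inj₁ (slot z)) (ω (pickOf (slot z)))) refl
      where
      byCase : ∀ b → isPick (inj₁ (slot z)) (ω (pickOf (slot z))) ≡ b → main τ z ω ∨ fail (pickOf (slot z)) ω ≡ true
      byCase true h = ∨-right {main τ z ω} (failing (fail (pickOf (slot z)) ω) refl)
        where
        failing : ∀ b → fail (pickOf (slot z)) ω ≡ b → b ≡ true
        failing true _ = refl
        failing false q = ⊥-elim (true≢false (∧-intro h (not-false q)) (₁→open z e))
      byCase false h = ∨-left (not-false (¬true λ q → clear (anyF-witness q)))
        where
        blocked : ∀ v b → ev (fam (obstacle τ z) z v) v b ≡ true →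
            (Σ (Fin Q) λ w → Σ (Fin K) λ s → v ≡ inj₁ s × b ≡ just w × supp (inj₁ s) w ≡ true × slot w ≡ slot z) ⊎ ev
            (fam (λ w → clash w z) z v) v b ≡ true
        blocked (inj₁ s) (just w) q with ∨-elim {slot w == slot z} (proj₂ (∧-elim {supp (inj₁ s) w} q))
        ... | inj₁ same = inj₁ (w , s , refl , refl , proj₁ (∧-elim {supp (inj₁ s) w} q) , ==→≡ same)
        ... | inj₂ c = inj₂ (∧-intro (proj₁ (∧-elim {supp (inj₁ s) w} q)) (viaτ τ c))
          where
          viaτ : ∀ τ → r (not τ) w z ≡ true → clash w z ≡ true
          viaτ true c = ∨-right {r true w z} c
          viaτ false c = ∨-left c
        blocked (inj₂ x) (just w) q = inj₂ q
        clear : (Σ (Fin V) λ t → hits (obstacle τ z) z t (ω t) ≡ true) → ⊥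
        clear (t , q) with blocked (u t) (ω t) q
        ... | inj₂ k = true≢false (anyF-intro t k) (₁→safe z e)
        ... | inj₁ (w , s , ut , ωt , sw , same) = true≢false (∧-intro (supp-intro (proj₁ (∧-elim sw)) same) refl)
            (trans (sym (cong (isPick (inj₁ (slot z))) (trans (cong ω pt) ωt))) h)
          where
          slot-s : slot w ≡ s
          slot-s = ==→≡ (proj₂ (∧-elim {alive w} sw))
          pt : pickOf (slot z) ≡ t
          pt = trans (cong pickOf (trans (sym same) slot-s)) (FP.splitAt⁻¹-↑ˡ ut)

    degs' : ∀ τ x → alive' x ≡ true → count (λ z → alive' z ∧ r τ z x) ℕ.≤ M'
    degs' τ x e = ℕP.≤-trans (count-mono pt) (ℕP.≤-trans (count-∨ (λ z → nbr τ x z ∧ main τ z ω)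
        (λ z → nbr τ x z ∧ fail (pickOf (slot z)) ω))
        (ℕP.+-mono-≤ (ℕP.<⇒≤ (≤ᵇ-false {Km} {mainCount τ x ω} (proj₁ fb))) (ℕP.<⇒≤ (≤ᵇ-false {Kc} {failCount τ x ω} (proj₂ fb)))))
      where
      fb = ∨-false-elim {Km ℕ.≤ᵇ mainCount τ x ω} (fineNbr τ x)
      pt : ∀ z → alive' z ∧ r τ z x ≡ true → (nbr τ x z ∧ main τ z ω) ∨ (nbr τ x z ∧ fail (pickOf (slot z)) ω) ≡ true
      pt z h = fin (∨-elim {main τ z ω} (main-or-fail τ z a1))
        where
        a1 : alive₁ z ω ≡ true
        a1 = alive'→₁ z (proj₁ (∧-elim h))
        n : nbr τ x z ≡ true
        n = ∧-intro (₁→alive x (alive'→₁ x e)) (∧-intro (₁→alive z a1) (trans (r-sym τ x z) (proj₂ (∧-elim {alive' z} h))))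
        fin : main τ z ω ≡ true ⊎ fail (pickOf (slot z)) ω ≡ true → (nbr τ x z ∧ main τ z ω) ∨
            (nbr τ x z ∧ fail (pickOf (slot z)) ω) ≡ true
        fin (inj₁ q) = ∨-left (∧-intro n q)
        fin (inj₂ q) = ∨-right {nbr τ x z ∧ main τ z ω} (∧-intro n q)

    advanced : State S L' M'
    advanced = record
      { sel = sel' ; alive = alive' ; sel-slot = sel-slot' ; sel-free = sel-free' ; sel-alive = sel-alive'
      ; alive-open = alive-open' ; rows = rows' ; degs = degs' }

-- Numerical thresholds and the gain of one round

lit : ℕ → ℚ
lit = ℕ→ℚ

-- The term q A³ exceeds q A (A - 1)² by q (2 A² - A), at most 2 A², and 4 (A - 1)² covers this once
-- A ≥ 5. Hence b may be q A + 4.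
pays-ceil : ∀ A q b → lit 5 ≤ A → 0ℚ ≤ q → q ≤ 1ℚ → q * A + lit 4 ≤ b → q * (A * A * A) ≤ b * ((A - 1ℚ) * (A - 1ℚ))
pays-ceil A q b 5≤A 0≤q q≤1 h = ≤-trans
  (le-by (lit 2 * (1ℚ - q) * (A * A) + (lit 2 * A * (A - lit 5) + lit 2 * A + q * A + lit 4))
     (0≤+ (0≤* (0≤* (0≤lit 2) (sub≥0 q≤1)) (0≤* 0≤A 0≤A)) (0≤+
         (0≤+ (0≤+ (0≤* (0≤* (0≤lit 2) 0≤A) (sub≥0 5≤A)) (0≤* (0≤lit 2) 0≤A)) (0≤* 0≤q 0≤A)) (0≤lit 4)))
     (solve 2 (λ A q → (q :* A :+ con (lit 4)) :* ((A :- con 1ℚ) :* (A :- con 1ℚ)) := q :* (A :* A :* A) :+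
         (con (lit 2) :* (con 1ℚ :- q) :* (A :* A) :+ (con (lit 2) :* A :* (A :- con (lit 5)) :+ con (lit 2) :* A :+ q :* A :+ con
         (lit 4)))) refl A q))
  (*monoʳ (0≤* (sub≥0 1≤A) (sub≥0 1≤A)) h)
  where
  0≤lit : ∀ n → 0ℚ ≤ lit n
  0≤lit n = subst (0ℚ ≤_) (ι-def n) (0≤ι n)
  1≤A : 1ℚ ≤ A
  1≤A = ≤-trans (subst₂ _≤_ ι-1 (ι-def 5) (ι-mono (s≤s z≤n))) 5≤A
  0≤A : 0ℚ ≤ A
  0≤A = ≤-trans 0≤1 1≤A

0≤lit : ∀ n → 0ℚ ≤ lit n
0≤lit n = subst (0ℚ ≤_) (ι-def n) (0≤ι n)

record Threshold (a : ℕ) (q : ℚ) (N : ℕ) : Set where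
  field
    b K : ℕ
    pays : q * (ι a * ι a * ι a) ≤ ι b * ((ι a - 1ℚ) * (ι a - 1ℚ))
    reach : suc b ℕ.* N ℕ.≤ a ℕ.* K
    cost : ι a * ι K ≤ (q * ι a + lit 7) * ι N

-- Take b as q a + 4 rounded up and K as (b + 1) N / a rounded up. The 7 in `cost` is the 4, one for
-- rounding b, one for b + 1, and one for rounding K, which costs at most a ≤ N after multiplication
-- by a.
threshold : ∀ a q N → 5 ℕ.≤ a → 0ℚ ≤ q → q ≤ 1ℚ → a ℕ.≤ N → Threshold a q N
threshold a q N 5≤a 0≤q q≤1 a≤N = record
  { b = b ; K = K
  ; pays = pays-ceil A q (ι b) (subst (_≤ A) (ι-def 5) (ι-mono 5≤a)) 0≤q q≤1 (proj₁ (proj₂ cb))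
  ; reach = ι-cancel (subst₂ _≤_ (sym (trans (ι-* (suc b) N) (cong (_* ι N) (ι-suc b)))) (sym (ι-* a K))
       (≤-trans (≤-reflexive (trans (solve 1 (λ x → x := con 1ℚ :* x) refl X)
           (trans (cong (_* X) (sym Aj)) (solve 3 (λ a j x → a :* j :* x := a :* (x :* j)) refl A j X))))
           (*mono 0≤A (proj₁ (proj₂ cK)))))
  ; cost = ≤-trans (*mono 0≤A (proj₂ (proj₂ cK))) (≤-trans (≤-reflexive
      (trans (solve 3 (λ a j x → a :* (x :* j :+ con 1ℚ) := (a :* j) :* x :+ a) refl A j X)
      (trans (cong (λ z → z * X + A) Aj) (cong (_+ A) (ℚP.*-identityˡ X)))))
      (≤-trans (+-mono-≤ (*monoʳ (0≤ι N) (ℚP.+-monoʳ-≤ 1ℚ (proj₂ (proj₂ cb)))) (ι-mono a≤N))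
        (≤-reflexive (solve 3 (λ q A n → (con 1ℚ :+ (q :* A :+ con (lit 4) :+ con 1ℚ)) :* n :+ n := (q :* A :+ con (lit 7)) :* n)
            refl q A (ι N)))))
  }
  where
  A = ι a
  0≤A : 0ℚ ≤ A
  0≤A = 0≤ι a
  0<A : 0ℚ < A
  0<A = 0<ι (ℕP.≤-trans (s≤s z≤n) 5≤a)
  j = proj₁ (recip A 0<A)
  Aj : A * j ≡ 1ℚ
  Aj = proj₂ (proj₂ (recip A 0<A))
  cb = ceil (q * A + lit 4) (0≤+ (0≤* 0≤q 0≤A) (0≤lit 4))
  b : ℕ
  b = proj₁ cb
  X : ℚ
  X = (1ℚ + ι b) * ι N
  cK = ceil (X * j) (0≤* (0≤* (0≤+ 0≤1 (0≤ι b)) (0≤ι N)) (<⇒≤ (proj₁ (proj₂ (recip A 0<A)))))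
  K : ℕ
  K = proj₁ cK

-- Parameters of the nibble when degrees are at most (1 - 1/e) times the list sizes: picks have probability 1/(t L), deviations use
-- the base (1+w)^a, and the ratio of degree to list size shrinks by the factor 1 - 1/c per round.
abstract
  tₑ aₑ cₑ rounds : ℕ → ℕ
  tₑ e = 68 ℕ.* e
  aₑ e = 80 ℕ.* e ℕ.* tₑ e
  cₑ e = 4 ℕ.* tₑ e ℕ.* e
  rounds e = 32 ℕ.* cₑ e

  tₑ-def : ∀ e → tₑ e ≡ 68 ℕ.* e
  tₑ-def e = refl
  aₑ-def : ∀ e → aₑ e ≡ 80 ℕ.* e ℕ.* tₑ e
  aₑ-def e = refl
  cₑ-def : ∀ e → cₑ e ≡ 4 ℕ.* tₑ e ℕ.* e
  cₑ-def e = refl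
  rounds-def : ∀ e → rounds e ≡ 32 ℕ.* cₑ e
  rounds-def e = refl

x-1≤x : ∀ x → x - 1ℚ ≤ x
x-1≤x x = le-by 1ℚ 0≤1 (solve 1 (λ e → e := e :- con 1ℚ :+ con 1ℚ) refl x)

1-x≤1 : ∀ {x} → 0ℚ ≤ x → 1ℚ - x ≤ 1ℚ
1-x≤1 {x} p = le-by x p (solve 1 (λ v → con 1ℚ := con 1ℚ :- v :+ v) refl x)

module Consts (e : ℕ) (1≤e : 1 ℕ.≤ e) where
  T A Ê Cc : ℚ
  Ê = ι e
  T = ι (tₑ e)
  A = ι (aₑ e)
  Cc = ι (cₑ e)
  T≡ : T ≡ lit 68 * Ê
  T≡ = trans (trans (cong ι (tₑ-def e)) (ι-* 68 e)) (cong (_* Ê) (ι-def 68))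
  A≡ : A ≡ lit 80 * Ê * T
  A≡ = trans (trans (cong ι (aₑ-def e)) (ι-* (80 ℕ.* e) (tₑ e))) (cong (_* T) (trans (ι-* 80 e) (cong (_* Ê) (ι-def 80))))
  C≡ : Cc ≡ lit 4 * T * Ê
  C≡ = trans (trans (cong ι (cₑ-def e)) (ι-* (4 ℕ.* tₑ e) e)) (cong (_* Ê) (trans (ι-* 4 (tₑ e)) (cong (_* T) (ι-def 4))))
  1≤E : 1ℚ ≤ Ê
  1≤E = subst (_≤ Ê) ι-1 (ι-mono 1≤e)
  0≤E : 0ℚ ≤ Ê
  0≤E = 0≤ι e
  0≤T : 0ℚ ≤ T
  0≤T = 0≤ι (tₑ e)
  0≤A : 0ℚ ≤ A
  0≤A = 0≤ι (aₑ e)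
  68≤t : 68 ℕ.≤ tₑ e
  68≤t = subst (68 ℕ.≤_) (sym (tₑ-def e)) (ℕP.*-monoʳ-≤ 68 1≤e)
  1≤t : 1 ℕ.≤ tₑ e
  1≤t = ℕP.≤-trans (s≤s z≤n) 68≤t
  80≤a : 80 ℕ.≤ aₑ e
  80≤a = subst (80 ℕ.≤_) (sym (aₑ-def e)) (ℕP.*-mono-≤ {80} {80 ℕ.* e} {1} (ℕP.*-monoʳ-≤ 80 1≤e) 1≤t)
  1≤c : 1 ℕ.≤ cₑ e
  1≤c = subst (1 ℕ.≤_) (sym (cₑ-def e)) (ℕP.*-mono-≤ {1} {4 ℕ.* tₑ e} (ℕP.*-mono-≤ {1} {4} (s≤s z≤n) 1≤t) 1≤e)
  5≤a : 5 ℕ.≤ aₑ e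
  5≤a = ℕP.≤-trans (ℕP.m≤m+n 5 75) 80≤a
  2≤a : 2 ℕ.≤ aₑ e
  2≤a = ℕP.≤-trans (ℕP.m≤m+n 2 78) 80≤a

record Step {ℓ D E₀} (S : System ℓ D E₀) (e L M : ℕ) : Set where
  field
    L' M' : ℕ
    state : State S L' M'
    shrink : L ℕ.≤ 2 ℕ.* L'
    improve : ι (cₑ e) * (ι M' * ι L) ≤ (ι (cₑ e) - 1ℚ) * (ι M * ι L')

-- To first order the new ratio is the old one times (1 - θ - μ)/(1 - 2 μ). The hypothesis on e
-- gives θ - μ ≥ θ/e, and the parameters are chosen so that this gain beats the quadratic terms and
-- the roundings.
nibble-step : ∀ {ℓ D E₀} (S : System ℓ D E₀) (e L M : ℕ) → 1 ℕ.≤ e → (1≤ℓ : 1 ℕ.≤ ℓ) → 1 ℕ.≤ D → State S L M → ι e * ι M ≤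
    (ι e - 1ℚ) * ι L →
  (2≤a : 2 ℕ.≤ aₑ e) → aₑ e ℕ.≤ M → ι (suc (20 ℕ.* E₀ ℕ.* ((D ℕ.* D) ℕ.* (D ℕ.* D)))) ≤ pow
      (Moment.y (aₑ e) ℓ 2≤a 1≤ℓ) M → Step S e L M
nibble-step {ℓ} {D} {E₀} S e L M 1≤e 1≤ℓ 1≤D St ratio 2≤a a≤M big = record
  { L' = L ℕ.∸ Kr ; M' = Km ℕ.+ Kc ; state = Adv.advanced (proj₁ out) (proj₂ out)
  ; shrink = ℕP.≤-trans (ℕP.≤-reflexive (sym (ℕP.m+[n∸m]≡n Kr≤L)))
      (ℕP.≤-trans (ℕP.+-monoˡ-≤ (L ℕ.∸ Kr) Kr≤L') (ℕP.≤-reflexive (cong (L ℕ.∸ Kr ℕ.+_) (sym (ℕP.+-identityʳ (L ℕ.∸ Kr))))))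
  ; improve = improve }
  where
  open Consts e 1≤e using (T; A; Ê; Cc; T≡; A≡; C≡; 1≤c; 1≤E; 0≤E; 0≤T; 0≤A; 68≤t; 5≤a; 80≤a)
  l m : ℚ
  l = ι L
  m = ι M
  1≤M : 1 ℕ.≤ M
  1≤M = ℕP.≤-trans (ℕP.≤-trans (s≤s z≤n) 5≤a) a≤M
  M≤L : M ℕ.≤ L
  M≤L = ι-cancel (*cancel {Ê} (<-≤-trans 0<1 1≤E) (≤-trans ratio (*monoʳ (0≤ι L) (x-1≤x Ê))))
  1≤L : 1 ℕ.≤ L
  1≤L = ℕP.≤-trans 1≤M M≤L
  0<TL : 0ℚ < T * l
  0<TL = 0<* (0<ι (ℕP.≤-trans (s≤s z≤n) 68≤t)) (0<ι 1≤L)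
  p : ℚ
  p = proj₁ (recip (T * l) 0<TL)
  0<p : 0ℚ < p
  0<p = proj₁ (proj₂ (recip (T * l) 0<TL))
  0≤p : 0ℚ ≤ p
  0≤p = <⇒≤ 0<p
  TLp : T * l * p ≡ 1ℚ
  TLp = proj₂ (proj₂ (recip (T * l) 0<TL))
  θ μ : ℚ
  θ = p * l
  μ = p * m
  Tθ : T * θ ≡ 1ℚ
  Tθ = trans (solve 3 (λ T p l → T :* (p :* l) := T :* l :* p) refl T p l) TLp
  0≤θ : 0ℚ ≤ θ
  0≤θ = 0≤* 0≤p (0≤ι L)
  0≤μ : 0ℚ ≤ μ
  0≤μ = 0≤* 0≤p (0≤ι M)
  μ≤θ : μ ≤ θ
  μ≤θ = *mono 0≤p (ι-mono M≤L)
  68θ≤1 : lit 68 * θ ≤ 1ℚ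
  68θ≤1 = ≤-trans (*monoʳ 0≤θ (≤-trans (≤-reflexive (sym (ι-def 68))) (ι-mono 68≤t))) (≤-reflexive Tθ)
  9θ≤1 : ι 9 * θ ≤ 1ℚ
  9θ≤1 = ≤-trans (*monoʳ 0≤θ (≤-trans (ι-mono (ℕP.m≤m+n 9 59)) (≤-reflexive (ι-def 68)))) 68θ≤1
  module Sp = Space S L M St p 0≤p M≤L 9θ≤1
  module Ta = Tails S L M St p 0≤p M≤L 9θ≤1 (aₑ e) 2≤a 5≤a 1≤ℓ
  qr qm qc : ℚ
  qr = μ + μ
  qm = Sp.qm
  qc = Ta.qc
  0≤2μ : 0ℚ ≤ μ + μ
  0≤2μ = 0≤+ 0≤μ 0≤μ
  θ≤1 : θ ≤ 1ℚ
  θ≤1 = Sp.θ≤1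
  qc≤8θ : qc ≤ lit 8 * (θ * θ)
  qc≤8θ = le-by (lit 8 * (θ * (θ - μ))) (0≤* (0≤lit 8) (0≤* 0≤θ (sub≥0 μ≤θ)))
     (solve 2 (λ t m → con (lit 8) :* (t :* t) := ((t :* (m :+ m) :+ t :* (m :+ m)) :+ (t :* (m :+ m) :+ t :* (m :+ m))) :+ con
         (lit 8) :* (t :* (t :- m))) refl θ μ)
  qc≤1 : qc ≤ 1ℚ
  qc≤1 = ≤-trans qc≤8θ (≤-trans (le-by (lit 60 * θ + lit 8 * (θ * (1ℚ - θ)))
      (0≤+ (0≤* (0≤lit 60) 0≤θ) (0≤* (0≤lit 8) (0≤* 0≤θ (sub≥0 θ≤1))))
     (solve 1 (λ t → con (lit 68) :* t := con (lit 8) :* (t :* t) :+ (con (lit 60) :* t :+ con (lit 8) :* (t :* (con 1ℚ :- t))))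
         refl θ)) 68θ≤1)
  0≤qc : 0ℚ ≤ qc
  0≤qc = 0≤+ (0≤+ x x) (0≤+ x x) where x = 0≤* 0≤θ 0≤2μ
  module Tr = Threshold (threshold (aₑ e) qr L 5≤a 0≤2μ Ta.qr≤1 (ℕP.≤-trans a≤M M≤L))
  module Tm = Threshold (threshold (aₑ e) qm M 5≤a Sp.0≤qm Sp.qm≤1 a≤M)
  module Tc = Threshold (threshold (aₑ e) qc M 5≤a 0≤qc qc≤1 a≤M)
  Kr Km Kc : ℕ
  Kr = Tr.K
  Km = Tm.K
  Kc = Tc.K
  module Nb = Nibble S L M St p 0≤p M≤L 9θ≤1 (aₑ e) 2≤a 5≤a 1≤ℓ 1≤D Tr.b Tm.b Tc.b Kr Km Kc
  module Adv = Advance S L M St p 0≤p M≤L 9θ≤1 (aₑ e) 2≤a 5≤a 1≤ℓ 1≤D Tr.b Tm.b Tc.b Kr Km Kc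
  out : Σ (Fin Sp.V → Sp.B) λ ω → ∀ i → Nb.bad i ω ≡ false
  out = Nb.Outcome.outcome Tr.pays Tm.pays Tc.pays qc≤1 Tr.reach Tm.reach Tc.reach big
  Aθ : A * θ ≡ lit 80 * Ê
  Aθ = trans (cong (_* θ) A≡) (trans (ℚP.*-assoc (lit 80 * Ê) T θ)
      (trans (cong (lit 80 * Ê *_) Tθ) (ℚP.*-identityʳ (lit 80 * Ê))))
  0<A : 0ℚ < A
  0<A = 0<ι (ℕP.≤-trans (s≤s z≤n) 5≤a)
  double : ι Kr + ι Kr ≤ l
  double = *cancel 0<A (≤-trans (≤-reflexive (ℚP.*-distribˡ-+ A (ι Kr) (ι Kr)))
      (≤-trans (+-mono-≤ Tr.cost Tr.cost) (≤-trans (≤-reflexive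
      (solve 3 (λ m A l → ((m :+ m) :* A :+ con (lit 7)) :* l :+ ((m :+ m) :* A :+ con (lit 7)) :* l :=
      (con (lit 4) :* (A :* m) :+ con (lit 14)) :* l) refl μ A l)) (*monoʳ (0≤ι L) up))))
    where
    up : lit 4 * (A * μ) + lit 14 ≤ A
    up = ≤-trans (+-mono-≤ (*mono (0≤lit 4) (≤-trans (*mono 0≤A μ≤θ) (≤-reflexive Aθ))) (≤-refl {lit 14}))
      (≤-trans (le-by (lit 320 * (Ê - 1ℚ) * Ê + lit 5106 * (Ê * Ê) + lit 14 * ((Ê - 1ℚ) * (Ê + 1ℚ)))
          (0≤+ (0≤+ (0≤* (0≤* (0≤lit 320) (sub≥0 1≤E)) 0≤E) (0≤* (0≤lit 5106) (0≤* 0≤E 0≤E)))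
          (0≤* (0≤lit 14) (0≤* (sub≥0 1≤E) (0≤+ 0≤E 0≤1))))
         (solve 1 (λ Ê → con (lit 80) :* Ê :* (con (lit 68) :* Ê) := con (lit 4) :* (con (lit 80) :* Ê) :+ con (lit 14) :+
             (con (lit 320) :* (Ê :- con 1ℚ) :* Ê :+ con (lit 5106) :* (Ê :* Ê) :+ con (lit 14) :*
             ((Ê :- con 1ℚ) :* (Ê :+ con 1ℚ)))) refl Ê))
        (≤-reflexive (sym (trans A≡ (cong (lit 80 * Ê *_) T≡)))))
  2Kr≤L : Kr ℕ.+ Kr ℕ.≤ L
  2Kr≤L = ι-cancel (≤-trans (≤-reflexive (ι-+ Kr Kr)) double)
  Kr≤L : Kr ℕ.≤ L
  Kr≤L = ℕP.≤-trans (ℕP.m≤m+n Kr Kr) 2Kr≤L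
  Kr≤L' : Kr ℕ.≤ L ℕ.∸ Kr
  Kr≤L' = ℕP.≤-trans (ℕP.≤-reflexive (sym (ℕP.m+n∸n≡m Kr Kr))) (ℕP.∸-monoˡ-≤ Kr 2Kr≤L)
  l' m' : ℚ
  l' = ι (L ℕ.∸ Kr)
  m' = ι (Km ℕ.+ Kc)
  l'≡ : l' ≡ l - ι Kr
  l'≡ = trans (solve 2 (λ a b → a := b :+ a :- b) refl l' (ι Kr))
      (cong (_- ι Kr) (trans (sym (ι-+ Kr (L ℕ.∸ Kr))) (cong ι (ℕP.m+[n∸m]≡n Kr≤L))))
  l'-lower : (A - ((μ + μ) * A + lit 7)) * l ≤ A * l'
  l'-lower = le-by (((μ + μ) * A + lit 7) * l - A * ι Kr) (sub≥0 Tr.cost)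
      (trans (cong (A *_) l'≡) (solve 4 (λ A l k x → A :* (l :- k) := (A :- x) :* l :+ (x :* l :- A :* k)) refl A l (ι Kr)
      ((μ + μ) * A + lit 7)))
  m'-upper : A * m' ≤ (qm * A + lit 7 + (lit 8 * (θ * θ) * A + lit 7)) * m
  m'-upper = ≤-trans (≤-reflexive (trans (cong (A *_) (ι-+ Km Kc)) (ℚP.*-distribˡ-+ A (ι Km) (ι Kc))))
      (≤-trans (+-mono-≤ Tm.cost (≤-trans Tc.cost (*monoʳ (0≤ι M) (ℚP.+-monoˡ-≤ (lit 7) (*monoʳ 0≤A qc≤8θ)))))
      (≤-reflexive (sym (ℚP.*-distribʳ-+ m (qm * A + lit 7) (lit 8 * (θ * θ) * A + lit 7)))))
  s : ℚ
  s = (Ê - 1ℚ) * θ - Ê * μ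
  0≤s : 0ℚ ≤ s
  0≤s = sub≥0 (≤-trans (≤-reflexive (solve 3 (λ Ê p m → Ê :* (p :* m) := p :* (Ê :* m)) refl Ê p m))
      (≤-trans (*mono 0≤p ratio) (≤-reflexive (solve 3 (λ Ê p l → p :* ((Ê :- con 1ℚ) :* l) := (Ê :- con 1ℚ) :* (p :* l)) refl Ê p
      l))))
  -- The budget that fixes the constants, in multiples of e t. After multiplication by c a the gain
  -- θ/e is 320. The quadratic terms (9 + 8) θ² take 80, the three roundings by 7 take 84, the
  -- factor 1 - 1/c takes 80, and 76 remain.
  key : Cc * (qm * A + lit 7 + (lit 8 * (θ * θ) * A + lit 7)) ≤ (Cc - 1ℚ) * (A - ((μ + μ) * A + lit 7))
  key = le-by (lit 4 * T * A * s + (μ + μ) * A + lit 76 * (T * Ê) + lit 7)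
      (0≤+ (0≤+ (0≤+ (0≤* (0≤* (0≤* (0≤lit 4) 0≤T) 0≤A) 0≤s) (0≤* 0≤2μ 0≤A)) (0≤* (0≤lit 76) (0≤* 0≤T 0≤E))) (0≤lit 7)) identity
    where
    k = T * θ - 1ℚ
    k0 : k ≡ 0ℚ
    k0 = trans (cong (_- 1ℚ) Tθ) (ℚP.+-inverseʳ 1ℚ)
    -- The relation t θ = 1 is unknown to the ring solver, so the identity carries an explicit
    -- multiple of t θ - 1, which is removed afterwards.
    poly : ∀ C A T Ê θ μ → C ≡ lit 4 * T * Ê → A ≡ lit 80 * Ê * T → T ≡ lit 68 * Ê →
       (C - 1ℚ) * (A - ((μ + μ) * A + lit 7)) ≡ C * ((1ℚ - (θ + μ) + lit 9 * (θ * θ)) * A + lit 7 + (lit 8 * (θ * θ) * A + lit 7))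
         + (lit 4 * T * A * ((Ê - 1ℚ) * θ - Ê * μ) + (μ + μ) * A + lit 76 * (T * Ê) + lit 7) + (T * θ - 1ℚ) *
             (lit 4 * A - A * (T * θ + 1ℚ))
    poly C A T Ê θ μ refl refl refl = solve 3 (λ Ê θ μ → let T = con (lit 68) :* Ê ; A = con (lit 80) :* Ê :* T ; C = con (lit 4) :* T :* Ê in
       (C :- con 1ℚ) :* (A :- ((μ :+ μ) :* A :+ con (lit 7))) := C :*
           ((con 1ℚ :- (θ :+ μ) :+ con (lit 9) :* (θ :* θ)) :* A :+ con (lit 7) :+ (con (lit 8) :* (θ :* θ) :* A :+ con (lit 7)))
         :+ (con (lit 4) :* T :* A :* ((Ê :- con 1ℚ) :* θ :- Ê :* μ) :+ (μ :+ μ) :* A :+ con (lit 76) :* (T :* Ê) :+ con (lit 7))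
             :+ (T :* θ :- con 1ℚ) :* (con (lit 4) :* A :- A :* (T :* θ :+ con 1ℚ))) refl Ê θ μ
    qm≡ : qm ≡ 1ℚ - (θ + μ) + lit 9 * (θ * θ)
    qm≡ = cong (λ n → 1ℚ - (θ + μ) + n * (θ * θ)) (ι-def 9)
    R = lit 4 * T * A * s + (μ + μ) * A + lit 76 * (T * Ê) + lit 7
    U = lit 8 * (θ * θ) * A + lit 7
    identity : (Cc - 1ℚ) * (A - ((μ + μ) * A + lit 7)) ≡ Cc * (qm * A + lit 7 + U) + R
    identity = trans (poly Cc A T Ê θ μ C≡ A≡ T≡) (trans (cong
        (λ z → Cc * ((1ℚ - (θ + μ) + lit 9 * (θ * θ)) * A + lit 7 + U) + R + z * (lit 4 * A - A * (T * θ + 1ℚ))) k0)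
        (trans (cong (λ z → Cc * ((1ℚ - (θ + μ) + lit 9 * (θ * θ)) * A + lit 7 + U) + R + z)
            (ℚP.*-zeroˡ (lit 4 * A - A * (T * θ + 1ℚ)))) (trans (ℚP.+-identityʳ _)
            (cong (λ z → Cc * (z * A + lit 7 + U) + R) (sym qm≡)))))
  0≤C : 0ℚ ≤ Cc
  0≤C = 0≤ι (cₑ e)
  1≤C : 1ℚ ≤ Cc
  1≤C = subst (_≤ Cc) ι-1 (ι-mono 1≤c)
  improve : Cc * (m' * l) ≤ (Cc - 1ℚ) * (m * l')
  improve = *cancel 0<A (≤-trans (≤-reflexive (solve 4 (λ A C m l → A :* (C :* (m :* l)) := C :* ((A :* m) :* l)) refl A Cc m' l))
      (≤-trans (*mono 0≤C (*monoʳ (0≤ι L) m'-upper))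
     (≤-trans (≤-reflexive (solve 4 (λ C x m l → C :* (x :* m :* l) := C :* x :* (m :* l)) refl Cc
         (qm * A + lit 7 + (lit 8 * (θ * θ) * A + lit 7)) m l)) (≤-trans (*monoʳ (0≤* (0≤ι M) (0≤ι L)) key)
       (≤-trans (≤-reflexive (solve 4 (λ c x m l → c :* x :* (m :* l) := c :* m :* (x :* l)) refl (Cc - 1ℚ)
           (A - ((μ + μ) * A + lit 7)) m l)) (≤-trans (*mono (0≤* (sub≥0 1≤C) (0≤ι M)) l'-lower)
         (≤-reflexive (solve 4 (λ c m A l → c :* m :* (A :* l) := A :* (c :* (m :* l))) refl (Cc - 1ℚ) m A l'))))))))

-- Iterating the nibble

pow-decay : ∀ {v} n → 0ℚ ≤ v → v ≤ 1ℚ → pow (1ℚ - v) n * (1ℚ + ι n * v) ≤ 1ℚ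
pow-decay {v} n 0≤v v≤1 = ≤-trans (*mono (0≤pow n (sub≥0 v≤1)) (bernoulli n 0≤v))
    (≤-trans (≤-reflexive (sym (pow-dist (1ℚ - v) (1ℚ + v) n)))
    (≤-trans (pow-monoˡ n (0≤* (sub≥0 v≤1) (0≤+ 0≤1 0≤v)) (le-by (v * v) (0≤* 0≤v 0≤v)
    (solve 1 (λ v → con 1ℚ := (con 1ℚ :- v) :* (con 1ℚ :+ v) :+ v :* v) refl v))) (≤-reflexive (one n))))
  where
  one : ∀ n → pow 1ℚ n ≡ 1ℚ
  one zero = refl
  one (suc n) = trans (ℚP.*-identityˡ _) (one n)

-- With uniform picks a given conflicting pair is chosen with probability at most 1/L², and its
-- event has at most 8 L M neighbours. The condition 4 p d ≤ 1 of the local lemma then reads 32 M ≤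
-- L.
record Thin {ℓ D E₀} (S : System ℓ D E₀) : Set where
  field
    L M : ℕ
    state : State S L M
    nonempty : 32 ℕ.≤ L
    thin : 32 ℕ.* M ℕ.≤ L

module Iterate {ℓ D E₀} (S : System ℓ D E₀) (e : ℕ) (1≤e : 1 ℕ.≤ e) (1≤ℓ : 1 ℕ.≤ ℓ) (1≤D : 1 ℕ.≤ D) (2≤a : 2 ℕ.≤ aₑ e) (m₀ : ℕ)
    (a≤m₀ : aₑ e ℕ.≤ m₀)
  (big : ι (suc (20 ℕ.* E₀ ℕ.* ((D ℕ.* D) ℕ.* (D ℕ.* D)))) ≤ pow (Moment.y (aₑ e) ℓ 2≤a 1≤ℓ) m₀) where

  C : ℚ
  C = ι (cₑ e)
  open Consts e 1≤e using (1≤c)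
  0<C : 0ℚ < C
  0<C = 0<ι 1≤c
  v ρ : ℚ
  v = proj₁ (recip C 0<C)
  ρ = 1ℚ - v
  Cv : C * v ≡ 1ℚ
  Cv = proj₂ (proj₂ (recip C 0<C))
  0≤v : 0ℚ ≤ v
  0≤v = <⇒≤ (proj₁ (proj₂ (recip C 0<C)))
  v≤1 : v ≤ 1ℚ
  v≤1 = ≤-trans (≤-reflexive (sym (ℚP.*-identityˡ v))) (≤-trans (*monoʳ 0≤v (subst (_≤ C) ι-1 (ι-mono 1≤c))) (≤-reflexive Cv))
  0≤ρ : 0ℚ ≤ ρ
  0≤ρ = sub≥0 v≤1

  Cρ : C - 1ℚ ≡ C * ρ
  Cρ = trans (cong (λ z → C - z) (sym Cv)) (solve 2 (λ C v → C :- C :* v := C :* (con 1ℚ :- v)) refl C v)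

  -- A round at most halves the lists and multiplies the ratio by at most ρ, so j rounds are
  -- affordable and sufficient. As long as the state is not thin, 32 M > L ≥ 32 m₀, hence M is still
  -- large enough for the local lemma of the next round.
  iterate : ∀ j L M → State S L M → ι e * ι M ≤ (ι e - 1ℚ) * ι L → 2 ℕ.^ j ℕ.* (32 ℕ.* m₀) ℕ.≤ L → pow ρ j * ι
      (32 ℕ.* M) ≤ ι L → Thin S
  iterate zero L M St ratio large close = record { state = St ; nonempty = 32≤L ; thin = ι-cancel
      (≤-trans (≤-reflexive (sym (ℚP.*-identityˡ (ι (32 ℕ.* M))))) close) }
    where
    32≤L : 32 ℕ.≤ L
    32≤L = ℕP.≤-trans (ℕP.≤-trans (ℕP.*-mono-≤ {32} {32} ℕP.≤-refl (ℕP.≤-trans (ℕP.≤-trans (s≤s z≤n) 2≤a) a≤m₀))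
        (ℕP.≤-reflexive (sym (ℕP.*-identityˡ (32 ℕ.* m₀))))) large
  iterate (suc j) L M St ratio large close = decide ((32 ℕ.* M) ℕP.≤? L)
   where
   decide : Dec (32 ℕ.* M ℕ.≤ L) → Thin S
   decide (yes h) = record { state = St ; nonempty = 32≤L ; thin = h }
     where
     32≤L : 32 ℕ.≤ L
     32≤L = ℕP.≤-trans (ℕP.*-mono-≤ {1} {2 ℕ.^ suc j} (ℕP.m^n>0 2 (suc j))
         (ℕP.*-mono-≤ {32} {32} ℕP.≤-refl (ℕP.≤-trans (ℕP.≤-trans (s≤s z≤n) 2≤a) a≤m₀))) large
   decide (no h) = iterate j L' M' state ratio' large' close'
     where
     m₀≤M : m₀ ℕ.≤ M
     m₀≤M = ℕP.*-cancelˡ-≤ 32 (ℕP.≤-trans (ℕP.≤-trans (ℕP.m≤n*m (32 ℕ.* m₀) (2 ℕ.^ suc j) {{ℕP.m^n≢0 2 (suc j)}}) large)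
         (ℕP.<⇒≤ (ℕP.≰⇒> h)))
     open Step (nibble-step S e L M 1≤e 1≤ℓ 1≤D St ratio 2≤a (ℕP.≤-trans a≤m₀ m₀≤M)
         (≤-trans big (pow-monoʳ (Moment.1≤y (aₑ e) ℓ 2≤a 1≤ℓ) m₀≤M)))
     large' : 2 ℕ.^ j ℕ.* (32 ℕ.* m₀) ℕ.≤ L'
     large' = ℕP.*-cancelˡ-≤ 2 (ℕP.≤-trans (ℕP.≤-reflexive (sym (ℕP.*-assoc 2 (2 ℕ.^ j) (32 ℕ.* m₀)))) (ℕP.≤-trans large shrink))
     1≤L : 1 ℕ.≤ L
     1≤L = ℕP.≤-trans (ℕP.*-mono-≤ {1} {2 ℕ.^ suc j} (ℕP.m^n>0 2 (suc j))
         (ℕP.*-mono-≤ {1} {32} (s≤s z≤n) (ℕP.≤-trans (ℕP.≤-trans (s≤s z≤n) 2≤a) a≤m₀))) large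
     0<L : 0ℚ < ι L
     0<L = 0<ι 1≤L
     imp : ι M' * ι L ≤ ρ * (ι M * ι L')
     imp = *cancel 0<C (≤-trans improve (≤-reflexive (trans (cong (_* (ι M * ι L')) Cρ) (ℚP.*-assoc C ρ (ι M * ι L')))))
     ratio' : ι e * ι M' ≤ (ι e - 1ℚ) * ι L'
     ratio' = *cancel 0<L (≤-trans (≤-reflexive (solve 3 (λ l e m → l :* (e :* m) := e :* (m :* l)) refl (ι L) (ι e) (ι M')))
         (≤-trans (*mono (0≤ι e) (≤-trans imp (≤-trans (*monoʳ (0≤* (0≤ι M) (0≤ι L')) (1-x≤1 0≤v))
         (≤-reflexive (ℚP.*-identityˡ (ι M * ι L'))))))
        (≤-trans (≤-reflexive (sym (ℚP.*-assoc (ι e) (ι M) (ι L'))))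
            (≤-trans (*monoʳ (0≤ι L') ratio) (≤-reflexive (solve 3 (λ e l k → e :* l :* k := l :* (e :* k)) refl (ι e - 1ℚ) (ι L)
            (ι L')))))))
     close' : pow ρ j * ι (32 ℕ.* M') ≤ ι L'
     close' = *cancel 0<L (≤-trans (≤-reflexive (trans (cong (λ z → ι L * (pow ρ j * z)) (ι-* 32 M'))
         (solve 4 (λ l r t m → l :* (r :* (t :* m)) := r :* t :* (m :* l)) refl (ι L) (pow ρ j) (ι 32) (ι M'))))
        (≤-trans (*mono (0≤* (0≤pow j 0≤ρ) (0≤ι 32)) imp) (≤-trans
            (≤-reflexive (trans (solve 5 (λ r t x m k → r :* t :* (x :* (m :* k)) := x :* r :* (t :* m) :* k) refl (pow ρ j)
            (ι 32) ρ (ι M) (ι L')) (cong (λ z → ρ * pow ρ j * z * ι L') (sym (ι-* 32 M)))))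
          (*monoʳ (0≤ι L') close))))

  thinned : ∀ L M → State S L M → ι e * ι M ≤ (ι e - 1ℚ) * ι L → 2 ℕ.^ rounds e ℕ.* (32 ℕ.* m₀) ℕ.≤ L → Thin S
  thinned L M St ratio large = iterate (rounds e) L M St ratio large
      (≤-trans (≤-reflexive (cong (pow ρ (rounds e) *_) (ι-* 32 M))) (≤-trans (*mono (0≤pow (rounds e) 0≤ρ) (*mono (0≤ι 32) M≤L))
      (≤-trans (≤-reflexive (sym (ℚP.*-assoc (pow ρ (rounds e)) (ι 32) (ι L))))
          (≤-trans (*monoʳ (0≤ι L) small) (≤-reflexive (ℚP.*-identityˡ (ι L)))))))
    where
    M≤L : ι M ≤ ι L
    M≤L = *cancel {ι e} (0<ι 1≤e) (≤-trans ratio (*monoʳ (0≤ι L) (x-1≤x (ι e))))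
    rv : ι (rounds e) * v ≡ ι 32
    rv = trans (cong (_* v) (trans (cong ι (rounds-def e)) (ι-* 32 (cₑ e))))
        (trans (ℚP.*-assoc (ι 32) C v) (trans (cong (ι 32 *_) Cv) (ℚP.*-identityʳ (ι 32))))
    -- With 32 c rounds, (1 - 1/c)^(32 c) (1 + 32) ≤ 1 by `pow-decay`.
    small : pow ρ (rounds e) * ι 32 ≤ 1ℚ
    small = ≤-trans (*mono (0≤pow (rounds e) 0≤ρ) (≤-trans (≤-reflexive (sym rv))
        (le-by 1ℚ 0≤1 (ℚP.+-comm 1ℚ (ι (rounds e) * v))))) (pow-decay (rounds e) 0≤v v≤1)

-- Completing a thin state

∑-pairs : ∀ m n (f : Fin m → Fin n → ℚ) → ∑ (λ j → f (proj₁ (F.remQuot {m} n j)) (proj₂ (F.remQuot {m} n j))) ≡ ∑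
    (λ i → ∑ (λ k → f i k))
∑-pairs zero n f = refl
∑-pairs (suc m) n f = trans (∑-cong (λ t → pt t (F.splitAt n t) refl))
    (trans (∑-splitAt n (f zero) (λ j → f (suc (proj₁ (F.remQuot {m} n j))) (proj₂ (F.remQuot {m} n j))))
    (cong (∑ (f zero) +_) (∑-pairs m n (λ i → f (suc i)))))
  where
  pair : Fin n ⊎ Fin (m ℕ.* n) → Fin (suc m) × Fin n
  pair (inj₁ k) = zero , k
  pair (inj₂ j) = suc (proj₁ (F.remQuot {m} n j)) , proj₂ (F.remQuot {m} n j)
  same : ∀ t → F.remQuot {suc m} n t ≡ pair (F.splitAt n t)
  same t with F.splitAt n t
  ... | inj₁ k = refl
  ... | inj₂ j = refl
  pt' : ∀ v → f (proj₁ (pair v)) (proj₂ (pair v)) ≡ [ f zero ,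
      (λ j → f (suc (proj₁ (F.remQuot {m} n j))) (proj₂ (F.remQuot {m} n j))) ]′ v
  pt' (inj₁ k) = refl
  pt' (inj₂ j) = refl
  pt : ∀ t v → F.splitAt n t ≡ v → f (proj₁ (F.remQuot {suc m} n t)) (proj₂ (F.remQuot {suc m} n t)) ≡ [ f zero ,
      (λ j → f (suc (proj₁ (F.remQuot {m} n j))) (proj₂ (F.remQuot {m} n j))) ]′ v
  pt t v e = trans (cong (λ q → f (proj₁ q) (proj₂ q)) (trans (same t) (cong pair e))) (pt' v)

module Finish {ℓ D E₀} (S : System ℓ D E₀) (Th : Thin S) where
  open System S
  open Thin Th
  open State state

  0<L : 0ℚ < ι L
  0<L = 0<ι (ℕP.≤-trans (s≤s z≤n) nonempty)
  p : ℚ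
  p = proj₁ (recip (ι L) 0<L)
  Lp : ι L * p ≡ 1ℚ
  Lp = proj₂ (proj₂ (recip (ι L) 0<L))
  0≤p : 0ℚ ≤ p
  0≤p = <⇒≤ (proj₁ (proj₂ (recip (ι L) 0<L)))
  supp : Fin K → Fin Q → Bool
  supp s z = alive z ∧ (slot z == s)
  isOpen : Maybe (Fin Q) → Bool
  isOpen nothing = true
  isOpen (just _) = false

  sumπ : ∀ s → ∑ (λ z → ⟦ supp s z ⟧ * p) ≡ ι (count (supp s)) * p
  sumπ s = trans (∑-*ʳ p (λ z → ⟦ supp s z ⟧)) (cong (_* p) (sym (ι-count (supp s))))

  open-sum : ∀ s → sel s ≡ nothing → ∑ (λ z → ⟦ supp s z ⟧ * p) ≡ 1ℚ
  open-sum s e = trans (sumπ s) (trans (cong (λ n → ι n * p) (rows s e)) Lp)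

  closed-sum : ∀ s y → sel s ≡ just y → ∑ (λ z → ⟦ supp s z ⟧ * p) ≡ 0ℚ
  closed-sum s y e = trans (∑-cong (λ z → trans (cong (λ b → ⟦ b ⟧ * p) (none z)) (ℚP.*-zeroˡ p))) (∑-0 {Q})
    where
    none : ∀ z → supp s z ≡ false
    none z = ¬true λ h → absurd (trans (sym (alive-open z (proj₁ (∧-elim h))))
        (trans (cong sel (==→≡ (proj₂ (∧-elim {alive z} h)))) e))
      where
      absurd : ∀ {y : Fin Q} → nothing ≡ just y → ⊥
      absurd ()

  π≤1 : ∀ s → ∑ (λ z → ⟦ supp s z ⟧ * p) ≤ 1ℚ
  π≤1 s = go (sel s) refl
    where
    go : ∀ v → sel s ≡ v → ∑ (λ z → ⟦ supp s z ⟧ * p) ≤ 1ℚ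
    go nothing e = ≤-reflexive (open-sum s e)
    go (just y) e = ≤-trans (≤-reflexive (closed-sum s y e)) 0≤1

  row≤L : ∀ s → count (supp s) ℕ.≤ L
  row≤L s = ι-cancel (≤-trans (≤-reflexive (sym (trans (cong (ι (count (supp s)) *_) Lp) (ℚP.*-identityʳ _))))
     (≤-trans (≤-reflexive (solve 3 (λ c l p → c :* (l :* p) := (c :* p) :* l) refl (ι (count (supp s))) (ι L) p))
         (≤-trans (*monoʳ (0≤ι L) (≤-trans (≤-reflexive (sym (sumπ s))) (π≤1 s))) (≤-reflexive (ℚP.*-identityˡ (ι L))))))

  π≥0 : ∀ s z → 0ℚ ≤ ⟦ supp s z ⟧ * p
  π≥0 s z = 0≤* 0≤⟦ supp s z ⟧ 0≤p

  P : Fin K → Exp (Maybe (Fin Q))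
  P s = pick (λ z → ⟦ supp s z ⟧ * p) (π≥0 s) (π≤1 s)

  is : Fin Q → Maybe (Fin Q) → Bool
  is z nothing = false
  is z (just z') = z == z'

  𝔼-is : ∀ z s → 𝔼 (P s) (λ b → ⟦ is z b ⟧) ≤ p
  𝔼-is z s = ≤-trans (≤-reflexive (trans (pick-nothing0 (λ z → ⟦ supp s z ⟧ * p) (π≥0 s) (π≤1 s) (λ b → ⟦ is z b ⟧) refl)
      (trans (∑-cong (λ z' → ℚP.*-comm (⟦ supp s z' ⟧ * p) ⟦ z == z' ⟧)) (∑-single z (λ z' → ⟦ supp s z' ⟧ * p)))))
     (≤-trans (*monoʳ 0≤p ⟦ supp s z ⟧≤1) (≤-reflexive (ℚP.*-identityˡ p)))

  clash : Fin Q → Fin Q → Bool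
  clash z y = r true z y ∨ r false z y

  I : ℕ
  I = Q ℕ.* Q
  fst snd : Fin I → Fin Q
  fst i = proj₁ (F.remQuot {Q} Q i)
  snd i = proj₂ (F.remQuot {Q} Q i)

  pair : Fin Q → Fin Q → Bool
  pair z z' = (alive z ∧ alive z') ∧ clash z z'

  Ω : Set
  Ω = Fin K → Maybe (Fin Q)
  both : Fin Q → Fin Q → Ω → Bool
  both z z' ω = is z (ω (slot z)) ∧ is z' (ω (slot z'))
  bad : Fin I → Ω → Bool
  bad i ω = pair (fst i) (snd i) ∧ both (fst i) (snd i) ω
  touch : Fin Q → Fin Q → Fin K → Bool
  touch z z' t = (slot z == t) ∨ (slot z' == t)
  -- All ordered pairs of candidates serve as indices. Pairs that do not conflict get an empty ball,
  -- so they do not enter the count of neighbours.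
  ball : Fin I → Fin K → Bool
  ball i t = pair (fst i) (snd i) ∧ touch (fst i) (snd i) t
  nb : Fin I → Fin I → Bool
  nb i j = anyF (λ t → ball i t ∧ ball j t)

  dep : ∀ i → Dep (ball i) (λ ω → ⟦ bad i ω ⟧)
  dep i ω ω' e = go (pair (fst i) (snd i)) refl
    where
    z = fst i
    z' = snd i
    go : ∀ v → pair z z' ≡ v → ⟦ v ∧ both z z' ω ⟧ ≡ ⟦ v ∧ both z z' ω' ⟧
    go false _ = refl
    go true q = cong₂ (λ a b → ⟦ is z a ∧ is z' b ⟧) (e (slot z) (∧-intro q (∨-left (==-refl (slot z)))))
        (e (slot z') (∧-intro q (∨-right {slot z == slot z'} (==-refl (slot z')))))

  slot-differ : ∀ z z' → clash z z' ≡ true → slot z ≡ slot z' → ⊥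
  slot-differ z z' c h with ∨-elim {r true z z'} c
  ... | inj₁ q = r-slot true z z' q h
  ... | inj₂ q = r-slot false z z' q h

  rare : ∀ i → E P (λ ω → ⟦ bad i ω ⟧) ≤ p * p
  rare i = go (pair z z') refl
    where
    z = fst i
    z' = snd i
    go : ∀ v → pair z z' ≡ v → E P (λ ω → ⟦ v ∧ both z z' ω ⟧) ≤ p * p
    go false _ = ≤-trans (≤-reflexive (𝔼-0 (prodExp P))) (0≤* 0≤p 0≤p)
    go true q = ≤-trans (≤-reflexive (trans (𝔼-cong (prodExp P) (λ ω → ⟦∧⟧ (is z (ω (slot z))) (is z' (ω (slot z'))))) (trans
       (indep P (λ t → slot z == t) (λ t → slot z' == t) (λ ω → ⟦ is z (ω (slot z)) ⟧) (λ ω → ⟦ is z' (ω (slot z')) ⟧)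
           (λ ω ω' e → cong (λ b → ⟦ is z b ⟧) (e (slot z) (==-refl (slot z))))
           (λ ω ω' e → cong (λ b → ⟦ is z' b ⟧) (e (slot z') (==-refl (slot z'))))
         (λ t a b → slot-differ z z' (proj₂ (∧-elim {alive z ∧ alive z'} q)) (trans (==→≡ a) (sym (==→≡ b)))))
       (cong₂ _*_ (E-single P (slot z) (λ b → ⟦ is z b ⟧)) (E-single P (slot z') (λ b → ⟦ is z' b ⟧))))))
       (*-mono₂ (𝔼-nonneg (P (slot z)) (λ b → 0≤⟦ is z b ⟧)) 0≤p (𝔼-is z (slot z)) (𝔼-is z' (slot z')))

  clash-sym : ∀ z y → clash z y ≡ clash y z
  clash-sym z y = cong₂ _∨_ (r-sym true z y) (r-sym false z y)

  clash-count : ∀ z → ∑ (λ z' → ⟦ pair z z' ⟧) ≤ ⟦ alive z ⟧ * ι (M ℕ.+ M)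
  clash-count z = go (alive z) refl
    where
    go : ∀ v → alive z ≡ v → ∑ (λ z' → ⟦ (v ∧ alive z') ∧ clash z z' ⟧) ≤ ⟦ v ⟧ * ι (M ℕ.+ M)
    go false _ = ≤-reflexive (trans (∑-0 {Q}) (sym (ℚP.*-zeroˡ (ι (M ℕ.+ M)))))
    go true e = ≤-trans (≤-reflexive (sym (ι-count (λ z' → alive z' ∧ clash z z'))))
        (≤-trans (ι-mono (ℕP.≤-trans (count-mono h) (ℕP.≤-trans
        (count-∨ (λ z' → alive z' ∧ r true z' z) (λ z' → alive z' ∧ r false z' z))
        (ℕP.+-mono-≤ (degs true z e) (degs false z e)))))
       (≤-reflexive (sym (ℚP.*-identityˡ (ι (M ℕ.+ M))))))
      where
      h : ∀ z' → alive z' ∧ clash z z' ≡ true → (alive z' ∧ r true z' z) ∨ (alive z' ∧ r false z' z) ≡ true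
      h z' q with ∨-elim {r true z' z} (trans (clash-sym z' z) (proj₂ (∧-elim {alive z'} q)))
      ... | inj₁ c = ∨-left (∧-intro (proj₁ (∧-elim {alive z'} q)) c)
      ... | inj₂ c = ∨-right {alive z' ∧ r true z' z} (∧-intro (proj₁ (∧-elim {alive z'} q)) c)

  half : ∀ t → ∑ (λ z → ∑ (λ z' → ⟦ pair z z' ⟧ * ⟦ slot z == t ⟧)) ≤ ι L * ι (M ℕ.+ M)
  half t = ≤-trans (∑-mono (λ z → ≤-trans (≤-reflexive (∑-*ʳ ⟦ slot z == t ⟧ (λ z' → ⟦ pair z z' ⟧)))
      (≤-trans (*monoʳ 0≤⟦ slot z == t ⟧ (clash-count z))
      (≤-reflexive (trans (solve 3 (λ a m s → a :* m :* s := (a :* s) :* m) refl ⟦ alive z ⟧ (ι (M ℕ.+ M)) ⟦ slot z == t ⟧)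
          (cong (_* ι (M ℕ.+ M)) (sym (⟦∧⟧ (alive z) (slot z == t)))))))))
    (≤-trans (≤-reflexive (trans (∑-*ʳ (ι (M ℕ.+ M)) (λ z → ⟦ supp t z ⟧)) (cong (_* ι (M ℕ.+ M)) (sym (ι-count (supp t))))))
        (*monoʳ (0≤ι (M ℕ.+ M)) (ι-mono (row≤L t))))

  pair-sym : ∀ z z' → pair z z' ≡ pair z' z
  pair-sym z z' = cong₂ _∧_ (BP.∧-comm (alive z) (alive z')) (clash-sym z z')

  balls : ∀ t → count (λ j → ball j t) ℕ.≤ (L ℕ.* (M ℕ.+ M)) ℕ.+ (L ℕ.* (M ℕ.+ M))
  balls t = ι-cancel (≤-trans (≤-reflexive (trans (ι-count (λ j → ball j t))
      (∑-pairs Q Q (λ z z' → ⟦ pair z z' ∧ touch z z' t ⟧)))) (≤-trans (∑-mono (λ z → ∑-mono (λ z' → pt z z')))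
      (≤-trans (≤-reflexive (trans (∑-cong (λ z → ∑-+ (A z) (B' z))) (∑-+ (λ z → ∑ (A z)) (λ z → ∑ (B' z)))))
          (≤-trans (+-mono-≤ (half t) (≤-trans (≤-reflexive (trans (∑-swap B')
          (∑-cong (λ z' → ∑-cong (λ z → cong (λ b → ⟦ b ⟧ * ⟦ slot z' == t ⟧) (pair-sym z z')))))) (half t)))
        (≤-reflexive (sym (trans (ι-+ (L ℕ.* (M ℕ.+ M)) _) (cong₂ _+_ (ι-* L (M ℕ.+ M)) (ι-* L (M ℕ.+ M))))))))))
    where
    A B' : Fin Q → Fin Q → ℚ
    A z z' = ⟦ pair z z' ⟧ * ⟦ slot z == t ⟧
    B' z z' = ⟦ pair z z' ⟧ * ⟦ slot z' == t ⟧
    pt : ∀ z z' → ⟦ pair z z' ∧ touch z z' t ⟧ ≤ A z z' + B' z z'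
    pt z z' = ≤-trans (≤-reflexive (⟦∧⟧ (pair z z') (touch z z' t)))
        (≤-trans (*mono 0≤⟦ pair z z' ⟧ (⟦∨⟧ (slot z == t) (slot z' == t)))
        (≤-reflexive (ℚP.*-distribˡ-+ ⟦ pair z z' ⟧ ⟦ slot z == t ⟧ ⟦ slot z' == t ⟧)))

  few : ∀ i → count (nb i) ℕ.≤ 2 ℕ.* ((L ℕ.* (M ℕ.+ M)) ℕ.+ (L ℕ.* (M ℕ.+ M)))
  few i = count-compose (ball i) (λ t j → ball j t) 2 _ (ℕP.≤-trans
      (count-mono {P = ball i} {R = touch (fst i) (snd i)} (λ t e → proj₂ (∧-elim {pair (fst i) (snd i)} e)))
      (ℕP.≤-trans (count-∨ (λ t → slot (fst i) == t) (λ t → slot (snd i) == t))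
      (ℕP.≤-reflexive (cong₂ ℕ._+_ (count-single (slot (fst i))) (count-single (slot (snd i))))))) balls

  apart : ∀ i j → nb i j ≡ false → ∀ t → ball i t ≡ true → ball j t ≡ true → ⊥
  apart i j n t a b = true≢false (anyF-intro t (∧-intro a b)) n

  d : ℕ
  d = 2 ℕ.* ((L ℕ.* (M ℕ.+ M)) ℕ.+ (L ℕ.* (M ℕ.+ M)))

  4pp = (p * p + p * p) + (p * p + p * p)

  d≡ : ι d ≡ lit 8 * ι L * ι M
  d≡ = trans (ι-* 2 _) (trans (cong₂ _*_ (ι-def 2) (trans (ι-+ (L ℕ.* (M ℕ.+ M)) _)
      (cong (λ z → z + z) (trans (ι-* L (M ℕ.+ M)) (cong (ι L *_) (ι-+ M M))))))
     (solve 2 (λ l m → con (lit 2) :* (l :* (m :+ m) :+ l :* (m :+ m)) := con (lit 8) :* l :* m) refl (ι L) (ι M)))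

  4ppd≤1 : 4pp * ι d ≤ 1ℚ
  4ppd≤1 = *cancel 0<L (≤-trans (≤-reflexive (trans (cong (λ z → ι L * (4pp * z)) d≡)
      (trans (solve 3 (λ p l m → l :* (((p :* p :+ p :* p) :+ (p :* p :+ p :* p)) :* (con (lit 8) :* l :* m)) := (l :* p) :*
      (l :* p) :* (con (lit 32) :* m)) refl p (ι L) (ι M))
      (trans (cong (λ z → z * z * (lit 32 * ι M)) Lp) (solve 1
          (λ m → con 1ℚ :* con 1ℚ :* (con (lit 32) :* m) := con (lit 32) :* m) refl (ι M))))))
    (≤-trans (≤-reflexive (trans (cong (_* ι M) (sym (ι-def 32))) (sym (ι-* 32 M))))
        (≤-trans (ι-mono thin) (≤-reflexive (sym (ℚP.*-identityʳ (ι L)))))))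

  4pp<1 : 4pp < 1ℚ
  4pp<1 = ℚP.*-cancelʳ-<-nonNeg (ι L * ι L) {{ℚ.nonNegative (0≤* (0≤ι L) (0≤ι L))}}
      (≤-<-trans (≤-reflexive (trans (solve 2 (λ p l → ((p :* p :+ p :* p) :+ (p :* p :+ p :* p)) :* (l :* l) := con (lit 4) :*
      ((l :* p) :* (l :* p))) refl p (ι L)) (trans (cong (λ z → lit 4 * (z * z)) Lp) (sym (ι-def 4)))))
     (<-≤-trans (ι-mono-< (ℕP.m≤m+n 5 (32 ℕ.* 32 ℕ.∸ 5))) (≤-trans
         (≤-trans (ι-mono (ℕP.*-mono-≤ nonempty nonempty)) (≤-reflexive (ι-* L L)))
         (≤-reflexive (sym (ℚP.*-identityˡ (ι L * ι L)))))))

  ok : Fin K → Maybe (Fin Q) → Bool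
  ok s nothing = false
  ok s (just z) = supp s z

  -- Every open slot picks a candidate of its list. This has probability one because a list has
  -- exactly L members of weight 1/L, but outcomes of probability zero must be excluded explicitly.
  full : Ω → Bool
  full ω = not (anyF (λ s → isOpen (sel s) ∧ not (ok s (ω s))))

  null-slot : ∀ s → 𝔼 (P s) (λ b → ⟦ isOpen (sel s) ∧ not (ok s b) ⟧) ≤ 0ℚ
  null-slot s = go (sel s) refl
    where
    go : ∀ v → sel s ≡ v → 𝔼 (P s) (λ b → ⟦ isOpen v ∧ not (ok s b) ⟧) ≤ 0ℚ
    go (just y) e = ≤-reflexive (𝔼-0 (P s))
    go nothing e = ≤-reflexive (trans (cong₂ _+_ (trans (cong (λ z → (1ℚ - z) * 1ℚ) (open-sum s e)) refl)
        (trans (∑-cong (λ z → h (supp s z))) (∑-0 {Q}))) refl)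
      where
      h : ∀ b → ⟦ b ⟧ * p * ⟦ not b ⟧ ≡ 0ℚ
      h true = ℚP.*-zeroʳ (1ℚ * p)
      h false = trans (cong (_* 1ℚ) (ℚP.*-zeroˡ p)) refl

  null : E P (λ ω → ⟦ not (full ω) ⟧) ≤ 0ℚ
  null = ≤-trans (𝔼-mono (prodExp P) (λ ω → ≤-trans (≤-reflexive
      (cong ⟦_⟧ (not-not (anyF (λ s → isOpen (sel s) ∧ not (ok s (ω s))))))) (⟦anyF⟧ (λ s → isOpen (sel s) ∧ not (ok s (ω s))))))
     (≤-trans (≤-reflexive (trans (𝔼-∑ (prodExp P) (λ s ω → ⟦ isOpen (sel s) ∧ not (ok s (ω s)) ⟧))
         (∑-cong (λ s → E-single P s (λ b → ⟦ isOpen (sel s) ∧ not (ok s b) ⟧)))))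
         (≤-trans (∑-mono null-slot) (≤-reflexive (∑-0 {K}))))

  module LL = LocalLemma P bad ball dep nb apart (p * p) (ι d) (0≤* 0≤p 0≤p) rare (λ i → ι-mono (few i)) 4pp<1 4ppd≤1

  result : Σ Ω λ ω → full ω ≡ true × (∀ i → bad i ω ≡ false)
  result = LL.avoid full null

  data Final (ω : Ω) (s : Fin K) (y : Fin Q) : Set where
    old : sel s ≡ just y → Final ω s y
    new : ω s ≡ just y → alive y ≡ true → slot y ≡ s → Final ω s y

  final : ∀ ω → full ω ≡ true → ∀ s → Σ (Fin Q) (Final ω s)
  final ω f s = go (sel s) (ω s) refl refl
    where
    go : ∀ v b → sel s ≡ v → ω s ≡ b → Σ (Fin Q) (Final ω s)
    go (just y) b e q = y , old e
    go nothing b e q = go₂ b q (oks (ok s b) refl)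
      where
      oks : ∀ v → ok s b ≡ v → ok s b ≡ true
      oks true h = h
      oks false h = ⊥-elim (true≢false (∧-intro (cong isOpen e) (not-false (trans (cong (ok s) q) h))) (anyF-none (not-true f) s))
      go₂ : ∀ b → ω s ≡ b → ok s b ≡ true → Σ (Fin Q) (Final ω s)
      go₂ (just z) q h = z , new q (proj₁ (∧-elim h)) (==→≡ (proj₂ (∧-elim {alive z} h)))

  selection : ∀ ω → full ω ≡ true → (∀ i → bad i ω ≡ false) → Σ (Fin K → Fin Q) λ f → (∀ s → slot (f s) ≡ s) ×
      (∀ τ s s' → r τ (f s) (f s') ≡ false)
  selection ω fu nobad = f , (λ s → slotF s (f s) (Fin-f s)) , (λ τ s s' → free τ s s' (f s) (f s') (Fin-f s) (Fin-f s'))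
    where
    f : Fin K → Fin Q
    f s = proj₁ (final ω fu s)
    Fin-f : ∀ s → Final ω s (f s)
    Fin-f s = proj₂ (final ω fu s)
    slotF : ∀ s y → Final ω s y → slot y ≡ s
    slotF s y (old e) = sel-slot s y e
    slotF s y (new _ _ e) = e
    clash-r : ∀ τ z z' → r τ z z' ≡ true → clash z z' ≡ true
    clash-r true z z' h = ∨-left h
    clash-r false z z' h = ∨-right {r true z z'} h
    is-true : ∀ z s → ω s ≡ just z → is z (ω s) ≡ true
    is-true z s e = trans (cong (is z) e) (==-refl z)
    free : ∀ τ s s' y y' → Final ω s y → Final ω s' y' → r τ y y' ≡ false
    free τ s s' y y' (old e) (old e') = sel-free s s' y y' τ e e'
    free τ s s' y y' (old e) (new _ a _) = sel-alive s y y' τ e a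
    free τ s s' y y' (new _ a _) (old e') = trans (r-sym τ y y') (sel-alive s' y' y τ e' a)
    free τ s s' y y' (new q a sy) (new q' a' sy') = ¬true λ h → true≢false (evil h) (nobad (F.combine y y'))
      where
      evil : r τ y y' ≡ true → bad (F.combine y y') ω ≡ true
      evil h = trans (cong (λ w → pair (proj₁ w) (proj₂ w) ∧ both (proj₁ w) (proj₂ w) ω) (FP.remQuot-combine y y'))
         (∧-intro (∧-intro (∧-intro a a') (clash-r τ y y' h))
             (∧-intro (is-true y (slot y) (trans (cong ω sy) q)) (is-true y' (slot y') (trans (cong ω sy') q'))))

  complete : Σ (Fin K → Fin Q) λ f → (∀ s → slot (f s) ≡ s) × (∀ τ s s' → r τ (f s) (f s') ≡ false)
  complete = selection (proj₁ result) (proj₁ (proj₂ result)) (proj₂ (proj₂ result))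

-- Balanced multipartite graphs on Fin k × Fin n

record Balanced (k n : ℕ) : Set where
  field
    adj : Fin k → Fin n → Fin k → Fin n → Bool
    adj-sym : ∀ i x j y → adj i x j y ≡ adj j y i x
    adj-part : ∀ i x y → adj i x i y ≡ false

  deg : Fin k → Fin n → ℕ
  deg i x = sumN (λ j → count (adj i x j))

  codeg : Fin k → Fin n → Fin k → ℕ
  codeg i x j = count (adj i x j)

record Transversals {k n} (H : Balanced k n) (m : ℕ) : Set where
  open Balanced H
  field
    pos : Fin m → Fin k → Fin n
    indep-T : ∀ a i j → adj i (pos a i) j (pos a j) ≡ false
    disjoint : ∀ a b i → pos a i ≡ pos b i → a ≡ b

sumN-const : ∀ {n} c → sumN {n} (λ _ → c) ≡ n ℕ.* c
sumN-const {zero} c = refl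
sumN-const {suc n} c = cong (c ℕ.+_) (sumN-const {n} c)

sumN-mono : ∀ {n} {f g : Fin n → ℕ} → (∀ i → f i ℕ.≤ g i) → sumN f ℕ.≤ sumN g
sumN-mono {zero} h = z≤n
sumN-mono {suc n} h = ℕP.+-mono-≤ (h zero) (sumN-mono (λ i → h (suc i)))

module Nearness {k n : ℕ} (H : Balanced k n) (deg≤n : ∀ i x → Balanced.deg H i x ℕ.≤ n) where
  open Balanced H

  touch : Fin k → Fin k → Bool
  touch i j = anyF (λ x → anyF (λ y → adj i x j y))
  near : Fin k → Fin k → Bool
  near i j = (i == j) ∨ touch i j

  near-adj : ∀ {i x j y} → adj i x j y ≡ true → near i j ≡ true
  near-adj {i} {x} {j} {y} e = ∨-right {i == j} (anyF-intro {P = λ u → anyF (λ w → adj i u j w)} x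
      (anyF-intro {P = λ w → adj i x j w} y e))

  near-sym : ∀ i j → near i j ≡ near j i
  near-sym i j = cong₂ _∨_ (==-sym i j) (bool-eq (touch-flip i j) (touch-flip j i))
    where
    bool-eq : ∀ {a b} → (a ≡ true → b ≡ true) → (b ≡ true → a ≡ true) → a ≡ b
    bool-eq {true} f h = sym (f refl)
    bool-eq {false} {true} f h = h refl
    bool-eq {false} {false} f h = refl
    touch-flip : ∀ i j → touch i j ≡ true → touch j i ≡ true
    touch-flip i j e with anyF-witness {P = λ x → anyF (λ y → adj i x j y)} e
    ... | x , e' with anyF-witness {P = λ y → adj i x j y} e'
    ... | y , q = anyF-intro {P = λ y → anyF (λ x → adj j y i x)} y
        (anyF-intro {P = λ x → adj j y i x} x (trans (adj-sym j y i x) q))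

  -- A part has n vertices of degree at most n, so it touches at most n² others however many there
  -- are. This is how the number of parts disappears from all estimates.
  near-count : ∀ i → count (near i) ℕ.≤ suc (n ℕ.* n)
  near-count i = ℕP.≤-trans (count-∨ (i ==_) (touch i)) (ℕP.+-mono-≤ (ℕP.≤-reflexive (count-single i))
      (ℕP.≤-trans (count-any (λ x j → anyF (λ y → adj i x j y)))
     (ℕP.≤-trans (sumN-mono (λ x → ℕP.≤-trans (ι-cancel (≤-trans (≤-reflexive (ι-count (λ j → anyF (λ y → adj i x j y))))
         (≤-trans (∑-mono (λ j → ≤-trans (⟦anyF⟧ (λ y → adj i x j y)) (≤-reflexive (sym (ι-count (adj i x j))))))
         (≤-reflexive (sym (ι-sumN (λ j → count (adj i x j)))))))) (deg≤n i x))) (ℕP.≤-reflexive (sumN-const {n} n)))))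

module Colouring {k n : ℕ} (H : Balanced k n) (m ℓ : ℕ) (1≤ℓ : 1 ℕ.≤ ℓ) (1≤n : 1 ℕ.≤ n) (m≤n : m ℕ.≤ n)
  (deg≤n : ∀ i x → Balanced.deg H i x ℕ.≤ n) (codeg≤ℓ : ∀ i x j → Balanced.codeg H i x j ℕ.≤ ℓ) where
  open Balanced H
  open Nearness H deg≤n

  K Q : ℕ
  K = k ℕ.* m
  Q = (k ℕ.* n) ℕ.* m

  vtx : Fin Q → Fin (k ℕ.* n)
  vtx q = proj₁ (F.remQuot {k ℕ.* n} m q)
  col : Fin Q → Fin m
  col q = proj₂ (F.remQuot {k ℕ.* n} m q)
  prt : Fin Q → Fin k
  prt q = proj₁ (F.remQuot {k} n (vtx q))
  pos : Fin Q → Fin n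
  pos q = proj₂ (F.remQuot {k} n (vtx q))

  ∑-cands : (f : Fin k → Fin n → Fin m → ℚ) → ∑ (λ q → f (prt q) (pos q) (col q)) ≡ ∑ (λ i → ∑ (λ x → ∑ (λ a → f i x a)))
  ∑-cands f = trans (∑-pairs (k ℕ.* n) m (λ v a → f (proj₁ (F.remQuot {k} n v)) (proj₂ (F.remQuot {k} n v)) a))
     (∑-pairs k n (λ i x → ∑ (λ a → f i x a)))

  vtx≡ : ∀ q → F.combine {k} {n} (prt q) (pos q) ≡ vtx q
  vtx≡ q = FP.combine-remQuot {k} n (vtx q)

  slotOf : Fin k → Fin m → Fin K
  slotOf i a = F.combine {k} {m} i a
  slot : Fin Q → Fin K
  slot q = slotOf (prt q) (col q)
  gt : Fin K → Fin k
  gt s = proj₁ (F.remQuot {k} m s)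
  gf : Fin K → Fin m
  gf s = proj₂ (F.remQuot {k} m s)
  gt-slot : ∀ i a → gt (slotOf i a) ≡ i
  gt-slot i a = cong proj₁ (FP.remQuot-combine {k} {m} i a)
  gf-slot : ∀ i a → gf (slotOf i a) ≡ a
  gf-slot i a = cong proj₂ (FP.remQuot-combine {k} {m} i a)

  slot-test : ∀ i a s → (slotOf i a == s) ≡ (i == gt s) ∧ (a == gf s)
  slot-test i a s with i ≟ gt s | a ≟ gf s
  ... | yes refl | yes refl = trans (cong (_== s) (FP.combine-remQuot {k} m s)) (==-refl s)
  ... | yes _ | no ne = ==-false {i = slotOf i a} {s} (λ e → ne (trans (sym (gf-slot i a)) (cong gf e)))
  ... | no ne | _ = ==-false {i = slotOf i a} {s} (λ e → ne (trans (sym (gt-slot i a)) (cong gt e)))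

  -- Equal colours are excluded in the vertex conflict because a candidate must not conflict with
  -- itself, as `r-slot` demands.
  r : Bool → Fin Q → Fin Q → Bool
  r true q q' = (col q == col q') ∧ adj (prt q) (pos q) (prt q') (pos q')
  r false q q' = (vtx q == vtx q') ∧ not (col q == col q')

  G : Bool → ℕ
  G true = k
  G false = m
  g : (τ : Bool) → Fin K → Fin (G τ)
  g true = gt
  g false = gf

  r-sym : ∀ τ x y → r τ x y ≡ r τ y x
  r-sym true x y = cong₂ _∧_ (==-sym (col x) (col y)) (adj-sym (prt x) (pos x) (prt y) (pos y))
  r-sym false x y = cong₂ (λ a b → a ∧ not b) (==-sym (vtx x) (vtx y)) (==-sym (col x) (col y))

  adj-differ : ∀ {i x j y} → adj i x j y ≡ true → i ≡ j → ⊥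
  adj-differ {i} {x} {j} {y} e refl = true≢false e (adj-part i x y)

  r-slot : ∀ τ x y → r τ x y ≡ true → slot x ≡ slot y → ⊥
  r-slot true x y e h = adj-differ (proj₂ (∧-elim {col x == col y} e))
      (trans (sym (gt-slot (prt x) (col x))) (trans (cong gt h) (gt-slot (prt y) (col y))))
  r-slot false x y e h = true≢false (trans (cong (_== col y)
      (trans (sym (gf-slot (prt x) (col x))) (trans (cong gf h) (gf-slot (prt y) (col y))))) (==-refl (col y)))
      (not-true (proj₂ (∧-elim {vtx x == vtx y} e)))

  prt-eq : ∀ x y → vtx x ≡ vtx y → prt x ≡ prt y
  prt-eq x y e = cong (λ v → proj₁ (F.remQuot {k} n v)) e

  r-pres : ∀ τ x y → r τ x y ≡ true → g (not τ) (slot x) ≡ g (not τ) (slot y)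
  r-pres true x y e = trans (gf-slot (prt x) (col x)) (trans (==→≡ (proj₁ (∧-elim e))) (sym (gf-slot (prt y) (col y))))
  r-pres false x y e = trans (gt-slot (prt x) (col x)) (trans (prt-eq x y (==→≡ (proj₁ (∧-elim e))))
      (sym (gt-slot (prt y) (col y))))

  near-r : ∀ τ x y → r τ x y ≡ true → near (g true (slot x)) (g true (slot y)) ≡ true
  near-r true x y e = subst₂ (λ i j → near i j ≡ true) (sym (gt-slot (prt x) (col x))) (sym (gt-slot (prt y) (col y)))
      (near-adj (proj₂ (∧-elim {col x == col y} e)))
  near-r false x y e = ∨-left (trans (cong (_== gt (slot y)) (r-pres false x y e)) (==-refl (gt (slot y))))

  D E₀ : ℕ
  D = suc (n ℕ.* n)
  E₀ = n ℕ.* n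

  slots-count : ∀ i → count (λ s → gt s == i) ℕ.≤ E₀
  slots-count i = ι-cancel (≤-trans (≤-reflexive (trans (ι-count (λ s → gt s == i))
      (trans (∑-pairs k m (λ j a → ⟦ j == i ⟧)) (trans (∑-cong
      (λ j → trans (∑-const {m} ⟦ j == i ⟧) (trans (ℚP.*-comm (ι m) ⟦ j == i ⟧) (cong (λ b → ⟦ b ⟧ * ι m) (==-sym j i)))))
      (∑-single i (λ _ → ι m))))))
     (ι-mono (ℕP.≤-trans m≤n (ℕP.≤-trans (ℕP.≤-reflexive (sym (ℕP.*-identityʳ n))) (ℕP.*-monoʳ-≤ n 1≤n)))))

  cands-count : ∀ i → count (λ q → gt (slot q) == i) ℕ.≤ E₀
  cands-count i = ι-cancel (≤-trans (≤-reflexive (trans (ι-count (λ q → gt (slot q) == i))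
      (trans (∑-cong (λ q → cong (λ j → ⟦ j == i ⟧) (gt-slot (prt q) (col q)))) (trans (∑-cands (λ j x a → ⟦ j == i ⟧))
     (trans (∑-cong (λ j → trans (∑-cong {n} (λ x → ∑-const {m} ⟦ j == i ⟧))
         (trans (∑-const {n} (ι m * ⟦ j == i ⟧)) (trans (solve 3 (λ n m b → n :* (m :* b) := b :* (n :* m)) refl (ι n)
         (ι m) ⟦ j == i ⟧) (cong (λ b → ⟦ b ⟧ * (ι n * ι m)) (==-sym j i)))))) (∑-single i (λ _ → ι n * ι m)))))))
     (≤-trans (≤-reflexive (sym (ι-* n m))) (ι-mono (ℕP.*-monoʳ-≤ n m≤n))))

  edge-sum : ∀ q (w : Fin k → ℚ) → ∑ (λ q' → ⟦ r true q q' ⟧ * w (prt q')) ≡ ∑ (λ i → ι (codeg (prt q) (pos q) i) * w i)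
  edge-sum q w = trans (∑-cands (λ j y a → ⟦ (col q == a) ∧ adj (prt q) (pos q) j y ⟧ * w j))
      (∑-cong (λ j → trans (∑-cong (λ y → trans (∑-cong (λ a → trans (cong (_* w j) (⟦∧⟧ (col q == a) (adj (prt q) (pos q) j y)))
      (ℚP.*-assoc ⟦ col q == a ⟧ ⟦ adj (prt q) (pos q) j y ⟧ (w j))))
      (∑-single (col q) (λ _ → ⟦ adj (prt q) (pos q) j y ⟧ * w j))))
          (trans (∑-*ʳ (w j) (λ y → ⟦ adj (prt q) (pos q) j y ⟧)) (cong (_* w j) (sym (ι-count (adj (prt q) (pos q) j)))))))

  local : ∀ τ x i → count (λ y → r τ x y ∧ (g τ (slot y) == i)) ℕ.≤ ℓ
  local true x i = ι-cancel (≤-trans (≤-reflexive (trans (ι-count (λ y → r true x y ∧ (gt (slot y) == i)))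
      (trans (∑-cong (λ y → trans (⟦∧⟧ (r true x y) (gt (slot y) == i))
      (cong (λ j → ⟦ r true x y ⟧ * ⟦ j ⟧) (trans (cong (_== i) (gt-slot (prt y) (col y))) (==-sym (prt y) i)))))
      (trans (edge-sum x (λ j → ⟦ i == j ⟧)) (trans (∑-cong (λ j → ℚP.*-comm (ι (codeg (prt x) (pos x) j)) ⟦ i == j ⟧))
          (∑-single i (λ j → ι (codeg (prt x) (pos x) j))))))) ) (ι-mono (codeg≤ℓ (prt x) (pos x) i)))
  local false x i = ℕP.≤-trans (ι-cancel (≤-trans (≤-reflexive (ι-count (λ y → r false x y ∧ (gf (slot y) == i))))
      (≤-trans (∑-mono (λ y → pt y)) (≤-reflexive (trans (∑-pairs (k ℕ.* n) m (λ v a → ⟦ vtx x == v ⟧ * ⟦ i == a ⟧))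
      (trans (∑-cong (λ v → trans (∑-* ⟦ vtx x == v ⟧ (λ a → ⟦ i == a ⟧)) (cong (⟦ vtx x == v ⟧ *_) one)))
      (trans (∑-single (vtx x) (λ _ → 1ℚ)) (sym ι-1))))))) ) 1≤ℓ
    where
    one : ∑ (λ a → ⟦ i == a ⟧) ≡ 1ℚ
    one = trans (sym (ι-count (i ==_))) (trans (cong ι (count-single i)) ι-1)
    pt : ∀ y → ⟦ r false x y ∧ (gf (slot y) == i) ⟧ ≤ ⟦ vtx x == vtx y ⟧ * ⟦ i == col y ⟧
    pt y = ≤-trans (⟦⟧-mono {b = (vtx x == vtx y) ∧ (i == col y)}
        (λ e → ∧-intro (proj₁ (∧-elim (proj₁ (∧-elim {r false x y} e))))
        (trans (==-sym i (col y)) (trans (cong (_== i) (sym (gf-slot (prt y) (col y)))) (proj₂ (∧-elim {r false x y} e))))))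
        (≤-reflexive (⟦∧⟧ (vtx x == vtx y) (i == col y)))

  system : System ℓ D E₀
  system = record { K = K ; Q = Q ; slot = slot ; r = r ; G = G ; g = g ; near = near ; r-sym = r-sym ; r-slot = r-slot ; r-pres =
      r-pres ; local = local
    ; near-refl = λ i → ∨-left (==-refl i) ; near-sym = near-sym ; near-r = near-r ; near-count = near-count ; slots-count =
        slots-count ; cands-count = cands-count }

  -- A candidate conflicts through its vertex with at most one candidate per colour. The same M thus
  -- bounds both kinds of degree as soon as it bounds the graph degrees and the number m of colours.
  initial : ∀ M → m ℕ.≤ M → (∀ i x → deg i x ℕ.≤ M) → State system n M
  initial M m≤M deg≤M = record { sel = λ _ → nothing ; alive = λ _ → true ; sel-slot = λ s y () ; sel-free = λ s s' y y' τ
      () ; sel-alive = λ s y z τ () ; alive-open = λ z _ → refl ; rows = λ s _ → rows s ; degs = λ τ x _ → degs τ x }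
    where
    rows : ∀ s → count (λ z → slot z == s) ≡ n
    rows s = ι-inj (trans (ι-count (λ z → slot z == s)) (trans
        (∑-cong (λ z → trans (cong ⟦_⟧ (trans (slot-test (prt z) (col z) s)
        (cong₂ _∧_ (==-sym (prt z) (gt s)) (==-sym (col z) (gf s))))) (⟦∧⟧ (gt s == prt z) (gf s == col z))))
        (trans (∑-cands (λ i x a → ⟦ gt s == i ⟧ * ⟦ gf s == a ⟧))
       (trans (∑-cong (λ i → trans (∑-cong {n} (λ x → trans (∑-* ⟦ gt s == i ⟧ (λ a → ⟦ gf s == a ⟧))
           (cong (⟦ gt s == i ⟧ *_) (trans (sym (ι-count (gf s ==_))) (trans (cong ι (count-single (gf s))) ι-1)))))
           (trans (∑-const {n} (⟦ gt s == i ⟧ * 1ℚ)) (solve 2 (λ n b → n :* (b :* con 1ℚ) := b :* n) refl (ι n) ⟦ gt s == i ⟧))))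
           (∑-single (gt s) (λ _ → ι n))))))
    degs : ∀ τ x → count (λ z → r τ z x) ℕ.≤ M
    degs true x = ι-cancel (≤-trans (≤-reflexive (trans (ι-count (λ z → r true z x))
        (trans (∑-cong (λ z → trans (cong ⟦_⟧ (r-sym true z x)) (sym (ℚP.*-identityʳ ⟦ r true x z ⟧))))
        (trans (edge-sum x (λ _ → 1ℚ)) (trans (∑-cong (λ j → ℚP.*-identityʳ (ι (codeg (prt x) (pos x) j))))
        (sym (ι-sumN (codeg (prt x) (pos x)))))))) ) (ι-mono (deg≤M (prt x) (pos x))))
    degs false x = ℕP.≤-trans (ι-cancel (≤-trans (≤-reflexive (ι-count (λ z → r false z x)))
        (≤-trans (∑-mono (λ z → ⟦⟧-mono {b = vtx x == vtx z} (λ e → trans (==-sym (vtx x) (vtx z)) (proj₁ (∧-elim e)))))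
        (≤-reflexive (trans (∑-pairs (k ℕ.* n) m (λ v a → ⟦ vtx x == v ⟧))
        (trans (∑-cong (λ v → trans (∑-const {m} ⟦ vtx x == v ⟧) (ℚP.*-comm (ι m) ⟦ vtx x == v ⟧)))
        (∑-single (vtx x) (λ _ → ι m)))))))) m≤M

  transversals : (Σ (Fin K → Fin Q) λ f → (∀ s → slot (f s) ≡ s) × (∀ τ s s' → r τ (f s) (f s') ≡ false)) → Transversals H m
  transversals (f , slot-f , free) = record { pos = T ; indep-T = λ a i j → ¬true (conflict a i j) ; disjoint = distinct }
    where
    c : Fin m → Fin k → Fin Q
    c a i = f (slotOf i a)
    T : Fin m → Fin k → Fin n
    T a i = pos (c a i)
    prt-c : ∀ a i → prt (c a i) ≡ i
    prt-c a i = trans (sym (gt-slot (prt (c a i)) (col (c a i)))) (trans (cong gt (slot-f (slotOf i a))) (gt-slot i a))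
    col-c : ∀ a i → col (c a i) ≡ a
    col-c a i = trans (sym (gf-slot (prt (c a i)) (col (c a i)))) (trans (cong gf (slot-f (slotOf i a))) (gf-slot i a))
    conflict : ∀ a i j → adj i (T a i) j (T a j) ≡ true → ⊥
    conflict a i j e = true≢false (∧-intro (trans (cong₂ _==_ (col-c a i) (col-c a j)) (==-refl a))
        (trans (cong₂ (λ i' j' → adj i' (T a i) j' (T a j)) (prt-c a i) (prt-c a j)) e)) (free true (slotOf i a) (slotOf j a))
    distinct : ∀ a b i → T a i ≡ T b i → a ≡ b
    distinct a b i e with a ≟ b
    ... | yes q = q
    ... | no ne = ⊥-elim (true≢false (∧-intro (trans (cong (_== vtx (c b i)) same) (==-refl (vtx (c b i))))
        (not-false (trans (cong₂ _==_ (col-c a i) (col-c b i)) (==-false ne)))) (free false (slotOf i a) (slotOf i b)))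
      where
      same : vtx (c a i) ≡ vtx (c b i)
      same = trans (sym (vtx≡ (c a i))) (trans (cong₂ (F.combine {k} {n}) (trans (prt-c a i) (sym (prt-c b i))) e) (vtx≡ (c b i)))

  by-nibble : ∀ e M → 1 ℕ.≤ e → (2≤a : 2 ℕ.≤ aₑ e) → ∀ m₀ → aₑ e ℕ.≤ m₀ → ι (suc (20 ℕ.* E₀ ℕ.* ((D ℕ.* D) ℕ.* (D ℕ.* D)))) ≤ pow
      (Moment.y (aₑ e) ℓ 2≤a 1≤ℓ) m₀ →
    2 ℕ.^ rounds e ℕ.* (32 ℕ.* m₀) ℕ.≤ n → m ℕ.≤ M → (∀ i x → deg i x ℕ.≤ M) → ι e * ι M ≤ (ι e - 1ℚ) * ι n → Transversals H m
  by-nibble e M 1≤e 2≤a m₀ a≤m₀ big large m≤M deg≤M ratio = transversals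
      (Finish.complete system (Iterate.thinned system e 1≤e 1≤ℓ (s≤s z≤n) 2≤a m₀ a≤m₀ big n M (initial M m≤M deg≤M) ratio large))

-- Halving

½ : ℚ
½ = ℚ.½


0<½ : 0ℚ < ½
0<½ = pos-factor {1ℚ + 1ℚ} (0≤+ 0≤1 0≤1) (subst (0ℚ <_) (sym
    (trans (ℚP.*-distribʳ-+ ½ 1ℚ 1ℚ) (cong₂ _+_ (ℚP.*-identityˡ ½) (ℚP.*-identityˡ ½)))) 0<1)

fair : Exp Bool
fair = record
  { 𝔼 = λ f → ½ * (f true + f false)
  ; 𝔼-mono = λ h → *mono (<⇒≤ 0<½) (+-mono-≤ (h true) (h false))
  ; 𝔼-lin = λ c f g → solve 6 (λ h c a b x y → h :* (c :* a :+ x :+ (c :* b :+ y)) := c :* (h :* (a :+ b)) :+ h :* (x :+ y)) refl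
      ½ c (f true) (f false) (g true) (g false)
  ; 𝔼-1 = refl
  ; wit = λ {f} p → [ (λ q → true , q) , (λ q → false , q) ]′ (pos-summand {f true} {f false} (pos-factor {½} (<⇒≤ 0<½) p)) }

restrict : ∀ {k n h} → Balanced k n → (Fin k → Fin h → Fin n) → Balanced k h
restrict H φ = record { adj = λ i x j y → adj i (φ i x) j (φ j y) ; adj-sym = λ i x j y → adj-sym i (φ i x) j
    (φ j y) ; adj-part = λ i x y → adj-part i (φ i x) (φ i y) }
  where open Balanced H

-- Both halves are read off the same coin: whatever b is, the two values of σ receive the two
-- members of the pair formed by y on the left and y on the right.
choose : ∀ h → Bool → Bool → Fin h → Fin (h ℕ.+ h)
choose h σ b y = if (if σ then b else not b) then y F.↑ˡ h else h F.↑ʳ y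

choose-index : ∀ h σ b y → [ (λ z → z) , (λ z → z) ]′ (F.splitAt h (choose h σ b y)) ≡ y
choose-index h true true y = cong [ (λ z → z) , (λ z → z) ]′ (FP.splitAt-↑ˡ h y h)
choose-index h true false y = cong [ (λ z → z) , (λ z → z) ]′ (FP.splitAt-↑ʳ h h y)
choose-index h false true y = cong [ (λ z → z) , (λ z → z) ]′ (FP.splitAt-↑ʳ h h y)
choose-index h false false y = cong [ (λ z → z) , (λ z → z) ]′ (FP.splitAt-↑ˡ h y h)

choose-inj : ∀ h {σ σ'} (β : Fin h → Bool) {y y'} → choose h σ (β y) y ≡ choose h σ' (β y') y' → y ≡ y' × σ ≡ σ'
choose-inj h {σ} {σ'} β {y} {y'} e = same , cmp σ σ' (β y') (trans (cong (λ w → choose h σ (β w) w) (sym same)) e)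
  where
  same : y ≡ y'
  same = trans (sym (choose-index h σ (β y) y)) (trans (cong (λ w → [ (λ z → z) , (λ z → z) ]′ (F.splitAt h w)) e)
      (choose-index h σ' (β y') y'))
  lr : ∀ {w} → w F.↑ˡ h ≡ h F.↑ʳ w → ⊥
  lr {w} q with trans (sym (FP.splitAt-↑ˡ h w h)) (trans (cong (F.splitAt h) q) (FP.splitAt-↑ʳ h h w))
  ... | ()
  cmp : ∀ σ σ' b → choose h σ b y' ≡ choose h σ' b y' → σ ≡ σ'
  cmp true true b q = refl
  cmp false false b q = refl
  cmp true false true q = ⊥-elim (lr q)
  cmp true false false q = ⊥-elim (lr (sym q))
  cmp false true true q = ⊥-elim (lr (sym q))
  cmp false true false q = ⊥-elim (lr q)

-- A record rather than a synonym, so that conversion compares n, a, M and never unfolds the polynomial.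
record LocalCondition (n a M : ℕ) : Set where
  field
    local-condition : ∀ 2≤a → ι (suc (8 ℕ.* (n ℕ.* suc n) ℕ.* (suc (n ℕ.* n) ℕ.* suc (n ℕ.* n)))) ≤ pow
        (Moment.y a 1 2≤a (s≤s z≤n)) M

module Halving {k h : ℕ} (H : Balanced k (h ℕ.+ h)) (A M A' M' g : ℕ) (3≤g : 3 ℕ.≤ g)
  (deg≤A : ∀ i x → Balanced.deg H i x ℕ.≤ A) (codeg≤M : ∀ i x j → Balanced.codeg H i x j ℕ.≤ M) (A≤n : A ℕ.≤ h ℕ.+ h)
      (M≤A : M ℕ.≤ A)
  (reachA : suc (g ℕ.+ 4) ℕ.* A ℕ.≤ (2 ℕ.* g) ℕ.* suc A') (reachM : suc (g ℕ.+ 4) ℕ.* M ℕ.≤ (2 ℕ.* g) ℕ.* suc M') where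
  open Balanced H
  n : ℕ
  n = h ℕ.+ h
  open Nearness H (λ i x → ℕP.≤-trans (deg≤A i x) A≤n)

  -- For probability one half and exponent a = 2 g, the recipe b = q a + 4 of `pays-ceil` gives g +
  -- 4. The tail condition then allows the halved bound to exceed half of the old one by a factor of
  -- about 1 + 5/g.
  a b : ℕ
  a = 2 ℕ.* g
  b = g ℕ.+ 4
  6≤a : 6 ℕ.≤ a
  6≤a = ℕP.*-monoʳ-≤ 2 3≤g
  2≤a : 2 ℕ.≤ a
  2≤a = ℕP.≤-trans (ℕP.m≤m+n 2 4) 6≤a
  open Moment a 1 2≤a (s≤s z≤n) using (Pays; y; 1≤y; C; group-tail)

  payment : Pays b ½
  payment = pays-ceil (ι a) ½ (ι b) (subst (_≤ ι a) (ι-def 5) (ι-mono (ℕP.≤-trans (ℕP.m≤m+n 5 1) 6≤a))) (<⇒≤ 0<½)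
      (le-by ½ (<⇒≤ 0<½) refl)
    (≤-reflexive (sym (trans (ι-+ g 4) (cong₂ _+_ (trans (sym (ℚP.*-identityˡ (ι g)))
        (trans (cong (_* ι g) (sym ½*2)) (trans (ℚP.*-assoc ½ (ι 2) (ι g)) (cong (½ *_) (sym (ι-* 2 g)))))) (ι-def 4)))))
    where
    ½*2 : ½ * ι 2 ≡ 1ℚ
    ½*2 = trans (cong (½ *_) (ι-def 2)) refl

  V : ℕ
  V = k ℕ.* h
  prt : Fin V → Fin k
  prt t = proj₁ (F.remQuot {k} h t)
  idx : Fin V → Fin h
  idx t = proj₂ (F.remQuot {k} h t)
  var : Fin k → Fin h → Fin V
  var i y = F.combine {k} {h} i y
  left right : Fin V → Fin n
  left t = idx t F.↑ˡ h
  right t = h F.↑ʳ idx t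

  P : Fin V → Exp Bool
  P t = fair
  Ω : Set
  Ω = Fin V → Bool

  -- W selects the parts in which neighbours are counted: all parts for the degree, one part for the
  -- local degree.
  hit : Fin k → Fin n → (Fin k → Bool) → Bool → Fin V → Bool → Bool
  hit i x W σ t β = W (prt t) ∧ adj i x (prt t) (choose h σ β (idx t))

  cnt : Fin k → Fin n → (Fin k → Bool) → Bool → Ω → ℕ
  cnt i x W σ ω = sumN (λ t → if hit i x W σ t (ω t) then 1 else 0)

  ι-if : ∀ v → ι (if v then 1 else 0) ≡ ⟦ v ⟧
  ι-if true = ι-1
  ι-if false = ι-0

  members : Fin k → Fin n → (Fin k → Bool) → Fin (V ℕ.+ V) → Bool
  members i x W e = [ (λ t → W (prt t) ∧ adj i x (prt t) (left t)) , (λ t → W (prt t) ∧ adj i x (prt t) (right t)) ]′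
      (F.splitAt V e)

  push : ∀ {A B C D : Set} (f : C → D) (p : A → C) (q : B → C) v → f ([ p , q ]′ v) ≡ [ (λ x → f (p x)) , (λ x → f (q x)) ]′ v
  push f p q (inj₁ x) = refl
  push f p q (inj₂ x) = refl

  count-halves : ∀ {h'} h (X : Fin (h ℕ.+ h') → Bool) → count X ≡ count (λ y → X (y F.↑ˡ h')) ℕ.+ count (λ y → X (h F.↑ʳ y))
  count-halves zero X = refl
  count-halves (suc h) X = trans (cong ((if X zero then 1 else 0) ℕ.+_) (count-halves h (λ i → X (suc i))))
      (sym (ℕP.+-assoc (if X zero then 1 else 0) _ _))

  count-members : ∀ i x W → ι (count (members i x W)) ≡ ∑ (λ j → ⟦ W j ⟧ * ι (codeg i x j))
  count-members i x W = trans (ι-count (members i x W)) (trans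
      (∑-cong (λ e → push ⟦_⟧ (λ t → W (prt t) ∧ adj i x (prt t) (left t)) (λ t → W (prt t) ∧ adj i x (prt t) (right t))
      (F.splitAt V e)))
     (trans (∑-splitAt V (λ t → ⟦ W (prt t) ∧ adj i x (prt t) (left t) ⟧) (λ t → ⟦ W (prt t) ∧ adj i x (prt t) (right t) ⟧))
         (trans (cong₂ _+_ (∑-pairs k h (λ j y → ⟦ W j ∧ adj i x j (y F.↑ˡ h) ⟧))
         (∑-pairs k h (λ j y → ⟦ W j ∧ adj i x j (h F.↑ʳ y) ⟧)))
       (trans (sym (∑-+ (λ j → ∑ (λ y → ⟦ W j ∧ adj i x j (y F.↑ˡ h) ⟧)) (λ j → ∑ (λ y → ⟦ W j ∧ adj i x j (h F.↑ʳ y) ⟧))))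
           (∑-cong pt)))))
    where
    side : ∀ j (q : Fin h → Fin n) → ∑ (λ y → ⟦ W j ∧ adj i x j (q y) ⟧) ≡ ⟦ W j ⟧ * ι (count (λ y → adj i x j (q y)))
    side j q = trans (∑-cong (λ y → ⟦∧⟧ (W j) (adj i x j (q y))))
        (trans (∑-* ⟦ W j ⟧ (λ y → ⟦ adj i x j (q y) ⟧)) (cong (⟦ W j ⟧ *_) (sym (ι-count (λ y → adj i x j (q y))))))
    pt : ∀ j → ∑ (λ y → ⟦ W j ∧ adj i x j (y F.↑ˡ h) ⟧) + ∑ (λ y → ⟦ W j ∧ adj i x j (h F.↑ʳ y) ⟧) ≡ ⟦ W j ⟧ * ι (codeg i x j)
    pt j = trans (cong₂ _+_ (side j (λ y → y F.↑ˡ h)) (side j (λ y → h F.↑ʳ y)))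
        (trans (sym (ℚP.*-distribˡ-+ ⟦ W j ⟧ _ _)) (cong (⟦ W j ⟧ *_)
        (trans (sym (ι-+ (count (λ y → adj i x j (y F.↑ˡ h))) (count (λ y → adj i x j (h F.↑ʳ y)))))
        (cong ι (sym (count-halves h (adj i x j)))))))

  -- The items are the vertices, two to every coin, and each charges one half to its own coin. A
  -- coin contributes at most one neighbour, as one member of its pair enters the half σ.
  tail : ∀ i x W σ N K → count (members i x W) ℕ.≤ N → suc b ℕ.* N ℕ.≤ a ℕ.* K → E P
      (λ ω → ⟦ K ℕ.≤ᵇ cnt i x W σ ω ⟧) * pow y N ≤ 1ℚ
  tail i x W σ N K N≤ le = group-tail P b ½ N K (<⇒≤ 0<½) (le-by ½ (<⇒≤ 0<½) refl) payment (members i x W) N≤ le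
      (λ t t' → t == t') (λ t ω → if hit i x W σ t (ω t) then 1 else 0)
      (λ t ω ω' e → cong (λ v → ι (if hit i x W σ t v then 1 else 0)) (e t (==-refl t)))
          (λ s s' t p q → trans (==→≡ {i = s} {t} p) (sym (==→≡ {i = s'} {t} q))) (λ t ω → le1 (hit i x W σ t (ω t)))
      ρ ρ≥0 (λ e _ → ≤-reflexive (sums e)) mean
    where
    ρ' : Fin V → Fin V ⊎ Fin V → ℚ
    ρ' t v = [ (λ t' → ⟦ t' == t ⟧ * ½) , (λ t' → ⟦ t' == t ⟧ * ½) ]′ v
    ρ : Fin V → Fin (V ℕ.+ V) → ℚ
    ρ t e = ρ' t (F.splitAt V e)
    ρ≥0 : ∀ t e → 0ℚ ≤ ρ t e
    ρ≥0 t e = go (F.splitAt V e)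
      where
      go : ∀ v → 0ℚ ≤ ρ' t v
      go (inj₁ t') = 0≤* 0≤⟦ t' == t ⟧ (<⇒≤ 0<½)
      go (inj₂ t') = 0≤* 0≤⟦ t' == t ⟧ (<⇒≤ 0<½)
    le1 : ∀ v → (if v then 1 else 0) ℕ.≤ C
    le1 true = s≤s z≤n
    le1 false = z≤n
    sums : ∀ e → ∑ (λ t → ρ t e) ≡ ½
    sums e = go (F.splitAt V e)
      where
      go : ∀ v → ∑ (λ t → ρ' t v) ≡ ½
      go (inj₁ t') = ∑-single t' (λ _ → ½)
      go (inj₂ t') = ∑-single t' (λ _ → ½)
    mean : ∀ t → E P (λ ω → ι (if hit i x W σ t (ω t) then 1 else 0)) ≤ ∑ (λ e → ⟦ members i x W e ⟧ * ρ t e)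
    mean t = ≤-reflexive (trans (E-single P t (λ β → ι (if hit i x W σ t β then 1 else 0))) (trans (lhs σ) (sym rhs)))
      where
      l r : Fin V → ℚ
      l t = ⟦ W (prt t) ∧ adj i x (prt t) (left t) ⟧
      r t = ⟦ W (prt t) ∧ adj i x (prt t) (right t) ⟧
      lhs : ∀ σ → ½ * (ι (if hit i x W σ t true then 1 else 0) + ι (if hit i x W σ t false then 1 else 0)) ≡ l t * ½ + r t * ½
      lhs true = trans (cong (½ *_) (cong₂ _+_ (ι-if (hit i x W true t true)) (ι-if (hit i x W true t false))))
          (solve 3 (λ h a b → h :* (a :+ b) := a :* h :+ b :* h) refl ½ (l t) (r t))
      lhs false = trans (cong (½ *_) (cong₂ _+_ (ι-if (hit i x W false t true)) (ι-if (hit i x W false t false))))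
          (solve 3 (λ h a b → h :* (b :+ a) := a :* h :+ b :* h) refl ½ (l t) (r t))
      one : ∀ (q : Fin V → ℚ) → ∑ (λ t' → q t' * (⟦ t' == t ⟧ * ½)) ≡ q t * ½
      one q = trans (∑-cong (λ t' → trans (cong (λ b → q t' * (⟦ b ⟧ * ½)) (==-sym t' t))
          (solve 3 (λ q b h → q :* (b :* h) := b :* (q :* h)) refl (q t') ⟦ t == t' ⟧ ½))) (∑-single t (λ t' → q t' * ½))
      rhs : ∑ (λ e → ⟦ members i x W e ⟧ * ρ t e) ≡ l t * ½ + r t * ½
      rhs = trans (∑-cong (λ e → go (F.splitAt V e))) (trans
          (∑-splitAt V (λ t' → l t' * (⟦ t' == t ⟧ * ½)) (λ t' → r t' * (⟦ t' == t ⟧ * ½))) (cong₂ _+_ (one l) (one r)))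
        where
        go : ∀ v → ⟦ [ (λ t → W (prt t) ∧ adj i x (prt t) (left t)) ,
            (λ t → W (prt t) ∧ adj i x (prt t) (right t)) ]′ v ⟧ * ρ' t v ≡ [ (λ t' → l t' * (⟦ t' == t ⟧ * ½)) ,
            (λ t' → r t' * (⟦ t' == t ⟧ * ½)) ]′ v
        go (inj₁ _) = refl
        go (inj₂ _) = refl

  every : Fin k → Bool
  every _ = true

  badDeg : Fin k → Fin n → Bool → Ω → Bool
  badDeg i x σ ω = suc A' ℕ.≤ᵇ cnt i x every σ ω
  badLoc : Fin k → Fin n → Bool → Fin k → Ω → Bool
  badLoc i x σ j ω = suc M' ℕ.≤ᵇ cnt i x (j ==_) σ ω
  badσ : Fin k → Fin n → Bool → Ω → Bool
  badσ i x σ ω = badDeg i x σ ω ∨ anyF (λ j → badLoc i x σ j ω)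
  bad : Fin k → Ω → Bool
  bad i ω = anyF (λ x → badσ i x true ω ∨ badσ i x false ω)

  ball : Fin k → Fin V → Bool
  ball i t = near i (prt t)
  nb : Fin k → Fin k → Bool
  nb i j = anyF (λ l → near i l ∧ near j l)

  dep : ∀ i → Dep (ball i) (λ ω → ⟦ bad i ω ⟧)
  dep i ω ω' e = cong ⟦_⟧ (anyF-cong (λ x → cong₂ _∨_ (sideD x true) (sideD x false)))
    where
    agree : ∀ b (f : Bool → Bool) v v' → (b ≡ true → v ≡ v') → (∀ v → f v ≡ true → b ≡ true) → f v ≡ f v'
    agree true f v v' h k = cong f (h refl)
    agree false f v v' h k = trans (¬true (λ q → true≢false (k v q) refl)) (sym (¬true (λ q → true≢false (k v' q) refl)))
    same : ∀ x W σ → cnt i x W σ ω ≡ cnt i x W σ ω'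
    same x W σ = sumN-cong (λ t → cong (λ v → if v then 1 else 0)
        (agree (ball i t) (hit i x W σ t) (ω t) (ω' t) (e t) (λ v q → near-adj (proj₂ (∧-elim {W (prt t)} q)))))
    sideD : ∀ x σ → badσ i x σ ω ≡ badσ i x σ ω'
    sideD x σ = cong₂ _∨_ (cong (suc A' ℕ.≤ᵇ_) (same x every σ)) (anyF-cong (λ j → cong (suc M' ℕ.≤ᵇ_) (same x (j ==_) σ)))

  apart : ∀ i j → nb i j ≡ false → ∀ t → ball i t ≡ true → ball j t ≡ true → ⊥
  apart i j q t e f = true≢false (anyF-intro (prt t) (∧-intro e f)) q

  D : ℕ
  D = suc (n ℕ.* n)
  few : ∀ i → count (nb i) ℕ.≤ D ℕ.* D
  few i = count-compose (near i) (λ l j → near j l) D D (near-count i)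
      (λ l → ℕP.≤-trans (ℕP.≤-reflexive (count-cong (λ j → near-sym j l))) (near-count l))

  module Outcome (big : ι (suc (8 ℕ.* (n ℕ.* suc n) ℕ.* (D ℕ.* D))) ≤ pow y M) where

    Y δ : ℚ
    Y = pow y M
    0<Y : 0ℚ < Y
    0<Y = 0<pow M (<-≤-trans 0<1 1≤y)
    δ = proj₁ (recip Y 0<Y)
    0≤δ : 0ℚ ≤ δ
    0≤δ = <⇒≤ (proj₁ (proj₂ (recip Y 0<Y)))
    Yδ : Y * δ ≡ 1ℚ
    Yδ = proj₂ (proj₂ (recip Y 0<Y))
    toδ : ∀ {x} → x * Y ≤ 1ℚ → x ≤ δ
    toδ {x} q = *cancel 0<Y (≤-trans (≤-reflexive (ℚP.*-comm Y x)) (≤-trans q (≤-reflexive (sym Yδ))))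

    deg-rare : ∀ i x σ → E P (λ ω → ⟦ badDeg i x σ ω ⟧) ≤ δ
    deg-rare i x σ = toδ {E P (λ ω → ⟦ badDeg i x σ ω ⟧)} (≤-trans
        (*mono (𝔼-nonneg (prodExp P) (λ ω → 0≤⟦ badDeg i x σ ω ⟧)) (pow-monoʳ 1≤y M≤A))
        (tail i x every σ A (suc A') all≤A reachA))
      where
      all≤A : count (members i x every) ℕ.≤ A
      all≤A = ι-cancel (≤-trans (≤-reflexive (trans (count-members i x every)
          (trans (∑-cong (λ j → ℚP.*-identityˡ (ι (codeg i x j)))) (sym (ι-sumN (codeg i x)))))) (ι-mono (deg≤A i x)))

    -- The factor `codeg i x j` matters because j runs over all parts. Parts without neighbours of x
    -- contribute nothing, and the union bound over j costs the degree of x instead of the number of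
    -- parts.
    loc-rare : ∀ i x σ j → E P (λ ω → ⟦ badLoc i x σ j ω ⟧) ≤ ι (codeg i x j) * δ
    loc-rare i x σ j = byCase (codeg i x j) refl
      where
      one≤M : count (members i x (j ==_)) ℕ.≤ M
      one≤M = ι-cancel (≤-trans (≤-reflexive (trans (count-members i x (j ==_)) (∑-single j (λ j → ι (codeg i x j)))))
          (ι-mono (codeg≤M i x j)))
      byCase : ∀ c → codeg i x j ≡ c → E P (λ ω → ⟦ badLoc i x σ j ω ⟧) ≤ ι c * δ
      byCase (suc c) _ = ≤-trans (toδ {E P (λ ω → ⟦ badLoc i x σ j ω ⟧)} (tail i x (j ==_) σ M (suc M') one≤M reachM))
          (≤-trans (≤-reflexive (sym (ℚP.*-identityˡ δ))) (*monoʳ 0≤δ (subst (_≤ ι (suc c)) ι-1 (ι-mono (s≤s z≤n)))))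
      byCase zero e = ≤-reflexive (trans (trans (𝔼-cong (prodExp P)
          (λ ω → cong (λ c → ⟦ suc M' ℕ.≤ᵇ c ⟧) (trans (sumN-cong (λ t → cong (λ v → if v then 1 else 0) (none t (ω t))))
          (trans (sumN-const {V} 0) (ℕP.*-zeroʳ V))))) (𝔼-0 (prodExp P))) (sym (trans (cong (_* δ) ι-0) (ℚP.*-zeroˡ δ))))
        where
        free : ∀ z → adj i x j z ≡ false
        free z = ¬true λ q → absurd (ℕP.≤-trans (ℕP.≤-trans (ℕP.≤-reflexive (sym (count-single z)))
            (count-mono {P = z ==_} {R = adj i x j} (λ z' r → trans (cong (adj i x j) (sym (==→≡ {i = z} {z'} r))) q)))
            (ℕP.≤-reflexive e))
          where
          absurd : 1 ℕ.≤ 0 → ⊥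
          absurd ()
        none : ∀ t v → hit i x (j ==_) σ t v ≡ false
        none t v = ¬true λ q → true≢false (trans (cong (λ l → adj i x l (choose h σ v (idx t)))
            (==→≡ (proj₁ (∧-elim {j == prt t} q)))) (proj₂ (∧-elim {j == prt t} q))) (free (choose h σ v (idx t)))

    side-rare : ∀ i x σ → E P (λ ω → ⟦ badσ i x σ ω ⟧) ≤ ι (suc n) * δ
    side-rare i x σ = ≤-trans (𝔼-mono (prodExp P) (λ ω → ≤-trans (⟦∨⟧ (badDeg i x σ ω) (anyF (λ j → badLoc i x σ j ω)))
        (ℚP.+-monoʳ-≤ ⟦ badDeg i x σ ω ⟧ (⟦anyF⟧ (λ j → badLoc i x σ j ω)))))
      (≤-trans (≤-reflexive (trans (𝔼-+ (prodExp P) (λ ω → ⟦ badDeg i x σ ω ⟧) (λ ω → ∑ (λ j → ⟦ badLoc i x σ j ω ⟧)))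
          (cong (E P (λ ω → ⟦ badDeg i x σ ω ⟧) +_) (𝔼-∑ (prodExp P) (λ j ω → ⟦ badLoc i x σ j ω ⟧)))))
       (≤-trans (+-mono-≤ (deg-rare i x σ) (≤-trans (∑-mono (loc-rare i x σ))
           (≤-trans (≤-reflexive (trans (∑-*ʳ δ (λ j → ι (codeg i x j))) (cong (_* δ) (sym (ι-sumN (codeg i x))))))
           (*monoʳ 0≤δ (ι-mono (ℕP.≤-trans (deg≤A i x) A≤n))))))
         (≤-reflexive (trans (solve 2 (λ d m → d :+ m :* d := (con 1ℚ :+ m) :* d) refl δ (ι n)) (cong (_* δ) (sym (ι-suc n)))))))

    -- For each of n vertices and both halves there is one degree event, and the local events weigh
    -- at most n in total. Hence 4 η = 8 n (n + 1) δ, the polynomial of `LocalCondition`.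
    η : ℚ
    η = ι n * (ι (suc n) * δ + ι (suc n) * δ)
    rare : ∀ i → E P (λ ω → ⟦ bad i ω ⟧) ≤ η
    rare i = ≤-trans (𝔼-mono (prodExp P) (λ ω → ⟦anyF⟧ (λ x → badσ i x true ω ∨ badσ i x false ω)))
        (≤-trans (≤-reflexive (𝔼-∑ (prodExp P) (λ x ω → ⟦ badσ i x true ω ∨ badσ i x false ω ⟧)))
      (≤-trans (∑-mono both) (≤-reflexive (∑-const {n} (ι (suc n) * δ + ι (suc n) * δ)))))
      where
      both : ∀ x → E P (λ ω → ⟦ badσ i x true ω ∨ badσ i x false ω ⟧) ≤ ι (suc n) * δ + ι (suc n) * δ
      both x = ≤-trans (𝔼-mono (prodExp P) (λ ω → ⟦∨⟧ (badσ i x true ω) (badσ i x false ω)))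
          (≤-trans (≤-reflexive (𝔼-+ (prodExp P) (λ ω → ⟦ badσ i x true ω ⟧) (λ ω → ⟦ badσ i x false ω ⟧)))
          (+-mono-≤ (side-rare i x true) (side-rare i x false)))

    4η : ∀ m → (((η + η) + (η + η)) * ι m) * Y ≡ ι (8 ℕ.* (n ℕ.* suc n) ℕ.* m)
    4η m = trans (solve 5 (λ n s d m Y → ((n :* (s :* d :+ s :* d) :+ n :* (s :* d :+ s :* d)) :+
        (n :* (s :* d :+ s :* d) :+ n :* (s :* d :+ s :* d))) :* m :* Y := con (lit 8) :* (n :* s) :* m :* (Y :* d)) refl (ι n)
        (ι (suc n)) δ (ι m) Y)
      (trans (cong (lit 8 * (ι n * ι (suc n)) * ι m *_) Yδ) (trans (ℚP.*-identityʳ _)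
          (sym (trans (ι-* (8 ℕ.* (n ℕ.* suc n)) m) (cong (_* ι m)
          (trans (ι-* 8 (n ℕ.* suc n)) (cong₂ _*_ (ι-def 8) (ι-* n (suc n)))))))))

    4ηd≤1 : ((η + η) + (η + η)) * ι (D ℕ.* D) ≤ 1ℚ
    4ηd≤1 = *cancel 0<Y (≤-trans (≤-reflexive (trans (ℚP.*-comm Y (((η + η) + (η + η)) * ι (D ℕ.* D))) (4η (D ℕ.* D))))
        (≤-trans (ι-mono (ℕP.n≤1+n _)) (≤-trans big (≤-reflexive (sym (ℚP.*-identityʳ Y))))))

    4η<1 : (η + η) + (η + η) < 1ℚ
    4η<1 = ℚP.*-cancelʳ-<-nonNeg Y {{ℚ.nonNegative (<⇒≤ 0<Y)}}
        (<-≤-trans (≤-<-trans (≤-reflexive (trans (cong (_* Y)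
        (trans (sym (ℚP.*-identityʳ ((η + η) + (η + η)))) (cong (((η + η) + (η + η)) *_) (sym ι-1)))) (4η 1)))
        (ι-mono-< (s≤s (ℕP.*-monoʳ-≤ (8 ℕ.* (n ℕ.* suc n)) {1} {D ℕ.* D} (s≤s z≤n)))))
            (≤-trans big (≤-reflexive (sym (ℚP.*-identityˡ Y)))))

    0≤η : 0ℚ ≤ η
    0≤η = 0≤* (0≤ι n) (0≤+ (0≤* (0≤ι (suc n)) 0≤δ) (0≤* (0≤ι (suc n)) 0≤δ))

    module LL = LocalLemma P bad ball dep nb apart η (ι (D ℕ.* D)) 0≤η rare (λ i → ι-mono (few i)) 4η<1 4ηd≤1

    outcome : Σ Ω λ ω → true ≡ true × (∀ i → bad i ω ≡ false)
    outcome = LL.avoid (λ _ → true) (≤-reflexive (𝔼-0 (prodExp P)))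

  φ : Ω → Bool → Fin k → Fin h → Fin n
  φ ω σ i y = choose h σ (ω (var i y)) y

  half : Ω → Bool → Balanced k h
  half ω σ = restrict H (φ ω σ)

  cnt-half : ∀ ω σ i x W → ι (cnt i x W σ ω) ≡ ∑ (λ j → ⟦ W j ⟧ * ι (count (λ y → adj i x j (φ ω σ j y))))
  cnt-half ω σ i x W = trans (ι-sumN (λ t → if hit i x W σ t (ω t) then 1 else 0))
      (trans (∑-cong (λ t → trans (ι-if (hit i x W σ t (ω t)))
      (cong (λ s → ⟦ W (prt t) ∧ adj i x (prt t) (choose h σ (ω s) (idx t)) ⟧) (sym (FP.combine-remQuot {k} h t)))))
     (trans (∑-pairs k h (λ j y → ⟦ W j ∧ adj i x j (φ ω σ j y) ⟧))
         (∑-cong (λ j → trans (∑-cong (λ y → ⟦∧⟧ (W j) (adj i x j (φ ω σ j y))))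
         (trans (∑-* ⟦ W j ⟧ (λ y → ⟦ adj i x j (φ ω σ j y) ⟧))
         (cong (⟦ W j ⟧ *_) (sym (ι-count (λ y → adj i x j (φ ω σ j y))))))))))

  module _ (ω : Ω) (fine : ∀ i → bad i ω ≡ false) where

    fineσ : ∀ i x σ → badσ i x σ ω ≡ false
    fineσ i x true = proj₁ (∨-false-elim (anyF-none (fine i) x))
    fineσ i x false = proj₂ (∨-false-elim {badσ i x true ω} (anyF-none (fine i) x))

    half-deg : ∀ σ i x → Balanced.deg (half ω σ) i x ℕ.≤ A'
    half-deg σ i x = ℕP.≤-trans (ι-cancel (≤-reflexive (trans (ι-sumN (λ j → count (λ y → adj i (φ ω σ i x) j (φ ω σ j y))))
        (sym (trans (cnt-half ω σ i (φ ω σ i x) every) (∑-cong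
        (λ j → ℚP.*-identityˡ (ι (count (λ y → adj i (φ ω σ i x) j (φ ω σ j y)))))))))))
        (ℕP.≤-pred (≤ᵇ-false {suc A'} (proj₁ (∨-false-elim (fineσ i (φ ω σ i x) σ)))))

    half-codeg : ∀ σ i x j → Balanced.codeg (half ω σ) i x j ℕ.≤ M'
    half-codeg σ i x j = ℕP.≤-trans (ι-cancel (≤-reflexive (sym
        (trans (cnt-half ω σ i (φ ω σ i x) (j ==_)) (∑-single j (λ j → ι (count (λ y → adj i (φ ω σ i x) j (φ ω σ j y)))))))))
        (ℕP.≤-pred (≤ᵇ-false {suc M'} (anyF-none (proj₂ (∨-false-elim {badDeg i (φ ω σ i x) σ ω} (fineσ i (φ ω σ i x) σ))) j)))

  glue : ∀ ω m → Transversals (half ω true) m → Transversals (half ω false) m → Transversals H (m ℕ.+ m)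
  glue ω m T₁ T₂ = record { pos = λ c i → at i (F.splitAt m c) ; indep-T = λ c i j → free i j
      (F.splitAt m c) ; disjoint = λ c c' i e → trans (sym (FP.join-splitAt m m c))
      (trans (cong (F.join m m) (distinct i (F.splitAt m c) (F.splitAt m c') e)) (FP.join-splitAt m m c')) }
    where
    module T₁ = Transversals T₁
    module T₂ = Transversals T₂
    at : Fin k → Fin m ⊎ Fin m → Fin n
    at i (inj₁ c) = φ ω true i (T₁.pos c i)
    at i (inj₂ c) = φ ω false i (T₂.pos c i)
    free : ∀ i j v → adj i (at i v) j (at j v) ≡ false
    free i j (inj₁ c) = T₁.indep-T c i j
    free i j (inj₂ c) = T₂.indep-T c i j
    tf : true ≡ false → ⊥
    tf ()
    distinct : ∀ i v v' → at i v ≡ at i v' → v ≡ v'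
    distinct i (inj₁ c) (inj₁ c') e = cong inj₁ (T₁.disjoint c c' i (proj₁ (choose-inj h (λ y → ω (var i y)) e)))
    distinct i (inj₂ c) (inj₂ c') e = cong inj₂ (T₂.disjoint c c' i (proj₁ (choose-inj h {false} {false} (λ y → ω (var i y)) e)))
    distinct i (inj₁ c) (inj₂ c') e = ⊥-elim (tf (proj₂ (choose-inj h {true} {false} (λ y → ω (var i y)) e)))
    distinct i (inj₂ c) (inj₁ c') e = ⊥-elim (tf (sym (proj₂ (choose-inj h {false} {true} (λ y → ω (var i y)) e))))

  by-halving : LocalCondition n a M →
    ∀ m → (∀ (H' : Balanced k h) → (∀ i x → Balanced.deg H' i x ℕ.≤ A') →
        (∀ i x j → Balanced.codeg H' i x j ℕ.≤ M') → Transversals H' m) → Transversals H (m ℕ.+ m)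
  by-halving big m halves = split (Outcome.outcome (LocalCondition.local-condition big 2≤a))
    where
    split : (Σ Ω λ ω → true ≡ true × (∀ i → bad i ω ≡ false)) → Transversals H (m ℕ.+ m)
    split (ω , _ , fine) = glue ω m (halves (half ω true) (half-deg ω fine true) (half-codeg ω fine true))
        (halves (half ω false) (half-deg ω fine false) (half-codeg ω fine false))

-- Exponential growth


suc≤2^ : ∀ y → suc y ℕ.≤ 2 ^ y
suc≤2^ zero = s≤s z≤n
suc≤2^ (suc y) = ℕP.≤-trans (ℕP.≤-reflexive (sym (ℕP.+-comm (suc y) 1)))
    (ℕP.≤-trans (ℕP.+-mono-≤ (suc≤2^ y) (ℕP.m^n>0 2 y)) (ℕP.≤-reflexive (cong (2 ^ y ℕ.+_) (sym (ℕP.+-identityʳ (2 ^ y))))))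

^-dist : ∀ a b n → (a ℕ.* b) ^ n ≡ a ^ n ℕ.* b ^ n
^-dist a b zero = refl
^-dist a b (suc n) = trans (cong (a ℕ.* b ℕ.*_) (^-dist a b n))
    (NS.solve 4 (λ a b x y → a NS.:* b NS.:* (x NS.:* y) NS.:= a NS.:* x NS.:* (b NS.:* y)) refl a b (a ^ n) (b ^ n))

threshold₅ : ℕ → ℕ
threshold₅ c = 6 ℕ.* (c ℕ.* 7 ^ 5)

-- Put y = x / 6, rounded down. Then 2 + x ≤ 7 (y + 1), and c 7⁵ ≤ y turns the left side into at
-- most (y + 1)⁶ ≤ 2^(6 y). The fifth power is the need of halving: one factor for the logarithm of
-- the size and four for the square of the gap.
exp-beats : ∀ c x → threshold₅ c ℕ.≤ x → c ℕ.* (2 ℕ.+ x) ^ 5 ℕ.≤ 2 ^ x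
exp-beats c x h = ℕP.≤-trans (ℕP.*-monoʳ-≤ c (ℕP.≤-trans (ℕP.^-monoˡ-≤ 5 lin) (ℕP.≤-reflexive (^-dist 7 (suc y) 5))))
   (ℕP.≤-trans (ℕP.≤-reflexive (sym (ℕP.*-assoc c (7 ^ 5) (suc y ^ 5))))
       (ℕP.≤-trans (ℕP.*-monoˡ-≤ (suc y ^ 5) (ℕP.≤-trans big (ℕP.n≤1+n y)))
     (ℕP.≤-trans (ℕP.^-monoˡ-≤ 6 (suc≤2^ y)) (ℕP.≤-trans (ℕP.≤-reflexive (ℕP.^-*-assoc 2 y 6)) (ℕP.^-monoʳ-≤ 2 y6≤x)))))
  where
  y = x ℕD./ 6
  big : c ℕ.* 7 ^ 5 ℕ.≤ y
  big = ℕP.≤-trans (ℕP.≤-reflexive (sym (ℕD.m*n/n≡m (c ℕ.* 7 ^ 5) 6)))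
      (ℕD./-monoˡ-≤ 6 (subst (ℕ._≤ x) (ℕP.*-comm 6 (c ℕ.* 7 ^ 5)) h))
  y6≤x : y ℕ.* 6 ℕ.≤ x
  y6≤x = ℕD.m/n*n≤m x 6
  lin : 2 ℕ.+ x ℕ.≤ 7 ℕ.* suc y
  lin = ℕP.≤-trans (ℕP.+-monoʳ-≤ 2 (ℕP.≤-trans (ℕP.≤-reflexive (ℕD.m≡m%n+[m/n]*n x 6))
      (ℕP.+-monoˡ-≤ (y ℕ.* 6) (ℕP.≤-pred (ℕD.m%n<n x 6)))))
     (ℕP.≤-trans (ℕP.m≤m+n (7 ℕ.+ y ℕ.* 6) y) (ℕP.≤-reflexive
         (NS.solve 1 (λ y → NS.con 7 NS.:+ y NS.:* NS.con 6 NS.:+ y NS.:= NS.con 7 NS.:* (NS.con 1 NS.:+ y)) refl y)))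

ι-2^ : ∀ E → ι (2 ^ E) ≡ pow (1ℚ + 1ℚ) E
ι-2^ zero = ι-1
ι-2^ (suc E) = trans (ι-* 2 (2 ^ E)) (cong₂ _*_ (trans (ι-+ 1 1) (cong₂ _+_ ι-1 ι-1)) (ι-2^ E))

module Growth (a ℓ : ℕ) (2≤a : 2 ℕ.≤ a) (1≤ℓ : 1 ℕ.≤ ℓ) where
  open Moment a ℓ 2≤a 1≤ℓ using (y; w; 0≤w; 1≤y; Dw)

  doubling : ℕ
  doubling = (a ℕ.* a) ℕ.* (2 ℕ.* ℓ)

  -- Since w is the reciprocal of `doubling`, Bernoulli shows that y doubles at least once in every
  -- `doubling` steps.
  growth : ∀ E M → E ℕ.* doubling ℕ.≤ M → ι (2 ^ E) ≤ pow y M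
  growth E M h = ≤-trans (≤-reflexive (ι-2^ E)) (≤-trans (pow-monoˡ E (0≤+ 0≤1 0≤1) two)
      (≤-trans (≤-reflexive (sym (pow-* y E doubling))) (pow-monoʳ 1≤y h)))
    where
    two : 1ℚ + 1ℚ ≤ pow y doubling
    two = ≤-trans (≤-reflexive (cong (1ℚ +_) (sym (trans (cong (_* w)
        (trans (ι-* (a ℕ.* a) (2 ℕ.* ℓ)) (cong (_* ι (2 ℕ.* ℓ)) (ι-* a a)))) Dw)))) (bernoulli doubling 0≤w)

absorb : ∀ c k N X → suc c ℕ.≤ 2 ^ k → 2 ℕ.≤ N → 1 ℕ.≤ X → suc (c ℕ.* X) ℕ.≤ N ^ k ℕ.* X
absorb c k N X h 2≤N 1≤X = ℕP.≤-trans (ℕP.+-monoˡ-≤ (c ℕ.* X) 1≤X) (ℕP.*-monoˡ-≤ X (ℕP.≤-trans h (ℕP.^-monoˡ-≤ k 2≤N)))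

module _ (n E : ℕ) (1≤n : 1 ℕ.≤ n) (small : n ℕ.+ n ℕ.≤ 2 ^ E) where
  private
    N N² : ℕ
    N = n ℕ.+ n
    N² = N ℕ.* N
    2≤N : 2 ℕ.≤ N
    2≤N = ℕP.+-mono-≤ 1≤n 1≤n
    n≤N : n ℕ.≤ N
    n≤N = ℕP.m≤m+n n n
    nn≤N² : n ℕ.* n ℕ.≤ N²
    nn≤N² = ℕP.*-mono-≤ n≤N n≤N
    nsn≤N² : n ℕ.* suc n ℕ.≤ N²
    nsn≤N² = ℕP.*-mono-≤ n≤N (ℕP.+-monoˡ-≤ n 1≤n)
    D≤N² : suc (n ℕ.* n) ℕ.≤ N²
    D≤N² = ℕP.≤-trans (ℕP.+-mono-≤ (ℕP.*-mono-≤ 1≤n 1≤n) (ℕP.≤-refl {n ℕ.* n}))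
        (ℕP.≤-trans (ℕP.≤-reflexive (sym (ℕP.*-distribˡ-+ n n n))) (ℕP.*-monoˡ-≤ N n≤N))
    1≤N² : 1 ℕ.≤ N²
    1≤N² = ℕP.*-mono-≤ {1} {N} {1} {N} (ℕP.≤-trans (s≤s z≤n) 2≤N) (ℕP.≤-trans (s≤s z≤n) 2≤N)

  halving-poly : suc (8 ℕ.* (n ℕ.* suc n) ℕ.* (suc (n ℕ.* n) ℕ.* suc (n ℕ.* n))) ℕ.≤ 2 ^ (E ℕ.* 10)
  halving-poly = ℕP.≤-trans (s≤s (ℕP.≤-trans (ℕP.≤-reflexive (ℕP.*-assoc 8 (n ℕ.* suc n) _))
      (ℕP.*-monoʳ-≤ 8 (ℕP.*-mono-≤ nsn≤N² (ℕP.*-mono-≤ D≤N² D≤N²)))))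
    (ℕP.≤-trans (absorb 8 4 N (N² ℕ.* (N² ℕ.* N²)) (ℕP.m≤m+n 9 7) 2≤N (ℕP.*-mono-≤ 1≤N² (ℕP.*-mono-≤ 1≤N² 1≤N²)))
      (ℕP.≤-trans (ℕP.≤-reflexive (NS.solve 1 (λ x → x NS.:^ 4 NS.:*
          (x NS.:* x NS.:* (x NS.:* x NS.:* (x NS.:* x))) NS.:= x NS.:^ 10) refl N))
          (ℕP.≤-trans (ℕP.^-monoˡ-≤ 10 small) (ℕP.≤-reflexive (ℕP.^-*-assoc 2 E 10)))))

  nibble-poly : suc (20 ℕ.* (n ℕ.* n) ℕ.* ((suc (n ℕ.* n) ℕ.* suc (n ℕ.* n)) ℕ.* (suc (n ℕ.* n) ℕ.* suc (n ℕ.* n)))) ℕ.≤ 2 ^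
      (E ℕ.* 15)
  nibble-poly = ℕP.≤-trans (s≤s (ℕP.≤-trans (ℕP.≤-reflexive (ℕP.*-assoc 20 (n ℕ.* n) _))
      (ℕP.*-monoʳ-≤ 20 (ℕP.*-mono-≤ nn≤N² (ℕP.*-mono-≤ (ℕP.*-mono-≤ D≤N² D≤N²) (ℕP.*-mono-≤ D≤N² D≤N²))))))
    (ℕP.≤-trans (absorb 20 5 N (N² ℕ.* ((N² ℕ.* N²) ℕ.* (N² ℕ.* N²))) (ℕP.m≤m+n 21 11) 2≤N
        (ℕP.*-mono-≤ 1≤N² (ℕP.*-mono-≤ (ℕP.*-mono-≤ 1≤N² 1≤N²) (ℕP.*-mono-≤ 1≤N² 1≤N²))))
      (ℕP.≤-trans (ℕP.≤-reflexive (NS.solve 1 (λ x → x NS.:^ 5 NS.:*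
          (x NS.:* x NS.:* ((x NS.:* x NS.:* (x NS.:* x)) NS.:* (x NS.:* x NS.:* (x NS.:* x)))) NS.:= x NS.:^ 15) refl N))
          (ℕP.≤-trans (ℕP.^-monoˡ-≤ 15 small) (ℕP.≤-reflexive (ℕP.^-*-assoc 2 E 15)))))

-- Recursion over the scales

-- Defined by doubling, so that a graph of size `sz s (suc j)` is definitionally one of size h + h,
-- as `Halving` expects.
sz : ℕ → ℕ → ℕ
sz s zero = s
sz s (suc j) = sz s j ℕ.+ sz s j

sz≡ : ∀ s j → sz s j ≡ s ℕ.* 2 ^ j
sz≡ s zero = sym (ℕP.*-identityʳ s)
sz≡ s (suc j) = trans (cong₂ ℕ._+_ (sz≡ s j) (sz≡ s j)) (NS.solve 2
    (λ s t → s NS.:* t NS.:+ s NS.:* t NS.:= s NS.:* (t NS.:+ (t NS.:+ NS.con 0))) refl s (2 ^ j))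

private
  floor′ : ∀ x → 0ℚ ≤ x → Σ ℕ λ N → ι N ≤ x × x < ι (suc N)
  floor′ x 0≤x = go (proj₁ (ceil x 0≤x)) (proj₁ (proj₂ (ceil x 0≤x))) (proj₂ (proj₂ (ceil x 0≤x)))
    where
    below : ∀ b → x ≤ ι b → ι b ≤ x + 1ℚ → Dec (ι b ≤ x) → Σ ℕ λ N → ι N ≤ x × x < ι (suc N)
    below b p q (yes r) = b , r , ≤-<-trans p (ι-mono-< ℕP.≤-refl)
    below zero p q (no r) = ⊥-elim (r (≤-trans (≤-reflexive ι-0) 0≤x))
    below (suc b) p q (no r) = b , le-by (x + 1ℚ - ι (suc b)) (sub≥0 q)
        (trans (solve 2 (λ x b → x := b :+ (x :+ con 1ℚ :- (con 1ℚ :+ b))) refl x (ι b))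
        (cong (λ z → ι b + (x + 1ℚ - z)) (sym (ι-suc b)))) , ℚP.≰⇒> r
    go : ∀ b → x ≤ ι b → ι b ≤ x + 1ℚ → Σ ℕ λ N → ι N ≤ x × x < ι (suc N)
    go b p q = below b p q (ι b ℚP.≤? x)

abstract
  floor : ∀ x → 0ℚ ≤ x → Σ ℕ λ N → ι N ≤ x × x < ι (suc N)
  floor = floor′

floor-max : ∀ {x c N} → ι c ≤ x → x < ι (suc N) → c ℕ.≤ N
floor-max p q = ℕP.≤-pred (ι-cancel-< (≤-<-trans p q))

-- Ten divided by the gap is the telescoping difference 1/(d (j+1)) - 1/(d (j+2)) between
-- consecutive allowances `c`.
gap : ℕ → ℕ → ℕ
gap d j = 10 ℕ.* (d ℕ.* (suc j ℕ.* suc (suc j)))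

module Scale (d : ℕ) (1≤d : 1 ℕ.≤ d) where

  0<dj : ∀ j → 0ℚ < ι (d ℕ.* suc j)
  0<dj j = 0<ι (ℕP.*-mono-≤ 1≤d (s≤s z≤n))
  u c : ℕ → ℚ
  u j = proj₁ (recip (ι (d ℕ.* suc j)) (0<dj j))
  c j = 1ℚ + u j
  0≤u : ∀ j → 0ℚ ≤ u j
  0≤u j = <⇒≤ (proj₁ (proj₂ (recip (ι (d ℕ.* suc j)) (0<dj j))))
  du : ∀ j → ι (d ℕ.* suc j) * u j ≡ 1ℚ
  du j = proj₂ (proj₂ (recip (ι (d ℕ.* suc j)) (0<dj j)))
  0≤c : ∀ j → 0ℚ ≤ c j
  0≤c j = 0≤+ 0≤1 (0≤u j)
  u≤1 : ∀ j → u j ≤ 1ℚ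
  u≤1 j = ≤-trans (≤-reflexive (sym (ℚP.*-identityˡ (u j))))
      (≤-trans (*monoʳ (0≤u j) (≤-trans (≤-reflexive (sym ι-1)) (ι-mono (ℕP.*-mono-≤ 1≤d (s≤s (z≤n {j})))))) (≤-reflexive (du j)))

  gu : ∀ j → ι (gap d j) * u j ≡ lit 10 * ι (suc (suc j))
  gu j = trans (cong (_* u j) (trans (cong ι (NS.solve 3 (λ d a b → NS.con 10 NS.:* (d NS.:* (a NS.:* b)) NS.:= (d NS.:* a) NS.:*
      (NS.con 10 NS.:* b)) refl d (suc j) (suc (suc j)))) (ι-* (d ℕ.* suc j) (10 ℕ.* suc (suc j)))))
    (trans (solve 3 (λ a b u → a :* b :* u := a :* u :* b) refl (ι (d ℕ.* suc j)) (ι (10 ℕ.* suc (suc j))) (u j))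
        (trans (cong (_* ι (10 ℕ.* suc (suc j))) (du j)) (trans (ℚP.*-identityˡ _)
        (trans (ι-* 10 (suc (suc j))) (cong (_* ι (suc (suc j))) (ι-def 10))))))

  gu' : ∀ j → ι (gap d j) * u (suc j) ≡ lit 10 * ι (suc j)
  gu' j = trans (cong (_* u (suc j)) (trans (cong ι (NS.solve 3
      (λ d a b → NS.con 10 NS.:* (d NS.:* (a NS.:* b)) NS.:= (d NS.:* b) NS.:* (NS.con 10 NS.:* a)) refl d (suc j) (suc (suc j))))
      (ι-* (d ℕ.* suc (suc j)) (10 ℕ.* suc j))))
    (trans (solve 3 (λ a b u → a :* b :* u := a :* u :* b) refl (ι (d ℕ.* suc (suc j))) (ι (10 ℕ.* suc j)) (u (suc j)))
        (trans (cong (_* ι (10 ℕ.* suc j)) (du (suc j))) (trans (ℚP.*-identityˡ _)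
        (trans (ι-* 10 (suc j)) (cong (_* ι (suc j)) (ι-def 10))))))

  -- Multiplied by the gap, the allowance increases by exactly 10 from scale j + 1 to scale j. The
  -- halving error requires 5 c (j + 1), and c never exceeds 2.
  descend : ∀ j → (ι (gap d j) + lit 5) * c (suc j) ≤ ι (gap d j) * c j
  descend j = le-by (lit 5 * (1ℚ - u')) (0≤* (0≤lit 5) (sub≥0 (u≤1 (suc j))))
      (trans (solve 2 (λ g u → g :* (con 1ℚ :+ u) := g :+ g :* u) refl G (u j))
      (trans (cong (G +_) (trans (gu j) (trans (cong (lit 10 *_) (ι-suc (suc j)))
      (trans (ℚP.*-distribˡ-+ (lit 10) 1ℚ (ι (suc j))) (cong (lit 10 * 1ℚ +_) (sym (gu' j)))))))
     (solve 2 (λ g u → g :+ (con (lit 10) :* con 1ℚ :+ g :* u) := (g :+ con (lit 5)) :* (con 1ℚ :+ u) :+ con (lit 5) :*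
         (con 1ℚ :- u)) refl G u')))
    where
    G = ι (gap d j)
    u' = u (suc j)

  reach-floor : ∀ j α h A A' → 0ℚ ≤ α → ι A ≤ α * c (suc j) * ι (h ℕ.+ h) → α * c j * ι h < ι (suc A') → suc
      (gap d j ℕ.+ 4) ℕ.* A ℕ.≤ (2 ℕ.* gap d j) ℕ.* suc A'
  reach-floor j α h A A' 0≤α pA pA' = ι-cancel (≤-trans (≤-reflexive
      (trans (ι-* (suc (gap d j ℕ.+ 4)) A) (cong (_* ι A) (trans (cong ι (sym (ℕP.+-suc (gap d j) 4)))
      (trans (ι-+ (gap d j) 5) (cong (G +_) (ι-def 5)))))))
     (≤-trans (*mono (0≤+ (0≤ι (gap d j)) (0≤lit 5)) (≤-trans pA (≤-reflexive (cong (α * c (suc j) *_) (ι-+ h h)))))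
         (≤-trans (≤-reflexive (solve 4 (λ g a c h → g :* (a :* c :* (h :+ h)) := (g :* c) :* (a :* (h :+ h))) refl (G + lit 5) α
         (c (suc j)) (ι h)))
       (≤-trans (*monoʳ (0≤* 0≤α (0≤+ (0≤ι h) (0≤ι h))) (descend j))
           (≤-trans (≤-reflexive (solve 4 (λ g a c h → (g :* c) :* (a :* (h :+ h)) := (con (lit 2) :* g) :* (a :* c :* h)) refl G
           α (c j) (ι h)))
         (≤-trans (*mono (0≤* (0≤lit 2) (0≤ι (gap d j))) (<⇒≤ pA'))
             (≤-reflexive (sym (trans (ι-* (2 ℕ.* gap d j) (suc A'))
             (cong (_* ι (suc A')) (trans (ι-* 2 (gap d j)) (cong (_* G) (ι-def 2)))))))))))))
    where
    G = ι (gap d j)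

  3≤gap : ∀ j → 3 ℕ.≤ gap d j
  3≤gap j = ℕP.≤-trans (ℕP.m≤m+n 3 7) (ℕP.≤-trans (ℕP.≤-reflexive (sym (ℕP.*-identityʳ 10)))
      (ℕP.*-monoʳ-≤ 10 (ℕP.*-mono-≤ 1≤d (ℕP.*-mono-≤ {1} {suc j} {1} {suc (suc j)} (s≤s z≤n) (s≤s z≤n)))))

  2≤2gap : ∀ j → 2 ℕ.≤ 2 ℕ.* gap d j
  2≤2gap j = ℕP.*-monoʳ-≤ 2 (ℕP.≤-trans (s≤s z≤n) (3≤gap j))

  module Descent (s m : ℕ) (α β : ℚ) (0≤β : 0ℚ ≤ β) (β≤α : β ≤ α) (αc≤1 : ∀ j → α * c j ≤ 1ℚ)
    (big : ∀ j M → β * ι (sz s (suc j)) < ι (suc M) → LocalCondition (sz s (suc j)) (2 ℕ.* gap d j) M)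
    (base : ∀ {k} (H : Balanced k s) → (∀ i x → ι (Balanced.deg H i x) ≤ α * c 0 * ι s) → (∀ i x i' → ι (Balanced.codeg H i x i') ≤ β * c 0 * ι s) → Transversals H m) where

    0≤α : 0ℚ ≤ α
    0≤α = ≤-trans 0≤β β≤α

    -- The allowance c j grows as the size falls, so the errors of all halvings are already
    -- contained in the bound at each scale and the bottom sees only c 0. Floors turn the rational
    -- bounds into the integers that `Halving` takes.
    claim : ∀ j {k} (H : Balanced k (sz s j)) → (∀ i x → ι (Balanced.deg H i x) ≤ α * c j * ι (sz s j)) →
        (∀ i x i' → ι (Balanced.codeg H i x i') ≤ β * c j * ι (sz s j)) → Transversals H (sz m j)
    claim zero H dH cH = base H dH cH
    claim (suc j) {k} H dH cH = Halving.by-halving {k} {h} H A M A' M' (gap d j) (3≤gap j)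
        (λ i x → floor-max (dH i x) (proj₂ (proj₂ fA))) (λ i x i' → floor-max (cH i x i') (proj₂ (proj₂ fM))) A≤n M≤A
        (reach-floor j α h A A' 0≤α (proj₁ (proj₂ fA)) (proj₂ (proj₂ fA')))
            (reach-floor j β h M M' 0≤β (proj₁ (proj₂ fM)) (proj₂ (proj₂ fM')))
        (big j M β-low) (sz m j) (λ H' dH' cH' → claim j H' (λ i x → ≤-trans (ι-mono (dH' i x)) (proj₁ (proj₂ fA')))
            (λ i x i' → ≤-trans (ι-mono (cH' i x i')) (proj₁ (proj₂ fM'))))
      where
      h : ℕ
      h = sz s j
      nn : ∀ γ i → 0ℚ ≤ γ → ∀ l → 0ℚ ≤ γ * c i * ι l
      nn γ i p l = 0≤* (0≤* p (0≤c i)) (0≤ι l)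
      fA = floor (α * c (suc j) * ι (h ℕ.+ h)) (nn α (suc j) 0≤α (h ℕ.+ h))
      fM = floor (β * c (suc j) * ι (h ℕ.+ h)) (nn β (suc j) 0≤β (h ℕ.+ h))
      fA' = floor (α * c j * ι h) (nn α j 0≤α h)
      fM' = floor (β * c j * ι h) (nn β j 0≤β h)
      A M A' M' : ℕ
      A = proj₁ fA
      M = proj₁ fM
      A' = proj₁ fA'
      M' = proj₁ fM'
      A≤n : A ℕ.≤ h ℕ.+ h
      A≤n = ι-cancel (≤-trans (proj₁ (proj₂ fA)) (≤-trans (*monoʳ (0≤ι (h ℕ.+ h)) (αc≤1 (suc j)))
          (≤-reflexive (ℚP.*-identityˡ (ι (h ℕ.+ h))))))
      M≤A : M ℕ.≤ A
      M≤A = floor-max (≤-trans (proj₁ (proj₂ fM)) (*monoʳ (0≤ι (h ℕ.+ h)) (*monoʳ (0≤c (suc j)) β≤α))) (proj₂ (proj₂ fA))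
      β-low : β * ι (h ℕ.+ h) < ι (suc M)
      β-low = ≤-<-trans (*monoʳ (0≤ι (h ℕ.+ h)) (≤-trans (≤-reflexive (sym (ℚP.*-identityʳ β)))
          (*mono 0≤β (le-by (u (suc j)) (0≤u (suc j)) refl)))) (proj₂ (proj₂ fM))

-- Choice of the parameters

-- The constants that remain when the requirements `X<M` and `large` below are written as a constant
-- times a power of the exponent; `exp-beats` then dictates how large κ must be.
halvingCost nibbleCost : ℕ → ℕ
halvingCost d = 2 ℕ.* suc (3 ℕ.* 10 ℕ.* (((2 ℕ.* (10 ℕ.* d)) ℕ.* (2 ℕ.* (10 ℕ.* d))) ℕ.* (2 ℕ.* 1)))
nibbleCost e = 2 ^ rounds e ℕ.* (32 ℕ.* (2 ℕ.* 15 ℕ.* ((aₑ e ℕ.* aₑ e) ℕ.* 2)))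

module Parameters (e κ s : ℕ) (1≤e : 1 ℕ.≤ e) (e≤κ : e ℕ.≤ κ) (halvingCost≤ : threshold₅ (halvingCost (4 ℕ.* e)) ℕ.≤ κ)
    (nibbleCost≤ : threshold₅ (nibbleCost (2 ℕ.* e)) ℕ.≤ κ)
  (4^κ≤s : 2 ^ κ ℕ.* 2 ^ κ ℕ.≤ s) (s≤2·4^κ : s ℕ.≤ 2 ℕ.* (2 ^ κ ℕ.* 2 ^ κ)) where

  d : ℕ
  d = 4 ℕ.* e

  1≤d : 1 ℕ.≤ d
  1≤d = ℕP.*-mono-≤ {1} {4} (s≤s z≤n) 1≤e

  open Scale d 1≤d

  L : ℕ
  L = 2 ^ κ
  1≤L : 1 ℕ.≤ L
  1≤L = ℕP.m^n>0 2 κ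
  1≤s : 1 ℕ.≤ s
  1≤s = ℕP.≤-trans (ℕP.*-mono-≤ 1≤L 1≤L) 4^κ≤s

  -- With v = 1/(4 e) the budget is 4 v ≤ ε. Rounding n down to a scale leaves degrees at most α = 1
  -- - 3 v times the size, the halvings at most η = 1 - 2 v, and η = 1 - 1/(2 e) is the ratio with
  -- which the nibble starts.
  v α β : ℚ
  v = u 0
  α = 1ℚ - lit 3 * v

  0<4L : 0ℚ < ι (4 ℕ.* L)
  0<4L = 0<ι (ℕP.*-mono-≤ {1} {4} (s≤s z≤n) 1≤L)
  -- At the bottom s ≤ 2 L² and c 0 ≤ 2, so local degrees are at most 4 L² / (4 L) = L, no more than
  -- the root of s.
  β = proj₁ (recip (ι (4 ℕ.* L)) 0<4L)
  0≤β : 0ℚ ≤ β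
  0≤β = <⇒≤ (proj₁ (proj₂ (recip (ι (4 ℕ.* L)) 0<4L)))
  Lβ : lit 4 * ι L * β ≡ 1ℚ
  Lβ = trans (cong (_* β) (sym (trans (ι-* 4 L) (cong (_* ι L) (ι-def 4))))) (proj₂ (proj₂ (recip (ι (4 ℕ.* L)) 0<4L)))

  ev : lit 4 * ι e * v ≡ 1ℚ
  ev = trans (cong (_* v) (sym (trans (cong ι (ℕP.*-identityʳ (4 ℕ.* e))) (trans (ι-* 4 e) (cong (_* ι e) (ι-def 4)))))) (du 0)

  0≤v : 0ℚ ≤ v
  0≤v = 0≤u 0

  1≤ιe : 1ℚ ≤ ι e
  1≤ιe = subst (_≤ ι e) ι-1 (ι-mono 1≤e)

  4v≤1 : lit 4 * v ≤ 1ℚ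
  4v≤1 = ≤-trans (≤-reflexive (solve 1 (λ v → con (lit 4) :* v := con (lit 4) :* con 1ℚ :* v) refl v))
      (≤-trans (*monoʳ 0≤v (*mono (0≤lit 4) 1≤ιe)) (≤-reflexive ev))

  v≤α : v ≤ α
  v≤α = le-by (1ℚ - lit 4 * v) (sub≥0 4v≤1) (solve 1 (λ v → con 1ℚ :- con (lit 3) :* v := v :+ (con 1ℚ :- con (lit 4) :* v)) refl
      v)

  e≤L : e ℕ.≤ L
  e≤L = ℕP.≤-trans e≤κ (ℕP.≤-trans (ℕP.n≤1+n κ) (suc≤2^ κ))

  β≤v : β ≤ v
  β≤v = ≤-trans (≤-reflexive (trans (sym (ℚP.*-identityʳ β))
      (trans (cong (β *_) (sym ev)) (solve 3 (λ b e v → b :* (con (lit 4) :* e :* v) := (b :* v) :* (con (lit 4) :* e)) refl β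
      (ι e) v))))
    (≤-trans (*mono (0≤* 0≤β 0≤v) (*mono (0≤lit 4) (ι-mono e≤L)))
        (≤-reflexive (trans (solve 3 (λ b l v → (b :* v) :* (con (lit 4) :* l) := (con (lit 4) :* l :* b) :* v) refl β (ι L) v)
        (trans (cong (_* v) Lβ) (ℚP.*-identityˡ v)))))

  β≤α : β ≤ α
  β≤α = ≤-trans β≤v v≤α

  0≤α : 0ℚ ≤ α
  0≤α = ≤-trans 0≤β β≤α

  η : ℚ
  η = 1ℚ - lit 2 * v

  0≤η : 0ℚ ≤ η
  0≤η = ≤-trans 0≤α (le-by v 0≤v (solve 1 (λ v → con 1ℚ :- con (lit 2) :* v := con 1ℚ :- con (lit 3) :* v :+ v) refl v))

  η≤1 : η ≤ 1ℚ
  η≤1 = 1-x≤1 (0≤* (0≤lit 2) 0≤v)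

  αc₀ : α * c 0 ≤ η
  αc₀ = le-by (lit 3 * v * v) (0≤* (0≤* (0≤lit 3) 0≤v) 0≤v) (solve 1
      (λ v → con 1ℚ :- con (lit 2) :* v := (con 1ℚ :- con (lit 3) :* v) :* (con 1ℚ :+ v) :+ con (lit 3) :* v :* v) refl v)

  u≤v : ∀ j → u j ≤ v
  u≤v j = ≤-trans (≤-reflexive (trans (sym (ℚP.*-identityˡ (u j)))
      (trans (cong (_* u j) (sym (du 0))) (solve 3 (λ x v u → x :* v :* u := v :* (x :* u)) refl (ι (d ℕ.* 1)) v (u j)))))
    (≤-trans (*mono 0≤v (*monoʳ (0≤u j) (ι-mono (ℕP.*-monoʳ-≤ d (s≤s (z≤n {j}))))))
        (≤-reflexive (trans (cong (v *_) (du j)) (ℚP.*-identityʳ v))))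

  αc≤1 : ∀ j → α * c j ≤ 1ℚ
  αc≤1 j = ≤-trans (*mono 0≤α (ℚP.+-monoʳ-≤ 1ℚ (u≤v j))) (≤-trans αc₀ η≤1)

  module _ (j M : ℕ) (β-low : β * ι (sz s (suc j)) < ι (suc M)) where
    private
      x X K P E₁ : ℕ
      x = κ ℕ.+ j
      P = 2 ℕ.+ x
      E₁ = (κ ℕ.+ κ) ℕ.+ (3 ℕ.+ j)
      module G = Growth (2 ℕ.* gap d j) 1 (2≤2gap j) (s≤s z≤n)
      X = E₁ ℕ.* 10 ℕ.* G.doubling
      K = 3 ℕ.* 10 ℕ.* (((2 ℕ.* (10 ℕ.* d)) ℕ.* (2 ℕ.* (10 ℕ.* d))) ℕ.* (2 ℕ.* 1))
      n : ℕ
      n = sz s (suc j)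

      n≡ : n ≡ s ℕ.* (2 ℕ.* 2 ^ j)
      n≡ = sz≡ s (suc j)

      small : n ℕ.+ n ℕ.≤ 2 ^ E₁
      small = ℕP.≤-trans (ℕP.≤-reflexive (trans (cong₂ ℕ._+_ n≡ n≡)
          (NS.solve 2 (λ s t → s NS.:* (NS.con 2 NS.:* t) NS.:+ s NS.:* (NS.con 2 NS.:* t) NS.:= s NS.:* (NS.con 4 NS.:* t)) refl
          s (2 ^ j))))
        (ℕP.≤-trans (ℕP.*-monoˡ-≤ (4 ℕ.* 2 ^ j) s≤2·4^κ)
          (ℕP.≤-reflexive (trans (NS.solve 2 (λ l t → (NS.con 2 NS.:* (l NS.:* l)) NS.:* (NS.con 4 NS.:* t) NS.:=
              (l NS.:* l) NS.:* (NS.con 8 NS.:* t)) refl L (2 ^ j))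
            (sym (trans (ℕP.^-distribˡ-+-* 2 (κ ℕ.+ κ) (3 ℕ.+ j))
                (cong₂ ℕ._*_ (ℕP.^-distribˡ-+-* 2 κ κ) (ℕP.^-distribˡ-+-* 2 3 j)))))))

      2^x<2M : 2 ^ x ℕ.< 2 ℕ.* suc M
      2^x<2M = ℕP.*-cancelˡ-< (2 ℕ.* L) (2 ^ x) (2 ℕ.* suc M) (ℕP.≤-<-trans
        (ℕP.≤-trans (ℕP.≤-reflexive (trans (cong (2 ℕ.* L ℕ.*_) (ℕP.^-distribˡ-+-* 2 κ j))
            (NS.solve 2 (λ l t → NS.con 2 NS.:* l NS.:* (l NS.:* t) NS.:= (l NS.:* l) NS.:* (NS.con 2 NS.:* t)) refl L (2 ^ j))))
          (ℕP.≤-trans (ℕP.*-monoˡ-≤ (2 ℕ.* 2 ^ j) 4^κ≤s) (ℕP.≤-reflexive (sym n≡))))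
        (subst (n ℕ.<_) (NS.solve 2 (λ l m → NS.con 4 NS.:* l NS.:* m NS.:= NS.con 2 NS.:* l NS.:* (NS.con 2 NS.:* m)) refl L
            (suc M))
          (ι-cancel-< {n} {4 ℕ.* L ℕ.* suc M} (subst₂ _<_ (trans (sym (ℚP.*-assoc (ι (4 ℕ.* L)) β (ι n)))
              (trans (cong (_* ι n) (proj₂ (proj₂ (recip (ι (4 ℕ.* L)) 0<4L)))) (ℚP.*-identityˡ (ι n))))
            (sym (ι-* (4 ℕ.* L) (suc M))) (ℚP.*-monoʳ-<-pos (ι (4 ℕ.* L)) {{ℚ.positive 0<4L}} β-low)))))

      E₁≤ : E₁ ℕ.≤ 3 ℕ.* P
      E₁≤ = ℕP.≤-trans (ℕP.m≤m+n E₁ (κ ℕ.+ (3 ℕ.+ (j ℕ.+ j))))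
          (ℕP.≤-reflexive (NS.solve 2 (λ k j → (k NS.:+ k NS.:+ (NS.con 3 NS.:+ j)) NS.:+
          (k NS.:+ (NS.con 3 NS.:+ (j NS.:+ j))) NS.:= NS.con 3 NS.:* (NS.con 2 NS.:+ (k NS.:+ j))) refl κ j))

      2+j≤P : suc (suc j) ℕ.≤ P
      2+j≤P = ℕP.+-monoʳ-≤ 2 (ℕP.m≤n+m j κ)

      a≤ : 2 ℕ.* gap d j ℕ.≤ 2 ℕ.* (10 ℕ.* (d ℕ.* (P ℕ.* P)))
      a≤ = ℕP.*-monoʳ-≤ 2 (ℕP.*-monoʳ-≤ 10 (ℕP.*-monoʳ-≤ d (ℕP.*-mono-≤ (ℕP.≤-trans (ℕP.n≤1+n (suc j)) 2+j≤P) 2+j≤P)))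

      X≤KP : X ℕ.≤ K ℕ.* P ^ 5
      X≤KP = ℕP.≤-trans (ℕP.*-mono-≤ (ℕP.*-monoˡ-≤ 10 E₁≤) (ℕP.*-monoˡ-≤ (2 ℕ.* 1) (ℕP.*-mono-≤ a≤ a≤)))
        (ℕP.≤-reflexive (NS.solve 5 (λ p t h d q → h NS.:* p NS.:* t NS.:*
            (((q NS.:* (t NS.:* (d NS.:* (p NS.:* p)))) NS.:* (q NS.:* (t NS.:* (d NS.:* (p NS.:* p))))) NS.:* (q NS.:* NS.con 1))
          NS.:= h NS.:* t NS.:* (((q NS.:* (t NS.:* d)) NS.:* (q NS.:* (t NS.:* d))) NS.:* (q NS.:* NS.con 1)) NS.:* p NS.:^ 5)
              refl P 10 3 d 2))

      X<M : suc X ℕ.≤ M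
      X<M = ℕP.≤-pred (ℕP.*-cancelˡ-< 2 (suc X) (suc M) (ℕP.≤-<-trans
          (ℕP.≤-trans (ℕP.*-monoʳ-≤ 2 (ℕP.+-mono-≤ (ℕP.m^n>0 P 5) X≤KP))
          (ℕP.≤-trans (ℕP.≤-reflexive (sym (ℕP.*-assoc 2 (suc K) (P ^ 5))))
         (exp-beats (halvingCost d) x (ℕP.≤-trans halvingCost≤ (ℕP.m≤m+n κ j))))) 2^x<2M))

      1≤n : 1 ℕ.≤ n
      1≤n = ℕP.≤-trans (ℕP.*-mono-≤ 1≤s (ℕP.*-mono-≤ {1} {2} (s≤s z≤n) (ℕP.m^n>0 2 j))) (ℕP.≤-reflexive (sym n≡))

    big : LocalCondition (sz s (suc j)) (2 ℕ.* gap d j) M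
    big = record { local-condition = λ 2≤a → ≤-trans (ι-mono (halving-poly n E₁ 1≤n small))
        (Growth.growth (2 ℕ.* gap d j) 1 2≤a (s≤s z≤n) (E₁ ℕ.* 10) M (ℕP.≤-trans (ℕP.n≤1+n X) X<M)) }

  fm = floor (η * ι s) (0≤* 0≤η (0≤ι s))
  m : ℕ
  m = proj₁ fm

  m≤s : m ℕ.≤ s
  m≤s = ι-cancel (≤-trans (proj₁ (proj₂ fm)) (≤-trans (*monoʳ (0≤ι s) η≤1) (≤-reflexive (ℚP.*-identityˡ (ι s)))))

  m-low : η * ι s < ι (suc m)
  m-low = proj₂ (proj₂ fm)

  e₂ : ℕ
  e₂ = 2 ℕ.* e
  1≤e₂ : 1 ℕ.≤ e₂
  1≤e₂ = ℕP.*-mono-≤ {1} {2} (s≤s z≤n) 1≤e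

  ratio : ι e₂ * ι m ≤ (ι e₂ - 1ℚ) * ι s
  ratio = ≤-trans (*mono (0≤ι e₂) (proj₁ (proj₂ fm))) (≤-reflexive (trans (sym (ℚP.*-assoc (ι e₂) η (ι s))) (cong (_* ι s)
    (trans (cong (_* η) ιe₂) (trans (solve 2 (λ e v → (con (lit 2) :* e) :* (con 1ℚ :- con (lit 2) :* v) := con (lit 2) :* e :-
        (con (lit 4) :* e :* v)) refl (ι e) v) (cong₂ _-_ (sym ιe₂) ev))))))
    where
    ιe₂ : ι e₂ ≡ lit 2 * ι e
    ιe₂ = trans (ι-* 2 e) (cong (_* ι e) (ι-def 2))

  base : ∀ {k} (H : Balanced k s) → (∀ i x → ι (Balanced.deg H i x) ≤ α * c 0 * ι s) →
      (∀ i x i' → ι (Balanced.codeg H i x i') ≤ β * c 0 * ι s) → Transversals H m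
  base H dH cH = Colouring.by-nibble H m L 1≤L 1≤s m≤s (λ i x → ℕP.≤-trans (deg≤m i x) m≤s) codeg≤L e₂ m 1≤e₂ 2≤a m₀ a≤m₀
      (≤-trans (ι-mono (nibble-poly s E₂ 1≤s small)) (G.growth (E₂ ℕ.* 15) m₀ ℕP.≤-refl)) large ℕP.≤-refl deg≤m ratio
    where
    2≤a : 2 ℕ.≤ aₑ e₂
    2≤a = Consts.2≤a e₂ 1≤e₂
    module G = Growth (aₑ e₂) L 2≤a 1≤L
    E₂ m₀ : ℕ
    E₂ = 2 ℕ.* suc κ
    m₀ = E₂ ℕ.* 15 ℕ.* G.doubling
    deg≤m : ∀ i x → Balanced.deg H i x ℕ.≤ m
    deg≤m i x = floor-max (≤-trans (dH i x) (*monoʳ (0≤ι s) αc₀)) m-low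
    codeg≤L : ∀ i x i' → Balanced.codeg H i x i' ℕ.≤ L
    codeg≤L i x i' = ι-cancel (≤-trans (cH i x i') (≤-trans (*monoʳ (0≤ι s) (*mono 0≤β (ℚP.+-monoʳ-≤ 1ℚ (u≤1 0))))
      (≤-trans (*mono (0≤* 0≤β (0≤+ 0≤1 0≤1)) (≤-trans (ι-mono s≤2·4^κ)
          (≤-reflexive (trans (ι-* 2 (L ℕ.* L)) (cong₂ _*_ (ι-def 2) (ι-* L L))))))
        (≤-reflexive (trans (solve 2 (λ b l → (b :* (con 1ℚ :+ con 1ℚ)) :* (con (lit 2) :* (l :* l)) :=
            (con (lit 4) :* l :* b) :* l) refl β (ι L)) (trans (cong (_* ι L) Lβ) (ℚP.*-identityˡ (ι L))))))))
    small : s ℕ.+ s ℕ.≤ 2 ^ E₂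
    small = ℕP.≤-trans (ℕP.+-mono-≤ s≤2·4^κ s≤2·4^κ) (ℕP.≤-reflexive
        (trans (NS.solve 1 (λ l → NS.con 2 NS.:* (l NS.:* l) NS.:+ NS.con 2 NS.:* (l NS.:* l) NS.:= (NS.con 2 NS.:* l) NS.:*
        ((NS.con 2 NS.:* l) NS.:* NS.con 1)) refl L)
      (trans (cong (2 ^ suc κ ℕ.*_) (ℕP.*-identityʳ (2 ^ suc κ)))
          (trans (sym (ℕP.^-distribˡ-+-* 2 (suc κ) (suc κ))) (cong (2 ^_) (cong (suc κ ℕ.+_) (sym (ℕP.+-identityʳ (suc κ)))))))))
    a≤m₀ : aₑ e₂ ℕ.≤ m₀
    a≤m₀ = ℕP.≤-trans (ℕP.≤-reflexive (sym (trans (ℕP.*-identityˡ _) (trans (ℕP.*-identityʳ _) (ℕP.*-identityʳ (aₑ e₂))))))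
      (ℕP.*-mono-≤ {1} {E₂ ℕ.* 15} {aₑ e₂ ℕ.* 1 ℕ.* 1} (ℕP.*-mono-≤ {1} {E₂} {1} {15} (s≤s z≤n) (s≤s z≤n))
          (ℕP.*-mono-≤ {aₑ e₂ ℕ.* 1} (ℕP.*-monoʳ-≤ (aₑ e₂) (ℕP.≤-trans (s≤s z≤n) 2≤a)) (ℕP.*-mono-≤ {1} {2} (s≤s z≤n) 1≤L)))
    -- The least admissible degree m₀ is a constant times (κ + 1) L, because one pick affects at
    -- most L candidates of a group. Lists have length at least L², which suffices once 2^κ outgrows
    -- κ + 1.
    large : 2 ^ rounds e₂ ℕ.* (32 ℕ.* m₀) ℕ.≤ s
    large = ℕP.≤-trans (ℕP.≤-reflexive (NS.solve 7 (λ r p q t k a l → r NS.:*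
        (p NS.:* (t NS.:* k NS.:* q NS.:* (a NS.:* a NS.:* (t NS.:* l)))) NS.:=
        (r NS.:* (p NS.:* (t NS.:* q NS.:* (a NS.:* a NS.:* t)))) NS.:* k NS.:* l) refl (2 ^ rounds e₂) 32 15 2 (suc κ)
        (aₑ e₂) L))
      (ℕP.≤-trans (ℕP.*-monoˡ-≤ L (ℕP.≤-trans (ℕP.*-monoʳ-≤ (nibbleCost e₂) κ<P) (exp-beats (nibbleCost e₂) κ nibbleCost≤)))
          4^κ≤s)
      where
      κ<P : suc κ ℕ.≤ (2 ℕ.+ κ) ^ 5
      κ<P = ℕP.≤-trans (ℕP.n≤1+n (suc κ)) (ℕP.≤-trans (ℕP.≤-reflexive (sym (ℕP.*-identityʳ (2 ℕ.+ κ))))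
          (ℕP.*-monoʳ-≤ (2 ℕ.+ κ) (ℕP.m^n>0 (2 ℕ.+ κ) 4)))

  transversals-at-scale : ∀ j {k} (H : Balanced k (sz s j)) → (∀ i x → ι (Balanced.deg H i x) ≤ α * ι (sz s j)) →
      (∀ i x i' → ι (Balanced.codeg H i x i') ≤ β * ι (sz s j)) → Transversals H (sz m j)
  transversals-at-scale j H dH cH = Descent.claim s m α β 0≤β β≤α αc≤1 big base j H (λ i x → ≤-trans (dH i x) (raise 0≤α))
      (λ i x i' → ≤-trans (cH i x i') (raise 0≤β))
    where
    raise : ∀ {γ} → 0ℚ ≤ γ → γ * ι (sz s j) ≤ γ * c j * ι (sz s j)
    raise {γ} 0≤γ = *monoʳ (0≤ι (sz s j)) (≤-trans (≤-reflexive (sym (ℚP.*-identityʳ γ))) (*mono 0≤γ (le-by (u j) (0≤u j) refl)))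

-- Selecting equal parts

enumerate : ∀ {N} (P : Fin N → Bool) n → n ℕ.≤ count P → Σ (Fin n → Fin N) λ φ → (∀ x → P (φ x) ≡ true) ×
    (∀ x y → φ x ≡ φ y → x ≡ y)
enumerate P zero h = (λ ()) , (λ ()) , λ ()
enumerate {suc N} P (suc n) h = go (P zero) refl
  where
  go : ∀ b → P zero ≡ b → Σ (Fin (suc n) → Fin (suc N)) λ φ → (∀ x → P (φ x) ≡ true) × (∀ x y → φ x ≡ φ y → x ≡ y)
  go true q = φ , holds , injective
    where
    rest = enumerate (λ i → P (suc i)) n (ℕP.≤-pred (subst (λ b → suc n ℕ.≤ (if b then 1 else 0) ℕ.+ count (λ i → P (suc i))) q
        h))
    φ : Fin (suc n) → Fin (suc N)
    φ zero = zero
    φ (suc x) = suc (proj₁ rest x)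
    holds : ∀ x → P (φ x) ≡ true
    holds zero = q
    holds (suc x) = proj₁ (proj₂ rest) x
    injective : ∀ x y → φ x ≡ φ y → x ≡ y
    injective zero zero e = refl
    injective (suc x) (suc y) e = cong suc (proj₂ (proj₂ rest) x y (FP.suc-injective e))
  go false q = (λ x → suc (proj₁ rest x)) , proj₁ (proj₂ rest) , λ x y e → proj₂ (proj₂ rest) x y (FP.suc-injective e)
    where
    rest = enumerate (λ i → P (suc i)) (suc n) (subst (λ b → suc n ℕ.≤ (if b then 1 else 0) ℕ.+ count (λ i → P (suc i))) q h)

count-≤1 : ∀ {n} (P : Fin n → Bool) → (∀ i j → P i ≡ true → P j ≡ true → i ≡ j) → count P ℕ.≤ 1
count-≤1 {n} P h = go (anyF P) refl
  where
  go : ∀ b → anyF P ≡ b → count P ℕ.≤ 1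
  go true q = ℕP.≤-trans (count-mono {P = P} {R = i ==_} (λ j p → trans (cong (i ==_) (sym (h i j r p))) (==-refl i)))
      (ℕP.≤-reflexive (count-single i))
    where
    w = anyF-witness {P = P} q
    i = proj₁ w
    r = proj₂ w
  go false q = ℕP.≤-trans (count-mono {P = P} {R = λ _ → false} (λ j p → trans (sym (anyF-none {P = P} q j)) p))
      (ℕP.≤-trans (ℕP.≤-reflexive (count-false {n})) z≤n)

count-injective : ∀ {n N} (f : Fin n → Fin N) → (∀ x y → f x ≡ f y → x ≡ y) → (P : Fin N → Bool) → count
    (λ x → P (f x)) ℕ.≤ count P
count-injective f inj P = ι-cancel (≤-trans (≤-reflexive (trans (ι-count (λ x → P (f x)))
    (trans (∑-cong (λ x → sym (ℚP.*-identityˡ ⟦ P (f x) ⟧))) (sym (∑-fibre (λ _ → true) f (λ t → ⟦ P t ⟧))))))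
  (≤-trans (∑-mono (λ t → ≤-trans (*monoʳ 0≤⟦ P t ⟧ (≤-trans
      (ι-mono (count-≤1 (λ x → f x == t) (λ x y p q → inj x y (trans (==→≡ {i = f x} {t} p) (sym (==→≡ {i = f y} {t} q))))))
      (≤-reflexive ι-1))) (≤-reflexive (ℚP.*-identityˡ ⟦ P t ⟧))))
    (≤-reflexive (sym (ι-count P)))))

module Selection {N k} (G : MultipartiteGraph N k) (n : ℕ) (n≤size : ∀ i → n ℕ.≤ partSize G i) where
  open MultipartiteGraph G

  chosen : ∀ i → Σ (Fin n → Fin N) λ φ → (∀ x → (part (φ x) == i) ≡ true) × (∀ x y → φ x ≡ φ y → x ≡ y)
  chosen i = enumerate (λ w → part w == i) n (n≤size i)

  vertex : Fin k → Fin n → Fin N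
  vertex i = proj₁ (chosen i)

  vertex-part : ∀ i x → part (vertex i x) ≡ i
  vertex-part i x = ==→≡ {i = part (vertex i x)} {i} (proj₁ (proj₂ (chosen i)) x)

  vertex-injective : ∀ i x y → vertex i x ≡ vertex i y → x ≡ y
  vertex-injective i = proj₂ (proj₂ (chosen i))

  selected : Balanced k n
  selected = record { adj = λ i x j y → adj (vertex i x) (vertex j y) ; adj-sym = λ i x j y → adj-sym (vertex i x) (vertex j y)
    ; adj-part = λ i x y → adj-multipartite (vertex i x) (vertex i y) (trans (vertex-part i x) (sym (vertex-part i y))) }

  into-part : ∀ v j → count (λ y → adj v (vertex j y)) ℕ.≤ count (λ w → adj v w ∧ (part w == j))
  into-part v j = ℕP.≤-trans (count-mono {P = λ y → adj v (vertex j y)} {R = λ y → adj v (vertex j y) ∧ (part (vertex j y) == j)}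
      (λ y p → ∧-intro p (proj₁ (proj₂ (chosen j)) y)))
    (count-injective (vertex j) (vertex-injective j) (λ w → adj v w ∧ (part w == j)))

  deg≤degree : ∀ i x → Balanced.deg selected i x ℕ.≤ degree G (vertex i x)
  deg≤degree i x = ℕP.≤-trans (sumN-mono (into-part (vertex i x))) (ℕP.≤-reflexive (sym (count-fibre (adj (vertex i x)) part)))

  codeg≤localDegree : ∀ i x j → Balanced.codeg selected i x j ℕ.≤ localDegree G (vertex i x) j
  codeg≤localDegree i x j = ℕP.≤-trans (into-part v j) (count-mono {P = λ w → adj v w ∧ (part w == j)}
      {R = λ w → if adj v w then (part w == j) else false} (λ w → same (adj v w) (part w == j)))
    where
    v = vertex i x
    same : ∀ a b → a ∧ b ≡ true → (if a then b else false) ≡ true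
    same true b p = p

  lift : ∀ {m} → Transversals selected m → Σ (Fin m → Fin k → Fin N) (DisjointIndependentTransversals G m)
  lift T = (λ a i → vertex i (pos a i)) , (λ a → (λ i → vertex-part i (pos a i)) , indep-T a) , distinct
    where
    open Transversals T
    distinct : ∀ a b i j → vertex i (pos a i) ≡ vertex j (pos b j) → a ≡ b
    distinct a b i j e = go (trans (sym (vertex-part i (pos a i))) (trans (cong part e) (vertex-part j (pos b j)))) e
      where
      go : i ≡ j → vertex i (pos a i) ≡ vertex j (pos b j) → a ≡ b
      go refl e = disjoint a b i (vertex-injective i (pos a i) (pos b i) e)

edgeless : ∀ {k n} (H : Balanced k n) → (∀ i x j → Balanced.codeg H i x j ≡ 0) → Transversals H n
edgeless H none = record { pos = λ a i → a ; disjoint = λ a b i e → e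
  ; indep-T = λ a i j → ¬true λ p → ℕP.1+n≰n {0} (ℕP.≤-trans (ℕP.≤-reflexive (sym (count-single a)))
      (ℕP.≤-trans (count-mono {P = a ==_} {R = adj i a j} (λ y q → subst (λ z → adj i a j z ≡ true) (==→≡ {i = a} {y} q) p))
          (ℕP.≤-reflexive (none i a j)))) }
  where open Balanced H

-- Reducing to a scale

-- s is n divided by 2^j and rounded down, with j such that s lies between B and 2 B. Discarding the
-- remainder costs a factor of at most 1 + 1/s.
record ScaleOf (B n : ℕ) : Set where
  field
    s j : ℕ
    B≤s : B ℕ.≤ s
    s≤2B : s ℕ.≤ 2 ℕ.* B
    sz≤n : sz s j ℕ.≤ n
    n<sz : n ℕ.< sz (suc s) j

scaleOf : ∀ B n → B ℕ.≤ n → ScaleOf B n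
scaleOf B n = search n n ℕP.≤-refl
  where
  search : ∀ f n → n ℕ.≤ f → B ℕ.≤ n → ScaleOf B n
  halve : ∀ f n → n ℕ.≤ f → B ℕ.≤ n → Dec (n ℕ.≤ 2 ℕ.* B) → ScaleOf B n
  search f n n≤f B≤n = halve f n n≤f B≤n (n ℕP.≤? 2 ℕ.* B)
  halve f n n≤f B≤n (yes p) = record { s = n ; j = 0 ; B≤s = B≤n ; s≤2B = p ; sz≤n = ℕP.≤-refl ; n<sz = ℕP.≤-refl }
  halve f zero n≤f B≤n (no p) = ⊥-elim (p z≤n)
  halve (suc f) (suc n) (s≤s n≤f) B≤n (no p) = record { s = S.s ; j = suc S.j ; B≤s = S.B≤s ; s≤2B = S.s≤2B
    ; sz≤n = ℕP.≤-trans (ℕP.+-mono-≤ S.sz≤n S.sz≤n) (ℕP.≤-trans (ℕP.≤-reflexive double) (ℕD.m/n*n≤m (suc n) 2))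
    ; n<sz = ℕP.<-≤-trans (ℕP.≤-<-trans (ℕP.≤-reflexive (ℕD.m≡m%n+[m/n]*n (suc n) 2))
        (ℕP.≤-trans (ℕP.+-monoˡ-< (h ℕ.* 2) (ℕD.m%n<n (suc n) 2))
        (ℕP.≤-reflexive (NS.solve 1 (λ h → NS.con 2 NS.:+ h NS.:* NS.con 2 NS.:= (NS.con 1 NS.:+ h) NS.:+ (NS.con 1 NS.:+ h)) refl
        h)))) (ℕP.+-mono-≤ S.n<sz S.n<sz) }
    where
    h : ℕ
    h = suc n ℕD./ 2
    double : h ℕ.+ h ≡ h ℕ.* 2
    double = NS.solve 1 (λ h → h NS.:+ h NS.:= h NS.:* NS.con 2) refl h
    B≤h : B ℕ.≤ h
    B≤h = ℕP.≤-trans (ℕP.≤-reflexive (sym (ℕD.m*n/n≡m B 2)))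
        (ℕD./-monoˡ-≤ 2 (subst (ℕ._≤ suc n) (ℕP.*-comm 2 B) (ℕP.<⇒≤ (ℕP.≰⇒> p))))
    module S = ScaleOf (search f h (ℕP.≤-trans (ℕP.≤-pred (ℕD.m/n<m (suc n) 2 (s≤s (s≤s z≤n)))) n≤f) B≤h)

abstract
  -- A sum in place of a maximum. It is abstract because unfolding would expose an enormous numeral,
  -- while only the three lower bounds matter.
  scaleExponent : ∀ e → Σ ℕ λ κ → 4 ℕ.* e ℕ.≤ κ × threshold₅ (halvingCost (4 ℕ.* e)) ℕ.≤ κ × threshold₅
      (nibbleCost (2 ℕ.* e)) ℕ.≤ κ
  scaleExponent e = 4 ℕ.* e ℕ.+ x ℕ.+ y , ℕP.≤-trans (ℕP.m≤m+n (4 ℕ.* e) x) (ℕP.m≤m+n (4 ℕ.* e ℕ.+ x) y) , ℕP.≤-trans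
      (ℕP.m≤n+m x (4 ℕ.* e)) (ℕP.m≤m+n (4 ℕ.* e ℕ.+ x) y) , ℕP.m≤n+m y (4 ℕ.* e ℕ.+ x)
    where
    x y : ℕ
    x = threshold₅ (halvingCost (4 ℕ.* e))
    y = threshold₅ (nibbleCost (2 ℕ.* e))

module Reduction (ε : ℚ) (0<ε : 0ℚ < ε) where

  inverse = recip ε 0<ε
  rounded = ceil (proj₁ inverse) (<⇒≤ (proj₁ (proj₂ inverse)))

  e : ℕ
  e = proj₁ rounded

  1≤e : 1 ℕ.≤ e
  1≤e = ι-cancel-< {0} {e} (≤-<-trans (≤-reflexive ι-0) (<-≤-trans (proj₁ (proj₂ inverse)) (proj₁ (proj₂ rounded))))

  1≤eε : 1ℚ ≤ ι e * ε
  1≤eε = ≤-trans (≤-reflexive (trans (sym (proj₂ (proj₂ inverse))) (ℚP.*-comm ε (proj₁ inverse))))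
      (*monoʳ (<⇒≤ 0<ε) (proj₁ (proj₂ rounded)))

  exponent = scaleExponent e
  κ L : ℕ
  κ = proj₁ exponent
  L = 2 ^ κ

  4e≤κ : 4 ℕ.* e ℕ.≤ κ
  4e≤κ = proj₁ (proj₂ exponent)
  e≤κ : e ℕ.≤ κ
  e≤κ = ℕP.≤-trans (ℕP.m≤m+n e (3 ℕ.* e)) 4e≤κ

  1≤L : 1 ℕ.≤ L
  1≤L = ℕP.m^n>0 2 κ

  0<8LL : 0ℚ < ι (8 ℕ.* (L ℕ.* L))
  0<8LL = 0<ι (ℕP.*-mono-≤ {1} {8} (s≤s z≤n) (ℕP.*-mono-≤ 1≤L 1≤L))

  -- 1/(8 L²) serves two cases. If n ≤ L² then γ n < 1, so the selected vertices span no edge at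
  -- all. Otherwise 2 γ ≤ β, where the 2 covers the passage from n to the scale below it.
  γ : ℚ
  γ = proj₁ (recip (ι (8 ℕ.* (L ℕ.* L))) 0<8LL)
  0<γ : 0ℚ < γ
  0<γ = proj₁ (proj₂ (recip (ι (8 ℕ.* (L ℕ.* L))) 0<8LL))
  LLγ : lit 8 * (ι L * ι L) * γ ≡ 1ℚ
  LLγ = trans (cong (_* γ) (sym (trans (ι-* 8 (L ℕ.* L)) (cong₂ _*_ (ι-def 8) (ι-* L L)))))
      (proj₂ (proj₂ (recip (ι (8 ℕ.* (L ℕ.* L))) 0<8LL)))

  module _ {N k} (G : MultipartiteGraph N k) (n : ℕ) (size : ∀ i → n ℕ.≤ partSize G i)
    (degree≤ : ∀ v → ι (degree G v) ≤ (1ℚ - ε) * ι n) (local≤ : ∀ v i → ι (localDegree G v i) ≤ γ * ι n) where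

    Goal : Set
    Goal = Σ ℕ λ m → ((1ℚ - ε) * ι n < ι m + 1ℚ) × Σ (Fin m → Fin k → Fin N) (DisjointIndependentTransversals G m)

    small : n ℕ.≤ L ℕ.* L → Goal
    small n≤LL = n , ≤-<-trans (≤-trans (*monoʳ (0≤ι n) (1-x≤1 (<⇒≤ 0<ε))) (≤-reflexive (ℚP.*-identityˡ (ι n))))
        (x<x+1 (ι n)) , lift (edgeless selected no-edge)
      where
      open Selection G n size
      x<x+1 : ∀ x → x < x + 1ℚ
      x<x+1 x = subst (_< x + 1ℚ) (ℚP.+-identityʳ x) (ℚP.+-monoʳ-< x 0<1)
      γn<1 : γ * ι n < 1ℚ
      γn<1 = ≤-<-trans (*mono (<⇒≤ 0<γ) (≤-trans (ι-mono n≤LL) (≤-reflexive (ι-* L L))))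
        (<-≤-trans (subst (_< γ * (ι L * ι L) + lit 7 * (γ * (ι L * ι L))) (ℚP.+-identityʳ _)
            (ℚP.+-monoʳ-< (γ * (ι L * ι L)) (0<* (subst (0ℚ <_) (ι-def 7) (0<ι (s≤s z≤n))) (0<* 0<γ (0<* (0<ι 1≤L) (0<ι 1≤L))))))
          (≤-reflexive (trans (solve 2 (λ g l → g :* l :+ con (lit 7) :* (g :* l) := con (lit 8) :* l :* g) refl γ (ι L * ι L))
              LLγ)))
      no-edge : ∀ i x j → Balanced.codeg selected i x j ≡ 0
      no-edge i x j = ℕP.n≤0⇒n≡0 (ℕP.≤-pred (ι-cancel-< {b = 1}
          (≤-<-trans (ι-mono (codeg≤localDegree i x j)) (≤-<-trans (local≤ (vertex i x) j)
          (<-≤-trans γn<1 (≤-reflexive (sym ι-1)))))))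

    large : L ℕ.* L ℕ.≤ n → Goal
    large LL≤n = sz m S.j , bound , lift (transversals-at-scale S.j selected deg≤ codeg≤)
      where
      module S = ScaleOf (scaleOf (L ℕ.* L) n LL≤n)
      s n' t : ℕ
      s = S.s
      n' = sz s S.j
      t = 2 ^ S.j
      open Parameters e κ s 1≤e e≤κ (proj₁ (proj₂ (proj₂ exponent))) (proj₂ (proj₂ (proj₂ exponent))) S.B≤s S.s≤2B using
          (v; α; β; η; m; m-low; ev; 0≤v; 4v≤1; 0≤β; Lβ; transversals-at-scale)
      open Selection G n' (λ i → ℕP.≤-trans S.sz≤n (size i))
      ιsz : ∀ a → ι (sz a S.j) ≡ ι a * ι t
      ιsz a = trans (cong ι (sz≡ a S.j)) (ι-* a t)
      1≤sv : 1ℚ ≤ ι s * v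
      1≤sv = ≤-trans (≤-reflexive (sym ev)) (*monoʳ 0≤v (≤-trans (≤-reflexive (sym (trans (ι-* 4 e) (cong (_* ι e) (ι-def 4)))))
          (ι-mono
        (ℕP.≤-trans 4e≤κ (ℕP.≤-trans (ℕP.n≤1+n κ) (ℕP.≤-trans (suc≤2^ κ)
            (ℕP.≤-trans (ℕP.≤-reflexive (sym (ℕP.*-identityʳ L))) (ℕP.≤-trans (ℕP.*-monoʳ-≤ L 1≤L) S.B≤s))))))))
      4v≤ε : lit 4 * v ≤ ε
      4v≤ε = ≤-trans (≤-reflexive (sym (ℚP.*-identityʳ (lit 4 * v))))
          (≤-trans (*mono (0≤* (0≤lit 4) 0≤v) 1≤eε) (≤-reflexive
          (trans (solve 3 (λ v e x → con (lit 4) :* v :* (e :* x) := con (lit 4) :* e :* v :* x) refl v (ι e) ε)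
          (trans (cong (_* ε) ev) (ℚP.*-identityˡ ε)))))
      1-ε≤ : 1ℚ - ε ≤ 1ℚ - lit 4 * v
      1-ε≤ = ℚP.+-monoʳ-≤ 1ℚ (ℚP.neg-antimono-≤ 4v≤ε)
      0≤1-4v : 0ℚ ≤ 1ℚ - lit 4 * v
      0≤1-4v = sub≥0 4v≤1
      n≤ : ι n ≤ (1ℚ + ι s) * ι t
      n≤ = ≤-trans (ι-mono (ℕP.<⇒≤ S.n<sz)) (≤-reflexive (trans (ιsz (suc s)) (cong (_* ι t) (ι-suc s))))
      n≤vn' : ι n ≤ (1ℚ + v) * ι n'
      n≤vn' = ≤-trans n≤ (≤-trans (*monoʳ (0≤ι t) (ℚP.+-monoˡ-≤ (ι s) 1≤sv))
          (≤-reflexive (trans (solve 3 (λ s v t → (s :* v :+ s) :* t := (con 1ℚ :+ v) :* (s :* t)) refl (ι s) v (ι t))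
          (cong ((1ℚ + v) *_) (sym (ιsz s))))))
      shrink : (1ℚ - ε) * ι n ≤ (1ℚ - lit 4 * v) * ι n
      shrink = *monoʳ (0≤ι n) 1-ε≤
      deg≤ : ∀ i x → ι (Balanced.deg selected i x) ≤ α * ι n'
      deg≤ i x = ≤-trans (ι-mono (deg≤degree i x)) (≤-trans (degree≤ (vertex i x)) (≤-trans shrink (≤-trans (*mono 0≤1-4v n≤vn')
        (le-by (lit 4 * v * v * ι n') (0≤* (0≤* (0≤* (0≤lit 4) 0≤v) 0≤v) (0≤ι n'))
            (solve 2 (λ v n → (con 1ℚ :- con (lit 3) :* v) :* n := (con 1ℚ :- con (lit 4) :* v) :* ((con 1ℚ :+ v) :* n) :+ con
            (lit 4) :* v :* v :* n) refl v (ι n'))))))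
      2γ≤β : lit 2 * γ ≤ β
      2γ≤β = ≤-trans (≤-reflexive (sym (ℚP.*-identityʳ (lit 2 * γ))))
          (≤-trans (≤-reflexive (trans (cong (lit 2 * γ *_) (sym Lβ))
          (solve 3 (λ g l b → con (lit 2) :* g :* (con (lit 4) :* l :* b) := (con (lit 8) :* g :* b :* l) :* con 1ℚ) refl γ
          (ι L) β)))
        (≤-trans (*mono (0≤* (0≤* (0≤* (0≤lit 8) (<⇒≤ 0<γ)) 0≤β) (0≤ι L)) (subst (_≤ ι L) ι-1 (ι-mono 1≤L)))
            (≤-reflexive (trans (solve 3 (λ g l b → con (lit 8) :* g :* b :* l :* l := con (lit 8) :* (l :* l) :* g :* b) refl γ
            (ι L) β) (trans (cong (_* β) LLγ) (ℚP.*-identityˡ β))))))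
      v≤1 : v ≤ 1ℚ
      v≤1 = ≤-trans (le-by (lit 3 * v) (0≤* (0≤lit 3) 0≤v) (solve 1 (λ v → con (lit 4) :* v := v :+ con (lit 3) :* v) refl v))
          4v≤1
      codeg≤ : ∀ i x j → ι (Balanced.codeg selected i x j) ≤ β * ι n'
      codeg≤ i x j = ≤-trans (ι-mono (codeg≤localDegree i x j))
          (≤-trans (local≤ (vertex i x) j) (≤-trans (*mono (<⇒≤ 0<γ) (≤-trans n≤vn' (*monoʳ (0≤ι n') (ℚP.+-monoʳ-≤ 1ℚ v≤1))))
        (≤-trans (≤-reflexive (solve 2 (λ g n → g :* ((con 1ℚ :+ con 1ℚ) :* n) := con (lit 2) :* g :* n) refl γ (ι n')))
            (*monoʳ (0≤ι n') 2γ≤β))))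
      -- The spare 2 v s ≥ 2 pays for the rounding of m and for replacing s by s + 1; the latter is
      -- needed because n is only known to lie below (s + 1) 2^j.
      m≥ : (1ℚ - lit 4 * v) * (1ℚ + ι s) ≤ ι m
      m≥ = ≤-trans (le-by (lit 4 * v + lit 2 * (ι s * v - 1ℚ)) (0≤+ (0≤* (0≤lit 4) 0≤v) (0≤* (0≤lit 2) (sub≥0 1≤sv)))
             (solve 2 (λ v s → (con 1ℚ :- con (lit 2) :* v) :* s :- con 1ℚ := (con 1ℚ :- con (lit 4) :* v) :* (con 1ℚ :+ s) :+
                 (con (lit 4) :* v :+ con (lit 2) :* (s :* v :- con 1ℚ))) refl v (ι s)))
           (≤-trans (ℚP.+-monoˡ-≤ (ℚ.- 1ℚ) (<⇒≤ m-low)) (≤-reflexive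
               (trans (cong (_- 1ℚ) (ι-suc m)) (solve 1 (λ m → con 1ℚ :+ m :- con 1ℚ := m) refl (ι m)))))
      bound : (1ℚ - ε) * ι n < ι (sz m S.j) + 1ℚ
      bound = ≤-<-trans (≤-trans shrink (≤-trans (*mono 0≤1-4v n≤)
          (≤-trans (≤-reflexive (sym (ℚP.*-assoc (1ℚ - lit 4 * v) (1ℚ + ι s) (ι t))))
          (≤-trans (*monoʳ (0≤ι t) m≥) (≤-reflexive (sym (ιsz m)))))))
        (subst (_< ι (sz m S.j) + 1ℚ) (ℚP.+-identityʳ (ι (sz m S.j))) (ℚP.+-monoʳ-< (ι (sz m S.j)) 0<1))

    goal : Goal
    goal = [ small , large ]′ (ℕP.≤-total n (L ℕ.* L))

theorem1p3 : (ε : ℚ) → 0ℚ < ε → ε < 1ℚ →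
    Σ ℚ (λ γ → 0ℚ < γ ×
    ((N k n : ℕ) (G : MultipartiteGraph N k) →
    (∀ i → n Data.Nat.≤ partSize G i) →
    (∀ v → ℕ→ℚ (degree G v) ≤ (1ℚ - ε) * ℕ→ℚ n) →
    (∀ v i → ℕ→ℚ (localDegree G v i) ≤ γ * ℕ→ℚ n) →
    Σ ℕ (λ m → ((1ℚ - ε) * ℕ→ℚ n < ℕ→ℚ m + 1ℚ) ×
    Σ (Fin m → Fin k → Fin N) (λ T → DisjointIndependentTransversals G m T))))
theorem1p3 ε 0<ε ε<1 = γ , 0<γ , λ N k n G size degree≤ local≤ →
  back n (goal G n size (λ v → subst₂ (λ a b → a ≤ (1ℚ - ε) * b) (sym (ι-def (degree G v))) (sym (ι-def n)) (degree≤ v))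
      (λ v i → subst₂ (λ a b → a ≤ γ * b) (sym (ι-def (localDegree G v i))) (sym (ι-def n)) (local≤ v i)))
  where
  open Reduction ε 0<ε
  back : ∀ {Q : ℕ → Set} n → Σ ℕ (λ m → ((1ℚ - ε) * ι n < ι m + 1ℚ) × Q m) → Σ ℕ (λ m → ((1ℚ - ε) * ℕ→ℚ n < ℕ→ℚ m + 1ℚ) × Q m)
  back n (m , p , q) = m , subst₂ (λ a b → (1ℚ - ε) * a < b + 1ℚ) (ι-def n) (ι-def m) p , q
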